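{- Let $m\ge1$. For every choice of positive integers $h_1,h_2,\dots,h_m\ge 1$, we have \[S_{h_1,h_2,\dots,h_m}(Q)=A(h_1,h_2,\dots,h_m)\,N(Q)+O_{h_1,h_2,\dots,h_m}\left(Q\log^2Q\right)\] as $Q\to\infty$, where $A(h_1,h_2,\dots,h_m)$ is a positive rational constant, given in terms of the Farey transformation $T$ by \[A(h_1,\dots,h_m)=2\sum_{k,l_1,\dots,l_m=1}^{\infty}k\,l_1l_2\cdots l_m\ \mathrm{area}\left(\mathcal{T}_k\cap T^{ -h_1}\mathcal{T}_{l_1}\cap T^{ -h_2}\mathcal{T}_{l_2}\cap\dots\cap T^{ -h_m}\mathcal{T}_{l_m}\right).\]
   Context: $\mathcal{F}_Q$ is the Farey sequence of order $Q$: the increasing sequence $1/Q=\gamma_1<\gamma_2<\dots<\gamma_{N(Q)}=1$ of all fractions $a/q$ in $(0,1]$ with $\gcd(a,q)=1$ and $0<a\le q\le Q$; $N(Q)$ is its number of elements. The sequence is extended to all $i\in\mathbb{Z}$ by $\gamma_{i+N(Q)}=\gamma_i+1$. Writing $\gamma_i=a_i/q_i$ in lowest terms, the index of $\gamma_i$ is the integer $\nu_Q(\gamma_i)=\frac{q_{i-1}+q_{i+1}}{q_i}$ (so $\nu_Q(\gamma_1)=1$, $\nu_Q(\gamma_{N(Q)})=2Q$). The $m$-correlation function is \[S_{h_1,\dots,h_m}(Q)=\sum_{\gamma_i\in\mathcal{F}_Q}\nu_Q(\gamma_i)\nu_Q(\gamma_{i+h_1})\cdots\nu_Q(\gamma_{i+h_m}).\]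 The Farey triangle is $\mathcal{T}=\{(x,y)\in[0,1]^2: x+y>1\}$; the (bijective, area-preserving) Farey transformation $T:\mathcal{T}\to\mathcal{T}$ is $T(x,y)=\left(y,\left\lfloor\frac{1+x}{y}\right\rfloor y-x\right)$; and for $k\in\mathbb{N}$, $\mathcal{T}_k=\left\{(x,y)\in\mathcal{T}:\left\lfloor\frac{1+x}{y}\right\rfloor=k\right\}$. $T^{ -h}\mathcal{T}_l$ denotes the preimage of $\mathcal{T}_l$ under the $h$-th iterate $T^h$.
   Formalization: The integers h_1,…,h_m are assumed pairwise distinct: if two coincide, S is at least the sum of squared indices, of order Q² log Q, while N(Q) has order Q², and the series for A diverges, so the claim fails for every choice with a repetition. -}

module Defs where

open import Algebra.Bundles using (CommutativeMonoid)
open import Data.Rational.Properties using (+-0-commutativeMonoid)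
open import Algebra.Properties.CommutativeSemigroup
  (CommutativeMonoid.commutativeSemigroup +-0-commutativeMonoid) using (interchange)
open import Data.Integer.Base as ℤ using (ℤ; +_)
open import Data.Integer.DivMod using (_/ℕ_; _%ℕ_; n%ℕd<d)
open import Data.Fin.Base using (fromℕ<)
open import Data.List.Base
  using (List; []; _∷_; length; lookup; map; filter; foldr; upTo; concatMap; cartesianProductWith)
open import Data.List.Relation.Unary.All using (All)
open import Data.List.Relation.Unary.Any using (Any)
open import Data.List.Relation.Unary.AllPairs using (AllPairs)
import Data.List.Sort as Sort
open import Data.Nat.Base as ℕ using (ℕ; zero; suc)
open import Data.Nat.Coprimality using (coprime?)
open import Data.Nat.Logarithm using (⌊log₂_⌋)
import Data.Nat.Properties as ℕ
open import Data.Product.Base using (Σ-syntax; ∃-syntax; _×_; _,_)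
open import Data.Rational.Base as ℚ using (ℚ; 0ℚ; 1ℚ; ½; _/_; ↧ₙ_; ∣_∣)
import Data.Rational.Properties as ℚ
open import Data.Sum.Base using (_⊎_)
open import Data.Vec.Base as Vec using (Vec; []; _∷_)
open import Function.Base using (_∘_)
open import Level using (0ℓ)
open import Relation.Binary.PropositionalEquality.Core using (_≡_; cong; subst; trans; sym)
open import Relation.Unary using (Pred; _∈_; _∩_; _⊆_)

fromℕ : ℕ → ℚ
fromℕ n = + n / 1

[1⋯_] : ℕ → List ℕ
[1⋯ n ] = map suc (upTo n)

------------------------------------------------------------------------
-- Farey sequences

fareyFractions : ℕ → List ℚ
fareyFractions Q =
  concatMap
    (λ q → map (λ a → + suc a / suc q)
               (filter (λ a → coprime? (suc a) (suc q)) (upTo (suc q))))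
    (upTo Q)

𝓕 : ℕ → List ℚ
𝓕 Q = Sort.sort ℚ.≤-decTotalOrder (fareyFractions Q)

N : ℕ → ℕ
N Q = length (𝓕 Q)

-- The extension of a list x₁, …, xₙ to all indices i ∈ ℤ by xᵢ₊ₙ = xᵢ + 1.
-- The value for the empty list is junk; it only occurs for Q = 0.
extend : List ℚ → ℤ → ℚ
extend []          _ = 0ℚ
extend xs@(_ ∷ _) i =
  lookup xs (fromℕ< (n%ℕd<d j (length xs))) ℚ.+ (j /ℕ length xs) / 1
  where
  j : ℤ
  j = i ℤ.- + 1

γ : ℕ → ℤ → ℚ
γ Q = extend (𝓕 Q)

ν : ℕ → ℤ → ℚ
ν Q i = + (↧ₙ γ Q (i ℤ.- + 1) ℕ.+ ↧ₙ γ Q (i ℤ.+ + 1)) / ↧ₙ γ Q i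

S : ∀ {m} → Vec ℕ m → ℕ → ℚ
S h Q = foldr ℚ._+_ 0ℚ (map term [1⋯ N Q ])
  where
  term : ℕ → ℚ
  term i = ν Q (+ i) ℚ.* Vec.foldr _ ℚ._*_ 1ℚ (Vec.map (λ hⱼ → ν Q (+ (i ℕ.+ hⱼ))) h)

------------------------------------------------------------------------
-- Real numbers: Cauchy sequences of rationals, compared by ≤ᴿ and <ᴿ.
-- Two sequences denote the same real when each is ≤ᴿ the other.

record ℝ : Set where
  constructor mkℝ
  field
    approx : ℕ → ℚ
    cauchy : ∀ ε → 0ℚ ℚ.< ε →
             ∃[ n₀ ] (∀ m n → n₀ ℕ.≤ m → n₀ ℕ.≤ n → ∣ approx m ℚ.- approx n ∣ ℚ.< ε)

open ℝ public

infix  4 _≤ᴿ_ _<ᴿ_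
infixl 6 _+ᴿ_ _-ᴿ_
infixl 7 _·ᴿ_
infix  8 -ᴿ_

_≤ᴿ_ : ℝ → ℝ → Set
x ≤ᴿ y = ∀ ε → 0ℚ ℚ.< ε →
         ∃[ n₀ ] (∀ n → n₀ ℕ.≤ n → approx x n ℚ.≤ approx y n ℚ.+ ε)

_<ᴿ_ : ℝ → ℝ → Set
x <ᴿ y = ∃[ ε ] (0ℚ ℚ.< ε ×
         ∃[ n₀ ] (∀ n → n₀ ℕ.≤ n → approx x n ℚ.+ ε ℚ.≤ approx y n))

private
  half-pos : ∀ ε → 0ℚ ℚ.< ε → 0ℚ ℚ.< ½ ℚ.* ε
  half-pos ε 0<ε =
    subst (ℚ._< ½ ℚ.* ε) (ℚ.*-zeroʳ ½) (ℚ.*-monoʳ-<-pos ½ 0<ε)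

  half+half : ∀ ε → ½ ℚ.* ε ℚ.+ ½ ℚ.* ε ≡ ε
  half+half ε = trans (sym (ℚ.*-distribʳ-+ ε ½ ½)) (ℚ.*-identityˡ ε)

  +-interchange : ∀ a b c d → (a ℚ.+ b) ℚ.- (c ℚ.+ d) ≡ (a ℚ.- c) ℚ.+ (b ℚ.- d)
  +-interchange a b c d =
    trans (cong ((a ℚ.+ b) ℚ.+_) (ℚ.neg-distrib-+ c d))
          (interchange a b (ℚ.- c) (ℚ.- d))

fromℚ : ℚ → ℝ
fromℚ q .approx _ = q
fromℚ q .cauchy ε 0<ε =
  0 , λ _ _ _ _ → subst (ℚ._< ε) (sym (cong ∣_∣ (ℚ.+-inverseʳ q))) 0<ε

_+ᴿ_ : ℝ → ℝ → ℝ
(x +ᴿ y) .approx n = approx x n ℚ.+ approx y n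
(x +ᴿ y) .cauchy ε 0<ε
  with cauchy x (½ ℚ.* ε) (half-pos ε 0<ε) | cauchy y (½ ℚ.* ε) (half-pos ε 0<ε)
... | a , p | b , q = a ℕ.⊔ b , λ m n c≤m c≤n →
  let a≤m = ℕ.≤-trans (ℕ.m≤m⊔n a b) c≤m
      a≤n = ℕ.≤-trans (ℕ.m≤m⊔n a b) c≤n
      b≤m = ℕ.≤-trans (ℕ.m≤n⊔m a b) c≤m
      b≤n = ℕ.≤-trans (ℕ.m≤n⊔m a b) c≤n
      xm  = approx x m
      xn  = approx x n
      ym  = approx y m
      yn  = approx y n
      open ℚ.≤-Reasoning
  in begin-strict
    ∣ (xm ℚ.+ ym) ℚ.- (xn ℚ.+ yn) ∣     ≡⟨ cong ∣_∣ (+-interchange xm ym xn yn) ⟩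
    ∣ (xm ℚ.- xn) ℚ.+ (ym ℚ.- yn) ∣     ≤⟨ ℚ.∣p+q∣≤∣p∣+∣q∣ (xm ℚ.- xn) (ym ℚ.- yn) ⟩
    ∣ xm ℚ.- xn ∣ ℚ.+ ∣ ym ℚ.- yn ∣     <⟨ ℚ.+-mono-< (p m n a≤m a≤n) (q m n b≤m b≤n) ⟩
    ½ ℚ.* ε ℚ.+ ½ ℚ.* ε                 ≡⟨ half+half ε ⟩
    ε                                   ∎

-ᴿ_ : ℝ → ℝ
(-ᴿ x) .approx n = ℚ.- approx x n
(-ᴿ x) .cauchy ε 0<ε with cauchy x ε 0<ε
... | a , p = a , λ m n a≤m a≤n →
  subst (ℚ._< ε)
        (trans (sym (ℚ.∣-p∣≡∣p∣ (approx x m ℚ.- approx x n)))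
               (cong ∣_∣ (ℚ.neg-distrib-+ (approx x m) (ℚ.- approx x n))))
        (p m n a≤m a≤n)

_-ᴿ_ : ℝ → ℝ → ℝ
x -ᴿ y = x +ᴿ -ᴿ y

_·ᴿ_ : ℕ → ℝ → ℝ
zero  ·ᴿ x = fromℚ 0ℚ
suc k ·ᴿ x = x +ᴿ k ·ᴿ x

------------------------------------------------------------------------
-- Area of plane sets

Plane : Set
Plane = ℝ × ℝ

record Box : Set where
  field
    left right bottom top : ℚ
    left≤right            : left ℚ.≤ right
    bottom≤top            : bottom ℚ.≤ top

open Box public

⟦_⟧ : Box → Pred Plane 0ℓ
⟦ b ⟧ (x , y) = (fromℚ (left b) ≤ᴿ x × x ≤ᴿ fromℚ (right b))
              × (fromℚ (bottom b) ≤ᴿ y × y ≤ᴿ fromℚ (top b))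

NonOverlapping : Box → Box → Set
NonOverlapping b c = (right b ℚ.≤ left c ⊎ right c ℚ.≤ left b)
                   ⊎ (top b ℚ.≤ bottom c ⊎ top c ℚ.≤ bottom b)

totalArea : List Box → ℚ
totalArea = foldr ℚ._+_ 0ℚ ∘ map (λ b → (right b ℚ.- left b) ℚ.* (top b ℚ.- bottom b))

-- HasArea X a: X is Jordan measurable with area a.  Up to any ε, the number a
-- is bounded above by the area of finitely many non-overlapping boxes inside X
-- and below by that of finitely many boxes covering X.
HasArea : Pred Plane 0ℓ → ℝ → Set
HasArea X a = ∀ ε → 0ℚ ℚ.< ε →
    (∃[ bs ] (AllPairs NonOverlapping bs × All (λ b → ⟦ b ⟧ ⊆ X) bs
              × a ≤ᴿ fromℚ (totalArea bs ℚ.+ ε)))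
  × (∃[ bs ] ((∀ {p} → p ∈ X → Any (λ b → p ∈ ⟦ b ⟧) bs)
              × fromℚ (totalArea bs ℚ.- ε) ≤ᴿ a))

------------------------------------------------------------------------
-- The Farey transformation

𝒯 : Pred Plane 0ℓ
𝒯 (x , y) = (fromℚ 0ℚ ≤ᴿ x × x ≤ᴿ fromℚ 1ℚ)
          × (fromℚ 0ℚ ≤ᴿ y × y ≤ᴿ fromℚ 1ℚ)
          × fromℚ 1ℚ <ᴿ x +ᴿ y

-- On 𝒯 we have y > 0, so ⌊(1 + x) / y⌋ = k iff k y ≤ 1 + x < (k + 1) y.
𝒯[_] : ℕ → Pred Plane 0ℓ
𝒯[ k ] (x , y) = (x , y) ∈ 𝒯
               × k ·ᴿ y ≤ᴿ fromℚ 1ℚ +ᴿ x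
               × fromℚ 1ℚ +ᴿ x <ᴿ suc k ·ᴿ y

-- The floor is not a constructive function on ℝ, so the transformation T is
-- given by its graph: T (x , y) is (y , k y - x) whenever (x , y) ∈ 𝒯[ k ].
T⁻¹ : Pred Plane 0ℓ → Pred Plane 0ℓ
T⁻¹ X (x , y) = ∃[ k ] ((x , y) ∈ 𝒯[ k ] × (y , k ·ᴿ y -ᴿ x) ∈ X)

T⁻[_] : ℕ → Pred Plane 0ℓ → Pred Plane 0ℓ
T⁻[ zero ]  X = X
T⁻[ suc h ] X = T⁻¹ (T⁻[ h ] X)

region : ∀ {m} → Vec ℕ m → ℕ → Vec ℕ m → Pred Plane 0ℓ
region h k l = Vec.foldr _ _∩_ 𝒯[ k ] (Vec.zipWith (λ hⱼ lⱼ → T⁻[ hⱼ ] 𝒯[ lⱼ ]) h l)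

------------------------------------------------------------------------
-- Series over multi-indices of positive integers

indices : ℕ → ∀ d → List (Vec ℕ d)
indices n zero    = [] ∷ []
indices n (suc d) = cartesianProductWith _∷_ [1⋯ n ] (indices n d)

-- The sum of f over all d-tuples of positive integers is A, as the limit of
-- the sums over {1, …, n}ᵈ.  It is meant for nonnegative f, where the order of
-- summation is immaterial.
SumsTo : ∀ {d} → (Vec ℕ d → ℝ) → ℚ → Set
SumsTo {d} f A = ∀ ε → 0ℚ ℚ.< ε →
  ∃[ n₀ ] (∀ n → n₀ ℕ.≤ n →
    let s = foldr _+ᴿ_ (fromℚ 0ℚ) (map f (indices n d))
    in fromℚ (A ℚ.- ε) ≤ᴿ s × s ≤ᴿ fromℚ (A ℚ.+ ε))

-- A = 2 ∑ k l₁ ⋯ lₘ area (𝒯ₖ ∩ T^{-h₁} 𝒯_{l₁} ∩ ⋯ ∩ T^{-hₘ} 𝒯_{lₘ}), including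
-- the existence of the areas and the convergence of the series.
IsCorrelationConstant : ∀ {m} → Vec ℕ m → ℚ → Set
IsCorrelationConstant {m} h A =
  Σ[ area ∈ (ℕ → Vec ℕ m → ℝ) ]
    ((∀ k l → HasArea (region h k l) (area k l)) × SumsTo (term area) A)
  where
  term : (ℕ → Vec ℕ m → ℝ) → Vec ℕ (suc m) → ℝ
  term area (k ∷ l) = (2 ℕ.* (k ℕ.* Vec.foldr _ ℕ._*_ 1 l)) ·ᴿ area k l

------------------------------------------------------------------------
-- Asymptotics

_=O[_] : (ℕ → ℚ) → (ℕ → ℚ) → Set
f =O[ g ] = ∃[ C ] ∃[ Q₀ ] (∀ Q → Q₀ ℕ.≤ Q → ∣ f Q ∣ ℚ.≤ C ℚ.* ∣ g Q ∣)

-- Inside O(·) the integer part of the binary logarithm may stand for log,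
-- since ⌊log₂ Q⌋ and log Q bound each other up to constants for Q ≥ 2.
Qlog²Q : ℕ → ℚ
Qlog²Q Q = fromℕ (Q ℕ.* ⌊log₂ Q ⌋ ℕ.^ 2)

-- The denominators (a , b) of consecutive fractions of the Farey sequence of order n are the
-- coprime points of L n = {(a , b) ∈ [1, n]² : a + b > n}, and the Farey map
-- T (a , b) = (b , κb - a), κ = ⌊(n + a)/b⌋, leads from one pair to the next, κ being the index.
-- So S_h(n) is the sum of Φ = κ ∏ⱼ κ ∘ T^hⱼ over the coprime points of L n.  The points of L n
-- divisible by d are d · L ⌊n/d⌋, compatibly with κ and T; by Möbius inversion it suffices that
-- the sum of Φ over all of L n is (A/2) n² + O(n).
--
-- If κ (T^t s) is large, then the letters κ (T^p s) around it are 1 (for |p - t| = 1) or 2, hence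
-- Φ is an affine function of κ (T^t s).  As T permutes L n and the sum of κ over L n is exactly
-- 3 |L n| - n, this reduces everything to words of bounded letters.  The points with a given word
-- are the lattice points of a rational polygon; column by column their number is, up to O(1), a
-- piecewise affine function of a/n, which has a rational antiderivative.
--
-- The areas of the regions are the limits of these counts: boxes around lattice points whose orbit
-- stays away from the boundary of the triangle lie in one region, and since T permutes L n there
-- are only O(n) other points.  Large letters are negligible, as the sum of κ over κ > M is O(n²/M).

module Submission where

open import Defs
open import Data.Empty using (⊥; ⊥-elim)
open import Data.Integer.Base as ℤ using (ℤ; -[1+_])
import Data.Integer.Properties as ℤ
import Data.Integer.DivMod as ℤ
import Data.Integer.Divisibility.Signed as ℤ∣
open import Data.Fin.Base using (Fin; toℕ; fromℕ<)
import Data.Fin.Properties as Fin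
open import Data.List.Base as List
  using (List; []; _∷_; _++_; length; map; filter; foldr; upTo; cartesianProduct; cartesianProductWith)
open import Data.List.Membership.Propositional using (_∈_; _∉_; find; lose)
import Data.List.Membership.Propositional.Properties as ∈
import Data.List.Properties as List
open import Data.List.Relation.Binary.Permutation.Propositional as ↭ using (_↭_)
open import Data.List.Relation.Unary.All as All using (All; []; _∷_)
open import Data.List.Relation.Unary.AllPairs as AllPairs using (AllPairs; []; _∷_)
import Data.List.Relation.Unary.AllPairs.Properties as AllPairs
import Data.List.Relation.Unary.All.Properties as All
open import Data.List.Relation.Unary.Any as Any using (Any; here; there)
open import Data.List.Relation.Binary.BagAndSetEquality using (∼bag⇒↭)
open import Data.List.Membership.Propositional.Properties.WithK using (unique∧set⇒bag)
import Data.List.Relation.Binary.Permutation.Propositional.Properties as ↭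
import Data.List.Relation.Binary.Pointwise as Pointwise
import Data.List.Relation.Unary.Sorted.TotalOrder.Properties as Sorted
import Data.List.Sort as Sort
open import Data.List.Relation.Unary.Unique.Propositional using (Unique)
import Data.List.Relation.Unary.Unique.Propositional.Properties as Unique
open import Data.Nat.Base as ℕ using (ℕ; zero; suc; z≤n; s≤s)
import Data.Nat.DivMod as ℕ
import Data.Nat.Properties as ℕ
open import Data.Nat.Divisibility as ∣ using (divides; _∣?_) renaming (_∣_ to _∣ℕ_)
open import Data.Nat.GCD as GCD using (gcd)
open import Data.Nat.Induction using (<-rec)
open import Data.Nat.Logarithm using (⌊log₂_⌋; ⌊log₂⌋-mono-≤; ⌊log₂⌊n/2⌋⌋≡⌊log₂n⌋∸1; ⌊log₂[2^n]⌋≡n)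
open import Data.Nat.Primality using (Prime; prime?; euclidsLemma; prime⇒irreducible; prime⇒nonTrivial)
open import Data.Nat.Primality.Factorisation using (factorise)
open import Data.Nat.Coprimality as Coprime using (Coprime; coprime?)
import Data.Nat.Solver as ℕ-Solver
open import Data.Product.Base using (Σ; ∃-syntax; _×_; _,_; proj₁; proj₂)
open import Data.Product.Properties using (≡-dec)
open import Data.Rational.Base as ℚ
  using (ℚ; mkℚ; 0ℚ; 1ℚ; ½; _+_; _*_; _-_; -_; _≤_; _<_; _/_; _⊔_; _⊓_; ∣_∣; ↧ₙ_; *≤*; *<*)
import Data.Rational.Properties as ℚ
import Data.Rational.Solver as ℚ-Solver
import Data.Rational.Unnormalised.Base as ℚᵘ
import Data.Rational.Unnormalised.Properties as ℚᵘ
open import Data.Sum.Base using (_⊎_; inj₁; inj₂; [_,_]′)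
open import Data.Unit.Base using (⊤; tt)
open import Data.Vec.Base as Vec using (Vec; []; _∷_)
import Data.Vec.Properties as Vec
open import Data.Vec.Relation.Unary.AllPairs.Core using ([]; _∷_)
open import Data.Vec.Relation.Unary.All as VecAll using ([]; _∷_)
open import Data.Vec.Relation.Unary.Unique.Propositional as VecUnique using ()
open import Function.Base using (_∘_; id; case_of_)
open import Function.Bundles using (Equivalence; mk⇔; _⇔_)
open import Relation.Binary.Bundles using (DecTotalOrder)
open import Relation.Binary.Definitions as Tri using (DecidableEquality)
open import Relation.Binary.PropositionalEquality
  using (_≡_; _≢_; refl; sym; trans; cong; cong₂; subst; subst₂; module ≡-Reasoning)
open import Relation.Nullary using (¬_; Dec; yes; no)
open import Relation.Nullary.Decidable using (True; toWitness; _×-dec_; ¬?)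

open ℚ-Solver.+-*-Solver using (solve; _:=_; _:+_; _:*_; _:-_; :-_; con)
open ℕ-Solver.+-*-Solver using ()
  renaming (solve to solveℕ; _:=_ to _⊜_; _:+_ to _⊞_; _:*_ to _⊠_; con to conℕ)

-- Inequalities are proved by certificates: a nonnegative combination L ≤ R of
-- known inequalities together with a ring identity that identifies it with the goal.

-- Every word has its own error O(n), and these errors cannot be added up over infinitely many
-- words. Large letters are therefore never counted word by word: their contribution is a total,
-- known exactly, minus the part with bounded letters. For this Φ has to be affine in the large
-- letter, which is where pairwise distinct positions enter. A repeated position would bring in κ²,
-- whose sum over L n is of order n² log n.
--
-- The constant A is rational although the single areas are only constructed as limits. The letters
-- between the chosen positions are unbounded, so one region may consist of infinitely many
-- polygons. A is instead the leading coefficient of a lattice-point sum, where a rational total and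
-- finitely many rational polygons suffice. The series of areas is compared with A at finite n,
-- before leading coefficients are taken, so that no limit and infinite sum are ever interchanged.
--
-- Coprimality enters last: Φ - A has sum O(n) over L n, hence Möbius inversion meets no main term
-- and N(Q) needs no asymptotics of its own.

infixl 6 _⊕_ _<⊕_ _⊕<_ _<⊕<_ _⊕ℕ_
infixr 7 _⊛_ _⊛<_ _⊛ℕ_

lin≤ : ∀ {L R x y} → L ≤ R → x + R ≡ y + L → x ≤ y
lin≤ {L} {R} {x} {y} L≤R eq = subst₂ _≤_
  (solve 2 (λ a b → a :+ b :- b := a) refl x L)
  (trans (cong (_- L) eq) (solve 2 (λ a b → a :+ b :- b := a) refl y L))
  (ℚ.+-monoˡ-≤ (- L) (ℚ.+-monoʳ-≤ x L≤R))

lin< : ∀ {L R x y} → L < R → x + R ≡ y + L → x < y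
lin< {L} {R} {x} {y} L<R eq = subst₂ _<_
  (solve 2 (λ a b → a :+ b :- b := a) refl x L)
  (trans (cong (_- L) eq) (solve 2 (λ a b → a :+ b :- b := a) refl y L))
  (ℚ.+-monoˡ-< (- L) (ℚ.+-monoʳ-< x L<R))

_⊕_ : ∀ {a b c d} → a ≤ b → c ≤ d → a + c ≤ b + d
_⊕_ = ℚ.+-mono-≤

_<⊕_ : ∀ {a b c d} → a < b → c ≤ d → a + c < b + d
_<⊕_ = ℚ.+-mono-<-≤

_⊕<_ : ∀ {a b c d} → a ≤ b → c < d → a + c < b + d
_⊕<_ = ℚ.+-mono-≤-<

_<⊕<_ : ∀ {a b c d} → a < b → c < d → a + c < b + d
_<⊕<_ = ℚ.+-mono-<

-- The scalars of a certificate are closed rationals, so their sign is decided by computation and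
-- need not be supplied.
_⊛_ : ∀ {a b} q {_ : True (0ℚ ℚ.≤? q)} → a ≤ b → q * a ≤ q * b
_⊛_ q {0≤q} = ℚ.*-monoˡ-≤-nonNeg q {{ℚ.nonNegative (toWitness 0≤q)}}

_⊛<_ : ∀ {a b} q {_ : True (0ℚ ℚ.<? q)} → a < b → q * a < q * b
_⊛<_ q {0<q} = ℚ.*-monoʳ-<-pos q {{ℚ.positive (toWitness 0<q)}}

nonneg : ∀ q {_ : True (0ℚ ℚ.≤? q)} → 0ℚ ≤ q
nonneg q {w} = toWitness w

pos : ∀ q {_ : True (0ℚ ℚ.<? q)} → 0ℚ < q
pos q {w} = toWitness w

linℕ : ∀ {L R x y} → L ℕ.≤ R → x ℕ.+ R ≡ y ℕ.+ L → x ℕ.≤ y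
linℕ {L} {R} {x} {y} L≤R eq = ℕ.+-cancelʳ-≤ L x y
  (ℕ.≤-trans (ℕ.+-monoʳ-≤ x L≤R) (ℕ.≤-reflexive eq))

-- A certificate over ℕ cannot have fractional coefficients; multiplying the goal by k + 1 clears
-- their denominators.
linℕ-scaled : ∀ k {L R x y} → L ℕ.≤ R → suc k ℕ.* x ℕ.+ R ≡ suc k ℕ.* y ℕ.+ L → x ℕ.≤ y
linℕ-scaled k {x = x} {y} L≤R eq = ℕ.*-cancelˡ-≤ (suc k) (linℕ L≤R eq)

linℕ≡ : ∀ {L R x y} → L ≡ R → x ℕ.+ R ≡ y ℕ.+ L → x ≡ y
linℕ≡ {L} {R} {x} {y} refl eq = ℕ.+-cancelʳ-≡ L x y eq

_⊕ℕ_ : ∀ {a b c d} → a ℕ.≤ b → c ℕ.≤ d → a ℕ.+ c ℕ.≤ b ℕ.+ d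
_⊕ℕ_ = ℕ.+-mono-≤

_⊛ℕ_ : ∀ {a b} k → a ℕ.≤ b → k ℕ.* a ℕ.≤ k ℕ.* b
k ⊛ℕ a≤b = ℕ.*-monoʳ-≤ k a≤b

absurd-ℕ : {A : Set} → 1 ℕ.≤ 0 → A
absurd-ℕ ()

absurd-ℚ : {A : Set} → 0ℚ < 0ℚ → A
absurd-ℚ 0<0 = ⊥-elim (ℚ.<-irrefl refl 0<0)

*-monoˡ-≤ : ∀ {p q} r → 0ℚ ≤ r → p ≤ q → r * p ≤ r * q
*-monoˡ-≤ r 0≤r = ℚ.*-monoˡ-≤-nonNeg r {{ℚ.nonNegative 0≤r}}

*-monoˡ-< : ∀ {p q} r → 0ℚ < r → p < q → r * p < r * q
*-monoˡ-< r 0<r = ℚ.*-monoʳ-<-pos r {{ℚ.positive 0<r}}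

*-cancelˡ-≤ : ∀ {p q} r → 0ℚ < r → r * p ≤ r * q → p ≤ q
*-cancelˡ-≤ r 0<r = ℚ.*-cancelˡ-≤-pos r {{ℚ.positive 0<r}}

*-cancelˡ-< : ∀ {p q} r → 0ℚ < r → r * p < r * q → p < q
*-cancelˡ-< r 0<r = ℚ.*-cancelˡ-<-nonNeg r {{ℚ.pos⇒nonNeg r {{ℚ.positive 0<r}}}}

*-mono-≤ : ∀ {p q r s} → 0ℚ ≤ q → 0ℚ ≤ r → p ≤ q → r ≤ s → p * r ≤ q * s
*-mono-≤ {p} {q} {r} {s} 0≤q 0≤r p≤q r≤s = ℚ.≤-trans
  (subst₂ _≤_ (ℚ.*-comm r p) (ℚ.*-comm r q) (*-monoˡ-≤ r 0≤r p≤q))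
  (*-monoˡ-≤ q 0≤q r≤s)

0≤* : ∀ {p q} → 0ℚ ≤ p → 0ℚ ≤ q → 0ℚ ≤ p * q
0≤* {p} {q} 0≤p 0≤q = subst (_≤ p * q) (ℚ.*-zeroʳ p) (*-monoˡ-≤ p 0≤p 0≤q)

0<* : ∀ {p q} → 0ℚ < p → 0ℚ < q → 0ℚ < p * q
0<* {p} {q} 0<p 0<q = subst (_< p * q) (ℚ.*-zeroʳ p) (*-monoˡ-< p 0<p 0<q)

p≤q⇒0≤q-p : ∀ {p q} → p ≤ q → 0ℚ ≤ q - p
p≤q⇒0≤q-p {p} {q} p≤q = lin≤ p≤q (solve 2 (λ a b → (con 0ℚ) :+ a := a :- b :+ b) refl q p)

∣∣≤ : ∀ {x c} → x ≤ c → - x ≤ c → ∣ x ∣ ≤ c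
∣∣≤ {x} {c} x≤c -x≤c with ℚ.∣p∣≡p∨∣p∣≡-p x
... | inj₁ eq = subst (_≤ c) (sym eq) x≤c
... | inj₂ eq = subst (_≤ c) (sym eq) -x≤c

x≤∣x∣ : ∀ x → x ≤ ∣ x ∣
x≤∣x∣ x with ℚ.≤-total 0ℚ x
... | inj₁ 0≤x = ℚ.≤-reflexive (sym (ℚ.0≤p⇒∣p∣≡p 0≤x))
... | inj₂ x≤0 = ℚ.≤-trans x≤0 (ℚ.0≤∣p∣ x)

-x≤∣x∣ : ∀ x → - x ≤ ∣ x ∣
-x≤∣x∣ x = subst (- x ≤_) (ℚ.∣-p∣≡∣p∣ x) (x≤∣x∣ (- x))

recip : ∀ p → 0ℚ < p → ∃[ v ] (0ℚ < v × p * v ≡ 1ℚ)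
recip p 0<p = (ℚ.1/ p) {{nz}} , ℚ.positive⁻¹ _ {{ℚ.1/pos⇒pos p {{ps}}}} , ℚ.*-inverseʳ p {{nz}}
  where
  ps = ℚ.positive 0<p
  nz = ℚ.pos⇒nonZero p {{ps}}

-- ι is fromℕ, made opaque so that unification does not unfold the normalisation of fractions.
opaque
  ι : ℕ → ℚ
  ι = fromℕ

  ι≡fromℕ : ∀ n → ι n ≡ fromℕ n
  ι≡fromℕ n = refl

opaque
  unfolding ι

  coprime-1 : ∀ n → Coprime n 1
  coprime-1 n = Coprime.sym (Coprime.1-coprimeTo n)

  ι≡mkℚ : ∀ n → ι n ≡ mkℚ (ℤ.+ n) 0 (coprime-1 n)
  ι≡mkℚ n = ℚ.normalize-coprime (coprime-1 n)

  toℚᵘ-ι : ∀ n → ℚ.toℚᵘ (ι n) ≡ ℚᵘ.mkℚᵘ (ℤ.+ n) 0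
  toℚᵘ-ι n = cong ℚ.toℚᵘ (ι≡mkℚ n)

  ι-+ : ∀ m n → ι (m ℕ.+ n) ≡ ι m + ι n
  ι-+ m n = ℚ.toℚᵘ-injective (ℚᵘ.≃-trans
    (ℚᵘ.≃-reflexive (toℚᵘ-ι (m ℕ.+ n)))
    (ℚᵘ.≃-trans (ℚᵘ.*≡* (trans (ℤ.*-identityʳ _) (sym (trans (ℤ.*-identityʳ _)
        (cong₂ ℤ._+_ (ℤ.*-identityʳ (ℤ.+ m)) (ℤ.*-identityʳ (ℤ.+ n)))))))
      (ℚᵘ.≃-sym (ℚᵘ.≃-trans (ℚ.toℚᵘ-homo-+ (ι m) (ι n))
        (ℚᵘ.≃-reflexive (cong₂ ℚᵘ._+_ (toℚᵘ-ι m) (toℚᵘ-ι n)))))))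

  ι-* : ∀ m n → ι (m ℕ.* n) ≡ ι m * ι n
  ι-* m n = ℚ.toℚᵘ-injective (ℚᵘ.≃-trans
    (ℚᵘ.≃-reflexive (toℚᵘ-ι (m ℕ.* n)))
    (ℚᵘ.≃-trans (ℚᵘ.*≡* (trans (ℤ.*-identityʳ _) (sym (trans (ℤ.*-identityʳ _)
        (sym (ℤ.pos-* m n))))))
      (ℚᵘ.≃-sym (ℚᵘ.≃-trans (ℚ.toℚᵘ-homo-* (ι m) (ι n))
        (ℚᵘ.≃-reflexive (cong₂ ℚᵘ._*_ (toℚᵘ-ι m) (toℚᵘ-ι n)))))))

  ι-≤ : ∀ {m n} → m ℕ.≤ n → ι m ≤ ι n
  ι-≤ {m} {n} m≤n = subst₂ _≤_ (sym (ι≡mkℚ m)) (sym (ι≡mkℚ n))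
    (*≤* (ℤ.*-monoʳ-≤-nonNeg (ℤ.+ 1) (ℤ.+≤+ m≤n)))

  ι-< : ∀ {m n} → m ℕ.< n → ι m < ι n
  ι-< {m} {n} m<n = subst₂ _<_ (sym (ι≡mkℚ m)) (sym (ι≡mkℚ n))
    (*<* (ℤ.*-monoʳ-<-pos (ℤ.+ 1) (ℤ.+<+ m<n)))

opaque
  unfolding ι

  ι-suc : ∀ n → ι (suc n) ≡ 1ℚ + ι n
  ι-suc = ι-+ 1

  0≤ι : ∀ n → 0ℚ ≤ ι n
  0≤ι n = ι-≤ {0} {n} z≤n

  0<ι : ∀ {n} → 1 ℕ.≤ n → 0ℚ < ι n
  0<ι {n} = ι-< {0} {n}

  ι-0 : ι 0 ≡ 0ℚ
  ι-0 = refl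

  ι-1 : ι 1 ≡ 1ℚ
  ι-1 = refl

ι-cancel-≤ : ∀ {m n} → ι m ≤ ι n → m ℕ.≤ n
ι-cancel-≤ {m} {n} le with m ℕ.≤? n
... | yes m≤n = m≤n
... | no m≰n = ⊥-elim (ℚ.<-irrefl refl (ℚ.<-≤-trans (ι-< (ℕ.≰⇒> m≰n)) le))

ι-cancel-< : ∀ {m n} → ι m < ι n → m ℕ.< n
ι-cancel-< {m} {n} lt with n ℕ.≤? m
... | yes n≤m = ⊥-elim (ℚ.<-irrefl refl (ℚ.<-≤-trans lt (ι-≤ n≤m)))
... | no n≰m = ℕ.≰⇒> n≰m

archimedean : ∀ q → ∃[ n ] (q ≤ ι n)
archimedean (mkℚ (ℤ.+ n) d c) = n , subst (mkℚ (ℤ.+ n) d c ≤_) (sym (ι≡mkℚ n))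
  (*≤* (ℤ.*-monoˡ-≤-nonNeg (ℤ.+ n) (ℤ.+≤+ (s≤s z≤n))))
archimedean q@(mkℚ -[1+ n ] d c) = 0 , ℚ.≤-trans (ℚ.<⇒≤ (ℚ.negative⁻¹ q)) (0≤ι 0)

-- A positive x would have a multiple above C, by the Archimedean property. Leading coefficients are
-- compared in this way, without limits.
bounded-multiples⇒≤0 : ∀ x C → (∀ n → 1 ℕ.≤ n → x * ι n ≤ C) → x ≤ 0ℚ
bounded-multiples⇒≤0 x C bound with x ℚ.≤? 0ℚ
... | yes x≤0 = x≤0
... | no x≰0 with recip x (ℚ.≰⇒> x≰0)
...   | v , 0<v , xv≡1 with archimedean (C * v)
...     | n , Cv≤n = ⊥-elim (ℚ.<-irrefl refl (begin-strict
  C                     ≡⟨ (solve 1 (λ a → a := a :* (con 1ℚ)) refl C) ⟩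
  C * 1ℚ                ≡⟨ cong (C *_) (sym xv≡1) ⟩
  C * (x * v)           ≡⟨ (solve 3 (λ a b c → a :* (b :* c) := b :* (a :* c)) refl C x v) ⟩
  x * (C * v)           ≤⟨ *-monoˡ-≤ x (ℚ.<⇒≤ 0<x) Cv≤n ⟩
  x * ι n           <⟨ *-monoˡ-< x 0<x (ι-< (ℕ.n<1+n n)) ⟩
  x * ι (suc n)     ≤⟨ bound (suc n) (s≤s z≤n) ⟩
  C                     ∎))
  where
  open ℚ.≤-Reasoning
  0<x = ℚ.≰⇒> x≰0

-- Finite sums

∑ : {A : Set} → List A → (A → ℚ) → ℚ
∑ xs f = foldr _+_ 0ℚ (map f xs)

𝟙 : {P : Set} → Dec P → ℚ
𝟙 (yes _) = 1ℚ
𝟙 (no _)  = 0ℚ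

𝟙-yes : {P : Set} (d : Dec P) → P → 𝟙 d ≡ 1ℚ
𝟙-yes (yes _) _ = refl
𝟙-yes (no ¬p) p = ⊥-elim (¬p p)

𝟙-no : {P : Set} (d : Dec P) → ¬ P → 𝟙 d ≡ 0ℚ
𝟙-no (yes p) ¬p = ⊥-elim (¬p p)
𝟙-no (no _) _ = refl

𝟙-⇔ : {P Q : Set} (d : Dec P) (e : Dec Q) → (P → Q) → (Q → P) → 𝟙 d ≡ 𝟙 e
𝟙-⇔ (yes p) e f g = sym (𝟙-yes e (f p))
𝟙-⇔ (no ¬p) e f g = sym (𝟙-no e (¬p ∘ g))

𝟙-× : {P Q : Set} (d : Dec P) (e : Dec Q) → 𝟙 (d ×-dec e) ≡ 𝟙 d * 𝟙 e
𝟙-× (yes _) (yes _) = refl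
𝟙-× (yes _) (no _) = refl
𝟙-× (no _) (yes _) = refl
𝟙-× (no _) (no _) = refl

0≤𝟙 : {P : Set} (d : Dec P) → 0ℚ ≤ 𝟙 d
0≤𝟙 (yes _) = nonneg 1ℚ
0≤𝟙 (no _)  = ℚ.≤-refl

𝟙≤1 : {P : Set} (d : Dec P) → 𝟙 d ≤ 1ℚ
𝟙≤1 (yes _) = ℚ.≤-refl
𝟙≤1 (no _)  = nonneg 1ℚ

𝟙-mono : {P Q : Set} (d : Dec P) (e : Dec Q) → (P → Q) → 𝟙 d ≤ 𝟙 e
𝟙-mono (yes p) e f = ℚ.≤-reflexive (sym (𝟙-yes e (f p)))
𝟙-mono (no _) e f = 0≤𝟙 e

module _ {A : Set} where

  ∑-cong : ∀ (xs : List A) {f g} → (∀ {x} → x ∈ xs → f x ≡ g x) → ∑ xs f ≡ ∑ xs g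
  ∑-cong [] eq = refl
  ∑-cong (x ∷ xs) eq = cong₂ _+_ (eq (here refl)) (∑-cong xs (eq ∘ there))

  ∑-mono : ∀ (xs : List A) {f g} → (∀ {x} → x ∈ xs → f x ≤ g x) → ∑ xs f ≤ ∑ xs g
  ∑-mono [] le = ℚ.≤-refl
  ∑-mono (x ∷ xs) le = ℚ.+-mono-≤ (le (here refl)) (∑-mono xs (le ∘ there))

  ∑-+ : ∀ (xs : List A) f g → ∑ xs (λ x → f x + g x) ≡ ∑ xs f + ∑ xs g
  ∑-+ [] f g = refl
  ∑-+ (x ∷ xs) f g = trans (cong (f x + g x +_) (∑-+ xs f g))
    (solve 4 (λ a b c d → a :+ b :+ (c :+ d)
        := a :+ c :+ (b :+ d))
      refl (f x) (g x) (∑ xs f) (∑ xs g))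

  ∑-*ˡ : ∀ (xs : List A) c f → ∑ xs (λ x → c * f x) ≡ c * ∑ xs f
  ∑-*ˡ [] c f = sym (ℚ.*-zeroʳ c)
  ∑-*ˡ (x ∷ xs) c f = trans (cong (c * f x +_) (∑-*ˡ xs c f)) (sym (ℚ.*-distribˡ-+ c (f x) (∑ xs f)))

  ∑-- : ∀ (xs : List A) f g → ∑ xs (λ x → f x - g x) ≡ ∑ xs f - ∑ xs g
  ∑-- [] f g = refl
  ∑-- (x ∷ xs) f g = trans (cong (f x - g x +_) (∑-- xs f g))
    (solve 4 (λ a b c d → a :- b :+ (c :- d)
        := a :+ c :- (b :+ d))
      refl (f x) (g x) (∑ xs f) (∑ xs g))

  ∑-0 : ∀ (xs : List A) → ∑ xs (λ _ → 0ℚ) ≡ 0ℚ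
  ∑-0 [] = refl
  ∑-0 (x ∷ xs) = trans (ℚ.+-identityˡ _) (∑-0 xs)

  ∑-zero : ∀ (xs : List A) {f} → (∀ {x} → x ∈ xs → f x ≡ 0ℚ) → ∑ xs f ≡ 0ℚ
  ∑-zero xs eq = trans (∑-cong xs eq) (∑-0 xs)

  0≤∑ : ∀ (xs : List A) {f} → (∀ {x} → x ∈ xs → 0ℚ ≤ f x) → 0ℚ ≤ ∑ xs f
  0≤∑ xs {f} le = subst (_≤ ∑ xs f) (∑-0 xs) (∑-mono xs le)

  ∑-const : ∀ (xs : List A) c → ∑ xs (λ _ → c) ≡ c * ι (length xs)
  ∑-const [] c = trans (sym (ℚ.*-zeroʳ c)) (cong (c *_) (sym ι-0))
  ∑-const (x ∷ xs) c = begin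
    c + ∑ xs (λ _ → c)              ≡⟨ cong (λ z → c + z) (∑-const xs c) ⟩
    c + c * ι (length xs)       ≡⟨ (solve 2 (λ a b → a :+ a :* b
                                       := a :* ((con 1ℚ) :+ b))
                                     refl c (ι (length xs))) ⟩
    c * (1ℚ + ι (length xs))    ≡⟨ cong (c *_) (sym (ι-suc (length xs))) ⟩
    c * ι (suc (length xs))     ∎
    where open ≡-Reasoning

  ∑-length : ∀ (xs : List A) → ∑ xs (λ _ → 1ℚ) ≡ ι (length xs)
  ∑-length xs = trans (∑-const xs 1ℚ) (ℚ.*-identityˡ _)

  ∑-++ : ∀ (xs ys : List A) f → ∑ (xs ++ ys) f ≡ ∑ xs f + ∑ ys f
  ∑-++ [] ys f = sym (ℚ.+-identityˡ _)
  ∑-++ (x ∷ xs) ys f = trans (cong (f x +_) (∑-++ xs ys f)) (sym (ℚ.+-assoc (f x) _ _))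

  ∑-filter : ∀ {P : A → Set} (P? : ∀ x → Dec (P x)) xs f →
             ∑ (filter P? xs) f ≡ ∑ xs (λ x → 𝟙 (P? x) * f x)
  ∑-filter P? [] f = refl
  ∑-filter P? (x ∷ xs) f with P? x
  ... | yes _ = cong₂ _+_ (sym (ℚ.*-identityˡ (f x))) (∑-filter P? xs f)
  ... | no _  = trans (∑-filter P? xs f)
    (sym (trans (cong (_+ ∑ xs (λ x → 𝟙 (P? x) * f x)) (ℚ.*-zeroˡ (f x))) (ℚ.+-identityˡ _)))

  ∑-↭ : ∀ {xs ys : List A} f → xs ↭ ys → ∑ xs f ≡ ∑ ys f
  ∑-↭ f ↭.refl = refl
  ∑-↭ f (↭.prep x p) = cong (f x +_) (∑-↭ f p)
  ∑-↭ f (↭.swap {xs} {ys} x y p) = trans (cong (λ s → f x + (f y + s)) (∑-↭ f p))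
    (solve 3 (λ a b c → a :+ (b :+ c) := b :+ (a :+ c)) refl (f x) (f y) (∑ ys f))
  ∑-↭ f (↭.trans p q) = trans (∑-↭ f p) (∑-↭ f q)

  ∑-δ-∉ : (_≟_ : DecidableEquality A) → ∀ xs x (f : A → ℚ) → x ∉ xs → ∑ xs (λ y → 𝟙 (x ≟ y) * f y) ≡ 0ℚ
  ∑-δ-∉ _≟_ xs x f x∉xs = ∑-zero xs λ {y} y∈xs → trans
    (cong (_* f y) (𝟙-no (x ≟ y) (λ { refl → x∉xs y∈xs }))) (ℚ.*-zeroˡ (f y))

  ∑-δ : (_≟_ : DecidableEquality A) → ∀ {xs} x (f : A → ℚ) → Unique xs → x ∈ xs →
        ∑ xs (λ y → 𝟙 (x ≟ y) * f y) ≡ f x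
  ∑-δ _≟_ {x ∷ xs} .x f (x# ∷ _) (here refl) = begin
    𝟙 (x ≟ x) * f x + ∑ xs (λ y → 𝟙 (x ≟ y) * f y)
      ≡⟨ cong₂ (λ u v → u * f x + v) (𝟙-yes (x ≟ x) refl)
           (∑-δ-∉ _≟_ xs x f (λ x∈xs → All.lookup x# x∈xs refl)) ⟩
    1ℚ * f x + 0ℚ    ≡⟨ (solve 1 (λ a → (con 1ℚ) :* a :+ (con 0ℚ) := a) refl (f x)) ⟩
    f x              ∎
    where open ≡-Reasoning
  ∑-δ _≟_ {y ∷ xs} x f (y# ∷ u) (there x∈xs) = begin
    𝟙 (x ≟ y) * f y + ∑ xs (λ y → 𝟙 (x ≟ y) * f y)
      ≡⟨ cong₂ (λ u v → u * f y + v) (𝟙-no (x ≟ y) (λ { refl → All.lookup y# x∈xs refl }))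
           (∑-δ _≟_ x f u x∈xs) ⟩
    0ℚ * f y + f x    ≡⟨ (solve 2 (λ a b → (con 0ℚ) :* a :+ b := b) refl (f y) (f x)) ⟩
    f x               ∎
    where open ≡-Reasoning

module _ {A B : Set} where

  ∑-map : ∀ (g : B → A) xs (f : A → ℚ) → ∑ (map g xs) f ≡ ∑ xs (f ∘ g)
  ∑-map g [] f = refl
  ∑-map g (x ∷ xs) f = cong (f (g x) +_) (∑-map g xs f)

  ∑-swap : ∀ (xs : List A) (ys : List B) (f : A → B → ℚ) →
           ∑ xs (λ x → ∑ ys (λ y → f x y)) ≡ ∑ ys (λ y → ∑ xs (λ x → f x y))
  ∑-swap [] ys f = sym (∑-0 ys)
  ∑-swap (x ∷ xs) ys f = trans (cong (∑ ys (f x) +_) (∑-swap xs ys f))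
    (sym (∑-+ ys (f x) (λ y → ∑ xs (λ x → f x y))))

  ∑-productWith : ∀ {C : Set} (g : A → B → C) xs ys f →
                  ∑ (cartesianProductWith g xs ys) f ≡ ∑ xs (λ x → ∑ ys (λ y → f (g x y)))
  ∑-productWith g [] ys f = refl
  ∑-productWith g (x ∷ xs) ys f = trans
    (∑-++ (map (g x) ys) (cartesianProductWith g xs ys) f)
    (cong₂ _+_ (lemma ys) (∑-productWith g xs ys f))
    where
    lemma : ∀ ys → ∑ (map (g x) ys) f ≡ ∑ ys (λ y → f (g x y))
    lemma [] = refl
    lemma (y ∷ ys) = cong (f (g x y) +_) (lemma ys)

∑-*ʳ : {A : Set} (xs : List A) → ∀ c (f : A → ℚ) → ∑ xs (λ x → f x * c) ≡ ∑ xs f * c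
∑-*ʳ xs c f = trans (∑-cong xs (λ {x} _ → ℚ.*-comm (f x) c))
  (trans (∑-*ˡ xs c f) (ℚ.*-comm c (∑ xs f)))

∈[1⋯]⁺ : ∀ {n i} → 1 ℕ.≤ i → i ℕ.≤ n → i ∈ [1⋯ n ]
∈[1⋯]⁺ {n} {suc i} _ i<n = ∈.∈-map⁺ suc (∈.∈-upTo⁺ i<n)

∈[1⋯]⁻ : ∀ {n i} → i ∈ [1⋯ n ] → 1 ℕ.≤ i × i ℕ.≤ n
∈[1⋯]⁻ i∈ with ∈.∈-map⁻ suc i∈
... | j , j∈ , refl = s≤s z≤n , ∈.∈-upTo⁻ j∈

unique-[1⋯] : ∀ n → Unique [1⋯ n ]
unique-[1⋯] n = Unique.map⁺ ℕ.suc-injective (Unique.upTo⁺ n)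

length-[1⋯] : ∀ n → length [1⋯ n ] ≡ n
length-[1⋯] n = trans (List.length-map suc (upTo n)) (List.length-upTo n)

∑-[1⋯]-suc : ∀ n f → ∑ [1⋯ suc n ] f ≡ ∑ [1⋯ n ] f + f (suc n)
∑-[1⋯]-suc n f = begin
  ∑ (map suc (upTo (suc n))) f                 ≡⟨ cong (λ l → ∑ (map suc l) f) (List.applyUpTo-∷ʳ id n) ⟨
  ∑ (map suc (upTo n ++ n ∷ [])) f             ≡⟨ cong (λ l → ∑ l f) (List.map-++ suc (upTo n) _) ⟩
  ∑ (map suc (upTo n) ++ suc n ∷ []) f         ≡⟨ ∑-++ (map suc (upTo n)) _ f ⟩
  ∑ [1⋯ n ] f + (f (suc n) + 0ℚ)               ≡⟨ cong (∑ [1⋯ n ] f +_) (ℚ.+-identityʳ _) ⟩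
  ∑ [1⋯ n ] f + f (suc n)                      ∎
  where open ≡-Reasoning

-- Both sides are the double sum of F y over the pairs with f x = y, taken in the two possible
-- orders. No permutation of lists has to be constructed from the bijection.
∑-reindex : {A B : Set} (_≟₁_ : DecidableEquality A) (_≟₂_ : DecidableEquality B)
            {xs : List A} {ys : List B} → Unique xs → Unique ys →
            (f : A → B) (g : B → A) (F : B → ℚ) →
            (∀ {x} → x ∈ xs → f x ∈ ys) → (∀ {y} → y ∈ ys → g y ∈ xs) →
            (∀ {x} → x ∈ xs → g (f x) ≡ x) → (∀ {y} → y ∈ ys → f (g y) ≡ y) →
            ∑ xs (F ∘ f) ≡ ∑ ys F
∑-reindex _≟₁_ _≟₂_ {xs} {ys} ux uy f g F f∈ g∈ gf fg = begin
  ∑ xs (F ∘ f)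
    ≡⟨ ∑-cong xs (λ {x} x∈ → sym (∑-δ _≟₂_ (f x) F uy (f∈ x∈))) ⟩
  ∑ xs (λ x → ∑ ys (λ y → 𝟙 (f x ≟₂ y) * F y))
    ≡⟨ ∑-swap xs ys _ ⟩
  ∑ ys (λ y → ∑ xs (λ x → 𝟙 (f x ≟₂ y) * F y))
    ≡⟨ ∑-cong ys (λ {y} y∈ → ∑-cong xs (λ {x} x∈ → cong (_* F y)
         (𝟙-⇔ (f x ≟₂ y) (g y ≟₁ x) (λ { refl → gf x∈ }) (λ { refl → fg y∈ })))) ⟩
  ∑ ys (λ y → ∑ xs (λ x → 𝟙 (g y ≟₁ x) * F y))
    ≡⟨ ∑-cong ys (λ {y} y∈ → ∑-δ _≟₁_ (g y) (λ _ → F y) ux (g∈ y∈)) ⟩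
  ∑ ys F ∎
  where open ≡-Reasoning

-- Lattice points of the triangle and the Farey map

Pair : Set
Pair = ℕ × ℕ

_≟ᴾ_ : DecidableEquality Pair
_≟ᴾ_ = ≡-dec ℕ._≟_ ℕ._≟_

opaque
  L : ℕ → List Pair
  L n = filter (λ s → n ℕ.<? proj₁ s ℕ.+ proj₂ s) (cartesianProduct [1⋯ n ] [1⋯ n ])

record InL (n a b : ℕ) : Set where
  constructor inL
  field
    a≤n : a ℕ.≤ n
    b≤n : b ℕ.≤ n
    n<a+b : n ℕ.< a ℕ.+ b

  1≤a : 1 ℕ.≤ a
  1≤a = linℕ (b≤n ⊕ℕ n<a+b)
          (solveℕ 3 (λ a b c → (conℕ 1) ⊞ (a ⊞ (b ⊞ c)) ⊜ b ⊞ (c ⊞ ((conℕ 1) ⊞ a))) refl n a b)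

  1≤b : 1 ℕ.≤ b
  1≤b = linℕ (a≤n ⊕ℕ n<a+b)
          (solveℕ 3 (λ a b c → (conℕ 1) ⊞ (a ⊞ (b ⊞ c)) ⊜ c ⊞ (b ⊞ ((conℕ 1) ⊞ a))) refl n a b)

opaque
  unfolding L

  ∈L⁺ : ∀ {n a b} → InL n a b → (a , b) ∈ L n
  ∈L⁺ i = ∈.∈-filter⁺ _ (∈.∈-cartesianProduct⁺ (∈[1⋯]⁺ (1≤a i) (a≤n i)) (∈[1⋯]⁺ (1≤b i) (b≤n i))) (n<a+b i)
    where open InL

  ∈L⁻ : ∀ {n s} → s ∈ L n → InL n (proj₁ s) (proj₂ s)
  ∈L⁻ {n} s∈ with ∈.∈-filter⁻ _ {xs = cartesianProduct [1⋯ n ] [1⋯ n ]} s∈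
  ... | s∈′ , lt with ∈.∈-cartesianProduct⁻ [1⋯ n ] [1⋯ n ] s∈′
  ...   | a∈ , b∈ = inL (proj₂ (∈[1⋯]⁻ a∈)) (proj₂ (∈[1⋯]⁻ b∈)) lt

  unique-L : ∀ n → Unique (L n)
  unique-L n = Unique.filter⁺ _ (Unique.cartesianProduct⁺ (unique-[1⋯] n) (unique-[1⋯] n))

  ∑-L : ∀ n F → ∑ (L n) F ≡ ∑ [1⋯ n ] (λ a → ∑ [1⋯ n ] (λ b → 𝟙 (n ℕ.<? a ℕ.+ b) * F (a , b)))
  ∑-L n F = trans (∑-filter _ (cartesianProduct [1⋯ n ] [1⋯ n ]) F)
    (∑-productWith _,_ [1⋯ n ] [1⋯ n ] _)

opaque
  κ : ℕ → Pair → ℕ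
  -- A junk value: points of `L n` have positive entries.
  κ n (a , zero)  = 0
  κ n (a , suc b) = (n ℕ.+ a) ℕ./ suc b

  T : ℕ → Pair → Pair
  T n (a , b) = b , κ n (a , b) ℕ.* b ℕ.∸ a

-- Here c is the largest integer up to n that is congruent to -a modulo b. This describes one step
-- of the Farey map without division and truncated subtraction, and its equation is symmetric in a
-- and c, which makes the step reversible.
record Next (n a b c k : ℕ) : Set where
  constructor next
  field
    c+a≡kb : c ℕ.+ a ≡ k ℕ.* b
    c≤n : c ℕ.≤ n
    n<b+c : n ℕ.< b ℕ.+ c

opaque
  unfolding κ T

  κ-unique : ∀ {n a b c k} → 1 ℕ.≤ b → Next n a b c k → κ n (a , b) ≡ k
  κ-unique {n} {a} {suc b} {c} {k} _ (next eq c≤n n<b+c) = begin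
    (n ℕ.+ a) ℕ./ suc b                             ≡⟨ cong (ℕ._/ suc b) n+a≡ ⟩
    (n ℕ.∸ c ℕ.+ k ℕ.* suc b) ℕ./ suc b             ≡⟨ ℕ.+-distrib-/-∣ʳ (n ℕ.∸ c) (divides k refl) ⟩
    (n ℕ.∸ c) ℕ./ suc b ℕ.+ k ℕ.* suc b ℕ./ suc b   ≡⟨ cong₂ ℕ._+_ (ℕ.m<n⇒m/n≡0 r<b) (ℕ.m*n/n≡m k (suc b)) ⟩
    k                                               ∎
    where
    open ≡-Reasoning
    r+c≡n : n ℕ.∸ c ℕ.+ c ≡ n
    r+c≡n = ℕ.m∸n+n≡m c≤n
    n+a≡ : n ℕ.+ a ≡ n ℕ.∸ c ℕ.+ k ℕ.* suc b
    n+a≡ = trans (cong (ℕ._+ a) (sym r+c≡n))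
      (trans (ℕ.+-assoc (n ℕ.∸ c) c a) (cong (n ℕ.∸ c ℕ.+_) eq))
    r<b : n ℕ.∸ c ℕ.< suc b
    r<b = linℕ (n<b+c ⊕ℕ (ℕ.≤-reflexive r+c≡n))
            (solveℕ 4 (λ a b c d → (conℕ 1) ⊞ a ⊞ (b ⊞ c ⊞ d)
                ⊜ b ⊞ ((conℕ 1) ⊞ d ⊞ (a ⊞ c)))
              refl (n ℕ.∸ c) (suc b) c n)

  T-unique : ∀ {n a b c k} → 1 ℕ.≤ b → Next n a b c k → T n (a , b) ≡ (b , c)
  T-unique {n} {a} {b} {c} {k} 1≤b nx = cong (b ,_)
    (trans (cong (λ j → j ℕ.* b ℕ.∸ a) (κ-unique 1≤b nx))
      (trans (cong (ℕ._∸ a) (sym (Next.c+a≡kb nx))) (ℕ.m+n∸n≡m c a)))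

  κ-next : ∀ {n a b} → InL n a b → ∃[ c ] Next n a b c (κ n (a , b))
  κ-next {n} {a} {zero} i = ⊥-elim (ℕ.<-irrefl refl (InL.1≤b i))
  κ-next {n} {a} {b@(suc b′)} (inL a≤n b≤n n<a+b) =
    k ℕ.* b ℕ.∸ a , next (ℕ.m∸n+n≡m a≤kb)
      (linℕ ((ℕ.≤-reflexive eq) ⊕ℕ (ℕ.m/n*n≤m (n ℕ.+ a) b))
        (solveℕ 4 (λ a b c d → a ⊞ (b ⊞ (c ⊞ d)) ⊜ c ⊞ (a ⊞ d ⊞ b)) refl (k ℕ.* b ℕ.∸ a) (k ℕ.* b) n a))
      (linℕ ((ℕ.≤-reflexive (sym eq)) ⊕ℕ lt)
        (solveℕ 5 (λ a b c d e → (conℕ 1) ⊞ a ⊞ (b ⊞ c ⊞ (d ⊞ e))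
            ⊜ d ⊞ b ⊞ (e ⊞ ((conℕ 1) ⊞ (a ⊞ c))))
          refl n (k ℕ.* b ℕ.∸ a) a b (k ℕ.* b)))
    where
    k : ℕ
    k = (n ℕ.+ a) ℕ./ b
    lt : n ℕ.+ a ℕ.< b ℕ.+ k ℕ.* b
    lt = subst (ℕ._< b ℕ.+ k ℕ.* b) (sym (ℕ.m≡m%n+[m/n]*n (n ℕ.+ a) b))
           (ℕ.+-monoˡ-< (k ℕ.* b) (ℕ.m%n<n (n ℕ.+ a) b))
    -- kb exceeds n + a - b, which is at least a; so the truncated subtraction that defines c is
    -- exact.
    a≤kb : a ℕ.≤ k ℕ.* b
    a≤kb = linℕ (b≤n ⊕ℕ lt ⊕ℕ (z≤n {1}))
             (solveℕ 4 (λ a b c d → a ⊞ (b ⊞ (c ⊞ d) ⊞ (conℕ 1))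
                 ⊜ d ⊞ (c ⊞ ((conℕ 1) ⊞ (b ⊞ a)) ⊞ (conℕ 0)))
               refl a n b (k ℕ.* b))
    eq : k ℕ.* b ℕ.∸ a ℕ.+ a ≡ k ℕ.* b
    eq = ℕ.m∸n+n≡m a≤kb

Next⇒InL : ∀ {n a b c k} → InL n a b → Next n a b c k → InL n b c
Next⇒InL i nx = inL (InL.b≤n i) (Next.c≤n nx) (Next.n<b+c nx)

reverse-Next : ∀ {n a b c k} → InL n a b → Next n a b c k → Next n c b a k
reverse-Next {n} {a} {b} {c} i (next eq _ _) =
  next (trans (ℕ.+-comm a c) eq) (InL.a≤n i) (subst (n ℕ.<_) (ℕ.+-comm a b) (InL.n<a+b i))

swap-InL : ∀ {n a b} → InL n a b → InL n b a
swap-InL {n} {a} {b} (inL p q r) = inL q p (subst (n ℕ.<_) (ℕ.+-comm a b) r)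

κ≥1 : ∀ {n a b} → InL n a b → 1 ℕ.≤ κ n (a , b)
κ≥1 {n} {a} {b} i with κ n (a , b) | κ-next i
... | suc k | _ = s≤s z≤n
... | zero  | c , next eq c≤n n<b+c = absurd-ℕ
  ((linℕ ((ℕ.≤-reflexive eq) ⊕ℕ (InL.1≤a i) ⊕ℕ (z≤n {c}))
     (solveℕ 2 (λ a b → (conℕ 1) ⊞ ((conℕ 0) ⊞ a ⊞ b)
         ⊜ (conℕ 0) ⊞ (b ⊞ a ⊞ (conℕ 1) ⊞ (conℕ 0)))
       refl a c)))

swap : Pair → Pair
swap (a , b) = b , a

-- ρ sends (a , b) to (c , b), exchanging the two neighbours of the denominator b. By the symmetry
-- of `Next` it is an involution of `L n` that preserves κ. Since T is the composite of ρ and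
-- `swap`, T permutes `L n`.
ρ : ℕ → Pair → Pair
ρ n s = swap (T n s)

T-∈L : ∀ {n s} → s ∈ L n → T n s ∈ L n
T-∈L {n} {a , b} s∈ with κ-next (∈L⁻ s∈)
... | c , nx rewrite T-unique (InL.1≤b (∈L⁻ s∈)) nx = ∈L⁺ (Next⇒InL (∈L⁻ s∈) nx)

swap-∈L : ∀ {n s} → s ∈ L n → swap s ∈ L n
swap-∈L s∈ = ∈L⁺ (swap-InL (∈L⁻ s∈))

ρ-involutive : ∀ {n s} → s ∈ L n → ρ n (ρ n s) ≡ s
ρ-involutive {n} {a , b} s∈ with κ-next (∈L⁻ s∈)
... | c , nx rewrite T-unique (InL.1≤b (∈L⁻ s∈)) nx
                   | T-unique (InL.1≤b (∈L⁻ s∈)) (reverse-Next (∈L⁻ s∈) nx) = refl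

κ-ρ : ∀ {n s} → s ∈ L n → κ n (ρ n s) ≡ κ n s
κ-ρ {n} {a , b} s∈ with κ-next (∈L⁻ s∈)
... | c , nx rewrite T-unique (InL.1≤b (∈L⁻ s∈)) nx = κ-unique (InL.1≤b (∈L⁻ s∈)) (reverse-Next (∈L⁻ s∈) nx)

∑-swap-L : ∀ n F → ∑ (L n) (F ∘ swap) ≡ ∑ (L n) F
∑-swap-L n F = ∑-reindex _≟ᴾ_ _≟ᴾ_ (unique-L n) (unique-L n) swap swap F swap-∈L swap-∈L (λ _ → refl)
    (λ _ → refl)

∑-ρ : ∀ n F → ∑ (L n) (F ∘ ρ n) ≡ ∑ (L n) F
∑-ρ n F = ∑-reindex _≟ᴾ_ _≟ᴾ_ (unique-L n) (unique-L n) (ρ n) (ρ n) F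
  (swap-∈L ∘ T-∈L) (swap-∈L ∘ T-∈L) ρ-involutive ρ-involutive

∑-T : ∀ n F → ∑ (L n) (F ∘ T n) ≡ ∑ (L n) F
∑-T n F = trans (∑-ρ n (F ∘ swap)) (∑-swap-L n F)

T^ : ℕ → ℕ → Pair → Pair
T^ n zero s    = s
T^ n (suc t) s = T^ n t (T n s)

T^-+ : ∀ n t j s → T^ n (t ℕ.+ j) s ≡ T^ n j (T^ n t s)
T^-+ n zero j s = refl
T^-+ n (suc t) j s = T^-+ n t j (T n s)

T^-suc : ∀ n t s → T^ n (suc t) s ≡ T n (T^ n t s)
T^-suc n zero s = refl
T^-suc n (suc t) s = T^-suc n t (T n s)

T^-∈L : ∀ {n} t {s} → s ∈ L n → T^ n t s ∈ L n
T^-∈L zero s∈ = s∈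
T^-∈L (suc t) s∈ = T^-∈L t (T-∈L s∈)

∑-T^ : ∀ n t F → ∑ (L n) (F ∘ T^ n t) ≡ ∑ (L n) F
∑-T^ n zero F = refl
∑-T^ n (suc t) F = trans (∑-T n (F ∘ T^ n t)) (∑-T^ n t F)

-- Letters around a large one

-- The letter at distance n from a large one: 1 next to it, 2 further away. The value at distance 0
-- is junk.
forced : ℕ → ℕ
forced (suc (suc _)) = 2
forced n             = n

-- If b is small compared with n, then c > n - b, and the denominators after c are c - b, c - 2b,
-- and so on. The letter at c is 1 and the following ones are 2, as long as two consecutive terms
-- have sum above n. This lasts for about n / 2b steps, and the hypothesis on (2H + 5) b guarantees
-- H of them.
letters-after-large : ∀ {n a b} → InL n a b → ∀ H → (2 ℕ.* H ℕ.+ 5) ℕ.* b ℕ.≤ n →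
                      ∀ j → 1 ℕ.≤ j → j ℕ.≤ H → κ n (T^ n j (a , b)) ≡ forced j
letters-after-large {n} {a} {b} i H large j 1≤j j≤H with κ-next i
... | c , nx@(next eq c≤n n<b+c) = go j 1≤j j≤H
  where
  1≤b = InL.1≤b i
  b≤n = InL.b≤n i
  0≤Hb = z≤n {H ℕ.* b}
  b≤c : b ℕ.≤ c
  b≤c = linℕ-scaled 3 (n<b+c ⊕ℕ large ⊕ℕ (2 ⊛ℕ 0≤Hb) ⊕ℕ (3 ⊛ℕ (z≤n {c})) ⊕ℕ (z≤n {1}))
          (solveℕ 4 (λ a b c d → (conℕ 4) ⊠ a ⊞ (a ⊞ b ⊞ c ⊞ (conℕ 2) ⊠ (d ⊠ a) ⊞ (conℕ 3) ⊠ b ⊞ (conℕ 1))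
              ⊜ (conℕ 4) ⊠ b ⊞ ((conℕ 1) ⊞ c ⊞ ((conℕ 2) ⊠ d ⊞ (conℕ 5)) ⊠ a ⊞ (conℕ 2) ⊠ (conℕ 0) ⊞
                  (conℕ 3) ⊠ (conℕ 0) ⊞ (conℕ 0)))
            refl b c n H)
  d₀ = c ℕ.∸ b
  d₀+b≡c : d₀ ℕ.+ b ≡ c
  d₀+b≡c = ℕ.m∸n+n≡m b≤c
  first : Next n b c d₀ 1
  first = next (trans d₀+b≡c (sym (ℕ.*-identityˡ c)))
    (linℕ ((ℕ.≤-reflexive d₀+b≡c) ⊕ℕ c≤n ⊕ℕ (z≤n {b}))
      (solveℕ 4 (λ a b c d → a ⊞ (b ⊞ c ⊞ d) ⊜ c ⊞ (a ⊞ d ⊞ b ⊞ (conℕ 0))) refl d₀ c n b))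
    (linℕ-scaled 2 ((ℕ.≤-reflexive (sym d₀+b≡c)) ⊕ℕ large ⊕ℕ (2 ⊛ℕ 0≤Hb) ⊕ℕ (4 ⊛ℕ n<b+c) ⊕ℕ
        (2 ⊛ℕ (z≤n {d₀})) ⊕ℕ (z≤n {1}))
      (solveℕ 5 (λ a b c d e → (conℕ 3) ⊠ ((conℕ 1) ⊞ a) ⊞
          (b ⊞ c ⊞ a ⊞ (conℕ 2) ⊠ (d ⊠ c) ⊞ (conℕ 4) ⊠ (c ⊞ e) ⊞ (conℕ 2) ⊠ b ⊞ (conℕ 1))
          ⊜ (conℕ 3) ⊠ (e ⊞ b) ⊞ (e ⊞ ((conℕ 2) ⊠ d ⊞ (conℕ 5)) ⊠ c ⊞ (conℕ 2) ⊠ (conℕ 0) ⊞ (conℕ 4) ⊠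
              ((conℕ 1) ⊞ a) ⊞ (conℕ 2) ⊠ (conℕ 0) ⊞ (conℕ 0)))
        refl n d₀ b H c))
  -- From the second step on, the orbit is the arithmetic progression c − b, c − 2b, ….
  twos : ∀ t i d → d ℕ.+ (i ℕ.+ 1) ℕ.* b ≡ c → i ℕ.+ t ℕ.+ 2 ℕ.≤ H →
         κ n (T^ n t (d ℕ.+ b , d)) ≡ 2
  twos t i d eqᵈ i+t≤H = step t i+t≤H
    where
    ib≤Hb : (i ℕ.+ t ℕ.+ 2) ℕ.* b ℕ.≤ H ℕ.* b
    ib≤Hb = ℕ.*-monoˡ-≤ b i+t≤H
    0≤tb = z≤n {t ℕ.* b}
    1≤d : 1 ℕ.≤ d
    1≤d = linℕ-scaled 1 ((2 ⊛ℕ (ℕ.≤-reflexive (sym eqᵈ))) ⊕ℕ (2 ⊛ℕ ib≤Hb) ⊕ℕ (2 ⊛ℕ n<b+c) ⊕ℕ large ⊕ℕ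
        (2 ⊛ℕ 0≤tb) ⊕ℕ (5 ⊛ℕ (z≤n {b})) ⊕ℕ (z≤n {n}))
            (solveℕ 7 (λ a b c d e f g → (conℕ 2) ⊠ (conℕ 1) ⊞
                ((conℕ 2) ⊠ (a ⊞ (b ⊞ (conℕ 1)) ⊠ c) ⊞ (conℕ 2) ⊠ (d ⊠ c) ⊞ (conℕ 2) ⊠ (c ⊞ e) ⊞ f ⊞
                    (conℕ 2) ⊠ (g ⊠ c) ⊞ (conℕ 5) ⊠ c ⊞ f)
                ⊜ (conℕ 2) ⊠ a ⊞ ((conℕ 2) ⊠ e ⊞ (conℕ 2) ⊠ ((b ⊞ g ⊞ (conℕ 2)) ⊠ c) ⊞ (conℕ 2) ⊠
                    ((conℕ 1) ⊞ f) ⊞ ((conℕ 2) ⊠ d ⊞ (conℕ 5)) ⊠ c ⊞ (conℕ 2) ⊠ (conℕ 0) ⊞ (conℕ 5) ⊠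
                        (conℕ 0) ⊞ (conℕ 0)))
              refl d i b H c n t)
    b≤d : b ℕ.≤ d
    b≤d = linℕ-scaled 6 ((ℕ.≤-reflexive (sym eqᵈ)) ⊕ℕ (2 ⊛ℕ ib≤Hb) ⊕ℕ n<b+c ⊕ℕ large ⊕ℕ (2 ⊛ℕ 0≤tb) ⊕ℕ
        (z≤n {i ℕ.* b}) ⊕ℕ (6 ⊛ℕ (z≤n {d})) ⊕ℕ (z≤n {1}))
            (solveℕ 7 (λ a b c d e f g → (conℕ 7) ⊠ a ⊞
                (b ⊞ (c ⊞ (conℕ 1)) ⊠ a ⊞ (conℕ 2) ⊠ (d ⊠ a) ⊞ (a ⊞ e) ⊞ f ⊞ (conℕ 2) ⊠ (g ⊠ a) ⊞ c ⊠ a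
                    ⊞ (conℕ 6) ⊠ b ⊞ (conℕ 1))
                ⊜ (conℕ 7) ⊠ b ⊞ (e ⊞ (conℕ 2) ⊠ ((c ⊞ g ⊞ (conℕ 2)) ⊠ a) ⊞ ((conℕ 1) ⊞ f) ⊞
                    ((conℕ 2) ⊠ d ⊞ (conℕ 5)) ⊠ a ⊞ (conℕ 2) ⊠ (conℕ 0) ⊞ (conℕ 0) ⊞ (conℕ 6) ⊠ (conℕ 0)
                        ⊞ (conℕ 0)))
              refl b d i H c n t)
    e = d ℕ.∸ b
    e+b≡d : e ℕ.+ b ≡ d
    e+b≡d = ℕ.m∸n+n≡m b≤d
    nxᵈ : Next n (d ℕ.+ b) d e 2
    nxᵈ = next (ℕ.≤-antisym (linℕ (ℕ.≤-reflexive e+b≡d)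
                              (solveℕ 3 (λ a b c → a ⊞ (b ⊞ c) ⊞ b ⊜ (conℕ 2) ⊠ b ⊞ (a ⊞ c)) refl e d
                                  b)) (linℕ (ℕ.≤-reflexive (sym e+b≡d))
        (solveℕ 3 (λ a b c → (conℕ 2) ⊠ a ⊞ (b ⊞ c) ⊜ b ⊞ (a ⊞ c) ⊞ a) refl d e b)))
      (linℕ ((ℕ.≤-reflexive e+b≡d) ⊕ℕ (ℕ.≤-reflexive eqᵈ) ⊕ℕ c≤n ⊕ℕ (z≤n {i ℕ.* b}) ⊕ℕ (2 ⊛ℕ (z≤n {b})))
        (solveℕ 6 (λ a b c d e f → a ⊞ (b ⊞ c ⊞ d ⊞ e ⊠ f ⊞ (conℕ 2) ⊠ f)
            ⊜ d ⊞ (a ⊞ f ⊞ (b ⊞ (e ⊞ (conℕ 1)) ⊠ f) ⊞ c ⊞ (conℕ 0) ⊞ (conℕ 2) ⊠ (conℕ 0)))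
          refl e d c n i b))
      (linℕ ((ℕ.≤-reflexive (sym e+b≡d)) ⊕ℕ (2 ⊛ℕ (ℕ.≤-reflexive (sym eqᵈ))) ⊕ℕ (2 ⊛ℕ n<b+c) ⊕ℕ
          (2 ⊛ℕ ib≤Hb) ⊕ℕ large ⊕ℕ (2 ⊛ℕ 0≤tb) ⊕ℕ (4 ⊛ℕ (z≤n {b})) ⊕ℕ (z≤n {1}))
        (solveℕ 8 (λ a b c d e f g h → (conℕ 1) ⊞ a ⊞
            (b ⊞ c ⊞ (conℕ 2) ⊠ (d ⊞ (e ⊞ (conℕ 1)) ⊠ c) ⊞ (conℕ 2) ⊠ (c ⊞ f) ⊞ (conℕ 2) ⊠ (g ⊠ c) ⊞ a ⊞
                (conℕ 2) ⊠ (h ⊠ c) ⊞ (conℕ 4) ⊠ c ⊞ (conℕ 1))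
            ⊜ d ⊞ b ⊞ (d ⊞ (conℕ 2) ⊠ f ⊞ (conℕ 2) ⊠ ((conℕ 1) ⊞ a) ⊞ (conℕ 2) ⊠
                ((e ⊞ h ⊞ (conℕ 2)) ⊠ c) ⊞ ((conℕ 2) ⊠ g ⊞ (conℕ 5)) ⊠ c ⊞ (conℕ 2) ⊠ (conℕ 0) ⊞
                    (conℕ 4) ⊠ (conℕ 0) ⊞ (conℕ 0)))
          refl n e b d i c H t))
    step : ∀ t → i ℕ.+ t ℕ.+ 2 ℕ.≤ H → κ n (T^ n t (d ℕ.+ b , d)) ≡ 2
    step zero _ = κ-unique 1≤d nxᵈ
    step (suc t) le = trans
      (cong (λ s → κ n (T^ n t s)) (trans (T-unique 1≤d nxᵈ) (cong (_, e) (sym e+b≡d))))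
      (twos t (suc i) e
        (trans (solveℕ 3 (λ a b c → a ⊞ ((conℕ 1) ⊞ b ⊞ (conℕ 1)) ⊠ c
                   ⊜ a ⊞ c ⊞ (b ⊞ (conℕ 1)) ⊠ c)
                 refl e i b)
          (trans (cong (ℕ._+ (i ℕ.+ 1) ℕ.* b) e+b≡d) eqᵈ))
        (subst (ℕ._≤ H) (solveℕ 2 (λ a b → a ⊞ ((conℕ 1) ⊞ b) ⊞ (conℕ 2)
                            ⊜ (conℕ 1) ⊞ a ⊞ b ⊞ (conℕ 2))
                          refl i t) le))
  go : ∀ j → 1 ℕ.≤ j → j ℕ.≤ H → κ n (T^ n j (a , b)) ≡ forced j
  go (suc zero) _ _ = trans (cong (κ n) (T-unique 1≤b nx)) (κ-unique (ℕ.≤-trans 1≤b b≤c) first)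
  go (suc (suc j)) _ le = trans
    (cong (λ s → κ n (T^ n j s)) (trans (cong (T n) (T-unique 1≤b nx))
      (trans (T-unique (ℕ.≤-trans 1≤b b≤c) first) (cong (_, d₀) (sym d₀+b≡c)))))
    (twos j 0 d₀ (trans (cong (d₀ ℕ.+_) (ℕ.*-identityˡ b)) d₀+b≡c)
      (subst (ℕ._≤ H) (ℕ.+-comm 2 j) le))

-- κ b = a + c ≤ 2n, so a letter of at least 2 (2H + 5) forces (2H + 5) b ≤ n.
large-letter : ∀ {n a b} H → InL n a b → 4 ℕ.* H ℕ.+ 10 ℕ.≤ κ n (a , b) → (2 ℕ.* H ℕ.+ 5) ℕ.* b ℕ.≤ n
large-letter {n} {a} {b} H i le with κ-next i
... | c , next eq c≤n _ =
  linℕ-scaled 1 ((ℕ.*-monoˡ-≤ b le) ⊕ℕ (ℕ.≤-reflexive (sym eq)) ⊕ℕ c≤n ⊕ℕ (InL.a≤n i))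
    (solveℕ 6 (λ a b c d e f → (conℕ 2) ⊠ (((conℕ 2) ⊠ a ⊞ (conℕ 5)) ⊠ b) ⊞ (c ⊠ b ⊞ (d ⊞ e) ⊞ f ⊞ f)
        ⊜ (conℕ 2) ⊠ f ⊞ (((conℕ 4) ⊠ a ⊞ (conℕ 10)) ⊠ b ⊞ c ⊠ b ⊞ d ⊞ e))
      refl H b (κ n (a , b)) c a n)

-- ρ reverses the sequence of denominators, so the letters before a large one are the
-- letters after it in the reversed sequence.
T^-ρ : ∀ {n s} j → s ∈ L n → T^ n j (ρ n (T^ n j s)) ≡ ρ n s
T^-ρ zero s∈ = refl
T^-ρ {n} {s} (suc j) s∈ = begin
  T^ n j (T n (ρ n (T^ n (suc j) s)))   ≡⟨ cong (λ u → T^ n j (T n (ρ n u))) (T^-suc n j s) ⟩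
  T^ n j (T n (ρ n (T n (T^ n j s))))   ≡⟨ cong (λ u → T^ n j u) (T-ρ-T (T^-∈L j s∈)) ⟩
  T^ n j (ρ n (T^ n j s))               ≡⟨ T^-ρ j s∈ ⟩
  ρ n s                                 ∎
  where
  open ≡-Reasoning
  T-ρ-T : ∀ {s} → s ∈ L n → T n (ρ n (T n s)) ≡ ρ n s
  T-ρ-T s∈ = cong swap (ρ-involutive (T-∈L s∈))

letters-near-large : ∀ {n s} H → s ∈ L n → ∀ t p → t ℕ.≤ H → p ℕ.≤ H → p ≢ t →
                     4 ℕ.* H ℕ.+ 10 ℕ.≤ κ n (T^ n t s) → κ n (T^ n p s) ≡ forced ℕ.∣ p - t ∣
letters-near-large {n} {s} H s∈ t p t≤H p≤H p≢t big with ℕ.≤-total t p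
... | inj₁ t≤p = begin
  κ n (T^ n p s)                  ≡⟨ cong (λ q → κ n (T^ n q s)) (ℕ.m+[n∸m]≡n t≤p) ⟨
  κ n (T^ n (t ℕ.+ j) s)          ≡⟨ cong (κ n) (T^-+ n t j s) ⟩
  κ n (T^ n j (T^ n t s))         ≡⟨ letters-after-large i H (large-letter H i big) j
                                       (ℕ.m<n⇒0<n∸m (ℕ.≤∧≢⇒< t≤p (p≢t ∘ sym)))
                                       (ℕ.≤-trans (ℕ.m∸n≤m p t) p≤H) ⟩
  forced j                        ≡⟨ cong forced (ℕ.m≤n⇒∣n-m∣≡n∸m t≤p) ⟨
  forced ℕ.∣ p - t ∣              ∎
  where
  open ≡-Reasoning
  j = p ℕ.∸ t
  i = ∈L⁻ (T^-∈L t s∈)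
... | inj₂ p≤t = begin
  κ n (T^ n p s)                  ≡⟨ κ-ρ (T^-∈L p s∈) ⟨
  κ n (ρ n (T^ n p s))            ≡⟨ cong (κ n) (T^-ρ j (T^-∈L p s∈)) ⟨
  κ n (T^ n j (ρ n (T^ n j (T^ n p s))))
                                  ≡⟨ cong (λ u → κ n (T^ n j (ρ n u))) (T^-+ n p j s) ⟨
  κ n (T^ n j (ρ n (T^ n (p ℕ.+ j) s)))
                                  ≡⟨ cong (λ q → κ n (T^ n j (ρ n (T^ n q s)))) (ℕ.m+[n∸m]≡n p≤t) ⟩
  κ n (T^ n j (ρ n sₜ))           ≡⟨ letters-after-large i H
                                       (large-letter H i (subst (_ ℕ.≤_) (sym (κ-ρ (T^-∈L t s∈))) big)) j
                                       (ℕ.m<n⇒0<n∸m (ℕ.≤∧≢⇒< p≤t p≢t))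
                                       (ℕ.≤-trans (ℕ.m∸n≤m t p) t≤H) ⟩
  forced j                        ≡⟨ cong forced (ℕ.m≤n⇒∣m-n∣≡n∸m p≤t) ⟨
  forced ℕ.∣ p - t ∣              ∎
  where
  open ≡-Reasoning
  j = t ℕ.∸ p
  sₜ = T^ n t s
  i = ∈L⁻ (swap-∈L (T-∈L (T^-∈L t s∈)))

-- Sums over L n: recursion in n, cardinality, the sum of κ

𝟙* : {P : Set} (d : Dec P) (x : ℚ) → P → 𝟙 d * x ≡ x
𝟙* d x p = trans (cong (_* x) (𝟙-yes d p)) (ℚ.*-identityˡ x)

𝟙*0 : {P : Set} (d : Dec P) (x : ℚ) → ¬ P → 𝟙 d * x ≡ 0ℚ
𝟙*0 d x ¬p = trans (cong (_* x) (𝟙-no d ¬p)) (ℚ.*-zeroˡ x)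

-- Passing from L n to L (n + 1) replaces the pairs (a , b) with a + b = n + 1 by their
-- mediants, as for Farey sequences, and adds the diagonal pair.
mediants : ℕ → (Pair → ℚ) → Pair → ℚ
mediants n F (a , b) = 𝟙 (a ℕ.+ b ℕ.≟ suc n) * (F (a , suc n) + F (suc n , b))
                     + 𝟙 (suc n ℕ.<? a ℕ.+ b) * F (a , b)

-- The new pairs, apart from the diagonal one, are (a , n + 1) and (n + 1 , b) for all a and b up to
-- n. Each such a, and each such b, occurs exactly once on the antidiagonal a + b = n + 1 of `L n`,
-- so the new pairs can be indexed by the pairs that disappear.
∑-L-suc : ∀ n F → ∑ (L (suc n)) F ≡ ∑ (L n) (mediants n F) + F (suc n , suc n)
∑-L-suc n F = begin
  ∑ (L (suc n)) F
    ≡⟨ ∑-L (suc n) F ⟩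
  ∑ [1⋯ suc n ] (λ a → ∑ [1⋯ suc n ] (λ b → g a b))
    ≡⟨ ∑-[1⋯]-suc n _ ⟩
  ∑ [1⋯ n ] (λ a → ∑ [1⋯ suc n ] (λ b → g a b)) + ∑ [1⋯ suc n ] (λ b → g (suc n) b)
    ≡⟨ cong₂ _+_ (∑-cong [1⋯ n ] (λ {a} _ → ∑-[1⋯]-suc n (g a))) (∑-[1⋯]-suc n (g (suc n))) ⟩
  ∑ [1⋯ n ] (λ a → ∑ [1⋯ n ] (g a) + g a (suc n)) + (∑ [1⋯ n ] (g (suc n)) + g (suc n) (suc n))
    ≡⟨ cong₂ (λ u v → u + (∑ [1⋯ n ] (g (suc n)) + v)) (∑-+ [1⋯ n ] (λ a → ∑ [1⋯ n ] (g a)) _)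
         (𝟙* (suc n ℕ.<? suc n ℕ.+ suc n) _ (ℕ.m<m+n (suc n) (s≤s z≤n))) ⟩
  (A + ∑ [1⋯ n ] (λ a → g a (suc n))) + (∑ [1⋯ n ] (g (suc n)) + D)
    ≡⟨ cong₂ (λ u v → (A + u) + (v + D))
         (∑-cong [1⋯ n ] (λ {a} a∈ → trans
           (𝟙* (suc n ℕ.<? a ℕ.+ suc n) _ (ℕ.m<n+m (suc n) (proj₁ (∈[1⋯]⁻ a∈))))
           (sym (antidiagonal (∈[1⋯]⁻ a∈) (F (a , suc n))))))
         (trans (∑-cong [1⋯ n ] (λ {b} b∈ → trans
             (𝟙* (suc n ℕ.<? suc n ℕ.+ b) _ (ℕ.m<m+n (suc n) (proj₁ (∈[1⋯]⁻ b∈))))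
             (sym (trans (∑-cong [1⋯ n ] (λ {a} _ → cong (λ s → 𝟙 (s ℕ.≟ suc n) * F (suc n , b))
                 (ℕ.+-comm a b)))
               (antidiagonal (∈[1⋯]⁻ b∈) (F (suc n , b)))))))
           (∑-swap [1⋯ n ] [1⋯ n ] (λ b a → 𝟙 (a ℕ.+ b ℕ.≟ suc n) * F (suc n , b)))) ⟩
  (A + B) + (C + D)
    ≡⟨ (solve 4 (λ a b c d → a :+ b :+ (c :+ d) := b :+ c :+ a :+ d) refl A B C D) ⟩
  (B + C + A) + D
    ≡⟨ cong (λ u → u + A + D) (∑-+ [1⋯ n ] _ _) ⟨
  (∑ [1⋯ n ] (λ a → ∑ [1⋯ n ] (λ b → 𝟙 (a ℕ.+ b ℕ.≟ suc n) * F (a , suc n))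
                  + ∑ [1⋯ n ] (λ b → 𝟙 (a ℕ.+ b ℕ.≟ suc n) * F (suc n , b))) + A) + D
    ≡⟨ cong (_+ D) (∑-+ [1⋯ n ] _ _) ⟨
  ∑ [1⋯ n ] (λ a → ∑ [1⋯ n ] (λ b → 𝟙 (a ℕ.+ b ℕ.≟ suc n) * F (a , suc n))
                  + ∑ [1⋯ n ] (λ b → 𝟙 (a ℕ.+ b ℕ.≟ suc n) * F (suc n , b)) + ∑ [1⋯ n ] (g a)) + D
    ≡⟨ cong (_+ D) (∑-cong [1⋯ n ] (λ {a} _ → sym (trans (∑-cong [1⋯ n ] (λ {b} _ → pointwise a b))
         (trans (∑-+ [1⋯ n ] _ (g a)) (cong (_+ ∑ [1⋯ n ] (g a)) (∑-+ [1⋯ n ] _ _)))))) ⟩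
  ∑ [1⋯ n ] (λ a → ∑ [1⋯ n ] (λ b → 𝟙 (n ℕ.<? a ℕ.+ b) * mediants n F (a , b))) + D
    ≡⟨ cong (_+ D) (∑-L n (mediants n F)) ⟨
  ∑ (L n) (mediants n F) + D ∎
  where
  open ≡-Reasoning
  g : ℕ → ℕ → ℚ
  g a b = 𝟙 (suc n ℕ.<? a ℕ.+ b) * F (a , b)
  A = ∑ [1⋯ n ] (λ a → ∑ [1⋯ n ] (g a))
  B = ∑ [1⋯ n ] (λ a → ∑ [1⋯ n ] (λ b → 𝟙 (a ℕ.+ b ℕ.≟ suc n) * F (a , suc n)))
  C = ∑ [1⋯ n ] (λ a → ∑ [1⋯ n ] (λ b → 𝟙 (a ℕ.+ b ℕ.≟ suc n) * F (suc n , b)))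
  D = F (suc n , suc n)
  antidiagonal : ∀ {a} → 1 ℕ.≤ a × a ℕ.≤ n → ∀ x → ∑ [1⋯ n ] (λ b → 𝟙 (a ℕ.+ b ℕ.≟ suc n) * x) ≡ x
  antidiagonal {a} (1≤a , a≤n) x = trans
    (∑-cong [1⋯ n ] (λ {b} _ → cong (_* x) (𝟙-⇔ (a ℕ.+ b ℕ.≟ suc n) (suc n ℕ.∸ a ℕ.≟ b)
      (λ eq → trans (cong (ℕ._∸ a) (sym eq)) (ℕ.m+n∸m≡n a b))
      (λ { refl → ℕ.m+[n∸m]≡n (ℕ.m≤n⇒m≤1+n a≤n) }))))
    (∑-δ ℕ._≟_ (suc n ℕ.∸ a) (λ _ → x) (unique-[1⋯] n)
      (∈[1⋯]⁺ (ℕ.m<n⇒0<n∸m (s≤s a≤n)) (ℕ.∸-monoʳ-≤ (suc n) 1≤a)))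
  pointwise : ∀ a b → 𝟙 (n ℕ.<? a ℕ.+ b) * mediants n F (a , b) ≡
              𝟙 (a ℕ.+ b ℕ.≟ suc n) * F (a , suc n) + 𝟙 (a ℕ.+ b ℕ.≟ suc n) * F (suc n , b) + g a b
  pointwise a b with a ℕ.+ b ℕ.≟ suc n | suc n ℕ.<? a ℕ.+ b | n ℕ.<? a ℕ.+ b
  ... | yes eq | yes lt | _ = ⊥-elim (ℕ.<-irrefl (sym eq) lt)
  ... | yes eq | no _   | no ≮ = ⊥-elim (≮ (ℕ.≤-reflexive (sym eq)))
  ... | no _   | yes lt | no ≮ = ⊥-elim (≮ (ℕ.<-trans (ℕ.n<1+n n) lt))
  ... | no neq | no ≮   | yes lt = ⊥-elim (≮ (ℕ.≤∧≢⇒< lt (neq ∘ sym)))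
  ... | yes _  | no _   | yes _ = solve 3 (λ a b c → (con 1ℚ) :* ((con 1ℚ) :* (a :+ b) :+ (con 0ℚ) :* c)
                                      := (con 1ℚ) :* a :+ (con 1ℚ) :* b :+ (con 0ℚ) :* c)
                                    refl (F (a , suc n)) (F (suc n , b)) (F (a , b))
  ... | no _   | yes _  | yes _ = solve 3 (λ a b c → (con 1ℚ) :* ((con 0ℚ) :* (a :+ b) :+ (con 1ℚ) :* c)
                                      := (con 0ℚ) :* a :+ (con 0ℚ) :* b :+ (con 1ℚ) :* c)
                                    refl (F (a , suc n)) (F (suc n , b)) (F (a , b))
  ... | no _   | no _   | no _ = solve 3 (λ a b c → (con 0ℚ) :* ((con 0ℚ) :* (a :+ b) :+ (con 0ℚ) :* c)
                                     := (con 0ℚ) :* a :+ (con 0ℚ) :* b :+ (con 0ℚ) :* c)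
                                   refl (F (a , suc n)) (F (suc n , b)) (F (a , b))

L0 : ∀ F → ∑ (L 0) F ≡ 0ℚ
L0 F = ∑-L 0 F

count-above-antidiagonal : ∀ n m b → b ℕ.≤ n → m ℕ.≤ n →
                           ∑ [1⋯ m ] (λ a → 𝟙 (n ℕ.<? a ℕ.+ b)) ≡ ι (m ℕ.+ b ℕ.∸ n)
count-above-antidiagonal n zero b b≤n m≤n = trans (sym ι-0) (sym (cong ι (ℕ.m≤n⇒m∸n≡0 b≤n)))
count-above-antidiagonal n (suc m) b b≤n m<n = trans (∑-[1⋯]-suc m _)
  (trans (cong (_+ 𝟙 (n ℕ.<? suc m ℕ.+ b)) (count-above-antidiagonal n m b b≤n (ℕ.<⇒≤ m<n))) step)
  where
  step : ι (m ℕ.+ b ℕ.∸ n) + 𝟙 (n ℕ.<? suc m ℕ.+ b) ≡ ι (suc m ℕ.+ b ℕ.∸ n)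
  step with n ℕ.<? suc m ℕ.+ b
  ... | yes (s≤s n≤m+b) = trans (trans (cong (ι (m ℕ.+ b ℕ.∸ n) +_) (sym ι-1)) (sym (ι-+ (m ℕ.+ b ℕ.∸ n) 1)))
    (cong ι (trans (ℕ.+-comm _ 1) (sym (ℕ.+-∸-assoc 1 n≤m+b))))
  ... | no ≮ = trans (ℚ.+-identityʳ _) (cong ι
    (trans (ℕ.m≤n⇒m∸n≡0 (ℕ.<⇒≤ (ℕ.≮⇒≥ ≮))) (sym (ℕ.m≤n⇒m∸n≡0 (ℕ.≮⇒≥ ≮)))))

∑-𝟙-above : ∀ n b → b ℕ.≤ n → ∑ [1⋯ n ] (λ a → 𝟙 (n ℕ.<? a ℕ.+ b)) ≡ ι b
∑-𝟙-above n b b≤n = trans (count-above-antidiagonal n n b b≤n ℕ.≤-refl) (cong ι (ℕ.m+n∸m≡n n b))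

card : ℕ → ℚ
card n = ∑ (L n) (λ _ → 1ℚ)

-- For given a there are exactly a values of b with n < a + b, so the cardinality is a triangular
-- number.
twice-card : ∀ n → fromℕ 2 * card n ≡ ι n * (ι n + 1ℚ)
twice-card n = begin
  fromℕ 2 * card n
    ≡⟨ cong (fromℕ 2 *_) (trans (∑-L n _) (∑-cong [1⋯ n ] (λ {a} a∈ →
         trans (∑-cong [1⋯ n ] (λ {b} _ → trans (ℚ.*-identityʳ _)
           (cong (λ s → 𝟙 (n ℕ.<? s)) (ℕ.+-comm a b))))
           (∑-𝟙-above n a (proj₂ (∈[1⋯]⁻ a∈)))))) ⟩
  fromℕ 2 * ∑ [1⋯ n ] ι     ≡⟨ gauss n ⟩
  ι n * (ι n + 1ℚ)      ∎
  where
  open ≡-Reasoning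
  gauss : ∀ n → fromℕ 2 * ∑ [1⋯ n ] ι ≡ ι n * (ι n + 1ℚ)
  gauss zero = sym (trans (cong (_* (ι 0 + 1ℚ)) ι-0) (ℚ.*-zeroˡ (ι 0 + 1ℚ)))
  gauss (suc n) = begin
    fromℕ 2 * ∑ [1⋯ suc n ] ι                        ≡⟨ cong (fromℕ 2 *_) (∑-[1⋯]-suc n ι) ⟩
    fromℕ 2 * (∑ [1⋯ n ] ι + ι (suc n))          ≡⟨ ℚ.*-distribˡ-+ (fromℕ 2) (∑ [1⋯ n ] ι) (ι (suc n)) ⟩
    fromℕ 2 * ∑ [1⋯ n ] ι + fromℕ 2 * ι (suc n)  ≡⟨ cong₂ (λ u v → u + fromℕ 2 * v) (gauss n) (ι-suc n) ⟩
    ι n * (ι n + 1ℚ) + fromℕ 2 * (1ℚ + ι n)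
      ≡⟨ (solve 1 (λ a → a :* (a :+ (con 1ℚ)) :+ (con (fromℕ 2)) :* ((con 1ℚ) :+ a)
             := ((con 1ℚ) :+ a) :* ((con 1ℚ) :+ a :+ (con 1ℚ)))
           refl (ι n)) ⟩
    (1ℚ + ι n) * (1ℚ + ι n + 1ℚ)                 ≡⟨ cong (λ x → x * (x + 1ℚ)) (ι-suc n) ⟨
    ι (suc n) * (ι (suc n) + 1ℚ)                 ∎

opaque
  inv : ℕ → ℚ
  inv zero    = 0ℚ
  inv (suc n) = proj₁ (recip (ι (suc n)) (0<ι (s≤s z≤n)))

  inv-inverse : ∀ {n} → 1 ℕ.≤ n → ι n * inv n ≡ 1ℚ
  inv-inverse {suc n} _ = proj₂ (proj₂ (recip (ι (suc n)) (0<ι (s≤s z≤n))))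

  inv-positive : ∀ {n} → 1 ℕ.≤ n → 0ℚ < inv n
  inv-positive {suc n} _ = proj₁ (proj₂ (recip (ι (suc n)) (0<ι (s≤s z≤n))))

-- κ = a/b + c/b, and as T permutes `L n` the second quotients have the same sum as b/a. So r = a/b
-- + b/a has the same sum as κ. Replacing a pair with a + b = m by (a , m) and (m , b) turns r into
-- r + 3, since m/a + m/b = 2 + r and a/m + b/m = 1, and it adds one pair. The diagonal pair adds
-- only 2, which accounts for the -n.
κ-∑ : ∀ n → ∑ (L n) (λ s → ι (κ n s)) ≡ fromℕ 3 * card n - ι n
κ-∑ n = begin
  ∑ (L n) (λ s → ι (κ n s))                       ≡⟨ ∑-cong (L n) (λ s∈ → κ≡ s∈) ⟩
  ∑ (L n) (λ s → q s + (q ∘ swap) (T n s))            ≡⟨ ∑-+ (L n) q _ ⟩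
  ∑ (L n) q + ∑ (L n) (q ∘ swap ∘ T n)                ≡⟨ cong (∑ (L n) q +_) (trans (∑-T n (q ∘ swap)) refl) ⟩
  ∑ (L n) q + ∑ (L n) (q ∘ swap)                      ≡⟨ ∑-+ (L n) q (q ∘ swap) ⟨
  ∑ (L n) r                                           ≡⟨ ∑r n ⟩
  fromℕ 3 * card n - ι n                          ∎
  where
  open ≡-Reasoning
  q r : Pair → ℚ
  q (a , b) = ι a * inv b
  r s = q s + q (swap s)
  κ≡ : ∀ {s} → s ∈ L n → ι (κ n s) ≡ q s + q (swap (T n s))
  κ≡ {a , b} s∈ with κ-next (∈L⁻ s∈)
  ... | c , nx@(next eq _ _) = begin
    k                                       ≡⟨ (solve 1 (λ a → a := a :* (con 1ℚ)) refl k) ⟩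
    k * 1ℚ                                  ≡⟨ cong (k *_) (inv-inverse 1≤b) ⟨
    k * (ι b * inv b)                   ≡⟨ (solve 3 (λ a b c → a :* (b :* c)
          := a :* b :* c)
        refl k (ι b) (inv b)) ⟩
    k * ι b * inv b                     ≡⟨ cong (_* inv b) (ι-* (κ n (a , b)) b) ⟨
    ι (κ n (a , b) ℕ.* b) * inv b       ≡⟨ cong (λ x → ι x * inv b) eq ⟨
    ι (c ℕ.+ a) * inv b                 ≡⟨ cong (_* inv b) (ι-+ c a) ⟩
    (ι c + ι a) * inv b             ≡⟨ (solve 3 (λ a b c → (a :+ b) :* c
                                           := b :* c :+ a :* c)
                                         refl (ι c) (ι a) (inv b)) ⟩
    q (a , b) + q (c , b)                   ≡⟨ cong (λ s → q (a , b) + q (swap s)) (T-unique 1≤b nx) ⟨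
    q (a , b) + q (swap (T n (a , b)))      ∎
    where
    1≤b = InL.1≤b (∈L⁻ s∈)
    k = ι (κ n (a , b))
  ∑r : ∀ n → ∑ (L n) r ≡ fromℕ 3 * card n - ι n
  ∑r zero = trans (L0 r) (sym (cong₂ (λ x y → fromℕ 3 * x - y) (L0 (λ _ → 1ℚ)) ι-0))
  ∑r (suc n) = begin
    ∑ (L (suc n)) r                                   ≡⟨ ∑-L-suc n r ⟩
    ∑ (L n) (mediants n r) + r (suc n , suc n)        ≡⟨ cong₂ _+_ (∑-cong (L n) (λ s∈ → mediants-r (∈L⁻ s∈)))
                                                          (cong₂ _+_ (inv-inverse {suc n} (s≤s z≤n))
                                                              (inv-inverse {suc n} (s≤s z≤n))) ⟩
    ∑ (L n) (λ s → r s + (fromℕ 3 * mediants n (λ _ → 1ℚ) s - fromℕ 3 * 1ℚ)) + (1ℚ + 1ℚ)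
      ≡⟨ cong (_+ (1ℚ + 1ℚ)) (trans (∑-+ (L n) r _) (cong (∑ (L n) r +_) (trans (∑-- (L n) _ _)
           (cong₂ _-_ (∑-*ˡ (L n) (fromℕ 3) _) (∑-*ˡ (L n) (fromℕ 3) _))))) ⟩
    ∑ (L n) r + (fromℕ 3 * M - fromℕ 3 * card n) + (1ℚ + 1ℚ)
      ≡⟨ cong (λ x → x + (fromℕ 3 * M - fromℕ 3 * card n) + (1ℚ + 1ℚ)) (∑r n) ⟩
    fromℕ 3 * card n - ι n + (fromℕ 3 * M - fromℕ 3 * card n) + (1ℚ + 1ℚ)
      ≡⟨ (solve 3 (λ a b c → (con (fromℕ 3)) :* a :- b :+ ((con (fromℕ 3)) :* c :- (con (fromℕ 3)) :* a)
          :+ ((con 1ℚ) :+ (con 1ℚ))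
             := (con (fromℕ 3)) :* (c :+ (con 1ℚ)) :- ((con 1ℚ) :+ b))
           refl (card n) (ι n) M) ⟩
    fromℕ 3 * (M + 1ℚ) - (1ℚ + ι n)
      ≡⟨ cong₂ (λ u v → fromℕ 3 * u - v) (∑-L-suc n (λ _ → 1ℚ)) (ι-suc n) ⟨
    fromℕ 3 * card (suc n) - ι (suc n) ∎
    where
    M = ∑ (L n) (mediants n (λ _ → 1ℚ))
    mediants-r : ∀ {a b} → InL n a b →
                 mediants n r (a , b) ≡ r (a , b) + (fromℕ 3 * mediants n (λ _ → 1ℚ) (a , b) - fromℕ 3 * 1ℚ)
    mediants-r {a} {b} i with a ℕ.+ b ℕ.≟ suc n | suc n ℕ.<? a ℕ.+ b
    ... | yes eq | yes lt = ⊥-elim (ℕ.<-irrefl (sym eq) lt)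
    ... | no neq | no ≮ = ⊥-elim (≮ (ℕ.≤∧≢⇒< (InL.n<a+b i) (neq ∘ sym)))
    ... | no _ | yes _ = solve 3 (λ a b c → (con 0ℚ) :* (a :+ b) :+ (con 1ℚ) :* c
                             := c :+ ((con (fromℕ 3)) :* ((con 0ℚ) :* ((con 1ℚ) :+ (con 1ℚ)) :+ (con 1ℚ)
                                 :* (con 1ℚ)) :- (con (fromℕ 3)) :* (con 1ℚ)))
                           refl (r (a , suc n)) (r (suc n , b)) (r (a , b))
    ... | yes eq | no _ = begin
      1ℚ * (x * u + m * v + (m * w + y * u)) + 0ℚ * (x * w + y * v)
        ≡⟨ (solve 6 (λ a b c d e f → (con 1ℚ) :* (a :* b :+ c :* d :+ (c :* e :+ f :* b)) :+ (con 0ℚ) :*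
            (a :* e :+ f :* d)
               := (a :+ f) :* b :+ c :* d :+ c :* e)
             refl x u m v w y) ⟩
      (x + y) * u + m * v + m * w
        ≡⟨ cong₂ (λ s m → s * u + m * v + m * w) x+y≡m (sym x+y≡m) ⟩
      m * u + (x + y) * v + (x + y) * w
        ≡⟨ (solve 6 (λ a b c d e f → a :* b :+ (c :+ d) :* e :+ (c :+ d) :* f
               := a :* b :+ c :* e :+ d :* f :+ (c :* f :+ d :* e))
             refl m u x y v w) ⟩
      m * u + x * v + y * w + (x * w + y * v)
        ≡⟨ cong (_+ (x * w + y * v)) (cong₂ _+_
            (cong₂ _+_ (inv-inverse {suc n} (s≤s z≤n)) (inv-inverse (InL.1≤a i))) (inv-inverse (InL.1≤b i))) ⟩
      1ℚ + 1ℚ + 1ℚ + (x * w + y * v)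
        ≡⟨ (solve 1 (λ a → (con 1ℚ) :+ (con 1ℚ) :+ (con 1ℚ) :+ a
               := a :+ ((con (fromℕ 3)) :* ((con 1ℚ) :* ((con 1ℚ) :+ (con 1ℚ)) :+ (con 0ℚ) :* (con 1ℚ))
                   :- (con (fromℕ 3)) :* (con 1ℚ)))
             refl (x * w + y * v)) ⟩
      (x * w + y * v) + (fromℕ 3 * (1ℚ * (1ℚ + 1ℚ) + 0ℚ * 1ℚ) - fromℕ 3 * 1ℚ) ∎
      where
      x = ι a
      y = ι b
      m = ι (suc n)
      u = inv (suc n)
      v = inv a
      w = inv b
      x+y≡m : x + y ≡ m
      x+y≡m = trans (sym (ι-+ a b)) (cong ι eq)

∑-𝟙-multiples-≤ : ∀ k q n → ι k * ∑ [1⋯ n ] (λ b → 𝟙 (k ℕ.* b ℕ.≤? q)) ≤ ι q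
∑-𝟙-multiples-≤ k q zero = subst (_≤ ι q) (sym (ℚ.*-zeroʳ (ι k))) (0≤ι q)
∑-𝟙-multiples-≤ k q (suc n) = subst (λ x → ι k * x ≤ ι q) (sym (∑-[1⋯]-suc n _)) step
  where
  open ℚ.≤-Reasoning
  s = ∑ [1⋯ n ] (λ b → 𝟙 (k ℕ.* b ℕ.≤? q))
  step : ι k * (s + 𝟙 (k ℕ.* suc n ℕ.≤? q)) ≤ ι q
  step with k ℕ.* suc n ℕ.≤? q
  ... | no _ = subst (λ x → ι k * x ≤ ι q) (sym (ℚ.+-identityʳ s)) (∑-𝟙-multiples-≤ k q n)
  ... | yes le = begin
    ι k * (s + 1ℚ)              ≤⟨ *-monoˡ-≤ (ι k) (0≤ι k) (ℚ.+-monoˡ-≤ 1ℚ s≤n) ⟩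
    ι k * (ι n + 1ℚ)        ≡⟨ cong (ι k *_) (trans (ℚ.+-comm (ι n) 1ℚ) (sym (ι-suc n))) ⟩
    ι k * ι (suc n)         ≡⟨ ι-* k (suc n) ⟨
    ι (k ℕ.* suc n)             ≤⟨ ι-≤ le ⟩
    ι q                         ∎
    where
    s≤n : s ≤ ι n
    s≤n = begin
      s                             ≤⟨ ∑-mono [1⋯ n ] (λ {b} _ → 𝟙≤1 (k ℕ.* b ℕ.≤? q)) ⟩
      ∑ [1⋯ n ] (λ _ → 1ℚ)          ≡⟨ ∑-length [1⋯ n ] ⟩
      ι (length [1⋯ n ])        ≡⟨ cong ι (length-[1⋯] n) ⟩
      ι n                       ∎

-- From κ b ≤ 2n follows κ ≤ 2n/b, and κ > M forces (M + 1) b ≤ 2n. The b points with second entry b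
-- thus contribute at most 2n together, and at most 2n / (M + 1) values of b occur.
κ-tail : ∀ n M → ι (suc M) * ∑ (L n) (λ s → 𝟙 (M ℕ.<? κ n s) * ι (κ n s)) ≤ fromℕ 4 * (ι n * ι n)
κ-tail n M = begin
  m * ∑ (L n) (λ s → 𝟙 (M ℕ.<? κ n s) * ι (κ n s))
    ≤⟨ *-monoˡ-≤ m (0≤ι (suc M)) (∑-mono (L n) (λ s∈ → pointwise (∈L⁻ s∈))) ⟩
  m * ∑ (L n) (λ s → e (proj₂ s) * inv (proj₂ s))
    ≡⟨ cong (m *_) (trans (∑-L n _) (∑-swap [1⋯ n ] [1⋯ n ] _)) ⟩
  m * ∑ [1⋯ n ] (λ b → ∑ [1⋯ n ] (λ a → 𝟙 (n ℕ.<? a ℕ.+ b) * (e b * inv b)))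
    ≡⟨ cong (m *_) (∑-cong [1⋯ n ] (λ {b} b∈ → column (∈[1⋯]⁻ b∈))) ⟩
  m * ∑ [1⋯ n ] e
    ≡⟨ cong (m *_) (∑-*ʳ [1⋯ n ] (ι (2 ℕ.* n)) _) ⟩
  m * (∑ [1⋯ n ] (λ b → 𝟙 (suc M ℕ.* b ℕ.≤? 2 ℕ.* n)) * ι (2 ℕ.* n))
    ≡⟨ sym (ℚ.*-assoc m _ (ι (2 ℕ.* n))) ⟩
  m * ∑ [1⋯ n ] (λ b → 𝟙 (suc M ℕ.* b ℕ.≤? 2 ℕ.* n)) * ι (2 ℕ.* n)
    ≤⟨ *-mono-≤ (0≤ι (2 ℕ.* n)) (0≤ι (2 ℕ.* n)) (∑-𝟙-multiples-≤ (suc M) (2 ℕ.* n) n) ℚ.≤-refl ⟩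
  ι (2 ℕ.* n) * ι (2 ℕ.* n)
    ≡⟨ cong (λ x → x * x) (trans (ι-* 2 n) (cong (_* ι n) (ι≡fromℕ 2))) ⟩
  fromℕ 2 * ι n * (fromℕ 2 * ι n)
    ≡⟨ (solve 1 (λ a → (con (fromℕ 2)) :* a :* ((con (fromℕ 2)) :* a)
           := (con (fromℕ 4)) :* (a :* a))
         refl (ι n)) ⟩
  fromℕ 4 * (ι n * ι n) ∎
  where
  open ℚ.≤-Reasoning
  m = ι (suc M)
  e : ℕ → ℚ
  e b = 𝟙 (suc M ℕ.* b ℕ.≤? 2 ℕ.* n) * ι (2 ℕ.* n)
  column : ∀ {b} → 1 ℕ.≤ b × b ℕ.≤ n → ∑ [1⋯ n ] (λ a → 𝟙 (n ℕ.<? a ℕ.+ b) * (e b * inv b)) ≡ e b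
  column {b} (1≤b , b≤n) = begin-equality
    ∑ [1⋯ n ] (λ a → 𝟙 (n ℕ.<? a ℕ.+ b) * (e b * inv b))   ≡⟨ ∑-*ʳ [1⋯ n ] (e b * inv b) _ ⟩
    ∑ [1⋯ n ] (λ a → 𝟙 (n ℕ.<? a ℕ.+ b)) * (e b * inv b)   ≡⟨ cong (_* (e b * inv b)) (∑-𝟙-above n b b≤n) ⟩
    ι b * (e b * inv b)                                ≡⟨ (solve 3 (λ a b c → a :* (b :* c)
          := b :* (a :* c))
        refl (ι b) (e b) (inv b)) ⟩
    e b * (ι b * inv b)                                ≡⟨ cong (e b *_) (inv-inverse 1≤b) ⟩
    e b * 1ℚ                                               ≡⟨ ℚ.*-identityʳ (e b) ⟩
    e b                                                    ∎
  pointwise : ∀ {a b} → InL n a b → 𝟙 (M ℕ.<? κ n (a , b)) * ι (κ n (a , b)) ≤ e b * inv b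
  pointwise {a} {b} i with κ-next i
  ... | c , next eq c≤n _ with M ℕ.<? κ n (a , b)
  ...   | no _ = subst (_≤ e b * inv b) (sym (ℚ.*-zeroˡ (ι (κ n (a , b)))))
    (0≤* (0≤* (0≤𝟙 (suc M ℕ.* b ℕ.≤? 2 ℕ.* n)) (0≤ι (2 ℕ.* n))) (ℚ.<⇒≤ (inv-positive (InL.1≤b i))))
  ...   | yes lt = begin
    1ℚ * k                             ≡⟨ (solve 1 (λ a → (con 1ℚ) :* a := a :* (con 1ℚ)) refl k) ⟩
    k * 1ℚ                             ≡⟨ cong (k *_) (inv-inverse (InL.1≤b i)) ⟨
    k * (ι b * inv b)              ≡⟨ ℚ.*-assoc k (ι b) (inv b) ⟨
    k * ι b * inv b                ≡⟨ cong (_* inv b) (ι-* (κ n (a , b)) b) ⟨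
    ι (κ n (a , b) ℕ.* b) * inv b  ≤⟨ *-mono-≤ (0≤ι (2 ℕ.* n)) (ℚ.<⇒≤ (inv-positive (InL.1≤b i)))
        (ι-≤ kb≤2n) ℚ.≤-refl ⟩
    ι (2 ℕ.* n) * inv b            ≡⟨ cong (_* inv b)
        (𝟙* (suc M ℕ.* b ℕ.≤? 2 ℕ.* n) _ (ℕ.≤-trans (ℕ.*-monoˡ-≤ b lt) kb≤2n)) ⟨
    e b * inv b                        ∎
    where
    k = ι (κ n (a , b))
    kb≤2n : κ n (a , b) ℕ.* b ℕ.≤ 2 ℕ.* n
    kb≤2n = linℕ ((ℕ.≤-reflexive (sym eq)) ⊕ℕ c≤n ⊕ℕ (InL.a≤n i))
              (solveℕ 4 (λ a b c d → a ⊞ (b ⊞ c ⊞ d ⊞ d)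
                  ⊜ (conℕ 2) ⊠ d ⊞ (a ⊞ b ⊞ c))
                refl (κ n (a , b) ℕ.* b) c a n)

-- Functions with quadratic asymptotics

-- F n = coef n² + O(n), with the leading coefficient as a rational datum. Whatever is shown to be
-- `Quad` has a rational constant, so the rationality of A needs no separate argument.
record Quad (F : ℕ → ℚ) : Set where
  field
    coef err : ℚ
    upper : ∀ n → 1 ℕ.≤ n → F n ≤ coef * (ι n * ι n) + err * ι n
    lower : ∀ n → 1 ℕ.≤ n → coef * (ι n * ι n) ≤ F n + err * ι n

open Quad

Quad-near : ∀ {F G} D → Quad F → (∀ n → 1 ℕ.≤ n → G n ≤ F n + D * ι n) →
            (∀ n → 1 ℕ.≤ n → F n ≤ G n + D * ι n) → Quad G
Quad-near D q u l .coef = coef q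
Quad-near D q u l .err = err q + D
Quad-near {F} {G} D q u l .upper n 1≤n =
  lin≤ ((u n 1≤n) ⊕ (upper q n 1≤n))
    (solve 6 (λ a b c d e f → a :+ (b :+ c :* d :+ (e :* (d :* d) :+ f :* d))
        := e :* (d :* d) :+ (f :+ c) :* d :+ (a :+ b))
      refl (G n) (F n) D (ι n) (coef q) (err q))
Quad-near {F} {G} D q u l .lower n 1≤n =
  lin≤ ((l n 1≤n) ⊕ (lower q n 1≤n))
    (solve 6 (λ a b c d e f → a :* (b :* b) :+ (c :+ d :* b :+ (e :+ f :* b))
        := c :+ (f :+ d) :* b :+ (e :+ a :* (b :* b)))
      refl (coef q) (ι n) (G n) D (F n) (err q))

Quad-cong : ∀ {F G} → Quad F → (∀ n → F n ≡ G n) → Quad G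
Quad-cong q eq .coef = coef q
Quad-cong q eq .err = err q
Quad-cong q eq .upper n 1≤n = subst (_≤ _) (eq n) (upper q n 1≤n)
Quad-cong q eq .lower n 1≤n = subst (λ f → _ ≤ f + _) (eq n) (lower q n 1≤n)

Quad-0 : Quad (λ _ → 0ℚ)
Quad-0 .coef = 0ℚ
Quad-0 .err = 0ℚ
Quad-0 .upper n _ = lin≤ (ℚ.≤-refl {0ℚ})
                      (solve 1 (λ a → (con 0ℚ) :+ (con 0ℚ)
                          := (con 0ℚ) :* (a :* a) :+ (con 0ℚ) :* a :+ (con 0ℚ))
                        refl (ι n))
Quad-0 .lower n _ = lin≤ (ℚ.≤-refl {0ℚ})
                      (solve 1 (λ a → (con 0ℚ) :* (a :* a) :+ (con 0ℚ)
                          := (con 0ℚ) :+ (con 0ℚ) :* a :+ (con 0ℚ))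
                        refl (ι n))

Quad-+ : ∀ {F G} → Quad F → Quad G → Quad (λ n → F n + G n)
Quad-+ p q .coef = coef p + coef q
Quad-+ p q .err = err p + err q
Quad-+ {F} {G} p q .upper n 1≤n =
  lin≤ ((upper p n 1≤n) ⊕ (upper q n 1≤n))
    (solve 7 (λ a b c d e f g → a :+ b :+ (c :* (d :* d) :+ e :* d :+ (f :* (d :* d) :+ g :* d))
        := (c :+ f) :* (d :* d) :+ (e :+ g) :* d :+ (a :+ b))
      refl (F n) (G n) (coef p) (ι n) (err p) (coef q) (err q))
Quad-+ {F} {G} p q .lower n 1≤n =
  lin≤ ((lower p n 1≤n) ⊕ (lower q n 1≤n))
    (solve 7 (λ a b c d e f g → (a :+ b) :* (c :* c) :+ (d :+ e :* c :+ (f :+ g :* c))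
        := d :+ f :+ (e :+ g) :* c :+ (a :* (c :* c) :+ b :* (c :* c)))
      refl (coef p) (coef q) (ι n) (F n) (err p) (G n) (err q))

Quad-neg : ∀ {F} → Quad F → Quad (λ n → - F n)
Quad-neg p .coef = - coef p
Quad-neg p .err = err p
Quad-neg {F} p .upper n 1≤n =
  lin≤ (lower p n 1≤n)
    (solve 4 (λ a b c d → (:- a) :+ (a :+ b :* c)
        := (:- d) :* (c :* c) :+ b :* c :+ d :* (c :* c))
      refl (F n) (err p) (ι n) (coef p))
Quad-neg {F} p .lower n 1≤n =
  lin≤ (upper p n 1≤n)
    (solve 4 (λ a b c d → (:- a) :* (b :* b) :+ (a :* (b :* b) :+ c :* b)
        := (:- d) :+ c :* b :+ d)
      refl (coef p) (ι n) (err p) (F n))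

Quad-*⁺ : ∀ {F} k → 0ℚ ≤ k → Quad F → Quad (λ n → k * F n)
Quad-*⁺ k 0≤k p .coef = k * coef p
Quad-*⁺ k 0≤k p .err = k * err p
Quad-*⁺ {F} k 0≤k p .upper n 1≤n =
  lin≤ (*-monoˡ-≤ k 0≤k (upper p n 1≤n))
    (solve 5 (λ a b c d e → a :* b :+ a :* (c :* (d :* d) :+ e :* d)
        := a :* c :* (d :* d) :+ a :* e :* d :+ a :* b)
      refl k (F n) (coef p) (ι n) (err p))
Quad-*⁺ {F} k 0≤k p .lower n 1≤n =
  lin≤ (*-monoˡ-≤ k 0≤k (lower p n 1≤n))
    (solve 5 (λ a b c d e → a :* b :* (c :* c) :+ a :* (d :+ e :* c)
        := a :* d :+ a :* e :* c :+ a :* (b :* (c :* c)))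
      refl k (coef p) (ι n) (F n) (err p))

Quad-∑ : {A : Set} (xs : List A) {F : A → ℕ → ℚ} → (∀ x → Quad (F x)) → Quad (λ n → ∑ xs (λ x → F x n))
Quad-∑ [] q = Quad-0
Quad-∑ (x ∷ xs) q = Quad-+ (q x) (Quad-∑ xs q)

coef-∑ : {A : Set} (xs : List A) {F : A → ℕ → ℚ} (q : ∀ x → Quad (F x)) →
         coef (Quad-∑ xs q) ≡ ∑ xs (λ x → coef (q x))
coef-∑ [] q = refl
coef-∑ (x ∷ xs) q = cong (coef (q x) +_) (coef-∑ xs q)

-- Dividing the inequality by n leaves a bounded multiple of n, so the excess of the coefficients is
-- not positive. The slack δ allows a truncation to be compared with the whole, and D absorbs errors
-- O(n).
coef-≤ : ∀ {F G} (p : Quad F) (q : Quad G) δ D →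
         (∀ n → 1 ℕ.≤ n → F n ≤ G n + δ * (ι n * ι n) + D * ι n) → coef p ≤ coef q + δ
coef-≤ {F} {G} p q δ D le =
  lin≤ (bounded-multiples⇒≤0 (coef p - coef q - δ) (err p + err q + D) bound)
    (solve 3 (λ a b c → a :+ (con 0ℚ) := b :+ c :+ (a :- b :- c)) refl (coef p) (coef q) δ)
  where
  bound : ∀ n → 1 ℕ.≤ n → (coef p - coef q - δ) * ι n ≤ err p + err q + D
  bound n 1≤n = *-cancelˡ-≤ (ι n) (0<ι 1≤n)
    (lin≤ ((lower p n 1≤n) ⊕ (upper q n 1≤n) ⊕ (le n 1≤n))
      (solve 9 (λ a b c d e f g h i → a :* ((b :- c :- d) :* a) :+
          (e :+ f :* a :+ (c :* (a :* a) :+ g :* a) :+ (h :+ d :* (a :* a) :+ i :* a))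
          := a :* (f :+ g :+ i) :+ (b :* (a :* a) :+ h :+ e))
        refl (ι n) (coef p) (coef q) δ (F n) (err p) (err q) (G n) D))

coef-mono : ∀ {F G} (p : Quad F) (q : Quad G) → (∀ n → F n ≤ G n) → coef p ≤ coef q
coef-mono {F} {G} p q le = subst (coef p ≤_) (ℚ.+-identityʳ _) (coef-≤ p q 0ℚ 0ℚ λ n _ →
  (lin≤ (le n)
    (solve 3 (λ a b c → a :+ b := b :+ (con 0ℚ) :* (c :* c) :+ (con 0ℚ) :* c :+ a) refl (F n) (G n) (ι n))))

-- Piecewise affine functions

-- The pieces are closed intervals with rational ends, and adjacent pieces share their common end;
-- such a function is automatically continuous.
data PL (g : ℚ → ℚ) : ℚ → ℚ → Set where
  leaf : ∀ {p q} → p ≤ q → ∀ α β → (∀ x → p ≤ x → x ≤ q → g x ≡ α * x + β) → PL g p q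
  node : ∀ {p q r} → PL g p r → PL g r q → PL g p q

PL⇒≤ : ∀ {g p q} → PL g p q → p ≤ q
PL⇒≤ (leaf p≤q _ _ _) = p≤q
PL⇒≤ (node l r) = ℚ.≤-trans (PL⇒≤ l) (PL⇒≤ r)

PL-cong : ∀ {g h p q} → (∀ x → p ≤ x → x ≤ q → g x ≡ h x) → PL g p q → PL h p q
PL-cong eq (leaf p≤q α β gx) = leaf p≤q α β (λ x l u → trans (sym (eq x l u)) (gx x l u))
PL-cong eq (node l r) = node
  (PL-cong (λ x p≤x x≤r → eq x p≤x (ℚ.≤-trans x≤r (PL⇒≤ r))) l)
  (PL-cong (λ x r≤x x≤q → eq x (ℚ.≤-trans (PL⇒≤ l) r≤x) x≤q) r)

restrict : ∀ {g p q p′ q′} → PL g p q → p ≤ p′ → p′ ≤ q′ → q′ ≤ q → PL g p′ q′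
restrict (leaf _ α β gx) p≤p′ p′≤q′ q′≤q =
  leaf p′≤q′ α β (λ x l u → gx x (ℚ.≤-trans p≤p′ l) (ℚ.≤-trans u q′≤q))
restrict {p′ = p′} {q′} (node {r = s} l r) p≤p′ p′≤q′ q′≤q with ℚ.≤-total q′ s | ℚ.≤-total s p′
... | inj₁ q′≤s | _         = restrict l p≤p′ p′≤q′ q′≤s
... | inj₂ s≤q′ | inj₁ s≤p′ = restrict r s≤p′ p′≤q′ q′≤q
... | inj₂ s≤q′ | inj₂ p′≤s = node (restrict l p≤p′ p′≤s ℚ.≤-refl) (restrict r ℚ.≤-refl s≤q′ q′≤q)

-- For a pointwise operation it suffices to treat two affine functions on one interval: the second
-- tree is restricted to the pieces of the first, and then the first is restricted implicitly to
-- those of the second.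
module Zip (_∙_ : ℚ → ℚ → ℚ)
           (affine : ∀ {p q} → p ≤ q → ∀ α β γ δ → PL (λ x → (α * x + β) ∙ (γ * x + δ)) p q) where

  zip-leaf : ∀ (f : ℚ → ℚ) {g p q} α β → (∀ x → p ≤ x → x ≤ q → f x ≡ α * x + β) → PL g p q → PL
      (λ x → f x ∙ g x) p q
  zip-leaf f α β fx (leaf p≤q γ δ gx) =
    PL-cong (λ x l u → sym (cong₂ _∙_ (fx x l u) (gx x l u))) (affine p≤q α β γ δ)
  zip-leaf f α β fx (node l r) = node
    (zip-leaf f α β (λ x p≤x x≤r → fx x p≤x (ℚ.≤-trans x≤r (PL⇒≤ r))) l)
    (zip-leaf f α β (λ x r≤x x≤q → fx x (ℚ.≤-trans (PL⇒≤ l) r≤x) x≤q) r)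

  PL-zip : ∀ {f g p q} → PL f p q → PL g p q → PL (λ x → f x ∙ g x) p q
  PL-zip {f} (leaf _ α β fx) g = zip-leaf f α β fx g
  PL-zip (node l r) g = node
    (PL-zip l (restrict g ℚ.≤-refl (PL⇒≤ l) (PL⇒≤ r)))
    (PL-zip r (restrict g (PL⇒≤ l) (PL⇒≤ r) ℚ.≤-refl))

affine-+ : ∀ {p q} → p ≤ q → ∀ α β γ δ → PL (λ x → (α * x + β) + (γ * x + δ)) p q
affine-+ p≤q α β γ δ = leaf p≤q (α + γ) (β + δ) (λ x _ _ →
  (solve 5 (λ a b c d e → a :* b :+ c :+ (d :* b :+ e) := (a :+ d) :* b :+ (c :+ e)) refl α x β γ δ))

-- The difference of the first and the second function is nondecreasing. If it is ≤ 0 at q, the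
-- first is the minimum throughout; if it is ≥ 0 at p, the second is. Otherwise the interval is cut
-- at the crossing point r, unless the slopes agree, when the sign at q again decides everywhere.
affine-⊓-steeper : ∀ {p q} → p ≤ q → ∀ α β γ δ → γ ≤ α → PL (λ x → (α * x + β) ⊓ (γ * x + δ)) p q
affine-⊓-steeper {p} {q} p≤q α β γ δ γ≤α with ℚ.≤-total (α * q + β) (γ * q + δ) | ℚ.≤-total (γ * p + δ)
    (α * p + β)
... | inj₁ fq≤gq | _ = leaf p≤q α β (λ x _ x≤q → ℚ.p≤q⇒p⊓q≡p {α * x + β} {γ * x + δ}
  (lin≤ (fq≤gq ⊕ (0≤* (p≤q⇒0≤q-p x≤q) (p≤q⇒0≤q-p γ≤α)))
    (solve 6 (λ a b c d e f → a :* b :+ c :+ (d :* e :+ f :+ (e :- b) :* (a :- d))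
        := d :* b :+ f :+ (a :* e :+ c :+ (con 0ℚ)))
      refl α x β γ q δ)))
... | inj₂ _ | inj₁ gp≤fp = leaf p≤q γ δ (λ x p≤x _ → ℚ.p≥q⇒p⊓q≡q {α * x + β} {γ * x + δ}
  (lin≤ (gp≤fp ⊕ (0≤* (p≤q⇒0≤q-p p≤x) (p≤q⇒0≤q-p γ≤α)))
    (solve 6 (λ a b c d e f → a :* b :+ c :+ (d :* e :+ f :+ (b :- e) :* (d :- a))
        := d :* b :+ f :+ (a :* e :+ c :+ (con 0ℚ)))
      refl γ x δ α p β)))
... | inj₂ gq≤fq | inj₂ fp≤gp with α - γ ℚ.≤? 0ℚ
...   | yes α≤γ = leaf p≤q γ δ (λ x _ x≤q → ℚ.p≥q⇒p⊓q≡q {α * x + β} {γ * x + δ}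
  (lin≤ (gq≤fq ⊕ (0≤* (p≤q⇒0≤q-p x≤q) (p≤q⇒0≤q-p α≤γ)))
    (solve 6 (λ a b c d e f → a :* b :+ c :+ (d :* e :+ f :+ (e :- b) :* ((con 0ℚ) :- (d :- a)))
        := d :* b :+ f :+ (a :* e :+ c :+ (con 0ℚ)))
      refl γ x δ α q β)))
...   | no α≰γ with recip (α - γ) (ℚ.≰⇒> α≰γ)
...     | v , 0<v , sv≡1 = node
  (leaf p≤r α β (λ x _ x≤r → ℚ.p≤q⇒p⊓q≡p {α * x + β} {γ * x + δ}
    (lin≤ ((ℚ.≤-reflexive root) ⊕ (*-monoˡ-≤ (α - γ) 0≤s x≤r))
      (solve 6 (λ a b c d e f → a :* b :+ c :+ (d :- c :+ (a :- e) :* f)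
          := e :* b :+ d :+ ((a :- e) :* f :+ (a :- e) :* b))
        refl α x β δ γ r))))
  (leaf r≤q γ δ (λ x r≤x _ → ℚ.p≥q⇒p⊓q≡q {α * x + β} {γ * x + δ}
    (lin≤ ((ℚ.≤-reflexive (sym root)) ⊕ (*-monoˡ-≤ (α - γ) 0≤s r≤x))
      (solve 6 (λ a b c d e f → a :* b :+ c :+ ((d :- a) :* e :+ (d :- a) :* b)
          := d :* b :+ f :+ (c :- f :+ (d :- a) :* e))
        refl γ x δ α r β))))
  where
  0<s = ℚ.≰⇒> α≰γ
  0≤s = ℚ.<⇒≤ 0<s
  r = (δ - β) * v
  root : (α - γ) * r ≡ δ - β
  root = trans (solve 3 (λ a b c → a :* (b :* c) := b :* (a :* c)) refl (α - γ) (δ - β) v)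
    (trans (cong ((δ - β) *_) sv≡1) (ℚ.*-identityʳ (δ - β)))
  p≤r : p ≤ r
  p≤r = *-cancelˡ-≤ (α - γ) 0<s (lin≤ ((ℚ.≤-reflexive (sym root)) ⊕ fp≤gp)
                                  (solve 6 (λ a b c d e f → (a :- b) :* c :+ ((a :- b) :* d :+ (b :* c :+ e))
                                      := (a :- b) :* d :+ (e :- f :+ (a :* c :+ f)))
                                    refl α γ p r δ β))
  r≤q : r ≤ q
  r≤q = *-cancelˡ-≤ (α - γ) 0<s (lin≤ ((ℚ.≤-reflexive root) ⊕ gq≤fq)
                                  (solve 6 (λ a b c d e f → (a :- b) :* c :+ (d :- e :+ (a :* f :+ e))
                                      := (a :- b) :* f :+ ((a :- b) :* c :+ (b :* f :+ d)))
                                    refl α γ r δ β q))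

affine-⊓ : ∀ {p q} → p ≤ q → ∀ α β γ δ → PL (λ x → (α * x + β) ⊓ (γ * x + δ)) p q
affine-⊓ p≤q α β γ δ with ℚ.≤-total γ α
... | inj₁ γ≤α = affine-⊓-steeper p≤q α β γ δ γ≤α
... | inj₂ α≤γ = PL-cong (λ x _ _ → ℚ.⊓-comm (γ * x + δ) (α * x + β)) (affine-⊓-steeper p≤q γ δ α β α≤γ)

PL-+ : ∀ {f g p q} → PL f p q → PL g p q → PL (λ x → f x + g x) p q
PL-+ = Zip.PL-zip _+_ affine-+

PL-⊓ : ∀ {f g p q} → PL f p q → PL g p q → PL (λ x → f x ⊓ g x) p q
PL-⊓ = Zip.PL-zip _⊓_ affine-⊓

PL-neg : ∀ {f p q} → PL f p q → PL (λ x → - f x) p q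
PL-neg (leaf p≤q α β fx) = leaf p≤q (- α) (- β) (λ x l u → trans (cong -_ (fx x l u))
  (solve 3 (λ a b c → :- (a :* b :+ c) := (:- a) :* b :+ (:- c)) refl α x β))
PL-neg (node l r) = node (PL-neg l) (PL-neg r)

-- A rational antiderivative replaces the integral.
record Antiderivative (g : ℚ → ℚ) (p q : ℚ) : Set where
  field
    G : ℚ → ℚ
    C K : ℚ
    0≤C : 0ℚ ≤ C
    0≤K : 0ℚ ≤ K
    G-upper : ∀ x y → p ≤ x → x ≤ y → y ≤ q → G y - G x ≤ g y * (y - x) + C * ((y - x) * (y - x))
    G-lower : ∀ x y → p ≤ x → x ≤ y → y ≤ q → g y * (y - x) ≤ G y - G x + C * ((y - x) * (y - x))
    g-upper : ∀ x y → p ≤ x → x ≤ y → y ≤ q → g y - g x ≤ K * (y - x)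
    g-lower : ∀ x y → p ≤ x → x ≤ y → y ≤ q → g x - g y ≤ K * (y - x)

-- On a leaf this is α x²/2 + β x, whose increment differs from g y (y - x) by exactly α/2 (y - x)².
-- The Lipschitz constant K serves only for gluing. If the breakpoint r lies between x and y, the
-- left piece is estimated with g r in place of g y, and the discrepancy is at most K₂ (y - r) (r -
-- x).
antiderivative : ∀ {g p q} → PL g p q → Antiderivative g p q
antiderivative {g} {p} {q} (leaf _ α β gx) = record
  { G = λ x → α * ½ * (x * x) + β * x
  ; C = a₊
  ; K = a₊
  ; 0≤C = ℚ.0≤∣p∣ α
  ; 0≤K = ℚ.0≤∣p∣ α
  ; G-upper = λ x y p≤x x≤y y≤q → subst
      (λ z → α * ½ * (y * y) + β * y - (α * ½ * (x * x) + β * x) ≤ z * (y - x) + a₊ * ((y - x) * (y - x)))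
      (sym (gx y (ℚ.≤-trans p≤x x≤y) y≤q))
      (lin≤ ((½ ⊛ (*-mono-≤ (ℚ.0≤∣p∣ α) (0≤sq x y x≤y) (-x≤∣x∣ α) ℚ.≤-refl)) ⊕
          (½ ⊛ (0≤* (ℚ.0≤∣p∣ α) (0≤sq x y x≤y))))
        (solve 5 (λ a b c d e → a :* (con ½) :* (b :* b) :+ c :* b :-
            (a :* (con ½) :* (d :* d) :+ c :* d) :+
                ((con ½) :* (e :* ((b :- d) :* (b :- d))) :+ (con ½) :* (e :* ((b :- d) :* (b :- d))))
            := (a :* b :+ c) :* (b :- d) :+ e :* ((b :- d) :* (b :- d)) :+
                ((con ½) :* ((:- a) :* ((b :- d) :* (b :- d))) :+ (con ½) :* (con 0ℚ)))
          refl α y β x a₊))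
  ; G-lower = λ x y p≤x x≤y y≤q → subst
      (λ z → z * (y - x) ≤ α * ½ * (y * y) + β * y - (α * ½ * (x * x) + β * x) + a₊ * ((y - x) * (y - x)))
      (sym (gx y (ℚ.≤-trans p≤x x≤y) y≤q))
      (lin≤ ((½ ⊛ (*-mono-≤ (ℚ.0≤∣p∣ α) (0≤sq x y x≤y) (x≤∣x∣ α) ℚ.≤-refl)) ⊕
          (½ ⊛ (0≤* (ℚ.0≤∣p∣ α) (0≤sq x y x≤y))))
        (solve 5 (λ a b c d e → (a :* b :+ c) :* (b :- d) :+
            ((con ½) :* (e :* ((b :- d) :* (b :- d))) :+ (con ½) :* (e :* ((b :- d) :* (b :- d))))
            := a :* (con ½) :* (b :* b) :+ c :* b :- (a :* (con ½) :* (d :* d) :+ c :* d) :+ e :*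
                ((b :- d) :* (b :- d)) :+ ((con ½) :* (a :* ((b :- d) :* (b :- d))) :+ (con ½) :* (con 0ℚ)))
          refl α y β x a₊))
  ; g-upper = λ x y p≤x x≤y y≤q → subst₂ (λ u v → u - v ≤ a₊ * (y - x))
      (sym (gx y (ℚ.≤-trans p≤x x≤y) y≤q)) (sym (gx x p≤x (ℚ.≤-trans x≤y y≤q)))
      (lin≤ (*-mono-≤ (ℚ.0≤∣p∣ α) (p≤q⇒0≤q-p x≤y) (x≤∣x∣ α) ℚ.≤-refl)
        (solve 5 (λ a b c d e → a :* b :+ c :- (a :* d :+ c) :+ e :* (b :- d)
            := e :* (b :- d) :+ a :* (b :- d))
          refl α y β x a₊))
  ; g-lower = λ x y p≤x x≤y y≤q → subst₂ (λ u v → v - u ≤ a₊ * (y - x))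
      (sym (gx y (ℚ.≤-trans p≤x x≤y) y≤q)) (sym (gx x p≤x (ℚ.≤-trans x≤y y≤q)))
      (lin≤ (*-mono-≤ (ℚ.0≤∣p∣ α) (p≤q⇒0≤q-p x≤y) (-x≤∣x∣ α) ℚ.≤-refl)
        (solve 5 (λ a b c d e → a :* b :+ c :- (a :* d :+ c) :+ e :* (d :- b)
            := e :* (d :- b) :+ (:- a) :* (d :- b))
          refl α x β y a₊))
  }
  where
  a₊ = ∣ α ∣
  0≤sq : ∀ x y → x ≤ y → 0ℚ ≤ (y - x) * (y - x)
  0≤sq x y x≤y = 0≤* (p≤q⇒0≤q-p x≤y) (p≤q⇒0≤q-p x≤y)
antiderivative {g} {p} {q} (node {r = r} l₁ l₂) = record
  { G = Gₙ
  ; C = C₁ + C₂ + K₂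
  ; K = K₁ + K₂
  ; 0≤C = lin≤ (0≤C₁ ⊕ 0≤C₂ ⊕ 0≤K₂)
            (solve 3 (λ a b c → (con 0ℚ) :+ (a :+ b :+ c)
                := a :+ b :+ c :+ ((con 0ℚ) :+ (con 0ℚ) :+ (con 0ℚ)))
              refl C₁ C₂ K₂)
  ; 0≤K = lin≤ (0≤K₁ ⊕ 0≤K₂)
            (solve 2 (λ a b → (con 0ℚ) :+ (a :+ b) := a :+ b :+ ((con 0ℚ) :+ (con 0ℚ))) refl K₁ K₂)
  ; G-upper = λ x y p≤x x≤y y≤q → proj₁ (G-bounds x y p≤x x≤y y≤q)
  ; G-lower = λ x y p≤x x≤y y≤q → proj₂ (G-bounds x y p≤x x≤y y≤q)
  ; g-upper = λ x y p≤x x≤y y≤q → proj₁ (g-bounds x y p≤x x≤y y≤q)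
  ; g-lower = λ x y p≤x x≤y y≤q → proj₂ (g-bounds x y p≤x x≤y y≤q)
  }
  where
  open Antiderivative (antiderivative l₁) renaming
    (G to G₁; C to C₁; K to K₁; 0≤C to 0≤C₁; 0≤K to 0≤K₁; G-upper to G-upper₁; G-lower to G-lower₁;
        g-upper to g-upper₁; g-lower to g-lower₁)
  open Antiderivative (antiderivative l₂) renaming
    (G to G₂; C to C₂; K to K₂; 0≤C to 0≤C₂; 0≤K to 0≤K₂; G-upper to G-upper₂; G-lower to G-lower₂;
        g-upper to g-upper₂; g-lower to g-lower₂)
  Gₙ : ℚ → ℚ
  -- Clamping at r makes each summand constant on the side of the other piece, so no integration
  -- constants have to be matched.
  Gₙ x = G₁ (x ⊓ r) + G₂ (x ⊔ r)
  Gₙ-left : ∀ x → x ≤ r → Gₙ x ≡ G₁ x + G₂ r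
  Gₙ-left x x≤r = cong₂ (λ u v → G₁ u + G₂ v) (ℚ.p≤q⇒p⊓q≡p x≤r) (ℚ.p≤q⇒p⊔q≡q x≤r)
  Gₙ-right : ∀ x → r ≤ x → Gₙ x ≡ G₁ r + G₂ x
  Gₙ-right x r≤x = cong₂ (λ u v → G₁ u + G₂ v) (ℚ.p≥q⇒p⊓q≡q r≤x) (ℚ.p≥q⇒p⊔q≡p r≤x)
  G-bounds : ∀ x y → p ≤ x → x ≤ y → y ≤ q →
             Gₙ y - Gₙ x ≤ g y * (y - x) + (C₁ + C₂ + K₂) * ((y - x) * (y - x)) ×
             g y * (y - x) ≤ Gₙ y - Gₙ x + (C₁ + C₂ + K₂) * ((y - x) * (y - x))
  G-bounds x y p≤x x≤y y≤q with ℚ.≤-total y r | ℚ.≤-total r x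
  ... | inj₁ y≤r | _ =
    (lin≤ ((ℚ.≤-reflexive (Gₙ-left y y≤r)) ⊕ (ℚ.≤-reflexive (sym (Gₙ-left x (ℚ.≤-trans x≤y y≤r)))) ⊕
        (G-upper₁ x y p≤x x≤y y≤r) ⊕ (0≤* 0≤C₂ sq) ⊕ (0≤* 0≤K₂ sq))
      (solve 11 (λ a b c d e f g h i j k → a :- b :+
          (c :+ d :+ b :+ (e :* (f :- g) :+ h :* ((f :- g) :* (f :- g))) :+ i :* ((f :- g) :* (f :- g))
              :+ j :* ((f :- g) :* (f :- g)))
          := e :* (f :- g) :+ (h :+ i :+ j) :* ((f :- g) :* (f :- g)) :+
              (a :+ (k :+ d) :+ (c :- k) :+ (con 0ℚ) :+ (con 0ℚ)))
        refl (Gₙ y) (Gₙ x) (G₁ y) (G₂ r) (g y) y x C₁ C₂ K₂ (G₁ x))) ,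
    (lin≤ ((ℚ.≤-reflexive (sym (Gₙ-left y y≤r))) ⊕ (ℚ.≤-reflexive (Gₙ-left x (ℚ.≤-trans x≤y y≤r))) ⊕
        (G-lower₁ x y p≤x x≤y y≤r) ⊕ (0≤* 0≤C₂ sq) ⊕ (0≤* 0≤K₂ sq))
      (solve 11 (λ a b c d e f g h i j k → a :* (b :- c) :+
          (d :+ (e :+ f) :+ (g :- e :+ h :* ((b :- c) :* (b :- c))) :+ i :* ((b :- c) :* (b :- c)) :+ j
              :* ((b :- c) :* (b :- c)))
          := d :- k :+ (h :+ i :+ j) :* ((b :- c) :* (b :- c)) :+
              (g :+ f :+ k :+ a :* (b :- c) :+ (con 0ℚ) :+ (con 0ℚ)))
        refl (g y) y x (Gₙ y) (G₁ x) (G₂ r) (G₁ y) C₁ C₂ K₂ (Gₙ x)))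
    where sq = 0≤* (p≤q⇒0≤q-p x≤y) (p≤q⇒0≤q-p x≤y)
  ... | inj₂ _ | inj₁ r≤x =
    (lin≤ ((ℚ.≤-reflexive (Gₙ-right y (ℚ.≤-trans r≤x x≤y))) ⊕ (ℚ.≤-reflexive (sym (Gₙ-right x r≤x))) ⊕
        (G-upper₂ x y r≤x x≤y y≤q) ⊕ (0≤* 0≤C₁ sq) ⊕ (0≤* 0≤K₂ sq))
      (solve 11 (λ a b c d e f g h i j k → a :- b :+
          (c :+ d :+ b :+ (e :* (f :- g) :+ h :* ((f :- g) :* (f :- g))) :+ i :* ((f :- g) :* (f :- g))
              :+ j :* ((f :- g) :* (f :- g)))
          := e :* (f :- g) :+ (i :+ h :+ j) :* ((f :- g) :* (f :- g)) :+
              (a :+ (c :+ k) :+ (d :- k) :+ (con 0ℚ) :+ (con 0ℚ)))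
        refl (Gₙ y) (Gₙ x) (G₁ r) (G₂ y) (g y) y x C₂ C₁ K₂ (G₂ x))) ,
    (lin≤ ((ℚ.≤-reflexive (sym (Gₙ-right y (ℚ.≤-trans r≤x x≤y)))) ⊕ (ℚ.≤-reflexive (Gₙ-right x r≤x)) ⊕
        (G-lower₂ x y r≤x x≤y y≤q) ⊕ (0≤* 0≤C₁ sq) ⊕ (0≤* 0≤K₂ sq))
      (solve 11 (λ a b c d e f g h i j k → a :* (b :- c) :+
          (d :+ (e :+ f) :+ (g :- f :+ h :* ((b :- c) :* (b :- c))) :+ i :* ((b :- c) :* (b :- c)) :+ j
              :* ((b :- c) :* (b :- c)))
          := d :- k :+ (i :+ h :+ j) :* ((b :- c) :* (b :- c)) :+
              (e :+ g :+ k :+ a :* (b :- c) :+ (con 0ℚ) :+ (con 0ℚ)))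
        refl (g y) y x (Gₙ y) (G₁ r) (G₂ x) (G₂ y) C₂ C₁ K₂ (Gₙ x)))
    where sq = 0≤* (p≤q⇒0≤q-p x≤y) (p≤q⇒0≤q-p x≤y)
  ... | inj₂ r≤y | inj₂ x≤r =
    (lin≤ ((ℚ.≤-reflexive (Gₙ-right y r≤y)) ⊕ (ℚ.≤-reflexive (sym (Gₙ-left x x≤r))) ⊕
        (G-upper₁ x r p≤x x≤r ℚ.≤-refl) ⊕ (G-upper₂ r y ℚ.≤-refl r≤y y≤q) ⊕
            (*-monoˡ-≤ (r - x) 0≤u (g-lower₂ r y ℚ.≤-refl r≤y y≤q)) ⊕ ((fromℕ 2) ⊛ (0≤* 0≤C₁ uv)) ⊕
                (0≤* 0≤C₁ vv) ⊕ ((fromℕ 2) ⊛ (0≤* 0≤C₂ uv)) ⊕ (0≤* 0≤C₂ uu) ⊕ (0≤* 0≤K₂ uv) ⊕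
                    (0≤* 0≤K₂ uu) ⊕ (0≤* 0≤K₂ vv))
      (solve 14 (λ a b c d e f g h i j k l m o → a :- b :+
          (c :+ d :+ b :+ (e :* (f :- g) :+ h :* ((f :- g) :* (f :- g))) :+
              (i :* (j :- f) :+ k :* ((j :- f) :* (j :- f))) :+ (f :- g) :* (l :* (j :- f)) :+
                  (con (fromℕ 2)) :* (h :* ((f :- g) :* (j :- f))) :+ h :* ((j :- f) :* (j :- f)) :+
                      (con (fromℕ 2)) :* (k :* ((f :- g) :* (j :- f))) :+ k :* ((f :- g) :* (f :- g)) :+
                          l :* ((f :- g) :* (j :- f)) :+ l :* ((f :- g) :* (f :- g)) :+ l :*
                              ((j :- f) :* (j :- f)))
          := i :* (j :- g) :+ (h :+ k :+ l) :* ((j :- g) :* (j :- g)) :+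
              (a :+ (m :+ o) :+ (c :- m) :+ (d :- o) :+ (f :- g) :* (e :- i) :+ (con (fromℕ 2)) :*
                  (con 0ℚ) :+ (con 0ℚ) :+ (con (fromℕ 2)) :* (con 0ℚ) :+ (con 0ℚ) :+ (con 0ℚ) :+
                      (con 0ℚ) :+ (con 0ℚ)))
        refl (Gₙ y) (Gₙ x) (G₁ r) (G₂ y) (g r) r x C₁ (g y) y C₂ K₂ (G₁ x) (G₂ r))) ,
    (lin≤ ((ℚ.≤-reflexive (sym (Gₙ-right y r≤y))) ⊕ (ℚ.≤-reflexive (Gₙ-left x x≤r)) ⊕
        (G-lower₁ x r p≤x x≤r ℚ.≤-refl) ⊕ (G-lower₂ r y ℚ.≤-refl r≤y y≤q) ⊕
            (*-monoˡ-≤ (r - x) 0≤u (g-upper₂ r y ℚ.≤-refl r≤y y≤q)) ⊕ ((fromℕ 2) ⊛ (0≤* 0≤C₁ uv)) ⊕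
                (0≤* 0≤C₁ vv) ⊕ ((fromℕ 2) ⊛ (0≤* 0≤C₂ uv)) ⊕ (0≤* 0≤C₂ uu) ⊕ (0≤* 0≤K₂ uv) ⊕
                    (0≤* 0≤K₂ uu) ⊕ (0≤* 0≤K₂ vv))
      (solve 14 (λ a b c d e f g h i j k l m o → a :* (b :- c) :+
          (d :+ (e :+ f) :+ (g :- e :+ h :* ((i :- c) :* (i :- c))) :+
              (j :- f :+ k :* ((b :- i) :* (b :- i))) :+ (i :- c) :* (l :* (b :- i)) :+ (con (fromℕ 2))
                  :* (h :* ((i :- c) :* (b :- i))) :+ h :* ((b :- i) :* (b :- i)) :+ (con (fromℕ 2)) :*
                      (k :* ((i :- c) :* (b :- i))) :+ k :* ((i :- c) :* (i :- c)) :+ l :*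
                          ((i :- c) :* (b :- i)) :+ l :* ((i :- c) :* (i :- c)) :+ l :* ((b :- i) :* (b :- i)))
          := d :- m :+ (h :+ k :+ l) :* ((b :- c) :* (b :- c)) :+
              (g :+ j :+ m :+ o :* (i :- c) :+ a :* (b :- i) :+ (i :- c) :* (a :- o) :+ (con (fromℕ 2))
                  :* (con 0ℚ) :+ (con 0ℚ) :+ (con (fromℕ 2)) :* (con 0ℚ) :+ (con 0ℚ) :+ (con 0ℚ) :+
                      (con 0ℚ) :+ (con 0ℚ)))
        refl (g y) y x (Gₙ y) (G₁ x) (G₂ r) (G₁ r) C₁ r (G₂ y) C₂ K₂ (Gₙ x) (g r)))
    where
    0≤u = p≤q⇒0≤q-p x≤r
    0≤v = p≤q⇒0≤q-p r≤y
    uu = 0≤* 0≤u 0≤u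
    uv = 0≤* 0≤u 0≤v
    vv = 0≤* 0≤v 0≤v
  g-bounds : ∀ x y → p ≤ x → x ≤ y → y ≤ q → g y - g x ≤ (K₁ + K₂) * (y - x) × g x - g y ≤ (K₁ + K₂) * (y - x)
  g-bounds x y p≤x x≤y y≤q with ℚ.≤-total y r | ℚ.≤-total r x
  ... | inj₁ y≤r | _ =
    (lin≤ ((g-upper₁ x y p≤x x≤y y≤r) ⊕ (0≤* 0≤K₂ (p≤q⇒0≤q-p x≤y)))
      (solve 6 (λ a b c d e f → a :- b :+ (c :* (d :- e) :+ f :* (d :- e))
          := (c :+ f) :* (d :- e) :+ (a :- b :+ (con 0ℚ)))
        refl (g y) (g x) K₁ y x K₂)) ,
    (lin≤ ((g-lower₁ x y p≤x x≤y y≤r) ⊕ (0≤* 0≤K₂ (p≤q⇒0≤q-p x≤y)))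
      (solve 6 (λ a b c d e f → a :- b :+ (c :* (d :- e) :+ f :* (d :- e))
          := (c :+ f) :* (d :- e) :+ (a :- b :+ (con 0ℚ)))
        refl (g x) (g y) K₁ y x K₂))
  ... | inj₂ _ | inj₁ r≤x =
    (lin≤ ((g-upper₂ x y r≤x x≤y y≤q) ⊕ (0≤* 0≤K₁ (p≤q⇒0≤q-p x≤y)))
      (solve 6 (λ a b c d e f → a :- b :+ (c :* (d :- e) :+ f :* (d :- e))
          := (f :+ c) :* (d :- e) :+ (a :- b :+ (con 0ℚ)))
        refl (g y) (g x) K₂ y x K₁)) ,
    (lin≤ ((g-lower₂ x y r≤x x≤y y≤q) ⊕ (0≤* 0≤K₁ (p≤q⇒0≤q-p x≤y)))
      (solve 6 (λ a b c d e f → a :- b :+ (c :* (d :- e) :+ f :* (d :- e))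
          := (f :+ c) :* (d :- e) :+ (a :- b :+ (con 0ℚ)))
        refl (g x) (g y) K₂ y x K₁))
  ... | inj₂ r≤y | inj₂ x≤r =
    (lin≤ ((g-upper₁ x r p≤x x≤r ℚ.≤-refl) ⊕ (g-upper₂ r y ℚ.≤-refl r≤y y≤q) ⊕
        (0≤* 0≤K₁ (p≤q⇒0≤q-p r≤y)) ⊕ (0≤* 0≤K₂ (p≤q⇒0≤q-p x≤r)))
      (solve 8 (λ a b c d e f g h → a :- b :+ (c :* (d :- e) :+ f :* (g :- d) :+ c :* (g :- d) :+ f :* (d :- e))
          := (c :+ f) :* (g :- e) :+ (h :- b :+ (a :- h) :+ (con 0ℚ) :+ (con 0ℚ)))
        refl (g y) (g x) K₁ r x K₂ y (g r))) ,
    (lin≤ ((g-lower₁ x r p≤x x≤r ℚ.≤-refl) ⊕ (g-lower₂ r y ℚ.≤-refl r≤y y≤q) ⊕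
        (0≤* 0≤K₁ (p≤q⇒0≤q-p r≤y)) ⊕ (0≤* 0≤K₂ (p≤q⇒0≤q-p x≤r)))
      (solve 8 (λ a b c d e f g h → a :- b :+ (c :* (d :- e) :+ f :* (g :- d) :+ c :* (g :- d) :+ f :* (d :- e))
          := (c :+ f) :* (g :- e) :+ (a :- h :+ (h :- b) :+ (con 0ℚ) :+ (con 0ℚ)))
        refl (g x) (g y) K₁ r x K₂ y (g r)))

-- Each of the n steps of length 1/n contributes an error C/n² to the telescoping sum of G, in total
-- C/n. After multiplication by n² this is C n.
riemann : ∀ {g} → PL g 0ℚ 1ℚ → Quad (λ n → ∑ [1⋯ n ] (λ a → ι n * g (ι a * inv n)))
riemann {g} pl = record { coef = I ; err = C ; upper = λ n 1≤n → proj₁ (bounds n 1≤n) ; lower = λ n 1≤n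
    → proj₂ (bounds n 1≤n) }
  where
  open Antiderivative (antiderivative pl)
  I = G 1ℚ - G 0ℚ
  module _ (n : ℕ) (1≤n : 1 ℕ.≤ n) where
    δ = inv n
    nδ≡1 = inv-inverse 1≤n
    0<δ = inv-positive 1≤n
    s : ℕ → ℚ
    s m = ∑ [1⋯ m ] (λ a → g (ι a * δ) * δ)
    partial : ∀ m → m ℕ.≤ n → G (ι m * δ) - G 0ℚ ≤ s m + ι m * (C * (δ * δ)) ×
                              s m ≤ G (ι m * δ) - G 0ℚ + ι m * (C * (δ * δ))
    partial zero _ =
      (lin≤ ((ℚ.≤-reflexive G0) ⊕ (ℚ.≤-reflexive (sym M≡0)))
        (solve 4 (λ a b c d → a :- b :+ (b :+ c :* d)
            := (con 0ℚ) :+ c :* d :+ (a :+ (con 0ℚ)))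
          refl (G (ι 0 * δ)) (G 0ℚ) (ι 0) (C * (δ * δ)))) ,
      (lin≤ ((ℚ.≤-reflexive (sym G0)) ⊕ (ℚ.≤-reflexive (sym M≡0)))
        (solve 4 (λ a b c d → (con 0ℚ) :+ (a :+ b :* c)
            := a :- d :+ b :* c :+ (d :+ (con 0ℚ)))
          refl (G (ι 0 * δ)) (ι 0) (C * (δ * δ)) (G 0ℚ)))
      where
      G0 : G (ι 0 * δ) ≡ G 0ℚ
      G0 = cong G (trans (cong (_* δ) ι-0) (ℚ.*-zeroˡ δ))
      M≡0 : ι 0 * (C * (δ * δ)) ≡ 0ℚ
      M≡0 = trans (cong (_* (C * (δ * δ))) ι-0) (ℚ.*-zeroˡ (C * (δ * δ)))
    partial (suc m) m<n = step (partial m (ℕ.<⇒≤ m<n))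
      where
      x = ι m * δ
      y = ι (suc m) * δ
      k = g y
      y-x : y - x ≡ δ
      y-x = trans (cong (λ t → t * δ - x) (ι-suc m)) (solve 2 (λ a b → ((con 1ℚ) :+ a) :* b :- a :* b
            := b)
          refl (ι m) δ)
      0≤x : 0ℚ ≤ x
      0≤x = 0≤* (0≤ι m) (ℚ.<⇒≤ 0<δ)
      x≤y : x ≤ y
      x≤y = lin≤ ((ℚ.≤-reflexive (sym y-x)) ⊕ (ℚ.<⇒≤ 0<δ))
              (solve 3 (λ a b c → a :+ (b :- a :+ c) := b :+ (c :+ (con 0ℚ))) refl x y δ)
      y≤1 : y ≤ 1ℚ
      y≤1 = subst (y ≤_) nδ≡1 (*-mono-≤ (0≤ι n) (ℚ.<⇒≤ 0<δ) (ι-≤ m<n) ℚ.≤-refl)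
      up : G y - G x ≤ k * δ + C * (δ * δ)
      up = subst (λ t → G y - G x ≤ k * t + C * (t * t)) y-x (G-upper x y 0≤x x≤y y≤1)
      lo : k * δ ≤ G y - G x + C * (δ * δ)
      lo = subst (λ t → k * t ≤ G y - G x + C * (t * t)) y-x (G-lower x y 0≤x x≤y y≤1)
      sum≡ : s (suc m) ≡ s m + k * δ
      sum≡ = ∑-[1⋯]-suc m _
      mult≡ : ι (suc m) * (C * (δ * δ)) ≡ (1ℚ + ι m) * (C * (δ * δ))
      mult≡ = cong (_* (C * (δ * δ))) (ι-suc m)
      step : G x - G 0ℚ ≤ s m + ι m * (C * (δ * δ)) × s m ≤ G x - G 0ℚ + ι m * (C * (δ * δ)) →
             G y - G 0ℚ ≤ s (suc m) + ι (suc m) * (C * (δ * δ)) × s (suc m) ≤ G y - G 0ℚ + ι (suc m) *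
                 (C * (δ * δ))
      step (ih₁ , ih₂) =
        (lin≤ ((ℚ.≤-reflexive (sym sum≡)) ⊕ (ℚ.≤-reflexive (sym mult≡)) ⊕ ih₁ ⊕ up)
          (solve 9 (λ a b c d e f g h i → a :- b :+ (c :+ d :* e :+ (f :+ g :* e) :+ (h :+ e))
              := c :+ d :* e :+ (f :+ h :+ ((con 1ℚ) :+ g) :* e :+ (i :- b) :+ (a :- i)))
            refl (G y) (G 0ℚ) (s (suc m)) (ι (suc m)) (C * (δ * δ)) (s m) (ι m) (k * δ) (G x))) ,
        (lin≤ ((ℚ.≤-reflexive sum≡) ⊕ (ℚ.≤-reflexive (sym mult≡)) ⊕ ih₂ ⊕ lo)
          (solve 9 (λ a b c d e f g h i → a :+ (b :+ c :+ d :* e :+ (f :- g :+ h :* e) :+ (i :- f :+ e))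
              := i :- g :+ d :* e :+ (a :+ ((con 1ℚ) :+ h) :* e :+ b :+ c))
            refl (s (suc m)) (s m) (k * δ) (ι (suc m)) (C * (δ * δ)) (G x) (G 0ℚ) (ι m) (G y)))
    total : ∑ [1⋯ n ] (λ a → ι n * g (ι a * δ)) ≡ ι n * ι n * s n
    total = trans (∑-cong [1⋯ n ] (λ {a} _ → sym (term (g (ι a * δ))))) (∑-*ˡ [1⋯ n ] (ι n * ι n) _)
      where
      term : ∀ k → ι n * ι n * (k * δ) ≡ ι n * k
      term k = trans (solve 3 (λ a b c → a :* a :* (b :* c) := a :* b :* (a :* c)) refl (ι n) k δ)
        (trans (cong (ι n * k *_) nδ≡1) (ℚ.*-identityʳ (ι n * k)))
    scaled : ∀ c → ι n * ι n * (ι n * (c * (δ * δ))) ≡ c * ι n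
    scaled c = trans (solve 3 (λ a b c → a :* a :* (a :* (b :* (c :* c)))
                         := b :* a :* (a :* c :* (a :* c)))
                       refl (ι n) c δ)
      (trans (cong (λ t → c * ι n * (t * t)) nδ≡1) (solve 2 (λ a b → a :* b :* ((con 1ℚ) :* (con 1ℚ))
            := a :* b)
          refl c (ι n)))
    0≤n² = 0≤* (0≤ι n) (0≤ι n)
    bounds : ∑ [1⋯ n ] (λ a → ι n * g (ι a * δ)) ≤ I * (ι n * ι n) + C * ι n ×
             I * (ι n * ι n) ≤ ∑ [1⋯ n ] (λ a → ι n * g (ι a * δ)) + C * ι n
    bounds = step (partial n ℕ.≤-refl)
      where
      G1 : G (ι n * δ) ≡ G 1ℚ
      G1 = cong G nδ≡1
      step : G (ι n * δ) - G 0ℚ ≤ s n + ι n * (C * (δ * δ)) × s n ≤ G (ι n * δ) - G 0ℚ + ι n * (C * (δ * δ)) →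
             ∑ [1⋯ n ] (λ a → ι n * g (ι a * δ)) ≤ I * (ι n * ι n) + C * ι n ×
             I * (ι n * ι n) ≤ ∑ [1⋯ n ] (λ a → ι n * g (ι a * δ)) + C * ι n
      step (lo , up) =
        (lin≤ ((ℚ.≤-reflexive total) ⊕ (ℚ.≤-reflexive (scaled C)) ⊕ (*-monoˡ-≤ (ι n * ι n) 0≤n² up) ⊕
            (ℚ.≤-reflexive (cong (ι n * ι n *_) G1)))
          (solve 8 (λ a b c d e f g h → a :+ (b :* c :+ d :+ b :* (e :- f :+ g) :+ b :* h)
              := (h :- f) :* b :+ d :+ (a :+ b :* g :+ b :* c :+ b :* e))
            refl (∑ [1⋯ n ] (λ a → ι n * g (ι a * δ))) (ι n * ι n) (s n) (C * ι n) (G (ι n * δ)) (G 0ℚ)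
                (ι n * (C * (δ * δ))) (G 1ℚ))) ,
        (lin≤ ((ℚ.≤-reflexive (sym total)) ⊕ (ℚ.≤-reflexive (scaled C)) ⊕
            (*-monoˡ-≤ (ι n * ι n) 0≤n² lo) ⊕ (ℚ.≤-reflexive (sym (cong (ι n * ι n *_) G1))))
          (solve 8 (λ a b c d e f g h → (a :- b) :* c :+ (d :+ e :+ c :* (f :+ g) :+ c :* h)
              := d :+ e :+ (c :* f :+ c :* g :+ c :* (h :- b) :+ c :* a))
            refl (G 1ℚ) (G 0ℚ) (ι n * ι n) (∑ [1⋯ n ] (λ a → ι n * g (ι a * δ))) (C * ι n) (s n)
                (ι n * (C * (δ * δ))) (G (ι n * δ))))

-- Words of letters and the intervals they cut out of a column

letters : ℕ → ∀ R → Pair → Vec ℕ R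
letters n zero s    = []
letters n (suc R) s = κ n s ∷ letters n R (T n s)

-- (α , β) is the linear form α ν + β x, evaluated at ν = n and x = a. Having no constant term, it
-- is homogeneous, so that n can be scaled out and a function of a/n remains.
Aff : Set
Aff = ℚ × ℚ

⟦_⟧ᴬ : Aff → ℚ → ℚ → ℚ
⟦ α , β ⟧ᴬ ν x = α * ν + β * x

minAff : Aff → List Aff → ℚ → ℚ → ℚ
minAff c [] ν x       = ⟦ c ⟧ᴬ ν x
minAff c (d ∷ ds) ν x = ⟦ d ⟧ᴬ ν x ⊓ minAff c ds ν x

<⊓⁺ : ∀ {x} y z → x < y → x < z → x < y ⊓ z
<⊓⁺ y z x<y x<z with ℚ.⊓-sel y z
... | inj₁ eq = subst (_ <_) (sym eq) x<y
... | inj₂ eq = subst (_ <_) (sym eq) x<z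

module _ {ν x : ℚ} where

  ≤-minAff⁺ : ∀ {y} c cs → y ≤ ⟦ c ⟧ᴬ ν x → All (λ d → y ≤ ⟦ d ⟧ᴬ ν x) cs → y ≤ minAff c cs ν x
  ≤-minAff⁺ c [] y≤c [] = y≤c
  ≤-minAff⁺ c (d ∷ ds) y≤c (y≤d ∷ y≤ds) = ℚ.⊓-glb y≤d (≤-minAff⁺ c ds y≤c y≤ds)

  <-minAff⁺ : ∀ {y} c cs → y < ⟦ c ⟧ᴬ ν x → All (λ d → y < ⟦ d ⟧ᴬ ν x) cs → y < minAff c cs ν x
  <-minAff⁺ c [] y<c [] = y<c
  <-minAff⁺ c (d ∷ ds) y<c (y<d ∷ y<ds) = <⊓⁺ _ (minAff c ds ν x) y<d (<-minAff⁺ c ds y<c y<ds)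

  minAff-≤ : ∀ c cs → minAff c cs ν x ≤ ⟦ c ⟧ᴬ ν x × All (λ d → minAff c cs ν x ≤ ⟦ d ⟧ᴬ ν x) cs
  minAff-≤ c [] = ℚ.≤-refl , []
  minAff-≤ c (d ∷ ds) with minAff-≤ c ds
  ... | ≤c , ≤ds = ℚ.≤-trans le ≤c , ℚ.p⊓q≤p _ (minAff c ds ν x) ∷ All.map (ℚ.≤-trans le) ≤ds
    where le = ℚ.p⊓q≤q (⟦ d ⟧ᴬ ν x) (minAff c ds ν x)

minAff-homogeneous : ∀ c cs ν t → 0ℚ ≤ ν → minAff c cs ν (ν * t) ≡ ν * minAff c cs 1ℚ t
minAff-homogeneous (α , β) [] ν t 0≤ν = solve 4 (λ a b c d → a :* b :+ c :* (b :* d)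
                                            := b :* (a :* (con 1ℚ) :+ c :* d))
                                          refl α ν β t
minAff-homogeneous c ((α , β) ∷ ds) ν t 0≤ν = trans
  (cong₂ _⊓_ (solve 4 (λ a b c d → a :* b :+ c :* (b :* d)
                 := b :* (a :* (con 1ℚ) :+ c :* d))
               refl α ν β t) (minAff-homogeneous c ds ν t 0≤ν))
  (sym (ℚ.*-distribˡ-⊓-nonNeg ν {{ℚ.nonNegative 0≤ν}} _ _))

PL-minAff : ∀ c cs → PL (minAff c cs 1ℚ) 0ℚ 1ℚ
PL-minAff (α , β) [] = leaf (nonneg 1ℚ) β α (λ x _ _ → (solve 3 (λ a b c → a :* (con 1ℚ) :+ b :* c
      := b :* c :+ a)
    refl α β x))
PL-minAff c ((α , β) ∷ ds) = PL-⊓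
  (leaf (nonneg 1ℚ) β α (λ x _ _ → (solve 3 (λ a b c → a :* (con 1ℚ) :+ b :* c
                                       := b :* c :+ a)
                                     refl α β x))) (PL-minAff c ds)

-- For fixed n and a, the b with letters n R (a , b) ≡ w are those satisfying finitely many
-- inequalities b ≤ αn + βa and -b < αn + βa.  A word w leads from (a , b) to the pair of
-- linear forms pb - ra and p′b - r′a, with p′r - pr′ = -1.

Bounds : List Aff → List Aff → ℕ → ℕ → ℕ → Set
Bounds ups lows n a b = All (λ c → ι b ≤ ⟦ c ⟧ᴬ (ι n) (ι a)) ups × All (λ c → - ι b < ⟦ c ⟧ᴬ (ι n) (ι a)) lows

record Reached (p r p′ r′ : ℚ) (n a b u v : ℕ) : Set where
  constructor reached
  field
    inl : InL n u v
    1≤a : 1 ℕ.≤ a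
    u≡ : ι u ≡ p * ι b - r * ι a
    v≡ : ι v ≡ p′ * ι b - r′ * ι a

Column : ∀ {R} → Vec ℕ R → (p r p′ r′ : ℚ) → Set
Column {R} w p r p′ r′ =
    (∀ {n a b u v} → Reached p r p′ r′ n a b u v → letters n R (u , v) ≢ w)
  ⊎ Σ (List Aff) λ ups → Σ (List Aff) λ lows →
      ∀ {n a b u v} → Reached p r p′ r′ n a b u v → letters n R (u , v) ≡ w ⇔ Bounds ups lows n a b

module _ {n u v c k : ℕ} (nx : Next n u v c k) where
  ι-next : ι c ≡ ι k * ι v - ι u
  ι-next = begin
    ι c                   ≡⟨ (solve 2 (λ a b → a := a :+ b :- b) refl (ι c) (ι u)) ⟩
    ι c + ι u - ι u       ≡⟨ cong (_- ι u) (ι-+ c u) ⟨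
    ι (c ℕ.+ u) - ι u     ≡⟨ cong (λ t → ι t - ι u) (Next.c+a≡kb nx) ⟩
    ι (k ℕ.* v) - ι u     ≡⟨ cong (_- ι u) (ι-* k v) ⟩
    ι k * ι v - ι u       ∎
    where open ≡-Reasoning

-- Induction over the word. Each letter k replaces the forms for (u , v) by those for (v , kv - u),
-- which preserves the determinant. Positivity of the coefficients of b is part of the induction,
-- since it allows the conditions of every step to be solved for b.
column : ∀ {R} (w : Vec ℕ R) p r p′ r′ → 0ℚ ≤ p → 0ℚ < p′ → p′ * r - p * r′ ≡ - 1ℚ → Column w p r p′ r′
column [] p r p′ r′ _ _ _ = inj₂ ([] , [] , λ {n} {a} {b} {u} {v} _ → mk⇔ (λ _ → [] , []) (λ _ → refl))
column {suc R} (k ∷ w) p r p′ r′ 0≤p 0<p′ det = cases (0ℚ ℚ.<? p″)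
  where
  p″ = ι k * p′ - p
  r″ = ι k * r′ - r
  det′ : p″ * r′ - p′ * r″ ≡ - 1ℚ
  det′ = trans (solve 5 (λ a b c d e → (a :* b :- c) :* d :- b :* (a :* d :- e)
                   := b :* e :- c :* d)
                 refl (ι k) p′ p r′ r) det
  step : ∀ {n a b u v} → Reached p r p′ r′ n a b u v → ∀ {c} → Next n u v c k → Reached p′ r′ p″ r″ n a b v c
  step {n} {a} {b} {u} {v} (reached i 1≤a u≡ v≡) {c} nx = reached (Next⇒InL i nx) 1≤a v≡
    (trans (ι-next nx) (trans (cong₂ (λ x y → ι k * x - y) v≡ u≡)
      (solve 7 (λ a b c d e f g → a :* (b :* c :- d :* e) :- (f :* c :- g :* e)
          := (a :* b :- f) :* c :- (a :* d :- g) :* e)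
        refl (ι k) p′ (ι b) r′ (ι a) p r)))
  split : ∀ {n a b u v} → Reached p r p′ r′ n a b u v → letters n (suc R) (u , v) ≡ k ∷ w →
          Σ ℕ λ c → Next n u v c k × letters n R (v , c) ≡ w
  split {n} (reached i _ _ _) refl with κ-next i
  ... | c , nx = c , nx , cong (letters n R) (sym (T-unique (InL.1≤b i) nx))
  join : ∀ {n a b u v} → Reached p r p′ r′ n a b u v → ∀ {c} → Next n u v c k →
         letters n R (v , c) ≡ w → letters n (suc R) (u , v) ≡ k ∷ w
  join {n} (reached i _ _ _) nx refl =
    cong₂ _∷_ (κ-unique (InL.1≤b i) nx) (cong (letters n R) (T-unique (InL.1≤b i) nx))
  cases : Dec (0ℚ < p″) → Column (k ∷ w) p r p′ r′
  -- By the determinant a = p″ v - p′ c. As a ≥ 1 and p′ c ≥ 0, this forces p″ > 0, so for p″ ≤ 0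
  -- the word does not occur.
  cases (no p″≯0) = inj₁ λ {n} {a} {b} {u} {v} re eq → case split re eq of λ where
    (c , nx , _) → let reached _ 1≤a v≡ c≡ = step re nx in
      absurd-ℚ (lin< ((0≤* (ℚ.<⇒≤ 0<p′) (0≤ι c)) ⊕ (0≤* (p≤q⇒0≤q-p (ℚ.≮⇒≥ p″≯0)) (0≤ι v)) ⊕
          (ℚ.≤-reflexive (cong (p′ *_) c≡)) ⊕ (ℚ.≤-reflexive (sym (cong (p″ *_) v≡))) ⊕
              (ℚ.≤-reflexive (cong (_* ι a) det′)) ⊕< (0<ι 1≤a))
                 (solve 8 (λ a b c d e f g h → (con 0ℚ) :+
                     (a :* b :+ ((con 0ℚ) :- c) :* d :+ a :* (c :* e :- f :* g) :+ c :* d :+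
                         (:- (con 1ℚ)) :* g :+ g)
                     := (con 0ℚ) :+ ((con 0ℚ) :+ (con 0ℚ) :+ a :* b :+ c :* (a :* e :- h :* g) :+
                         (c :* h :- a :* f) :* g :+ (con 0ℚ)))
                   refl p′ (ι c) p″ (ι v) (ι b) r″ (ι a) r′))
  cases (yes 0<p″) = case column w p′ r′ p″ r″ (ℚ.<⇒≤ 0<p′) 0<p″ det′ of λ where
      (inj₁ empty) → inj₁ λ {n} {a} {b} {u} {v} re eq → case split re eq of λ where
        (c , nx , eq′) → empty (step re nx) eq′
      (inj₂ (ups , lows , iff)) → inj₂
        -- c ≤ n reads b ≤ (n + r″ a) / p″, and n < v + c reads b > (n + (r′ + r″) a) / (p′ + p″).
        ( (x , r″ * x) ∷ ups
        , (- y , - ((r′ + r″) * y)) ∷ lows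
        , λ {n} {a} {b} {u} {v} re → mk⇔ (to ups lows iff re) (from ups lows iff re))
    where
    0<π : 0ℚ < p′ + p″
    0<π = lin< (0<p′ <⊕< 0<p″)
            (solve 2 (λ a b → (con 0ℚ) :+ (a :+ b) := a :+ b :+ ((con 0ℚ) :+ (con 0ℚ))) refl p′ p″)
    x y : ℚ
    x = proj₁ (recip p″ 0<p″)
    y = proj₁ (recip (p′ + p″) 0<π)
    0<x : 0ℚ < x
    0<x = proj₁ (proj₂ (recip p″ 0<p″))
    px≡1 : p″ * x ≡ 1ℚ
    px≡1 = proj₂ (proj₂ (recip p″ 0<p″))
    πy≡1 : (p′ + p″) * y ≡ 1ℚ
    πy≡1 = proj₂ (proj₂ (recip (p′ + p″) 0<π))
    module _ (ups lows : List Aff)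
             (iff : ∀ {n a b u v} → Reached p′ r′ p″ r″ n a b u v → letters n R (u , v) ≡ w ⇔ Bounds ups
                 lows n a b)
             {n a b u v : ℕ} (re : Reached p r p′ r′ n a b u v) where
      up : Set
      up = ι b ≤ ⟦ x , r″ * x ⟧ᴬ (ι n) (ι a)
      low : Set
      low = - ι b < ⟦ - y , - ((r′ + r″) * y) ⟧ᴬ (ι n) (ι a)
      to : letters n (suc R) (u , v) ≡ k ∷ w → Bounds ((x , r″ * x) ∷ ups)
          ((- y , - ((r′ + r″) * y)) ∷ lows) n a b
      to eq = case split re eq of λ where
        (c , nx , eq′) → let reached _ _ v≡ c≡ = step re nx
                             bs = Equivalence.to (iff (step re nx)) eq′ in
          (*-cancelˡ-≤ p″ 0<p″
            (lin≤ ((ι-≤ (Next.c≤n nx)) ⊕ (ℚ.≤-reflexive (sym c≡)) ⊕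
                (ℚ.≤-reflexive (sym (cong (_* ι n) px≡1))) ⊕ (ℚ.≤-reflexive (sym (cong (_* (r″ * ι a)) px≡1))))
              (solve 7 (λ a b c d e f g → a :* b :+ (c :+ d :+ a :* e :* c :+ a :* e :* (f :* g))
                  := a :* (e :* c :+ f :* e :* g) :+
                      (d :+ (a :* b :- f :* g) :+ (con 1ℚ) :* c :+ (con 1ℚ) :* (f :* g)))
                refl p″ (ι b) (ι n) (ι c) x r″ (ι a))) ∷ proj₁ bs) ,
          (*-cancelˡ-< (p′ + p″) 0<π
            (lin< ((subst (ι n <_) (ι-+ v c) (ι-< (Next.n<b+c nx))) <⊕ (ℚ.≤-reflexive c≡) <⊕
                (ℚ.≤-reflexive v≡) <⊕ (ℚ.≤-reflexive (cong (_* ι n) πy≡1)) <⊕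
                    (ℚ.≤-reflexive (cong (_* ((r′ + r″) * ι a)) πy≡1)))
              (solve 10 (λ a b c d e f g h i j → (a :+ b) :* (:- c) :+
                  (d :+ e :+ (b :* c :- f :* g) :+ (a :* c :- h :* g) :+ (con 1ℚ) :* i :+ (con 1ℚ) :*
                      ((h :+ f) :* g))
                  := (a :+ b) :* ((:- j) :* i :+ (:- ((h :+ f) :* j)) :* g) :+
                      (i :+ e :+ d :+ (a :+ b) :* j :* i :+ (a :+ b) :* j :* ((h :+ f) :* g)))
                refl p′ p″ (ι b) (ι v) (ι c) r″ (ι a) r′ (ι n) y)) ∷ proj₂ bs)
      from : Bounds ((x , r″ * x) ∷ ups) ((- y , - ((r′ + r″) * y)) ∷ lows) n a b → letters n (suc R)
          (u , v) ≡ k ∷ w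
      from (up ∷ ups′ , low ∷ lows′) = join re nx (Equivalence.from (iff (step re nx)) (ups′ , lows′))
        where
        open Reached re
        z : ℚ
        z = ι k * ι v - ι u
        z≡ : z ≡ p″ * ι b - r″ * ι a
        z≡ = trans (cong₂ (λ x y → ι k * x - y) v≡ u≡)
          (solve 7 (λ a b c d e f g → a :* (b :* c :- d :* e) :- (f :* c :- g :* e)
              := (a :* b :- f) :* c :- (a :* d :- g) :* e)
            refl (ι k) p′ (ι b) r′ (ι a) p r)
        z≤ιn : z ≤ ι n
        z≤ιn = lin≤ ((*-monoˡ-≤ p″ (ℚ.<⇒≤ 0<p″) up) ⊕ (ℚ.≤-reflexive z≡) ⊕
            (ℚ.≤-reflexive (cong (_* ι n) px≡1)) ⊕ (ℚ.≤-reflexive (cong (_* (r″ * ι a)) px≡1)))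
                 (solve 7 (λ a b c d e f g → a :+
                     (b :* (c :* d :+ e :* c :* f) :+ (b :* g :- e :* f) :+ (con 1ℚ) :* d :+ (con 1ℚ) :*
                         (e :* f))
                     := d :+ (b :* g :+ a :+ b :* c :* d :+ b :* c :* (e :* f)))
                   refl z p″ x (ι n) r″ (ι a) (ι b))
        ιn<v+z : ι n < ι v + z
        ιn<v+z = lin< ((*-monoˡ-< (p′ + p″) 0<π low) <⊕ (ℚ.≤-reflexive (sym z≡)) <⊕
            (ℚ.≤-reflexive (sym v≡)) <⊕ (ℚ.≤-reflexive (sym (cong (_* ι n) πy≡1))) <⊕
                (ℚ.≤-reflexive (sym (cong (_* ((r′ + r″) * ι a)) πy≡1))))
                   (solve 10 (λ a b c d e f g h i j → a :+
                       ((b :+ c) :* ((:- d) :* a :+ (:- ((e :+ f) :* d)) :* g) :+ h :+ i :+ (b :+ c) :*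
                           d :* a :+ (b :+ c) :* d :* ((e :+ f) :* g))
                       := i :+ h :+ ((b :+ c) :* (:- j) :+ (c :* j :- f :* g) :+ (b :* j :- e :* g) :+
                           (con 1ℚ) :* a :+ (con 1ℚ) :* ((e :+ f) :* g)))
                     refl (ι n) p′ p″ y r′ r″ (ι a) z (ι v) (ι b))
        -- z > n - v ≥ 0, so the next denominator is a natural number.
        u≤kv : u ℕ.≤ k ℕ.* v
        u≤kv = ι-cancel-≤ (subst (ι u ≤_) (sym (ι-* k v))
          (lin≤ ((ℚ.<⇒≤ ιn<v+z) ⊕ (ι-≤ (InL.b≤n inl)))
            (solve 4 (λ a b c d → a :+ (b :+ (c :* b :- a) :+ d)
                := c :* b :+ (d :+ b))
              refl (ι u) (ι v) (ι k) (ι n))))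
        c = k ℕ.* v ℕ.∸ u
        c+u≡kv : c ℕ.+ u ≡ k ℕ.* v
        c+u≡kv = ℕ.m∸n+n≡m u≤kv
        c≡z : ι c ≡ z
        c≡z = begin
          ι c                   ≡⟨ (solve 2 (λ a b → a := a :+ b :- b) refl (ι c) (ι u)) ⟩
          ι c + ι u - ι u       ≡⟨ cong (_- ι u) (ι-+ c u) ⟨
          ι (c ℕ.+ u) - ι u     ≡⟨ cong (λ t → ι t - ι u) c+u≡kv ⟩
          ι (k ℕ.* v) - ι u     ≡⟨ cong (_- ι u) (ι-* k v) ⟩
          z                     ∎
          where open ≡-Reasoning
        nx : Next n u v c k
        nx = next c+u≡kv (ι-cancel-≤ (subst (_≤ ι n) (sym c≡z) z≤ιn))
          (ι-cancel-< (subst (ι n <_) (sym (trans (ι-+ v c) (cong (ι v +_) c≡z))) ιn<v+z))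

-- Counting the integers of an interval

#≤ : ℕ → ℚ → ℚ
#≤ n q = ∑ [1⋯ n ] (λ b → 𝟙 (ι b ℚ.≤? q))

#≤-all : ∀ n q → ι n ≤ q → #≤ n q ≡ ι n
#≤-all n q n≤q = trans (∑-cong [1⋯ n ]
    (λ {b} b∈ → 𝟙-yes (ι b ℚ.≤? q) (ℚ.≤-trans (ι-≤ (proj₂ (∈[1⋯]⁻ b∈))) n≤q)))
  (trans (∑-length [1⋯ n ]) (cong ι (length-[1⋯] n)))

#≤-upper : ∀ n q → 0ℚ ≤ q → #≤ n q ≤ q
#≤-upper zero q 0≤q = 0≤q
#≤-upper (suc n) q 0≤q with ι (suc n) ℚ.≤? q
... | yes le = subst (_≤ q) (sym (#≤-all (suc n) q le)) le
... | no gt = subst (_≤ q) (sym (trans (∑-[1⋯]-suc n _)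
  (trans (cong (#≤ n q +_) (𝟙-no (ι (suc n) ℚ.≤? q) gt)) (ℚ.+-identityʳ _)))) (#≤-upper n q 0≤q)

#≤-lower : ∀ n q → q ≤ ι n → q - 1ℚ ≤ #≤ n q
#≤-lower zero q q≤0 = lin≤ ((subst (q ≤_) ι-0 q≤0) ⊕ (nonneg 1ℚ))
                        (solve 1 (λ a → a :- (con 1ℚ) :+ ((con 0ℚ) :+ (con 1ℚ))
                            := (con 0ℚ) :+ (a :+ (con 0ℚ)))
                          refl q)
#≤-lower (suc n) q q≤ with ℚ.≤-total q (ι n)
... | inj₁ q≤n = ℚ.≤-trans (#≤-lower n q q≤n) (subst (#≤ n q ≤_) (sym (∑-[1⋯]-suc n _))
  (lin≤ (0≤𝟙 (ι (suc n) ℚ.≤? q))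
    (solve 2 (λ a b → a :+ b := a :+ b :+ (con 0ℚ)) refl (#≤ n q) (𝟙 (ι (suc n) ℚ.≤? q)))))
... | inj₂ n≤q = subst (q - 1ℚ ≤_) (sym (∑-[1⋯]-suc n _))
  (lin≤ ((0≤𝟙 (ι (suc n) ℚ.≤? q)) ⊕ (ℚ.≤-reflexive (sym (#≤-all n q n≤q))) ⊕ q≤ ⊕ (ℚ.≤-reflexive (ι-suc n)))
    (solve 5 (λ a b c d e → a :- (con 1ℚ) :+ (b :+ c :+ d :+ ((con 1ℚ) :+ e))
        := c :+ b :+ ((con 0ℚ) :+ e :+ a :+ d))
      refl q (𝟙 (ι (suc n) ℚ.≤? q)) (#≤ n q) (ι (suc n)) (ι n)))

-- This is max(0 , x), expressed through minimum and negation because piecewise affine functions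
-- have been shown to be closed under these.
positivePart : ℚ → ℚ
positivePart x = - (0ℚ ⊓ - x)

-- The integers of the interval (-l , u] number `#≤ n u` minus `#≤ n (- l)`, and each of these is
-- within 1 below its real endpoint. The hypotheses keep the interval inside [0 , n], where neither
-- count is cut off.
interval-count : ∀ n l u → 0ℚ ≤ - l → u ≤ ι n →
                 ∀ {c} → c ≡ ∑ [1⋯ n ] (λ b → 𝟙 (ι b ℚ.≤? u) * 𝟙 (- ι b ℚ.<? l)) →
                 c ≤ positivePart (u + l) + 1ℚ × positivePart (u + l) ≤ c + 1ℚ
interval-count n l u 0≤-l u≤n {c} refl with ℚ.≤-total 0ℚ (u + l)
... | inj₁ 0≤ =
  (lin≤ ((ℚ.≤-reflexive count) ⊕ (ℚ.≤-reflexive (sym pp)) ⊕ (#≤-upper n u 0≤u) ⊕ (#≤-lower n (- l) -l≤n))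
    (solve 6 (λ a b c d e f → a :+ (b :- c :+ d :+ e :+ c)
        := d :+ (con 1ℚ) :+ (a :+ (e :+ f) :+ b :+ ((:- f) :- (con 1ℚ))))
      refl c (#≤ n u) (#≤ n (- l)) (positivePart (u + l)) u l)) ,
  (lin≤ ((ℚ.≤-reflexive (sym count)) ⊕ (ℚ.≤-reflexive pp) ⊕ (#≤-lower n u u≤n) ⊕ (#≤-upper n (- l) 0≤-l))
    (solve 6 (λ a b c d e f → a :+ (b :+ (c :+ d) :+ e :+ (:- d))
        := b :+ (con 1ℚ) :+ (e :- f :+ a :+ (c :- (con 1ℚ)) :+ f))
      refl (positivePart (u + l)) c u l (#≤ n u) (#≤ n (- l))))
  where
  -l≤n : - l ≤ ι n
  -l≤n = lin≤ (0≤ ⊕ u≤n)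
           (solve 3 (λ a b c → (:- a) :+ (b :+ a :+ c) := c :+ ((con 0ℚ) :+ b)) refl l u (ι n))
  0≤u : 0ℚ ≤ u
  0≤u = lin≤ (0≤ ⊕ 0≤-l)
          (solve 2 (λ a b → (con 0ℚ) :+ (a :+ b :+ (:- b)) := a :+ ((con 0ℚ) :+ (con 0ℚ))) refl u l)
  pp : positivePart (u + l) ≡ u + l
  pp = trans (cong -_ (ℚ.p≥q⇒p⊓q≡q {0ℚ} { - (u + l)} (lin≤ 0≤
      (solve 2 (λ a b → (:- (a :+ b)) :+ (a :+ b) := (con 0ℚ) :+ (con 0ℚ)) refl u l))))
          (solve 2 (λ a b → :- (:- (a :+ b))
        := a :+ b)
      refl u l)
  count : c ≡ #≤ n u - #≤ n (- l)
  count = trans (∑-cong [1⋯ n ] (λ {b} _ → term b)) (∑-- [1⋯ n ] _ _)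
    where
    term : ∀ b → 𝟙 (ι b ℚ.≤? u) * 𝟙 (- ι b ℚ.<? l) ≡ 𝟙 (ι b ℚ.≤? u) - 𝟙 (ι b ℚ.≤? - l)
    term b with ι b ℚ.≤? u | - ι b ℚ.<? l | ι b ℚ.≤? - l
    ... | yes _ | yes lt | yes le = absurd-ℚ (lin< (lt <⊕ le)
        (solve 2 (λ a b → (con 0ℚ) :+ (a :+ (:- a)) := (con 0ℚ) :+ ((:- b) :+ b)) refl l (ι b)))
    ... | yes _ | yes _  | no _   = refl
    ... | yes _ | no _   | yes _  = refl
    ... | yes _ | no ≮   | no ≰   = absurd-ℚ (lin< ((ℚ.≰⇒> ≰) <⊕ (ℚ.≮⇒≥ ≮))
        (solve 2 (λ a b → (con 0ℚ) :+ (a :+ (:- a)) := (con 0ℚ) :+ ((:- b) :+ b)) refl (ι b) l))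
    ... | no ≰  | _      | yes le = absurd-ℚ (lin< ((ℚ.≰⇒> ≰) <⊕ le <⊕ 0≤)
        (solve 3 (λ a b c → (con 0ℚ) :+ (a :+ (:- b) :+ (c :+ b))
            := (con 0ℚ) :+ (c :+ a :+ (con 0ℚ)))
          refl (ι b) l u))
    ... | no _  | yes _  | no _   = refl
    ... | no _  | no _   | no _   = refl
... | inj₂ ≤0 =
  (lin≤ ((ℚ.≤-reflexive count) ⊕ (ℚ.≤-reflexive (sym pp)) ⊕ (nonneg 1ℚ))
    (solve 2 (λ a b → a :+ ((con 0ℚ) :+ b :+ (con 1ℚ))
        := b :+ (con 1ℚ) :+ (a :+ (con 0ℚ) :+ (con 0ℚ)))
      refl c (positivePart (u + l)))) ,
  (lin≤ ((ℚ.≤-reflexive (sym count)) ⊕ (ℚ.≤-reflexive pp) ⊕ (nonneg 1ℚ))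
    (solve 2 (λ a b → a :+ (b :+ (con 0ℚ) :+ (con 1ℚ))
        := b :+ (con 1ℚ) :+ ((con 0ℚ) :+ a :+ (con 0ℚ)))
      refl (positivePart (u + l)) c))
  where
  pp : positivePart (u + l) ≡ 0ℚ
  pp = cong -_ (ℚ.p≤q⇒p⊓q≡p {0ℚ} { - (u + l)} (lin≤ ≤0
      (solve 2 (λ a b → (con 0ℚ) :+ (con 0ℚ) := (:- (a :+ b)) :+ (a :+ b)) refl u l)))
  count : c ≡ 0ℚ
  count = ∑-zero [1⋯ n ] (λ {b} _ → term b)
    where
    term : ∀ b → 𝟙 (ι b ℚ.≤? u) * 𝟙 (- ι b ℚ.<? l) ≡ 0ℚ
    term b with ι b ℚ.≤? u | - ι b ℚ.<? l
    ... | yes le | yes lt = absurd-ℚ (lin< (le ⊕< lt <⊕ ≤0)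
                                       (solve 3 (λ a b c → (con 0ℚ) :+ (a :+ b :+ (con 0ℚ))
                                           := (con 0ℚ) :+ (c :+ (:- c) :+ (a :+ b)))
                                         refl u l (ι b)))
    ... | yes _  | no _   = refl
    ... | no _   | yes _  = refl
    ... | no _   | no _   = refl

_≟ⱽ_ : ∀ {R} → DecidableEquality (Vec ℕ R)
_≟ⱽ_ = Vec.≡-dec ℕ._≟_

cell : ∀ {R} → Vec ℕ R → ℕ → ℚ
cell {R} w n = ∑ (L n) (λ s → 𝟙 (letters n R s ≟ⱽ w))

-- In column a the word occurs for the integers b of an interval whose ends are minima of linear
-- forms in n and a. Up to 1, their number is n g(a/n) with g piecewise affine, and the sum over a
-- is a Riemann sum.
Quad-cell : ∀ {R} (w : Vec ℕ R) → Quad (cell w)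
Quad-cell {R} w with column w 0ℚ (- 1ℚ) 1ℚ 0ℚ ℚ.≤-refl (pos 1ℚ) refl
... | inj₁ empty = Quad-cong Quad-0
    (λ n → sym (∑-zero (L n) (λ {s} s∈ → 𝟙-no (letters n R s ≟ⱽ w) (empty (start (∈L⁻ s∈))))))
  where
  start : ∀ {n a b} → InL n a b → Reached 0ℚ (- 1ℚ) 1ℚ 0ℚ n a b a b
  start {n} {a} {b} i = reached i (InL.1≤a i) (solve 2 (λ a b → a
        := (con 0ℚ) :* b :- (:- (con 1ℚ)) :* a)
      refl (ι a) (ι b)) (solve 2 (λ a b → a
        := (con 1ℚ) :* a :- (con 0ℚ) :* b)
      refl (ι b) (ι a))
... | inj₂ (ups , lows , iff) = Quad-near 1ℚ (riemann PL-g)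
    bound bound′
  where
  start : ∀ {n a b} → InL n a b → Reached 0ℚ (- 1ℚ) 1ℚ 0ℚ n a b a b
  start {n} {a} {b} i = reached i (InL.1≤a i) (solve 2 (λ a b → a
        := (con 0ℚ) :* b :- (:- (con 1ℚ)) :* a)
      refl (ι a) (ι b)) (solve 2 (λ a b → a
        := (con 1ℚ) :* a :- (con 0ℚ) :* b)
      refl (ι b) (ι a))
  U V : ℚ → ℚ → ℚ
  -- The initial forms express b ≤ n and a + b > n; membership in the triangle thus becomes part of
  -- the bounds on b.
  U = minAff (1ℚ , 0ℚ) ups
  V = minAff (- 1ℚ , 1ℚ) lows
  g : ℚ → ℚ
  g x = positivePart (U 1ℚ x + V 1ℚ x)
  PL-g : PL g 0ℚ 1ℚ
  PL-g = PL-neg (PL-⊓ (leaf (nonneg 1ℚ) 0ℚ 0ℚ (λ x _ _ → (solve 1 (λ a → con 0ℚ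
        := (con 0ℚ) :* a :+ (con 0ℚ))
      refl x)))
    (PL-neg (PL-+ (PL-minAff (1ℚ , 0ℚ) ups) (PL-minAff (- 1ℚ , 1ℚ) lows))))
  columnSum : ℕ → ℕ → ℚ
  columnSum n a = ∑ [1⋯ n ] (λ b → 𝟙 (n ℕ.<? a ℕ.+ b) * 𝟙 (letters n R (a , b) ≟ⱽ w))
  inBounds : ∀ {n a b} → a ℕ.≤ n → b ℕ.≤ n →
             𝟙 (n ℕ.<? a ℕ.+ b) * 𝟙 (letters n R (a , b) ≟ⱽ w) ≡
             𝟙 (ι b ℚ.≤? U (ι n) (ι a)) * 𝟙 (- ι b ℚ.<? V (ι n) (ι a))
  inBounds {n} {a} {b} a≤n b≤n = trans (sym (𝟙-× d₁ d₂))
      (trans (𝟙-⇔ (d₁ ×-dec d₂) (d₃ ×-dec d₄) to from) (𝟙-× d₃ d₄))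
    where
    d₁ = n ℕ.<? a ℕ.+ b
    d₂ = letters n R (a , b) ≟ⱽ w
    d₃ = ι b ℚ.≤? U (ι n) (ι a)
    d₄ = - ι b ℚ.<? V (ι n) (ι a)
    to : n ℕ.< a ℕ.+ b × letters n R (a , b) ≡ w → ι b ≤ U (ι n) (ι a) × - ι b < V (ι n) (ι a)
    to (lt , eq) =
      ≤-minAff⁺ (1ℚ , 0ℚ) ups (lin≤ (ι-≤ b≤n)
                                (solve 3 (λ a b c → a :+ b
                                    := (con 1ℚ) :* b :+ (con 0ℚ) :* c :+ a)
                                  refl (ι b) (ι n) (ι a))) (proj₁ (bs lt eq)) ,
      <-minAff⁺ (- 1ℚ , 1ℚ) lows (lin< (subst (ι n <_) (ι-+ a b) (ι-< lt))
                                   (solve 3 (λ a b c → (:- a) :+ (b :+ a)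
                                       := (:- (con 1ℚ)) :* c :+ (con 1ℚ) :* b :+ c)
                                     refl (ι b) (ι a) (ι n))) (proj₂ (bs lt eq))
      where
      bs : n ℕ.< a ℕ.+ b → letters n R (a , b) ≡ w → Bounds ups lows n a b
      bs lt eq = Equivalence.to (iff (start (inL a≤n b≤n lt))) eq
    from : ι b ≤ U (ι n) (ι a) × - ι b < V (ι n) (ι a) → n ℕ.< a ℕ.+ b × letters n R (a , b) ≡ w
    from (b≤U , -b<V) = lt , Equivalence.from (iff (start (inL a≤n b≤n lt)))
        (All.map (ℚ.≤-trans b≤U) (proj₂ (minAff-≤ (1ℚ , 0ℚ) ups)) , All.map (ℚ.<-≤-trans -b<V)
            (proj₂ (minAff-≤ (- 1ℚ , 1ℚ) lows)))
      where
      lt : n ℕ.< a ℕ.+ b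
      lt = ι-cancel-< (subst (ι n <_) (sym (ι-+ a b))
        (lin< (-b<V <⊕ (proj₁ (minAff-≤ (- 1ℚ , 1ℚ) lows)))
          (solve 4 (λ a b c d → a :+ (b :+ ((:- (con 1ℚ)) :* a :+ (con 1ℚ) :* c))
              := c :+ d :+ ((:- d) :+ b))
            refl (ι n) (V (ι n) (ι a)) (ι a) (ι b))))
  scale : ∀ n → 1 ℕ.≤ n → ∀ a → ι a ≡ ι n * (ι a * inv n)
  scale n 1≤n a = sym (trans (solve 3 (λ a b c → a :* (b :* c)
                                 := b :* (a :* c))
                               refl (ι n) (ι a) (inv n))
    (trans (cong (ι a *_) (inv-inverse 1≤n)) (ℚ.*-identityʳ (ι a))))
  col : ∀ n → 1 ℕ.≤ n → ∀ {a} → a ∈ [1⋯ n ] →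
        columnSum n a ≤ ι n * g (ι a * inv n) + 1ℚ × ι n * g (ι a * inv n) ≤ columnSum n a + 1ℚ
  col n 1≤n {a} a∈ = subst (λ P → columnSum n a ≤ P + 1ℚ × P ≤ columnSum n a + 1ℚ) homogeneous
    (interval-count n (V (ι n) (ι a)) (U (ι n) (ι a))
      (lin≤ ((proj₁ (minAff-≤ (- 1ℚ , 1ℚ) lows)) ⊕ (ι-≤ a≤n))
        (solve 3 (λ a b c → (con 0ℚ) :+ ((:- (con 1ℚ)) :* a :+ (con 1ℚ) :* b :+ a)
            := (:- c) :+ (c :+ b))
          refl (ι n) (ι a) (V (ι n) (ι a))))
      (lin≤ (proj₁ (minAff-≤ (1ℚ , 0ℚ) ups))
        (solve 3 (λ a b c → a :+ ((con 1ℚ) :* b :+ (con 0ℚ) :* c)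
            := b :+ a)
          refl (U (ι n) (ι a)) (ι n) (ι a)))
      (∑-cong [1⋯ n ] (λ b∈ → inBounds a≤n (proj₂ (∈[1⋯]⁻ b∈)))))
    where
    a≤n = proj₂ (∈[1⋯]⁻ a∈)
    homogeneous : positivePart (U (ι n) (ι a) + V (ι n) (ι a)) ≡ ι n * g (ι a * inv n)
    homogeneous = begin
      positivePart (U (ι n) (ι a) + V (ι n) (ι a))
        ≡⟨ cong (λ t → positivePart (U (ι n) t + V (ι n) t)) (scale n 1≤n a) ⟩
      positivePart (U (ι n) (ι n * x) + V (ι n) (ι n * x))
        ≡⟨ cong₂ (λ t t′ → positivePart (t + t′)) (minAff-homogeneous _ ups (ι n) x (0≤ι n))
            (minAff-homogeneous _ lows (ι n) x (0≤ι n)) ⟩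
      positivePart (ι n * U 1ℚ x + ι n * V 1ℚ x)
        ≡⟨ cong₂ (λ t t′ → - (t ⊓ t′)) (sym (ℚ.*-zeroʳ (ι n)))
             (solve 3 (λ a b c → :- (a :* b :+ a :* c)
                 := a :* (:- (b :+ c)))
               refl (ι n) (U 1ℚ x) (V 1ℚ x)) ⟩
      - ((ι n * 0ℚ) ⊓ (ι n * - (U 1ℚ x + V 1ℚ x)))
        ≡⟨ cong -_ (ℚ.*-distribˡ-⊓-nonNeg (ι n) {{ℚ.nonNegative (0≤ι n)}} 0ℚ (- (U 1ℚ x + V 1ℚ x))) ⟨
      - (ι n * (0ℚ ⊓ - (U 1ℚ x + V 1ℚ x)))
        ≡⟨ ℚ.neg-distribʳ-* (ι n) _ ⟩
      ι n * g x ∎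
      where
      open ≡-Reasoning
      x = ι a * inv n
  cell≡ : ∀ n → cell w n ≡ ∑ [1⋯ n ] (columnSum n)
  cell≡ n = ∑-L n _
  ones : ∀ n → ∑ [1⋯ n ] (λ _ → 1ℚ) ≡ 1ℚ * ι n
  ones n = trans (∑-const [1⋯ n ] 1ℚ) (cong (λ m → 1ℚ * ι m) (length-[1⋯] n))
  bound : ∀ n → 1 ℕ.≤ n → cell w n ≤ ∑ [1⋯ n ] (λ a → ι n * g (ι a * inv n)) + 1ℚ * ι n
  bound n 1≤n = subst₂ _≤_ (sym (cell≡ n))
      (trans (∑-+ [1⋯ n ] _ _) (cong (∑ [1⋯ n ] (λ a → ι n * g (ι a * inv n)) +_) (ones n)))
    (∑-mono [1⋯ n ] (λ a∈ → proj₁ (col n 1≤n a∈)))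
  bound′ : ∀ n → 1 ℕ.≤ n → ∑ [1⋯ n ] (λ a → ι n * g (ι a * inv n)) ≤ cell w n + 1ℚ * ι n
  bound′ n 1≤n = subst (∑ [1⋯ n ] (λ a → ι n * g (ι a * inv n)) ≤_)
    (trans (∑-+ [1⋯ n ] _ _) (cong₂ _+_ (sym (cell≡ n)) (ones n)))
    (∑-mono [1⋯ n ] (λ a∈ → proj₂ (col n 1≤n a∈)))

-- Sums over words of bounded letters

Small : ∀ {R} → ℕ → Vec ℕ R → Set
Small K = VecAll.All (ℕ._≤ K)

small? : ∀ {R} K (w : Vec ℕ R) → Dec (Small K w)
small? K = VecAll.all? (ℕ._≤? K)

unique-indices : ∀ n d → Unique (indices n d)
unique-indices n zero = [] ∷ []
unique-indices n (suc d) = Unique.cartesianProductWith⁺ _∷_ Vec.∷-injective (unique-[1⋯] n) (unique-indices n d)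

∈indices⁺ : ∀ {n d} {v : Vec ℕ d} → VecAll.All (1 ℕ.≤_) v → Small n v → v ∈ indices n d
∈indices⁺ [] [] = here refl
∈indices⁺ (1≤x ∷ ps) (x≤n ∷ qs) = ∈.∈-cartesianProductWith⁺ _∷_ (∈[1⋯]⁺ 1≤x x≤n) (∈indices⁺ ps qs)

∈indices⁻ : ∀ {n d} {v : Vec ℕ d} → v ∈ indices n d → Small n v
∈indices⁻ {d = zero} (here refl) = []
∈indices⁻ {n} {suc d} v∈ with ∈.∈-cartesianProductWith⁻ _∷_ [1⋯ n ] (indices n d) v∈
... | x , v , x∈ , v∈′ , refl = proj₂ (∈[1⋯]⁻ x∈) ∷ ∈indices⁻ v∈′

∑-indices-δ : ∀ n {d} (v : Vec ℕ d) → VecAll.All (1 ℕ.≤_) v → (f : Vec ℕ d → ℚ) →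
              ∑ (indices n d) (λ w → 𝟙 (v ≟ⱽ w) * f w) ≡ 𝟙 (small? n v) * f v
∑-indices-δ n {d} v 1≤v f with small? n v
... | yes v≤n = trans (∑-δ _≟ⱽ_ v f (unique-indices n d) (∈indices⁺ 1≤v v≤n)) (sym (ℚ.*-identityˡ (f v)))
... | no v≰n = trans (∑-δ-∉ _≟ⱽ_ (indices n d) v f (v≰n ∘ ∈indices⁻)) (sym (ℚ.*-zeroˡ (f v)))

letters≥1 : ∀ {n} R {s} → s ∈ L n → VecAll.All (1 ℕ.≤_) (letters n R s)
letters≥1 zero s∈ = []
letters≥1 (suc R) s∈ = κ≥1 (∈L⁻ s∈) ∷ letters≥1 R (T-∈L s∈)

smallSum : ∀ {R} → (Vec ℕ R → ℚ) → ℕ → ℕ → ℚ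
smallSum {R} φ K n = ∑ (L n) (λ s → 𝟙 (small? K (letters n R s)) * φ (letters n R s))

Quad-smallSum⁺ : ∀ {R} (φ : Vec ℕ R → ℚ) → (∀ w → 0ℚ ≤ φ w) → ∀ K → Quad (smallSum φ K)
Quad-smallSum⁺ {R} φ 0≤φ K = Quad-cong
    (Quad-∑ (indices K R) (λ w → Quad-*⁺ (φ w) (0≤φ w) (Quad-cell w))) λ n → begin
  ∑ (indices K R) (λ w → φ w * cell w n)
    ≡⟨ ∑-cong (indices K R) (λ {w} _ → sym (∑-*ˡ (L n) (φ w) _)) ⟩
  ∑ (indices K R) (λ w → ∑ (L n) (λ s → φ w * 𝟙 (letters n R s ≟ⱽ w)))
    ≡⟨ ∑-swap (indices K R) (L n) _ ⟩
  ∑ (L n) (λ s → ∑ (indices K R) (λ w → φ w * 𝟙 (letters n R s ≟ⱽ w)))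
    ≡⟨ ∑-cong (L n) (λ {s} s∈ → trans (∑-cong (indices K R) (λ {w} _ → ℚ.*-comm (φ w) _))
         (∑-indices-δ K (letters n R s) (letters≥1 R s∈) φ)) ⟩
  smallSum φ K n ∎
  where open ≡-Reasoning

small-or-large : ∀ n R K s → Small K (letters n R s) ⊎ ∃[ t ] (t ℕ.< R × K ℕ.< κ n (T^ n t s))
small-or-large n zero K s = inj₁ []
small-or-large n (suc R) K s with κ n s ℕ.≤? K
... | no κ≰K = inj₂ (0 , s≤s z≤n , ℕ.≰⇒> κ≰K)
... | yes κ≤K with small-or-large n R K (T n s)
...   | inj₁ small = inj₁ (κ≤K ∷ small)
...   | inj₂ (t , t<R , large) = inj₂ (suc t , s≤s t<R , large)

large⇒¬small : ∀ {n} R {K s} t → t ℕ.< R → K ℕ.< κ n (T^ n t s) → ¬ Small K (letters n R s)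
large⇒¬small (suc R) zero _ large (κ≤K ∷ _) = ℕ.<⇒≱ large κ≤K
large⇒¬small (suc R) (suc t) (s≤s t<R) large (_ ∷ small) = large⇒¬small R t t<R large small

-- The correlation sum over all lattice points

prodV : ∀ {d} → Vec ℕ d → ℕ
prodV = Vec.foldr _ ℕ._*_ 1

prodV≥1 : ∀ {d} {v : Vec ℕ d} → VecAll.All (1 ℕ.≤_) v → 1 ℕ.≤ prodV v
prodV≥1 [] = s≤s z≤n
prodV≥1 (1≤x ∷ ps) = ℕ.*-mono-≤ 1≤x (prodV≥1 ps)

atPositions : ∀ {d} → Vec ℕ d → ℕ → Pair → Vec ℕ d
atPositions ps n s = Vec.map (λ p → κ n (T^ n p s)) ps

atPositions≥1 : ∀ {d} (ps : Vec ℕ d) {n s} → s ∈ L n → VecAll.All (1 ℕ.≤_) (atPositions ps n s)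
atPositions≥1 [] s∈ = []
atPositions≥1 (p ∷ ps) s∈ = κ≥1 (∈L⁻ (T^-∈L p s∈)) ∷ atPositions≥1 ps s∈

Φ : ∀ {d} → Vec ℕ d → ℕ → Pair → ℚ
Φ ps n s = ι (prodV (atPositions ps n s))

Φ≥1 : ∀ {d} (ps : Vec ℕ d) {n s} → s ∈ L n → 1ℚ ≤ Φ ps n s
Φ≥1 ps {n} {s} s∈ = subst (_≤ Φ ps n s) ι-1 (ι-≤ (prodV≥1 (atPositions≥1 ps s∈)))

0≤Φ : ∀ {d} (ps : Vec ℕ d) {n s} → 0ℚ ≤ Φ ps n s
0≤Φ ps = 0≤ι _

nth : ∀ {R} → Vec ℕ R → ℕ → ℕ
nth [] _ = 0
nth (x ∷ w) zero = x
nth (x ∷ w) (suc p) = nth w p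

nth-letters : ∀ n R s p → p ℕ.< R → nth (letters n R s) p ≡ κ n (T^ n p s)
nth-letters n (suc R) s zero _ = refl
nth-letters n (suc R) s (suc p) (s≤s p<R) = nth-letters n R (T n s) p p<R

select : ∀ {d R} → Vec ℕ d → Vec ℕ R → Vec ℕ d
select ps w = Vec.map (nth w) ps

select-letters : ∀ {d} {ps : Vec ℕ d} n R s → VecAll.All (ℕ._< R) ps →
                 select ps (letters n R s) ≡ atPositions ps n s
select-letters n R s [] = refl
select-letters n R s (p<R ∷ ps<R) = cong₂ _∷_ (nth-letters n R s _ p<R) (select-letters n R s ps<R)

-- If the letter at position t is large, then it determines the letters at all positions.

nearLarge : ℕ → ℕ → ℕ → ℕ
nearLarge t k p with p ℕ.≟ t
... | yes _ = k
... | no _  = forced ℕ.∣ p - t ∣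

nearLarge-≢ : ∀ t k l {p} → p ≢ t → nearLarge t k p ≡ nearLarge t l p
nearLarge-≢ t k l {p} p≢t with p ℕ.≟ t
... | yes p≡t = ⊥-elim (p≢t p≡t)
... | no _ = refl

nearLarge-absent : ∀ {d} (ps : Vec ℕ d) t k l → VecAll.All (_≢ t) ps →
                   prodV (Vec.map (nearLarge t k) ps) ≡ prodV (Vec.map (nearLarge t l) ps)
nearLarge-absent [] t k l [] = refl
nearLarge-absent (p ∷ ps) t k l (p≢t ∷ ps≢t) = cong₂ ℕ._*_ (nearLarge-≢ t k l p≢t)
    (nearLarge-absent ps t k l ps≢t)

-- Distinct positions make the product affine in the large letter.
nearLarge-affine : ∀ {d} (ps : Vec ℕ d) → VecUnique.Unique ps → ∀ t →
                   ∃[ c ] ∃[ e ] (∀ k → prodV (Vec.map (nearLarge t k) ps) ≡ c ℕ.* k ℕ.+ e)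
nearLarge-affine [] _ t = 0 , 1 , λ k → refl
nearLarge-affine (p ∷ ps) (p# ∷ uniq) t with p ℕ.≟ t
-- The remaining positions differ from t, so the letter 0 put in at t has no effect on their
-- product.
... | yes refl = prodV (Vec.map (nearLarge t 0) ps) , 0 , λ k → trans
  (cong₂ ℕ._*_ (refl {x = k}) (nearLarge-absent ps t k 0 (VecAll.map (_∘ sym) p#)))
  (trans (ℕ.*-comm k _) (sym (ℕ.+-identityʳ _)))
... | no _ with nearLarge-affine ps uniq t
...   | c , e , eq = f ℕ.* c , f ℕ.* e , λ k → trans (cong (f ℕ.*_) (eq k))
    (solveℕ 4 (λ a b c d → a ⊠ (b ⊠ c ⊞ d) ⊜ a ⊠ b ⊠ c ⊞ a ⊠ d) refl f c k e)
  where f = forced ℕ.∣ p - t ∣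

atPositions-nearLarge : ∀ {d H n s} {ps : Vec ℕ d} → s ∈ L n → ∀ t → t ℕ.≤ H → VecAll.All (ℕ._≤ H) ps →
                        4 ℕ.* H ℕ.+ 10 ℕ.≤ κ n (T^ n t s) →
                        atPositions ps n s ≡ Vec.map (nearLarge t (κ n (T^ n t s))) ps
atPositions-nearLarge s∈ t t≤H [] big = refl
atPositions-nearLarge {H = H} {n} {s} {p ∷ ps} s∈ t t≤H (p≤H ∷ ps≤H) big = cong₂ _∷_ first
  (atPositions-nearLarge s∈ t t≤H ps≤H big)
  where
  first : κ n (T^ n p s) ≡ nearLarge t (κ n (T^ n t s)) p
  first with p ℕ.≟ t
  ... | yes refl = refl
  ... | no p≢t = letters-near-large H s∈ t p t≤H p≤H p≢t big

forced≤2 : ∀ j → forced j ℕ.≤ 2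
forced≤2 zero = z≤n
forced≤2 (suc zero) = s≤s z≤n
forced≤2 (suc (suc _)) = s≤s (s≤s z≤n)

Quad-card : Quad card
Quad-card .Quad.coef = ½
Quad-card .Quad.err = ½
Quad-card .Quad.upper n _ = lin≤ (½ ⊛ (ℚ.≤-reflexive (twice-card n)))
                              (solve 2 (λ a b → a :+ (con ½) :* (b :* (b :+ (con 1ℚ)))
                                  := (con ½) :* (b :* b) :+ (con ½) :* b :+ (con ½) :* ((con (fromℕ 2)) :* a))
                                refl (card n) (ι n))
Quad-card .Quad.lower n _ = lin≤ ((½ ⊛ (ℚ.≤-reflexive (sym (twice-card n)))) ⊕ (0≤ι n))
                              (solve 2 (λ a b → (con ½) :* (a :* a) :+ ((con ½) :* ((con (fromℕ 2)) :* b) :+ a)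
                                  := b :+ (con ½) :* a :+ ((con ½) :* (a :* (a :+ (con 1ℚ))) :+ (con 0ℚ)))
                                refl (ι n) (card n))

Quad-κ : Quad (λ n → ∑ (L n) (λ s → ι (κ n s)))
Quad-κ = Quad-near 1ℚ (Quad-*⁺ (fromℕ 3) (nonneg (fromℕ 3)) Quad-card)
  (λ n _ → (lin≤ ((ℚ.≤-reflexive (κ-∑ n)) ⊕ ((fromℕ 2) ⊛ (0≤ι n)))
             (solve 3 (λ a b c → a :+ ((con (fromℕ 3)) :* b :- c :+ (con (fromℕ 2)) :* c)
                 := (con (fromℕ 3)) :* b :+ (con 1ℚ) :* c :+ (a :+ (con (fromℕ 2)) :* (con 0ℚ)))
               refl (∑ (L n) (λ s → ι (κ n s))) (card n) (ι n))))
  (λ n _ → (lin≤ (ℚ.≤-reflexive (sym (κ-∑ n)))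
             (solve 3 (λ a b c → (con (fromℕ 3)) :* a :+ b
                 := b :+ (con 1ℚ) :* c :+ ((con (fromℕ 3)) :* a :- c))
               refl (card n) (∑ (L n) (λ s → ι (κ n s))) (ι n))))

large : ℕ → ℕ → ℕ → ℕ → Pair → ℚ
large c e K n s = 𝟙 (K ℕ.<? κ n s) * (ι c * ι (κ n s) + ι e)

-- The sum over large letters is the sum over all of `L n` minus the sum over small ones. The former
-- is known from the sum of κ and the cardinality, the latter is a finite sum over words of length
-- 1.
Quad-large : ∀ c e K → Quad (λ n → ∑ (L n) (large c e K n))
Quad-large c e K = Quad-cong
  (Quad-+ (Quad-+ (Quad-*⁺ (ι c) (0≤ι c) Quad-κ) (Quad-*⁺ (ι e) (0≤ι e) Quad-card))
          (Quad-neg (Quad-smallSum⁺ φ (λ w → 0≤+ (0≤* (0≤ι c) (0≤ι _)) (0≤ι e)) K)))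
  λ n → sym (trans (∑-cong (L n) (λ {s} _ → term n s)) (trans (∑-+ (L n) _ _) (cong₂ _+_
    (trans (∑-+ (L n) _ _) (cong₂ _+_ (∑-*ˡ (L n) (ι c) _) (∑-*ˡ (L n) (ι e) _)))
    (trans (∑-cong (L n) (λ _ → (solve 1 (λ a → :- a
                                    := (:- (con 1ℚ)) :* a)
                                  refl (𝟙 (small? K (letters n 1 _)) * φ (letters n 1 _)))))
      (trans (∑-*ˡ (L n) (- 1ℚ) _) (solve 1 (λ a → (:- (con 1ℚ)) :* a
                                       := :- a)
                                     refl (smallSum φ K n)))))))
  where
  0≤+ : ∀ {p q} → 0ℚ ≤ p → 0ℚ ≤ q → 0ℚ ≤ p + q
  0≤+ {p} {q} 0≤p 0≤q = lin≤ (0≤p ⊕ 0≤q)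
                          (solve 2 (λ a b → (con 0ℚ) :+ (a :+ b)
                              := a :+ b :+ ((con 0ℚ) :+ (con 0ℚ)))
                            refl p q)
  φ : Vec ℕ 1 → ℚ
  φ w = ι c * ι (nth w 0) + ι e
  term : ∀ n s → large c e K n s ≡ (ι c * ι (κ n s) + ι e * 1ℚ) + -
      (𝟙 (small? K (letters n 1 s)) * φ (letters n 1 s))
  term n s with K ℕ.<? κ n s
  ... | yes K<κ = trans (solve 3 (λ a b c → (con 1ℚ) :* (a :* b :+ c)
                            := a :* b :+ c :* (con 1ℚ) :+ (:- ((con 0ℚ) :* (a :* b :+ c))))
                          refl (ι c) (ι (κ n s)) (ι e))
    (cong (λ d → ι c * ι (κ n s) + ι e * 1ℚ + - (d * (ι c * ι (κ n s) + ι e)))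
      (sym (𝟙-no (small? K (letters n 1 s)) (large⇒¬small 1 0 (s≤s z≤n) K<κ))))
  ... | no K≮κ = trans (solve 3 (λ a b c → (con 0ℚ) :* (a :* b :+ c)
                           := a :* b :+ c :* (con 1ℚ) :+ (:- ((con 1ℚ) :* (a :* b :+ c))))
                         refl (ι c) (ι (κ n s)) (ι e))
    (cong (λ d → ι c * ι (κ n s) + ι e * 1ℚ + - (d * (ι c * ι (κ n s) + ι e)))
      (sym (𝟙-yes (small? K (letters n 1 s)) (ℕ.≮⇒≥ K≮κ ∷ []))))

module Correlation {d : ℕ} (ps : Vec ℕ d) (unique : VecUnique.Unique ps) (H : ℕ) (ps≤H : VecAll.All (ℕ._≤ H) ps) where

  R K₀ : ℕ
  R = suc H
  -- K₀ < κ is the bound 4H + 10 ≤ κ from which a letter determines its surroundings.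
  K₀ = 4 ℕ.* H ℕ.+ 9

  c e : ℕ → ℕ
  c t = proj₁ (nearLarge-affine ps unique t)
  e t = proj₁ (proj₂ (nearLarge-affine ps unique t))

  Φ-large : ∀ {n s} → s ∈ L n → ∀ t → t ℕ.< R → K₀ ℕ.< κ n (T^ n t s) →
            Φ ps n s ≡ ι (c t) * ι (κ n (T^ n t s)) + ι (e t)
  Φ-large {n} {s} s∈ t (s≤s t≤H) big = begin
    ι (prodV (atPositions ps n s))        ≡⟨ cong (ι ∘ prodV)
        (atPositions-nearLarge s∈ t t≤H ps≤H (subst (ℕ._≤ k) (sym (ℕ.+-suc (4 ℕ.* H) 9)) big)) ⟩
    ι (prodV (Vec.map (nearLarge t k) ps)) ≡⟨ cong ι (proj₂ (proj₂ (nearLarge-affine ps unique t)) k) ⟩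
    ι (c t ℕ.* k ℕ.+ e t)                 ≡⟨ ι-+ (c t ℕ.* k) (e t) ⟩
    ι (c t ℕ.* k) + ι (e t)               ≡⟨ cong (_+ ι (e t)) (ι-* (c t) k) ⟩
    ι (c t) * ι k + ι (e t)               ∎
    where
    open ≡-Reasoning
    k = κ n (T^ n t s)

  smallPart : ℕ → Pair → ℚ
  smallPart n s = 𝟙 (small? K₀ (letters n R s)) * ι (prodV (select ps (letters n R s)))

  -- At most one of the first R letters exceeds K₀, since the others are then at most 2. Hence
  -- exactly one of `smallPart` and the summands over t is non-zero or all the surviving value is
  -- carried by one of them, and that one equals Φ.
  Φ-split : ∀ {n s} → s ∈ L n →
            Φ ps n s ≡ smallPart n s + ∑ (upTo R) (λ t → large (c t) (e t) K₀ n (T^ n t s))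
  Φ-split {n} {s} s∈ with small-or-large n R K₀ s
  ... | inj₁ small = sym (begin
    smallPart n s + ∑ (upTo R) (λ t → large (c t) (e t) K₀ n (T^ n t s))
      ≡⟨ cong₂ (λ x y → x * ι (prodV (select ps (letters n R s))) + y) (𝟙-yes (small? K₀ (letters n R s)) small)
           (∑-zero (upTo R) (λ {t} t∈ → 𝟙*0 (K₀ ℕ.<? κ n (T^ n t s)) _
               (λ big → large⇒¬small R t (∈.∈-upTo⁻ t∈) big small))) ⟩
    1ℚ * ι (prodV (select ps (letters n R s))) + 0ℚ   ≡⟨ (solve 1 (λ a → (con 1ℚ) :* a :+ (con 0ℚ)
          := a)
        refl (ι (prodV (select ps (letters n R s))))) ⟩
    ι (prodV (select ps (letters n R s)))             ≡⟨ cong (ι ∘ prodV)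
        (select-letters n R s (VecAll.map s≤s ps≤H)) ⟩
    Φ ps n s ∎)
    where open ≡-Reasoning
  ... | inj₂ (t , t<R , big) = sym (begin
    smallPart n s + ∑ (upTo R) X
      ≡⟨ cong₂ (λ x y → x * ι (prodV (select ps (letters n R s))) + y)
           (𝟙-no (small? K₀ (letters n R s)) (large⇒¬small R t t<R big))
               (∑-cong (upTo R) (λ {t′} t′∈ → only t′ (∈.∈-upTo⁻ t′∈))) ⟩
    0ℚ * ι (prodV (select ps (letters n R s))) + ∑ (upTo R) (λ t′ → 𝟙 (t ℕ.≟ t′) * X t′)
      ≡⟨ cong₂ _+_ (ℚ.*-zeroˡ (ι (prodV (select ps (letters n R s)))))
          (∑-δ ℕ._≟_ t X (Unique.upTo⁺ R) (∈.∈-upTo⁺ t<R)) ⟩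
    0ℚ + X t
      ≡⟨ ℚ.+-identityˡ (X t) ⟩
    X t
      ≡⟨ 𝟙* (K₀ ℕ.<? κ n (T^ n t s)) _ big ⟩
    ι (c t) * ι (κ n (T^ n t s)) + ι (e t)
      ≡⟨ Φ-large s∈ t t<R big ⟨
    Φ ps n s ∎)
    where
    open ≡-Reasoning
    X : ℕ → ℚ
    X t = large (c t) (e t) K₀ n (T^ n t s)
    only : ∀ t′ → t′ ℕ.< R → X t′ ≡ 𝟙 (t ℕ.≟ t′) * X t′
    only t′ t′<R with t ℕ.≟ t′
    ... | yes _ = sym (ℚ.*-identityˡ (X t′))
    ... | no t≢t′ = trans (𝟙*0 (K₀ ℕ.<? κ n (T^ n t′ s)) _ ≮) (sym (ℚ.*-zeroˡ (X t′)))
      where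
      ≮ : ¬ K₀ ℕ.< κ n (T^ n t′ s)
      ≮ big′ = ℕ.<⇒≱ big′ (ℕ.≤-trans (ℕ.≤-reflexive
        (letters-near-large H s∈ t t′ (ℕ.≤-pred t<R) (ℕ.≤-pred t′<R) (t≢t′ ∘ sym)
          (subst (ℕ._≤ κ n (T^ n t s)) (sym (ℕ.+-suc (4 ℕ.* H) 9)) big)))
        (ℕ.≤-trans (forced≤2 ℕ.∣ t′ - t ∣) (ℕ.≤-trans (s≤s (s≤s z≤n)) (ℕ.m≤n+m 9 (4 ℕ.* H)))))

  Φ-sum : ℕ → ℚ
  Φ-sum n = ∑ (L n) (Φ ps n)

  -- As T permutes `L n`, the sum with the large letter at position t equals the sum with the large
  -- letter at position 0, to which `Quad-large` applies.
  Quad-Φ : Quad Φ-sum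
  Quad-Φ = Quad-cong
    (Quad-+ (Quad-smallSum⁺ {R} (λ w → ι (prodV (select ps w))) (λ w → 0≤ι _) K₀)
            (Quad-∑ (upTo R) (λ t → Quad-large (c t) (e t) K₀)))
    λ n → sym (begin
      ∑ (L n) (Φ ps n)
        ≡⟨ trans (∑-cong (L n) Φ-split) (∑-+ (L n) _ _) ⟩
      ∑ (L n) (smallPart n) + ∑ (L n) (λ s → ∑ (upTo R) (λ t → large (c t) (e t) K₀ n (T^ n t s)))
        ≡⟨ cong (∑ (L n) (smallPart n) +_) (trans (∑-swap (L n) (upTo R) _)
             (∑-cong (upTo R) (λ {t} _ → ∑-T^ n t (large (c t) (e t) K₀ n)))) ⟩
      ∑ (L n) (smallPart n) + ∑ (upTo R) (λ t → ∑ (L n) (large (c t) (e t) K₀ n)) ∎)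
    where open ≡-Reasoning

  -- `L n` has about n²/2 points, so the mean value of Φ is twice the leading coefficient.
  A : ℚ
  A = fromℕ 2 * Quad.coef Quad-Φ

  0<A : 0ℚ < A
  0<A = ℚ.<-≤-trans (pos 1ℚ)
    (lin≤ ((fromℕ 2) ⊛ (coef-mono Quad-card Quad-Φ (λ n → ∑-mono (L n) (Φ≥1 ps))))
      (solve 1 (λ a → (con 1ℚ) :+ (con (fromℕ 2)) :* a
          := (con (fromℕ 2)) :* a :+ (con (fromℕ 2)) :* (con ½))
        refl (Quad.coef Quad-Φ)))

  -- For κ ≥ 1 both cκ + e and 1 are at most (c + e + 1) κ, so one constant serves for the tail of Φ
  -- and for the number of points in the tail.
  tailConstant : ℚ
  tailConstant = ∑ (upTo R) (λ t → ι (c t) + ι (e t) + 1ℚ)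

  notSmall : ℕ → ℕ → Pair → ℚ
  notSmall M n s = 𝟙 (¬? (small? M (letters n R s)))

  -- f = 1 gives the number of s with a letter above M, f = Φ their contribution to the sum.
  tail : ∀ M n (f : Pair → ℚ) → (∀ {s} → s ∈ L n → ∀ t → t ℕ.< R → M ℕ.< κ n (T^ n t s) →
           f s ≤ (ι (c t) + ι (e t) + 1ℚ) * ι (κ n (T^ n t s))) →
         ι (suc M) * ∑ (L n) (λ s → notSmall M n s * f s) ≤ tailConstant * fromℕ 4 * (ι n * ι n)
  tail M n f bound = begin
    ι (suc M) * ∑ (L n) (λ s → notSmall M n s * f s)
      ≤⟨ *-monoˡ-≤ (ι (suc M)) (0≤ι (suc M)) (∑-mono (L n) pointwise) ⟩
    ι (suc M) * ∑ (L n) (λ s → ∑ (upTo R) (λ t → C t * B (T^ n t s)))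
      ≡⟨ cong (ι (suc M) *_) (trans (∑-swap (L n) (upTo R) _) (∑-cong (upTo R) (λ {t} _ →
           trans (∑-*ˡ (L n) (C t) _) (cong (C t *_) (∑-T^ n t B))))) ⟩
    ι (suc M) * ∑ (upTo R) (λ t → C t * ∑ (L n) B)
      ≡⟨ cong (ι (suc M) *_) (∑-*ʳ (upTo R) (∑ (L n) B) C) ⟩
    ι (suc M) * (tailConstant * ∑ (L n) B)
      ≡⟨ (solve 3 (λ a b c → a :* (b :* c)
             := b :* (a :* c))
           refl (ι (suc M)) tailConstant (∑ (L n) B)) ⟩
    tailConstant * (ι (suc M) * ∑ (L n) B)
      ≤⟨ *-monoˡ-≤ tailConstant (0≤∑ (upTo R) (λ {t} _ → 0≤C t)) (κ-tail n M) ⟩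
    tailConstant * (fromℕ 4 * (ι n * ι n))
      ≡⟨ sym (ℚ.*-assoc tailConstant (fromℕ 4) (ι n * ι n)) ⟩
    tailConstant * fromℕ 4 * (ι n * ι n) ∎
    where
    open ℚ.≤-Reasoning
    C : ℕ → ℚ
    C t = ι (c t) + ι (e t) + 1ℚ
    0≤C : ∀ t → 0ℚ ≤ C t
    0≤C t = lin≤ ((0≤ι (c t)) ⊕ (0≤ι (e t)) ⊕ (nonneg 1ℚ))
              (solve 2 (λ a b → (con 0ℚ) :+ (a :+ b :+ (con 1ℚ))
                  := a :+ b :+ (con 1ℚ) :+ ((con 0ℚ) :+ (con 0ℚ) :+ (con 0ℚ)))
                refl (ι (c t)) (ι (e t)))
    B : Pair → ℚ
    B s = 𝟙 (M ℕ.<? κ n s) * ι (κ n s)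
    0≤CB : ∀ t s → 0ℚ ≤ C t * B s
    0≤CB t s = 0≤* (0≤C t) (0≤* (0≤𝟙 (M ℕ.<? κ n s)) (0≤ι _))
    pointwise : ∀ {s} → s ∈ L n → notSmall M n s * f s ≤ ∑ (upTo R) (λ t → C t * B (T^ n t s))
    pointwise {s} s∈ with small-or-large n R M s
    ... | inj₁ small = subst (_≤ ∑ (upTo R) (λ t → C t * B (T^ n t s)))
      (sym (𝟙*0 (¬? (small? M (letters n R s))) (f s) (λ ¬small → ¬small small)))
      (0≤∑ (upTo R) (λ {t} _ → 0≤CB t (T^ n t s)))
    ... | inj₂ (t , t<R , big) = begin
      notSmall M n s * f s              ≡⟨ 𝟙* (¬? (small? M (letters n R s))) (f s) (large⇒¬small R t t<R big) ⟩
      f s                               ≤⟨ bound s∈ t t<R big ⟩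
      C t * ι (κ n (T^ n t s))          ≡⟨ cong (C t *_) (𝟙* (M ℕ.<? κ n (T^ n t s)) _ big) ⟨
      C t * B (T^ n t s)                ≡⟨ ∑-δ ℕ._≟_ t (λ t → C t * B (T^ n t s)) (Unique.upTo⁺ R)
          (∈.∈-upTo⁺ t<R) ⟨
      ∑ (upTo R) (λ t′ → 𝟙 (t ℕ.≟ t′) * (C t′ * B (T^ n t′ s)))
        ≤⟨ ∑-mono (upTo R) (λ {t′} _ → subst (𝟙 (t ℕ.≟ t′) * (C t′ * B (T^ n t′ s)) ≤_)
            (ℚ.*-identityˡ (C t′ * B (T^ n t′ s)))
             (*-mono-≤ (nonneg 1ℚ) (0≤CB t′ (T^ n t′ s)) (𝟙≤1 (t ℕ.≟ t′)) ℚ.≤-refl)) ⟩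
      ∑ (upTo R) (λ t → C t * B (T^ n t s)) ∎

  count-tail : ∀ M n → ι (suc M) * ∑ (L n) (notSmall M n) ≤ tailConstant * fromℕ 4 * (ι n * ι n)
  count-tail M n = subst (λ x → ι (suc M) * x ≤ tailConstant * fromℕ 4 * (ι n * ι n))
    (∑-cong (L n) (λ {s} _ → ℚ.*-identityʳ (notSmall M n s)))
    (tail M n (λ _ → 1ℚ) λ {s} s∈ t _ _ → bound t
        (subst (_≤ ι (κ n (T^ n t s))) ι-1 (ι-≤ (κ≥1 (∈L⁻ (T^-∈L t s∈))))))
    where
    bound : ∀ t {k} → 1ℚ ≤ k → 1ℚ ≤ (ι (c t) + ι (e t) + 1ℚ) * k
    bound t {k} 1≤k = lin≤ (1≤k ⊕ (0≤* (0≤ι (c t)) 0≤k) ⊕ (0≤* (0≤ι (e t)) 0≤k))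
                        (solve 3 (λ a b c → (con 1ℚ) :+ (a :+ b :* a :+ c :* a)
                            := (b :+ c :+ (con 1ℚ)) :* a :+ ((con 1ℚ) :+ (con 0ℚ) :+ (con 0ℚ)))
                          refl k (ι (c t)) (ι (e t)))
      where 0≤k = ℚ.≤-trans (nonneg 1ℚ) 1≤k

  Φ-tail : ∀ M n → K₀ ℕ.≤ M → ι (suc M) * ∑ (L n) (λ s → notSmall M n s * Φ ps n s) ≤ tailConstant *
      fromℕ 4 * (ι n * ι n)
  Φ-tail M n K₀≤M = tail M n (Φ ps n) λ {s} s∈ t t<R big →
    subst (_≤ (ι (c t) + ι (e t) + 1ℚ) * ι (κ n (T^ n t s))) (sym (Φ-large s∈ t t<R (ℕ.≤-<-trans K₀≤M big)))
      (bound t (subst (_≤ ι (κ n (T^ n t s))) ι-1 (ι-≤ (κ≥1 (∈L⁻ (T^-∈L t s∈))))))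
    where
    bound : ∀ t {k} → 1ℚ ≤ k → ι (c t) * k + ι (e t) ≤ (ι (c t) + ι (e t) + 1ℚ) * k
    bound t {k} 1≤k = lin≤ (1≤k ⊕ (*-monoˡ-≤ (ι (e t)) (0≤ι (e t)) 1≤k) ⊕ (nonneg 1ℚ))
                        (solve 3 (λ a b c → a :* b :+ c :+ (b :+ c :* b :+ (con 1ℚ))
                            := (a :+ c :+ (con 1ℚ)) :* b :+ ((con 1ℚ) :+ c :* (con 1ℚ) :+ (con 0ℚ)))
                          refl (ι (c t)) k (ι (e t)))

-- Dilation of lattice points and Möbius inversion

infixl 7 _÷_

_÷_ : ℕ → ℕ → ℕ
n ÷ zero  = 0
n ÷ suc d = n ℕ./ suc d

*÷ : ∀ z {n} → 1 ℕ.≤ z → z ℕ.* n ÷ z ≡ n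
*÷ z@(suc _) {n} _ = trans (cong (ℕ._/ z) (ℕ.*-comm z n)) (ℕ.m*n/n≡m n z)

÷-* : ∀ {z n} → 1 ℕ.≤ z → z ∣ℕ n → z ℕ.* (n ÷ z) ≡ n
÷-* {z@(suc _)} {n} _ z∣n = trans (ℕ.*-comm z (n ÷ z)) (ℕ.m/n*n≡m z∣n)

÷-÷ : ∀ n z d → 1 ℕ.≤ z → 1 ℕ.≤ d → n ÷ z ÷ d ≡ n ÷ (z ℕ.* d)
÷-÷ n z@(suc _) d@(suc _) _ _ = ℕ.m/n/o≡m/[n*o] n z d

*-÷-≤ : ∀ Q z → z ℕ.* (Q ÷ z) ℕ.≤ Q
*-÷-≤ Q zero = z≤n
*-÷-≤ Q z@(suc _) = subst (ℕ._≤ Q) (ℕ.*-comm (Q ÷ z) z) (ℕ.m/n*n≤m Q z)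

<*suc÷ : ∀ Q z → 1 ℕ.≤ z → Q ℕ.< z ℕ.* suc (Q ÷ z)
<*suc÷ Q z@(suc _) _ = subst₂ ℕ._<_ (sym (ℕ.m≡m%n+[m/n]*n Q z))
  (solveℕ 2 (λ a b → a ⊞ b ⊠ a ⊜ a ⊠ ((conℕ 1) ⊞ b)) refl z (Q ÷ z)) (ℕ.+-monoˡ-< (Q ÷ z ℕ.* z) (ℕ.m%n<n Q z))

≤÷ : ∀ {Q z a} → 1 ℕ.≤ z → z ℕ.* a ℕ.≤ Q → a ℕ.≤ Q ÷ z
≤÷ {Q} {z@(suc _)} {a} 1≤z za≤Q = ℕ.≮⇒≥ λ lt → ℕ.<⇒≱ (<*suc÷ Q z 1≤z) (ℕ.≤-trans (ℕ.*-monoʳ-≤ z lt) za≤Q)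

scale-InL⁺ : ∀ {Q z a b} → 1 ℕ.≤ z → InL (Q ÷ z) a b → InL Q (z ℕ.* a) (z ℕ.* b)
scale-InL⁺ {Q} {z} {a} {b} 1≤z (inL a≤ b≤ lt) = inL (ℕ.≤-trans (ℕ.*-monoʳ-≤ z a≤) (*-÷-≤ Q z))
    (ℕ.≤-trans (ℕ.*-monoʳ-≤ z b≤) (*-÷-≤ Q z))
  (ℕ.<-≤-trans (<*suc÷ Q z 1≤z) (subst (z ℕ.* suc (Q ÷ z) ℕ.≤_) (ℕ.*-distribˡ-+ z a b) (ℕ.*-monoʳ-≤ z lt)))

scale-InL⁻ : ∀ {Q z a b} → 1 ℕ.≤ z → InL Q (z ℕ.* a) (z ℕ.* b) → InL (Q ÷ z) a b
scale-InL⁻ {Q} {z} {a} {b} 1≤z (inL a≤ b≤ lt) = inL (≤÷ 1≤z a≤) (≤÷ 1≤z b≤)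
  (ℕ.*-cancelˡ-< z (Q ÷ z) (a ℕ.+ b) (ℕ.≤-<-trans (*-÷-≤ Q z) (subst (Q ℕ.<_) (sym (ℕ.*-distribˡ-+ z a b)) lt)))

scale : ℕ → Pair → Pair
scale z (a , b) = z ℕ.* a , z ℕ.* b

-- For integers, c ≤ ⌊Q/z⌋ is the same as zc ≤ Q, and ⌊Q/z⌋ < b + c the same as Q < z (b + c). So
-- the relation `Next` is multiplied by z with the same k.
T-scale : ∀ {Q z s} → 1 ℕ.≤ z → s ∈ L (Q ÷ z) → T Q (scale z s) ≡ scale z (T (Q ÷ z) s) × κ Q
    (scale z s) ≡ κ (Q ÷ z) s
T-scale {Q} {z} {a , b} 1≤z s∈ with κ-next (∈L⁻ s∈)
... | c , nx@(next eq c≤ lt) = trans (T-unique 1≤zb nx′) (cong (scale z) (sym (T-unique 1≤b nx))) ,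
    κ-unique 1≤zb nx′
  where
  1≤b = InL.1≤b (∈L⁻ s∈)
  1≤zb : 1 ℕ.≤ z ℕ.* b
  1≤zb = ℕ.*-mono-≤ 1≤z 1≤b
  k = κ (Q ÷ z) (a , b)
  i′ = scale-InL⁺ 1≤z (inL (InL.b≤n (∈L⁻ s∈)) c≤ lt)
  nx′ : Next Q (z ℕ.* a) (z ℕ.* b) (z ℕ.* c) k
  nx′ = next (trans (solveℕ 3 (λ a b c → a ⊠ b ⊞ a ⊠ c ⊜ a ⊠ (b ⊞ c)) refl z c a)
      (trans (cong (z ℕ.*_) eq) (solveℕ 3 (λ a b c → a ⊠ (b ⊠ c)
        ⊜ b ⊠ (a ⊠ c))
      refl z k b)))
    (InL.b≤n i′) (InL.n<a+b i′)

T^-scale : ∀ {Q z} t {s} → 1 ℕ.≤ z → s ∈ L (Q ÷ z) → T^ Q t (scale z s) ≡ scale z (T^ (Q ÷ z) t s)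
T^-scale zero 1≤z s∈ = refl
T^-scale {Q} {z} (suc t) 1≤z s∈ = trans (cong (T^ Q t) (proj₁ (T-scale 1≤z s∈))) (T^-scale t 1≤z (T-∈L s∈))

κ-T^-scale : ∀ {Q z} t {s} → 1 ℕ.≤ z → s ∈ L (Q ÷ z) → κ Q (T^ Q t (scale z s)) ≡ κ (Q ÷ z) (T^ (Q ÷ z) t s)
κ-T^-scale {Q} t 1≤z s∈ = trans (cong (κ Q) (T^-scale t 1≤z s∈)) (proj₂ (T-scale 1≤z (T^-∈L t s∈)))

∑-multiples : ∀ Q z → 1 ℕ.≤ z → ∀ G → ∑ [1⋯ Q ] (λ e → 𝟙 (z ∣? e) * G e) ≡ ∑ [1⋯ Q ÷ z ] (λ d → G (z ℕ.* d))
∑-multiples Q z 1≤z G = sym (trans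
  (∑-reindex ℕ._≟_ ℕ._≟_ (unique-[1⋯] (Q ÷ z)) (Unique.filter⁺ (z ∣?_) (unique-[1⋯] Q)) (z ℕ.*_) (_÷ z) G
    (λ d∈ → let 1≤d , d≤ = ∈[1⋯]⁻ d∈ in ∈.∈-filter⁺ (z ∣?_)
      (∈[1⋯]⁺ (ℕ.*-mono-≤ 1≤z 1≤d) (ℕ.≤-trans (ℕ.*-monoʳ-≤ z d≤) (*-÷-≤ Q z))) (∣.m∣m*n _))
    (λ e∈ → let e∈′ , z∣e = ∈.∈-filter⁻ (z ∣?_) {xs = [1⋯ Q ]} e∈
                1≤e , e≤ = ∈[1⋯]⁻ e∈′
                eq = ÷-* 1≤z z∣e in
      ∈[1⋯]⁺ (positive eq 1≤e) (≤÷ 1≤z (subst (ℕ._≤ Q) (sym eq) e≤)))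
    (λ _ → *÷ z 1≤z)
    (λ e∈ → ÷-* 1≤z (proj₂ (∈.∈-filter⁻ (z ∣?_) {xs = [1⋯ Q ]} e∈))))
  (∑-filter (z ∣?_) [1⋯ Q ] G))
  where
  positive : ∀ {d e} → z ℕ.* d ≡ e → 1 ℕ.≤ e → 1 ℕ.≤ d
  positive {zero} eq 1≤e = ⊥-elim (ℕ.<⇒≱ 1≤e (ℕ.≤-reflexive (trans (sym eq) (ℕ.*-zeroʳ z))))
  positive {suc d} _ _ = s≤s z≤n

common? : ∀ z (s : Pair) → Dec (z ∣ℕ proj₁ s × z ∣ℕ proj₂ s)
common? z s = (z ∣? proj₁ s) ×-dec (z ∣? proj₂ s)

∑-L-multiples : ∀ Q z → 1 ℕ.≤ z → ∀ G → ∑ (L Q) (λ s → 𝟙 (common? z s) * G s) ≡ ∑ (L (Q ÷ z)) (G ∘ scale z)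
∑-L-multiples Q z 1≤z G = sym (trans
  (∑-reindex _≟ᴾ_ _≟ᴾ_ (unique-L (Q ÷ z)) (Unique.filter⁺ (common? z) (unique-L Q)) (scale z)
      (λ s → proj₁ s ÷ z , proj₂ s ÷ z) G
    (λ s∈ → ∈.∈-filter⁺ (common? z) (∈L⁺ (scale-InL⁺ 1≤z (∈L⁻ s∈))) (∣.m∣m*n _ , ∣.m∣m*n _))
    (λ s∈ → let s∈′ , z∣a , z∣b = ∈.∈-filter⁻ (common? z) {xs = L Q} s∈ in
      ∈L⁺ (scale-InL⁻ 1≤z (subst₂ (InL Q) (sym (÷-* 1≤z z∣a)) (sym (÷-* 1≤z z∣b)) (∈L⁻ s∈′))))
    (λ _ → cong₂ _,_ (*÷ z 1≤z) (*÷ z 1≤z))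
    (λ s∈ → let _ , z∣a , z∣b = ∈.∈-filter⁻ (common? z) {xs = L Q} s∈ in cong₂ _,_ (÷-* 1≤z z∣a) (÷-* 1≤z z∣b)))
  (∑-filter (common? z) (L Q) G))

1≤prime : ∀ {p} → Prime p → 1 ℕ.≤ p
1≤prime pr = ℕ.<⇒≤ (ℕ.nonTrivial⇒n>1 _ {{prime⇒nonTrivial pr}})

-- sifted z s = 1 if no prime below z divides both entries of s, and 0 otherwise.
sifted : ℕ → Pair → ℚ
sifted zero s = 1ℚ
sifted (suc z) s with prime? z
... | yes _ = sifted z s - 𝟙 (common? z s) * sifted z s
... | no _  = sifted z s

prime∣prime⇒≡ : ∀ {p q} → Prime p → Prime q → p ∣ℕ q → p ≡ q
prime∣prime⇒≡ {p} pp pq p∣q with prime⇒irreducible pq p∣q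
... | inj₁ refl = ⊥-elim (ℕ.<-irrefl refl (ℕ.nonTrivial⇒n>1 _ {{prime⇒nonTrivial pp}}))
... | inj₂ eq = eq

prime∣scale : ∀ {p q a} → Prime p → Prime q → p ≢ q → p ∣ℕ q ℕ.* a → p ∣ℕ a
prime∣scale {p} {q} {a} pp pq p≢q p∣qa with euclidsLemma q a pp p∣qa
... | inj₁ p∣q = ⊥-elim (p≢q (prime∣prime⇒≡ pp pq p∣q))
... | inj₂ p∣a = p∣a

-- The primes below z are different from q, so they divide qa exactly when they divide a. Hence
-- sifting by q subtracts the same sifted sum at level Q/q.
sifted-scale : ∀ z {q} s → Prime q → z ℕ.≤ q → sifted z (scale q s) ≡ sifted z s
sifted-scale zero s pq z≤q = refl
sifted-scale (suc z) {q} s pq z<q with prime? z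
... | no _ = sifted-scale z s pq (ℕ.<⇒≤ z<q)
... | yes pz = cong₂ (λ x y → x - y * x) (sifted-scale z s pq (ℕ.<⇒≤ z<q))
  (𝟙-⇔ (common? z (scale q s)) (common? z s)
    (λ (z∣a , z∣b) → prime∣scale pz pq (ℕ.<⇒≢ z<q) z∣a , prime∣scale pz pq (ℕ.<⇒≢ z<q) z∣b)
    (λ (z∣a , z∣b) → ∣.∣n⇒∣m*n q z∣a , ∣.∣n⇒∣m*n q z∣b))

sifted-zero : ∀ z {p s} → Prime p → p ℕ.< z → p ∣ℕ proj₁ s × p ∣ℕ proj₂ s → sifted z s ≡ 0ℚ
sifted-zero (suc z) {p} {s} pp (s≤s p≤z) com with ℕ.m≤n⇒m<n∨m≡n p≤z | prime? z
... | inj₁ p<z | yes _ = trans (cong (λ x → x - 𝟙 (common? z s) * x) (sifted-zero z pp p<z com))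
  (solve 1 (λ a → (con 0ℚ) :- a :* (con 0ℚ) := con 0ℚ) refl (𝟙 (common? z s)))
... | inj₁ p<z | no _ = sifted-zero z pp p<z com
... | inj₂ refl | no ¬pz = ⊥-elim (¬pz pp)
... | inj₂ refl | yes _ = trans (cong (λ d → sifted z s - d * sifted z s) (𝟙-yes (common? z s) com))
  (solve 1 (λ a → a :- (con 1ℚ) :* a := con 0ℚ) refl (sifted z s))

sifted-one : ∀ z {s} → Coprime (proj₁ s) (proj₂ s) → sifted z s ≡ 1ℚ
sifted-one zero cop = refl
sifted-one (suc z) {s} cop with prime? z
... | no _ = sifted-one z cop
... | yes pz = trans (cong₂ (λ d x → x - d * x) (𝟙-no (common? z s) ¬common) (sifted-one z cop)) refl
  where
  ¬common : ¬ (z ∣ℕ proj₁ s × z ∣ℕ proj₂ s)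
  ¬common com with cop com
  ... | refl = ℕ.<-irrefl refl (ℕ.nonTrivial⇒n>1 _ {{prime⇒nonTrivial pz}})

prime-divisor : ∀ n → 2 ℕ.≤ n → ∃[ p ] (Prime p × p ∣ℕ n)
prime-divisor n@(suc _) 2≤n with factorise n
... | record { factors = [] ; isFactorisation = eq } = ⊥-elim (ℕ.<⇒≢ 2≤n (sym eq))
... | record { factors = p ∷ ps ; isFactorisation = eq ; factorsPrime = pp ∷ _ } =
  p , pp , subst (p ∣ℕ_) (sym eq) (∣.m∣m*n _)

-- A common prime factor divides the first entry and is therefore at most Q, so sifting by the
-- primes below Q + 1 detects it.
sifted-coprime : ∀ {Q s} → s ∈ L Q → sifted (suc Q) s ≡ 𝟙 (coprime? (proj₁ s) (proj₂ s))
sifted-coprime {Q} {a , b} s∈ with coprime? a b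
... | yes cop = sifted-one (suc Q) cop
... | no ¬cop with prime-divisor (gcd a b) 2≤gcd
  where
  1≤a = InL.1≤a (∈L⁻ s∈)
  2≤gcd : 2 ℕ.≤ gcd a b
  2≤gcd = ℕ.≤∧≢⇒< (ℕ.n≢0⇒n>0 (GCD.gcd[m,n]≢0 a b (inj₁ (ℕ.n>0⇒n≢0 1≤a))))
      (λ eq → ¬cop (Coprime.gcd≡1⇒coprime (sym eq)))
...   | p , pp , p∣g = sifted-zero (suc Q) pp
    (s≤s (ℕ.≤-trans (∣.∣⇒≤ {{ℕ.>-nonZero (InL.1≤a (∈L⁻ s∈))}} p∣a) (InL.a≤n (∈L⁻ s∈))))
        (p∣a , ∣.∣-trans p∣g (GCD.gcd[m,n]∣n a b))
  where p∣a = ∣.∣-trans p∣g (GCD.gcd[m,n]∣m a b)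

-- The Möbius function restricted to the integers whose prime factors are below z
μ : ℕ → ℕ → ℚ
μ zero d = 𝟙 (d ℕ.≟ 1)
μ (suc z) d with prime? z
... | yes _ = μ z d - 𝟙 (z ∣? d) * μ z (d ÷ z)
... | no _  = μ z d

-- The second component says that `μ z` is supported on integers whose prime factors are all below
-- z. Therefore at most one of the two terms of the recursion is non-zero, and absolute values do
-- not grow.
μ-bounded : ∀ z d → (∣ μ z d ∣ ≤ 1ℚ) × (μ z d ≡ 0ℚ ⊎ (∀ p → Prime p → z ℕ.≤ p → ¬ p ∣ℕ d))
μ-bounded zero d with d ℕ.≟ 1
... | no _ = nonneg 1ℚ , inj₁ refl
... | yes refl = ℚ.≤-refl , inj₂ λ p pp _ p∣1 →
  ℕ.<⇒≢ (ℕ.nonTrivial⇒n>1 _ {{prime⇒nonTrivial pp}}) (sym (∣.∣1⇒≡1 p∣1))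
μ-bounded (suc z) d with prime? z
... | no _ = proj₁ (μ-bounded z d) , [ inj₁ , (λ rough → inj₂ λ p pp z<p → rough p pp (ℕ.<⇒≤ z<p)) ]′
    (proj₂ (μ-bounded z d))
... | yes pz with z ∣? d
...   | no _ = subst (λ x → (∣ x ∣ ≤ 1ℚ) × (x ≡ 0ℚ ⊎ (∀ p → Prime p → suc z ℕ.≤ p → ¬ p ∣ℕ d))) (sym eq)
    (proj₁ (μ-bounded z d) , [ inj₁ , (λ rough → inj₂ λ p pp z<p → rough p pp (ℕ.<⇒≤ z<p)) ]′
        (proj₂ (μ-bounded z d)))
  where
  eq : μ z d - 0ℚ * μ z (d ÷ z) ≡ μ z d
  eq = solve 2 (λ a b → a :- (con 0ℚ) :* b := a) refl (μ z d) (μ z (d ÷ z))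
...   | yes z∣d = subst (λ x → (∣ x ∣ ≤ 1ℚ) × (x ≡ 0ℚ ⊎ (∀ p → Prime p → suc z ℕ.≤ p → ¬ p ∣ℕ d))) (sym eq)
    ( subst (_≤ 1ℚ) (sym (ℚ.∣-p∣≡∣p∣ (μ z (d ÷ z)))) (proj₁ (μ-bounded z (d ÷ z)))
    , [ (λ eq → inj₁ (cong -_ eq))
      , (λ rough → inj₂ λ p pp z<p p∣d → rough p pp (ℕ.<⇒≤ z<p)
          (prime∣scale pp pz (ℕ.<⇒≢ z<p ∘ sym) (subst (p ∣ℕ_) (sym (÷-* (1≤prime pz) z∣d)) p∣d))) ]′
              (proj₂ (μ-bounded z (d ÷ z))))
  where
  μz≡0 : μ z d ≡ 0ℚ
  μz≡0 = [ id , (λ rough → ⊥-elim (rough z pz ℕ.≤-refl z∣d)) ]′ (proj₂ (μ-bounded z d))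
  eq : μ z d - 1ℚ * μ z (d ÷ z) ≡ - μ z (d ÷ z)
  eq = trans (cong (_- 1ℚ * μ z (d ÷ z)) μz≡0) (solve 1 (λ a → (con 0ℚ) :- (con 1ℚ) :* a
        := :- a)
      refl (μ z (d ÷ z)))

module _ (f : ℕ → Pair → ℚ) (f-scale : ∀ {Q z s} → 1 ℕ.≤ z → s ∈ L (Q ÷ z) → f Q (scale z s) ≡ f (Q ÷ z) s) where

  private
    E : ℕ → ℚ
    E Q = ∑ (L Q) (f Q)

    W : ℕ → ℕ → ℚ
    W z Q = ∑ (L Q) (λ s → sifted z s * f Q s)

    W-step : ∀ z Q → Prime z → ∑ (L Q) (λ s → (sifted z s - 𝟙 (common? z s) * sifted z s) * f Q s) ≡ W z
        Q - W z (Q ÷ z)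
    W-step z Q pz = begin
      ∑ (L Q) (λ s → (sifted z s - 𝟙 (common? z s) * sifted z s) * f Q s)
        ≡⟨ ∑-cong (L Q) (λ {s} _ → (solve 3 (λ a b c → (a :- b :* a) :* c
                                       := a :* c :- b :* (a :* c))
                                     refl (sifted z s) (𝟙 (common? z s)) (f Q s))) ⟩
      ∑ (L Q) (λ s → sifted z s * f Q s - 𝟙 (common? z s) * (sifted z s * f Q s))
        ≡⟨ ∑-- (L Q) _ _ ⟩
      W z Q - ∑ (L Q) (λ s → 𝟙 (common? z s) * (sifted z s * f Q s))
        ≡⟨ cong (λ x → W z Q - x) (trans (∑-L-multiples Q z (1≤prime pz) _)
             (∑-cong (L (Q ÷ z)) (λ {s} s∈ → cong₂ _*_ (sifted-scale z s pz ℕ.≤-refl)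
                 (f-scale (1≤prime pz) s∈)))) ⟩
      W z Q - W z (Q ÷ z) ∎
      where open ≡-Reasoning

    -- Legendre's sieve: induction over the primes, where removing the multiples of z subtracts the
    -- formula for Q/z. Its terms are placed at the multiples of z, which is the recursion defining
    -- μ.
    W≡ : ∀ z Q → W z Q ≡ ∑ [1⋯ Q ] (λ d → μ z d * E (Q ÷ d))
    W≡ zero zero = trans (L0 _) refl
    W≡ zero Q@(suc Q′) = begin
      W 0 Q                        ≡⟨ ∑-cong (L Q) (λ {s} _ → ℚ.*-identityˡ (f Q s)) ⟩
      E Q                          ≡⟨ cong E (ℕ.n/1≡n Q) ⟨
      E (Q ÷ 1)                    ≡⟨ ∑-δ ℕ._≟_ 1 (λ d → E (Q ÷ d)) (unique-[1⋯] Q)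
          (∈[1⋯]⁺ (s≤s z≤n) (s≤s z≤n)) ⟨
      ∑ [1⋯ Q ] (λ d → 𝟙 (1 ℕ.≟ d) * E (Q ÷ d))
        ≡⟨ ∑-cong [1⋯ Q ] (λ {d} _ → cong (_* E (Q ÷ d)) (𝟙-⇔ (1 ℕ.≟ d) (d ℕ.≟ 1) sym sym)) ⟩
      ∑ [1⋯ Q ] (λ d → μ 0 d * E (Q ÷ d)) ∎
      where open ≡-Reasoning
    W≡ (suc z) Q with prime? z
    ... | no _ = W≡ z Q
    ... | yes pz = begin
      ∑ (L Q) (λ s → (sifted z s - 𝟙 (common? z s) * sifted z s) * f Q s)
        ≡⟨ W-step z Q pz ⟩
      W z Q - W z (Q ÷ z)
        ≡⟨ cong₂ _-_ (W≡ z Q) (W≡ z (Q ÷ z)) ⟩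
      ∑ [1⋯ Q ] (λ d → μ z d * E (Q ÷ d)) - ∑ [1⋯ Q ÷ z ] (λ d → μ z d * E (Q ÷ z ÷ d))
        ≡⟨ cong (λ x → ∑ [1⋯ Q ] (λ d → μ z d * E (Q ÷ d)) - x) (sym (trans
             (∑-multiples Q z 1≤z (λ e → μ z (e ÷ z) * E (Q ÷ e)))
             (∑-cong [1⋯ Q ÷ z ] (λ {d} d∈ → cong₂ (λ x y → μ z x * E y) (*÷ z 1≤z)
                 (sym (÷-÷ Q z d 1≤z (proj₁ (∈[1⋯]⁻ d∈)))))))) ⟩
      ∑ [1⋯ Q ] (λ d → μ z d * E (Q ÷ d)) - ∑ [1⋯ Q ] (λ d → 𝟙 (z ∣? d) * (μ z (d ÷ z) * E (Q ÷ d)))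
        ≡⟨ ∑-- [1⋯ Q ] _ _ ⟨
      ∑ [1⋯ Q ] (λ d → μ z d * E (Q ÷ d) - 𝟙 (z ∣? d) * (μ z (d ÷ z) * E (Q ÷ d)))
        ≡⟨ ∑-cong [1⋯ Q ] (λ {d} _ → (solve 4 (λ a b c d → a :* b :- c :* (d :* b)
                                         := (a :- c :* d) :* b)
                                       refl (μ z d) (E (Q ÷ d)) (𝟙 (z ∣? d)) (μ z (d ÷ z)))) ⟩
      ∑ [1⋯ Q ] (λ d → (μ z d - 𝟙 (z ∣? d) * μ z (d ÷ z)) * E (Q ÷ d)) ∎
      where
      open ≡-Reasoning
      1≤z = 1≤prime pz

  coprimeSum : ℕ → ℚ
  coprimeSum Q = ∑ (L Q) (λ s → 𝟙 (coprime? (proj₁ s) (proj₂ s)) * f Q s)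

  coprimeSum≡ : ∀ Q → coprimeSum Q ≡ ∑ [1⋯ Q ] (λ d → μ (suc Q) d * ∑ (L (Q ÷ d)) (f (Q ÷ d)))
  coprimeSum≡ Q = trans (∑-cong (L Q) (λ {s} s∈ → cong (_* f Q s) (sym (sifted-coprime s∈)))) (W≡ (suc Q) Q)

-- The divisor sum ∑_{d ≤ Q} ⌊Q/d⌋

divisorSum : ℕ → ℚ
divisorSum Q = ∑ [1⋯ Q ] (λ d → ι (Q ÷ d))

÷-monoʳ : ∀ Q {c d} → 1 ℕ.≤ c → c ℕ.≤ d → Q ÷ d ℕ.≤ Q ÷ c
÷-monoʳ Q {suc c} {suc d} _ c≤d = ℕ./-monoʳ-≤ Q c≤d

-- The terms for d = 2j and d = 2j + 1 are both at most ⌊Q/2j⌋ = ⌊⌊Q/2⌋/j⌋, and the term for d = 1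
-- is Q.
divisorSum-halving : ∀ Q k → ∑ [1⋯ suc (2 ℕ.* k) ] (λ d → ι (Q ÷ d)) ≤ ι Q + fromℕ 2 * ∑ [1⋯ k ]
    (λ d → ι (Q ÷ 2 ÷ d))
divisorSum-halving Q zero = lin≤ (ℚ.≤-reflexive (cong ι (ℕ.n/1≡n Q)))
                              (solve 2 (λ a b → a :+ (con 0ℚ) :+ b
                                  := b :+ (con (fromℕ 2)) :* (con 0ℚ) :+ a)
                                refl (ι (Q ÷ 1)) (ι Q))
divisorSum-halving Q (suc k) = subst
    (λ j → ∑ [1⋯ suc j ] (λ d → ι (Q ÷ d)) ≤ ι Q + fromℕ 2 * ∑ [1⋯ suc k ] (λ d → ι (Q ÷ 2 ÷ d)))
  (sym 2*suc) (lin≤ ((ℚ.≤-reflexive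
      (trans (∑-[1⋯]-suc (suc (suc (2 ℕ.* k))) g)
          (cong (_+ ι (Q ÷ (3 ℕ.+ 2 ℕ.* k))) (∑-[1⋯]-suc (suc (2 ℕ.* k)) g)))) ⊕
              ((fromℕ 2) ⊛ (ℚ.≤-reflexive (sym (∑-[1⋯]-suc k (λ d → ι (Q ÷ 2 ÷ d)))))) ⊕
                  (divisorSum-halving Q k) ⊕ ((fromℕ 2) ⊛ a≤h) ⊕ b≤a)
                (solve 8 (λ a b c d e f g h → a :+
                    (b :+ c :+ d :+ (con (fromℕ 2)) :* e :+ (f :+ (con (fromℕ 2)) :* g) :+
                        (con (fromℕ 2)) :* h :+ c)
                    := f :+ (con (fromℕ 2)) :* e :+
                        (a :+ (con (fromℕ 2)) :* (g :+ h) :+ b :+ (con (fromℕ 2)) :* c :+ d))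
                  refl (∑ [1⋯ suc (suc (suc (2 ℕ.* k))) ] (λ d → ι (Q ÷ d)))
                      (∑ [1⋯ suc (2 ℕ.* k) ] (λ d → ι (Q ÷ d))) (ι (Q ÷ (2 ℕ.+ 2 ℕ.* k)))
                          (ι (Q ÷ (3 ℕ.+ 2 ℕ.* k))) (∑ [1⋯ suc k ] (λ d → ι (Q ÷ 2 ÷ d))) (ι Q)
                              (∑ [1⋯ k ] (λ d → ι (Q ÷ 2 ÷ d))) (ι (Q ÷ 2 ÷ suc k))))
  where
  g : ℕ → ℚ
  g d = ι (Q ÷ d)
  2*suc : 2 ℕ.* suc k ≡ 2 ℕ.+ 2 ℕ.* k
  2*suc = solveℕ 1 (λ a → (conℕ 2) ⊠ ((conℕ 1) ⊞ a) ⊜ (conℕ 2) ⊞ (conℕ 2) ⊠ a) refl k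
  a≤h : ι (Q ÷ (2 ℕ.+ 2 ℕ.* k)) ≤ ι (Q ÷ 2 ÷ suc k)
  a≤h = ℚ.≤-reflexive (cong ι (sym (trans (÷-÷ Q 2 (suc k) (s≤s z≤n) (s≤s z≤n)) (cong (Q ÷_) 2*suc))))
  b≤a : ι (Q ÷ (3 ℕ.+ 2 ℕ.* k)) ≤ ι (Q ÷ (2 ℕ.+ 2 ℕ.* k))
  b≤a = ι-≤ (÷-monoʳ Q (s≤s z≤n) (ℕ.n≤1+n _))

∑-[1⋯]-≤ : ∀ {m n} {f : ℕ → ℚ} → m ℕ.≤ n → (∀ d → 0ℚ ≤ f d) → ∑ [1⋯ m ] f ≤ ∑ [1⋯ n ] f
∑-[1⋯]-≤ {m} {zero} z≤n 0≤f = ℚ.≤-refl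
∑-[1⋯]-≤ {m} {suc n} {f} m≤n 0≤f with ℕ.m≤n⇒m<n∨m≡n m≤n
... | inj₂ refl = ℚ.≤-refl
... | inj₁ (s≤s m≤n′) = subst (∑ [1⋯ m ] f ≤_) (sym (∑-[1⋯]-suc n f))
  (lin≤ ((∑-[1⋯]-≤ m≤n′ 0≤f) ⊕ (0≤f (suc n)))
    (solve 3 (λ a b c → a :+ (b :+ c)
        := b :+ c :+ (a :+ (con 0ℚ)))
      refl (∑ [1⋯ m ] f) (∑ [1⋯ n ] f) (f (suc n))))

÷2≡⌊/2⌋ : ∀ n → n ÷ 2 ≡ ℕ.⌊ n /2⌋
÷2≡⌊/2⌋ zero = refl
÷2≡⌊/2⌋ (suc zero) = refl
÷2≡⌊/2⌋ (suc (suc n)) = trans (ℕ.+-distrib-/-∣ˡ n {2} (divides 1 refl)) (cong suc (÷2≡⌊/2⌋ n))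

log≥1 : ∀ {Q} → 2 ℕ.≤ Q → 1 ℕ.≤ ⌊log₂ Q ⌋
log≥1 {Q} 2≤Q = subst (ℕ._≤ ⌊log₂ Q ⌋) (⌊log₂[2^n]⌋≡n 1) (⌊log₂⌋-mono-≤ 2≤Q)

-- Halving gives D(Q) ≤ Q + 2 D(⌊Q/2⌋), and the binary logarithm drops by 1; so each of the 1 + log₂
-- Q levels costs at most Q.
divisorSum-bound : ∀ Q → divisorSum Q ≤ ι (Q ℕ.* suc ⌊log₂ Q ⌋)
divisorSum-bound = <-rec (λ Q → divisorSum Q ≤ ι (Q ℕ.* suc ⌊log₂ Q ⌋)) step
  where
  step : ∀ Q → (∀ {k} → k ℕ.< Q → divisorSum k ≤ ι (k ℕ.* suc ⌊log₂ k ⌋)) → divisorSum Q ≤ ι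
      (Q ℕ.* suc ⌊log₂ Q ⌋)
  step zero _ = 0≤ι 0
  step (suc zero) _ = ℚ.≤-reflexive (ℚ.+-identityʳ (ι 1))
  step Q@(suc (suc Q′)) ih = begin
    divisorSum Q
      ≤⟨ ∑-[1⋯]-≤ Q≤2k+1 (λ d → 0≤ι (Q ÷ d)) ⟩
    ∑ [1⋯ suc (2 ℕ.* k) ] (λ d → ι (Q ÷ d))
      ≤⟨ divisorSum-halving Q k ⟩
    ι Q + fromℕ 2 * divisorSum k
      ≤⟨ ℚ.+-monoʳ-≤ (ι Q) (*-monoˡ-≤ (fromℕ 2) (nonneg (fromℕ 2)) (ih k<Q)) ⟩
    ι Q + fromℕ 2 * ι (k ℕ.* suc ⌊log₂ k ⌋)
      ≡⟨ cong (λ l → ι Q + fromℕ 2 * ι (k ℕ.* l)) log-k ⟩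
    ι Q + fromℕ 2 * ι (k ℕ.* ⌊log₂ Q ⌋)
      ≡⟨ cong (λ x → ι Q + x * ι (k ℕ.* ⌊log₂ Q ⌋)) (ι≡fromℕ 2) ⟨
    ι Q + ι 2 * ι (k ℕ.* ⌊log₂ Q ⌋)
      ≡⟨ trans (cong (ι Q +_) (sym (ι-* 2 (k ℕ.* ⌊log₂ Q ⌋)))) (sym (ι-+ Q _)) ⟩
    ι (Q ℕ.+ 2 ℕ.* (k ℕ.* ⌊log₂ Q ⌋))
      ≤⟨ ι-≤ (subst (Q ℕ.+ 2 ℕ.* (k ℕ.* ⌊log₂ Q ⌋) ℕ.≤_) (sym (ℕ.*-suc Q ⌊log₂ Q ⌋))
           (ℕ.+-monoʳ-≤ Q (subst (ℕ._≤ Q ℕ.* ⌊log₂ Q ⌋) (ℕ.*-assoc 2 k ⌊log₂ Q ⌋)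
               (ℕ.*-monoˡ-≤ ⌊log₂ Q ⌋ (*-÷-≤ Q 2))))) ⟩
    ι (Q ℕ.* suc ⌊log₂ Q ⌋) ∎
    where
    open ℚ.≤-Reasoning
    k = Q ÷ 2
    Q≤2k+1 : Q ℕ.≤ suc (2 ℕ.* k)
    Q≤2k+1 = linℕ (<*suc÷ Q 2 (s≤s z≤n))
               (solveℕ 2 (λ a b → a ⊞ (conℕ 2) ⊠ ((conℕ 1) ⊞ b)
                   ⊜ (conℕ 1) ⊞ (conℕ 2) ⊠ b ⊞ ((conℕ 1) ⊞ a))
                 refl Q k)
    k<Q : k ℕ.< Q
    k<Q = ℕ.m/n<m Q 2 (s≤s (s≤s z≤n))
    log-k : suc ⌊log₂ k ⌋ ≡ ⌊log₂ Q ⌋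
    log-k = trans (cong (λ j → suc ⌊log₂ j ⌋) (÷2≡⌊/2⌋ Q)) (trans (cong suc (⌊log₂⌊n/2⌋⌋≡⌊log₂n⌋∸1 Q))
      (ℕ.m+[n∸m]≡n (log≥1 {Q} (s≤s (s≤s z≤n)))))

module _ (f : ℕ → Pair → ℚ) (f-scale : ∀ {Q z s} → 1 ℕ.≤ z → s ∈ L (Q ÷ z) → f Q (scale z s) ≡ f (Q ÷ z) s) where

  coprimeSum-bound : ∀ D → (∀ n → ∣ ∑ (L n) (f n) ∣ ≤ D * ι n) → 0ℚ ≤ D →
                     ∀ Q → ∣ coprimeSum f f-scale Q ∣ ≤ D * ι (Q ℕ.* suc ⌊log₂ Q ⌋)
  coprimeSum-bound D E≤ 0≤D Q = begin
    ∣ coprimeSum f f-scale Q ∣                               ≡⟨ cong ∣_∣ (coprimeSum≡ f f-scale Q) ⟩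
    ∣ ∑ [1⋯ Q ] (λ d → μ (suc Q) d * E (Q ÷ d)) ∣   ≤⟨ ∣∑∣≤ [1⋯ Q ] (λ d → μ (suc Q) d * E (Q ÷ d)) ⟩
    ∑ [1⋯ Q ] (λ d → ∣ μ (suc Q) d * E (Q ÷ d) ∣)   ≤⟨ ∑-mono [1⋯ Q ] (λ {d} _ → term d) ⟩
    ∑ [1⋯ Q ] (λ d → D * ι (Q ÷ d))                 ≡⟨ ∑-*ˡ [1⋯ Q ] D _ ⟩
    D * divisorSum Q                                ≤⟨ *-monoˡ-≤ D 0≤D (divisorSum-bound Q) ⟩
    D * ι (Q ℕ.* suc ⌊log₂ Q ⌋)                     ∎
    where
    open ℚ.≤-Reasoning
    E : ℕ → ℚ
    E n = ∑ (L n) (f n)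
    ∣∑∣≤ : ∀ {A : Set} (xs : List A) (g : A → ℚ) → ∣ ∑ xs g ∣ ≤ ∑ xs (λ x → ∣ g x ∣)
    ∣∑∣≤ [] g = ℚ.≤-refl
    ∣∑∣≤ (x ∷ xs) g = ℚ.≤-trans (ℚ.∣p+q∣≤∣p∣+∣q∣ (g x) (∑ xs g)) (ℚ.+-monoʳ-≤ ∣ g x ∣ (∣∑∣≤ xs g))
    term : ∀ d → ∣ μ (suc Q) d * E (Q ÷ d) ∣ ≤ D * ι (Q ÷ d)
    term d = begin
      ∣ μ (suc Q) d * E (Q ÷ d) ∣           ≡⟨ ℚ.∣p*q∣≡∣p∣*∣q∣ (μ (suc Q) d) (E (Q ÷ d)) ⟩
      ∣ μ (suc Q) d ∣ * ∣ E (Q ÷ d) ∣       ≤⟨ *-mono-≤ (nonneg 1ℚ) (ℚ.0≤∣p∣ (E (Q ÷ d)))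
          (proj₁ (μ-bounded (suc Q) d)) (E≤ (Q ÷ d)) ⟩
      1ℚ * (D * ι (Q ÷ d))                  ≡⟨ ℚ.*-identityˡ _ ⟩
      D * ι (Q ÷ d)                         ∎

-- The Farey sequence as a chain of neighbouring fractions

num den : Pair → ℕ
num = proj₁
den = proj₂

-- Consecutive fractions of the Farey sequence of order Q, as pairs (numerator , denominator)
record Adjacent (Q : ℕ) (x y : Pair) : Set where
  constructor adjacent
  field
    det : num y ℕ.* den x ≡ suc (num x ℕ.* den y)
    Q<  : Q ℕ.< den x ℕ.+ den y
    y≤Q : den y ℕ.≤ Q
    y≥1 : 1 ℕ.≤ den y
    y≤1 : num y ℕ.≤ den y

data Chain (Q : ℕ) : Pair → List Pair → Set where
  end  : Chain Q (1 , 1) []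
  link : ∀ {x y ys} → Adjacent Q x y → Chain Q y ys → Chain Q x (y ∷ ys)

mediant : Pair → Pair → Pair
mediant x y = num x ℕ.+ num y , den x ℕ.+ den y

insertMediants : ℕ → Pair → List Pair → List Pair
insertMediants q x [] = []
insertMediants q x (y ∷ ys) with den x ℕ.+ den y ℕ.≟ q
... | yes _ = mediant x y ∷ y ∷ insertMediants q y ys
... | no _  = y ∷ insertMediants q y ys

-- The list omits 0/1, which serves only as the left neighbour of the first fraction.
farey : ℕ → List Pair
farey zero          = []
farey (suc zero)    = (1 , 1) ∷ []
farey (suc (suc q)) = insertMediants (suc (suc q)) (0 , 1) (farey (suc q))

-- Neighbours of order Q stop being neighbours of order Q + 1 only if their denominators add up to Q
-- + 1. Their mediant then has this denominator, and it has determinant 1 with both of them.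
insertMediants-chain : ∀ {Q x ys} → 1 ℕ.≤ den x → num x ℕ.≤ den x → Chain Q x ys → Chain (suc Q) x
    (insertMediants (suc Q) x ys)
insertMediants-chain _ _ end = end
insertMediants-chain {Q} {x} {y ∷ ys} x≥1 x≤1 (link (adjacent det Q< y≤Q y≥1 y≤1) ch) with den x ℕ.+ den
    y ℕ.≟ suc Q
... | no ≢ = link (adjacent det (ℕ.≤∧≢⇒< Q< (≢ ∘ sym)) (ℕ.m≤n⇒m≤1+n y≤Q) y≥1 y≤1)
    (insertMediants-chain y≥1 y≤1 ch)
... | yes eq = link
  (adjacent (linℕ≡ det
              (solveℕ 4 (λ a b c d → (a ⊞ b) ⊠ c ⊞ ((conℕ 1) ⊞ a ⊠ d)
                  ⊜ (conℕ 1) ⊞ a ⊠ (c ⊞ d) ⊞ b ⊠ c)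
                refl (num x) (num y) (den x) (den y)))
    (linℕ ((ℕ.≤-reflexive (sym eq)) ⊕ℕ x≥1)
      (solveℕ 3 (λ a b c → (conℕ 1) ⊞ ((conℕ 1) ⊞ a) ⊞ (b ⊞ c ⊞ b)
          ⊜ b ⊞ (b ⊞ c) ⊞ ((conℕ 1) ⊞ a ⊞ (conℕ 1)))
        refl Q (den x) (den y)))
    (ℕ.≤-reflexive eq) (linℕ (y≥1 ⊕ℕ (z≤n {den x}))
                         (solveℕ 2 (λ a b → (conℕ 1) ⊞ (a ⊞ b)
                             ⊜ b ⊞ a ⊞ ((conℕ 1) ⊞ (conℕ 0)))
                           refl (den y) (den x))) (ℕ.+-mono-≤ x≤1 y≤1))
  (link (adjacent (linℕ≡ det
                    (solveℕ 4 (λ a b c d → a ⊠ (b ⊞ c) ⊞ ((conℕ 1) ⊞ d ⊠ c)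
                        ⊜ (conℕ 1) ⊞ (d ⊞ a) ⊠ c ⊞ a ⊠ b)
                      refl (num y) (den x) (den y) (num x)))
    (linℕ ((ℕ.≤-reflexive (sym eq)) ⊕ℕ y≥1)
      (solveℕ 3 (λ a b c → (conℕ 1) ⊞ ((conℕ 1) ⊞ a) ⊞ (b ⊞ c ⊞ c)
          ⊜ b ⊞ c ⊞ c ⊞ ((conℕ 1) ⊞ a ⊞ (conℕ 1)))
        refl Q (den x) (den y)))
    (ℕ.m≤n⇒m≤1+n y≤Q) y≥1 y≤1)
  (insertMediants-chain y≥1 y≤1 ch))

farey-chain : ∀ q → Chain (suc q) (0 , 1) (farey (suc q))
farey-chain zero = link (adjacent refl (s≤s (s≤s z≤n)) (s≤s z≤n) (s≤s z≤n) (s≤s z≤n)) end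
farey-chain (suc q) = insertMediants-chain (s≤s z≤n) z≤n (farey-chain q)

denominators : Pair → List Pair → List Pair
denominators x []       = []
denominators x (y ∷ ys) = (den x , den y) ∷ denominators y ys

∑-insertMediants : ∀ {Q x ys} F → Chain Q x ys →
                   ∑ (denominators x (insertMediants (suc Q) x ys)) F ≡ ∑ (denominators x ys) (mediants Q F)
∑-insertMediants F end = refl
∑-insertMediants {Q} {x} {y ∷ ys} F (link (adjacent _ Q< _ _ _) ch) with den x ℕ.+ den y ℕ.≟ suc Q | suc
    Q ℕ.<? den x ℕ.+ den y
... | yes eq | yes lt = ⊥-elim (ℕ.<-irrefl (sym eq) lt)
... | no neq | no ≮ = ⊥-elim (≮ (ℕ.≤∧≢⇒< Q< (neq ∘ sym)))
... | no _ | yes _ = trans (cong (F (den x , den y) +_) (∑-insertMediants F ch))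
  (solve 4 (λ a b c d → a :+ b
      := (con 0ℚ) :* (c :+ d) :+ (con 1ℚ) :* a :+ b)
    refl (F (den x , den y)) (∑ (denominators y ys) (mediants Q F)) (F (den x , suc Q)) (F (suc Q , den y)))
... | yes eq | no _ = trans (cong₂ (λ q r → F (den x , q) + (F (q , den y) + r)) eq (∑-insertMediants F ch))
  (solve 4 (λ a b c d → a :+ (b :+ c)
      := (con 1ℚ) :* (a :+ b) :+ (con 0ℚ) :* d :+ c)
    refl (F (den x , suc Q)) (F (suc Q , den y)) (∑ (denominators y ys) (mediants Q F)) (F (den x , den y)))

𝟙-coprime : Pair → ℚ
𝟙-coprime s = 𝟙 (coprime? (proj₁ s) (proj₂ s))

coprime-antidiagonal : ∀ {a b m} → a ℕ.+ b ≡ m → (Coprime a b → Coprime a m) × (Coprime a m → Coprime a b)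
coprime-antidiagonal {a} {b} refl =
  (λ cop (d∣a , d∣m) → cop (d∣a , ∣.∣m+n∣m⇒∣n d∣m d∣a)) ,
  (λ cop (d∣a , d∣b) → cop (d∣a , ∣.∣m∣n⇒∣m+n d∣a d∣b))

-- Both sides satisfy the same recursion in Q. On the left a mediant is inserted; on the right
-- `∑-L-suc` does the same, because on the antidiagonal a + b = m the pairs (a , b), (a , m) and (m
-- , b) are coprime together. The new diagonal pair is not coprime. It need not be shown separately
-- that every coprime pair occurs once.
∑-denominators : ∀ q F → ∑ (denominators (0 , 1) (farey (suc q))) F ≡ ∑ (L (suc q)) (λ s → 𝟙-coprime s * F s)
∑-denominators zero F = sym (trans (∑-L-suc 0 _) (trans (cong (_+ (𝟙-coprime (1 , 1) * F (1 , 1))) (L0 _))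
  (solve 1 (λ a → (con 0ℚ) :+ (con 1ℚ) :* a := a :+ (con 0ℚ)) refl (F (1 , 1)))))
∑-denominators (suc q) F = begin
  ∑ (denominators (0 , 1) (farey (suc (suc q)))) F        ≡⟨ ∑-insertMediants F (farey-chain q) ⟩
  ∑ (denominators (0 , 1) (farey Q)) (mediants Q F)       ≡⟨ ∑-denominators q (mediants Q F) ⟩
  ∑ (L Q) (λ s → 𝟙-coprime s * mediants Q F s)            ≡⟨ ∑-cong (L Q) (λ {s} _ → pointwise s) ⟩
  ∑ (L Q) (mediants Q F′)                                 ≡⟨ (solve 2 (λ a b → a
        := a :+ (con 0ℚ) :* b)
      refl (∑ (L Q) (mediants Q F′)) (F (suc Q , suc Q))) ⟩
  ∑ (L Q) (mediants Q F′) + 0ℚ * F (suc Q , suc Q)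
    ≡⟨ cong (λ d → ∑ (L Q) (mediants Q F′) + d * F (suc Q , suc Q))
        (𝟙-no (coprime? (suc Q) (suc Q)) not-coprime) ⟨
  ∑ (L Q) (mediants Q F′) + F′ (suc Q , suc Q)            ≡⟨ ∑-L-suc Q F′ ⟨
  ∑ (L (suc Q)) F′                                        ∎
  where
  open ≡-Reasoning
  Q = suc q
  F′ : Pair → ℚ
  F′ s = 𝟙-coprime s * F s
  not-coprime : ¬ Coprime (suc Q) (suc Q)
  not-coprime cop with cop (∣.∣-refl , ∣.∣-refl)
  ... | ()
  pointwise : ∀ s → 𝟙-coprime s * mediants Q F s ≡ mediants Q F′ s
  pointwise (a , b) with a ℕ.+ b ℕ.≟ suc Q
  ... | no _ = solve 7 (λ a b c d e f g → a :* ((con 0ℚ) :* (b :+ c) :+ d :* e)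
                   := (con 0ℚ) :* (f :+ g) :+ d :* (a :* e))
                 refl (𝟙-coprime (a , b)) (F (a , suc Q)) (F (suc Q , b)) (𝟙 (suc Q ℕ.<? a ℕ.+ b))
                     (F (a , b)) (F′ (a , suc Q)) (F′ (suc Q , b))
  ... | yes eq = trans
    (solve 5 (λ a b c d e → a :* ((con 1ℚ) :* (b :+ c) :+ d :* e)
        := (con 1ℚ) :* (a :* b :+ a :* c) :+ d :* (a :* e))
      refl (𝟙-coprime (a , b)) (F (a , suc Q)) (F (suc Q , b)) (𝟙 (suc Q ℕ.<? a ℕ.+ b)) (F (a , b)))
    (cong₂ (λ u v → 1ℚ * (u * F (a , suc Q) + v * F (suc Q , b)) + 𝟙 (suc Q ℕ.<? a ℕ.+ b) * F′ (a , b))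
      (𝟙-⇔ (coprime? a b) (coprime? a (suc Q)) (proj₁ (coprime-antidiagonal eq))
          (proj₂ (coprime-antidiagonal eq)))
      (𝟙-⇔ (coprime? a b) (coprime? (suc Q) b)
        (λ cop → Coprime.sym (proj₁ (coprime-antidiagonal eq′) (Coprime.sym cop)))
        (λ cop → Coprime.sym (proj₂ (coprime-antidiagonal eq′) (Coprime.sym cop)))))
    where
    eq′ : b ℕ.+ a ≡ suc Q
    eq′ = trans (ℕ.+-comm b a) eq

-- Denominators along the chain form a T-orbit

module _ {Q : ℕ} where

  -- Subtracting the two determinant equations gives that den y divides num y (den z + den x). It is
  -- coprime to num y, so it divides den z + den x, and the quotient is the index.
  T-adjacent : ∀ {x y z} → Adjacent Q x y → Adjacent Q y z → T Q (den x , den y) ≡ (den y , den z)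
  T-adjacent {x} {y} {z} (adjacent det₁ _ _ y≥1 _) (adjacent det₂ Q<₂ z≤Q _ _) = T-unique
      {k = _∣ℕ_.quotient dy∣} y≥1 (next (_∣ℕ_.equality dy∣) z≤Q Q<₂)
    where
    nx = num x
    ny = num y
    nz = num z
    dx = den x
    dy = den y
    dz = den z
    both : ny ℕ.* (dz ℕ.+ dx) ≡ (nz ℕ.+ nx) ℕ.* dy
    both = linℕ≡ (cong₂ ℕ._+_ det₁ (sym det₂))
             (solveℕ 6 (λ a b c d e f → a ⊠ (b ⊞ c) ⊞ ((conℕ 1) ⊞ d ⊠ e ⊞ f ⊠ e)
                 ⊜ (f ⊞ d) ⊠ e ⊞ (a ⊠ c ⊞ ((conℕ 1) ⊞ a ⊠ b)))
               refl ny dz dx nx dy nz)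
    cop : Coprime dy ny
    cop {d} (d∣dy , d∣ny) = ∣.∣1⇒≡1
        (∣.∣m+n∣m⇒∣n (subst (d ∣ℕ_) (trans det₁ (ℕ.+-comm 1 (nx ℕ.* dy))) (∣.∣m⇒∣m*n dx d∣ny))
            (∣.∣n⇒∣m*n nx d∣dy))
    dy∣ : dy ∣ℕ (dz ℕ.+ dx)
    dy∣ = Coprime.coprime-divisor cop (subst (dy ∣ℕ_) (sym both) (∣.∣n⇒∣m*n (nz ℕ.+ nx) ∣.∣-refl))

  orbit : ∀ {x y ys} → Chain Q x (y ∷ ys) →
          denominators x (y ∷ ys) ≡ List.applyUpTo (λ r → T^ Q r (den x , den y)) (suc (length ys))
  orbit (link _ end) = refl
  orbit {x} {y} (link adj ch@(link {y = z} {ys = zs} adj′ _)) = cong ((den x , den y) ∷_)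
    (trans (orbit ch) (cong (λ s → List.applyUpTo (λ r → T^ Q r s) (suc (length zs)))
        (sym (T-adjacent adj adj′))))

  first-denominator : ∀ {y} → Adjacent Q (0 , 1) y → den y ≡ Q
  first-denominator (adjacent _ Q< y≤Q _ _) = ℕ.≤-antisym y≤Q (ℕ.≤-pred Q<)

  -- The last two denominators are Q and 1, and T sends (Q , 1) to (1 , Q) with index 2Q. The orbit
  -- thus closes up where the sequence is continued periodically.
  orbit-end : ∀ {x y ys} → den x ℕ.≤ Q → Chain Q x (y ∷ ys) → T^ Q (suc (length ys)) (den x , den y) ≡ (1 , Q)
  orbit-end {x} x≤Q (link (adjacent _ Q< y≤Q _ _) end) =
    T-unique {k = Q ℕ.+ Q} (s≤s z≤n) (next (trans (cong (Q ℕ.+_) x≡Q) (solveℕ 1 (λ a → a ⊞ a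
          ⊜ (a ⊞ a) ⊠ (conℕ 1))
        refl Q)) ℕ.≤-refl ℕ.≤-refl)
    where
    x≡Q : den x ≡ Q
    x≡Q = ℕ.≤-antisym x≤Q (ℕ.≤-pred (subst (Q ℕ.<_) (ℕ.+-comm (den x) 1) Q<))
  orbit-end {x} {y} {z ∷ zs} x≤Q (link adj ch@(link adj′ _)) =
    trans (cong (T^ Q (suc (length zs))) (T-adjacent adj adj′)) (orbit-end (Adjacent.y≤Q adj) ch)

-- The sorted list 𝓕 Q is the chain

toℚ : Pair → ℚ
toℚ (a , zero)  = 0ℚ
toℚ (a , suc q) = ℤ.+ a / suc q

toℚ≡ : ∀ {a q} (c : Coprime a (suc q)) → toℚ (a , suc q) ≡ mkℚ (ℤ.+ a) q c
toℚ≡ c = ℚ.normalize-coprime c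

toℚ-injective : ∀ {x y} → 1 ℕ.≤ den x → 1 ℕ.≤ den y → Coprime (num x) (den x) → Coprime (num y) (den y)
    → toℚ x ≡ toℚ y → x ≡ y
toℚ-injective {a , suc p} {b , suc q} _ _ c d eq = cong₂ _,_ (ℤ.+-injective (proj₁ eqs)) (cong suc (proj₂ eqs))
  where
  eqs : ℤ.+ a ≡ ℤ.+ b × p ≡ q
  eqs = ℚ.mkℚ-injective (trans (sym (toℚ≡ c)) (trans eq (toℚ≡ d)))

record Farey (Q : ℕ) (x : Pair) : Set where
  constructor isFarey
  field
    num≥1 : 1 ℕ.≤ num x
    num≤den : num x ℕ.≤ den x
    den≤Q : den x ℕ.≤ Q
    coprime : Coprime (num x) (den x)

module _ {Q : ℕ} where

  adjacent⇒coprime : ∀ {x y} → Adjacent Q x y → Coprime (num y) (den y)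
  adjacent⇒coprime {x} {y} adj {d} (d∣n , d∣d) = ∣.∣1⇒≡1 (∣.∣m+n∣m⇒∣n
    (subst (d ∣ℕ_) (trans (Adjacent.det adj) (ℕ.+-comm 1 (num x ℕ.* den y))) (∣.∣m⇒∣m*n (den x) d∣n))
        (∣.∣n⇒∣m*n (num x) d∣d))

  adjacent⇒num≥1 : ∀ {x y} → Adjacent Q x y → 1 ℕ.≤ num y
  adjacent⇒num≥1 {x} {zero , _} adj with Adjacent.det adj
  ... | ()
  adjacent⇒num≥1 {x} {suc _ , _} adj = s≤s z≤n

  chain⇒Farey : ∀ {x ys y} → Chain Q x ys → y ∈ ys → Farey Q y
  chain⇒Farey (link adj ch) (here refl) = isFarey (adjacent⇒num≥1 adj) (Adjacent.y≤1 adj)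
      (Adjacent.y≤Q adj) (adjacent⇒coprime adj)
  chain⇒Farey (link adj ch) (there y∈) = chain⇒Farey ch y∈

  -- Walking along the chain, z is either met or lies strictly between two neighbours. In the latter
  -- case its denominator is at least the sum of theirs, which exceeds Q.
  Farey⇒chain : ∀ {x ys z} → Chain Q x ys → Farey Q z → num x ℕ.* den z ℕ.< num z ℕ.* den x → z ∈ ys
  Farey⇒chain {z = a , q} end fz lt = ⊥-elim
      (ℕ.<⇒≱ lt (subst₂ ℕ._≤_ (sym (ℕ.*-identityʳ a)) (sym (ℕ.*-identityˡ q)) (Farey.num≤den fz)))
  Farey⇒chain {x} {y ∷ ys} {z} (link adj ch) fz lt with ℕ.<-cmp (num y ℕ.* den z) (num z ℕ.* den y)
  ... | Tri.tri< y<z _ _ = there (Farey⇒chain ch fz y<z)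
  ... | Tri.tri≈ _ y≡z _ = here (cong₂ _,_ num≡ den≡)
    where
    den≡ : den z ≡ den y
    den≡ = ∣.∣-antisym
      (Coprime.coprime-divisor (Coprime.sym (Farey.coprime fz))
          (subst (den z ∣ℕ_) y≡z (∣.∣n⇒∣m*n (num y) ∣.∣-refl)))
      (Coprime.coprime-divisor (Coprime.sym (adjacent⇒coprime adj))
          (subst (den y ∣ℕ_) (sym y≡z) (∣.∣n⇒∣m*n (num z) ∣.∣-refl)))
    num≡ : num z ≡ num y
    num≡ = sym (ℕ.*-cancelʳ-≡ (num y) (num z) (den y) {{ℕ.>-nonZero (Adjacent.y≥1 adj)}}
        (trans (cong (num y ℕ.*_) (sym den≡)) y≡z))
  ... | Tri.tri> _ _ y>z = ⊥-elim (ℕ.<⇒≱ (Adjacent.Q< adj) (ℕ.≤-trans between (Farey.den≤Q fz)))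
    where
    -- q = q (n_y d_x - n_x d_y) = d_x (n_y q - a d_y) + d_y (a d_x - n_x q) ≥ d_x + d_y
    between : den x ℕ.+ den y ℕ.≤ den z
    between = linℕ ((ℕ.*-monoʳ-≤ (den x) y>z) ⊕ℕ (ℕ.*-monoʳ-≤ (den y) lt) ⊕ℕ
        (ℕ.≤-reflexive (cong (ℕ._* den z) (Adjacent.det adj))))
                (solveℕ 6 (λ a b c d e f → a ⊞ b ⊞ (a ⊠ (c ⊠ d) ⊞ b ⊠ (e ⊠ a) ⊞ ((conℕ 1) ⊞ f ⊠ b) ⊠ d)
                    ⊜ d ⊞ (a ⊠ ((conℕ 1) ⊞ e ⊠ b) ⊞ b ⊠ ((conℕ 1) ⊞ f ⊠ d) ⊞ c ⊠ a ⊠ d))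
                  refl (den x) (den y) (num y) (den z) (num z) (num x))

  chain-increasing : ∀ {x ys} → Chain Q x ys → All (λ y → num x ℕ.* den y ℕ.< num y ℕ.* den x) ys
  chain-increasing end = []
  chain-increasing {x} (link {y = y} adj ch) = first ∷ All.tabulate λ {z} z∈ → step (chain⇒Farey ch z∈)
      (All.lookup (chain-increasing ch) z∈)
    where
    first : num x ℕ.* den y ℕ.< num y ℕ.* den x
    first = ℕ.≤-reflexive (sym (Adjacent.det adj))
    step : ∀ {z} → Farey Q z → num y ℕ.* den z ℕ.< num z ℕ.* den y → num x ℕ.* den z ℕ.< num z ℕ.* den x
    step {z} fz lt = ℕ.*-cancelˡ-< (den y) _ _
        (linℕ ((ℕ.*-monoˡ-≤ (den z) first) ⊕ℕ (ℕ.*-monoˡ-≤ (den x) (ℕ.<⇒≤ lt)) ⊕ℕ q≥1)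
        (solveℕ 6 (λ a b c d e f → (conℕ 1) ⊞ a ⊠ (b ⊠ c) ⊞ (d ⊠ e ⊠ c ⊞ f ⊠ a ⊠ e ⊞ c)
            ⊜ a ⊠ (f ⊠ e) ⊞ (((conℕ 1) ⊞ b ⊠ a) ⊠ c ⊞ d ⊠ c ⊠ e ⊞ (conℕ 1)))
          refl (den y) (num x) (den z) (num y) (den x) (num z)))
      where q≥1 = ℕ.≤-trans (Farey.num≥1 fz) (Farey.num≤den fz)

  toℚ-< : ∀ {x y} → 1 ℕ.≤ den x → 1 ℕ.≤ den y → num x ℕ.* den y ℕ.< num y ℕ.* den x → toℚ x < toℚ y
  toℚ-< {a , suc p} {b , suc q} _ _ lt = ℚ.toℚᵘ-cancel-<
    (ℚᵘ.<-respˡ-≃ (ℚᵘ.≃-sym (ℚ.toℚᵘ-fromℚᵘ (ℚᵘ.mkℚᵘ (ℤ.+ a) p)))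
      (ℚᵘ.<-respʳ-≃ (ℚᵘ.≃-sym (ℚ.toℚᵘ-fromℚᵘ (ℚᵘ.mkℚᵘ (ℤ.+ b) q)))
        (ℚᵘ.*<* (subst₂ ℤ._<_ (ℤ.pos-* a (suc q)) (ℤ.pos-* b (suc p)) (ℤ.+<+ lt)))))

  chain-sorted : ∀ {x ys} → Chain Q x ys → AllPairs _<_ (map toℚ ys)
  chain-sorted end = []
  chain-sorted (link {y = y} adj ch) = All.map⁺ (All.tabulate λ {z} z∈ →
    toℚ-< (Adjacent.y≥1 adj) (let fz = chain⇒Farey ch z∈ in ℕ.≤-trans (Farey.num≥1 fz) (Farey.num≤den fz)) (All.lookup (chain-increasing ch) z∈))
    ∷ chain-sorted ch

private
  fractionsWithDenominator : ℕ → List ℚ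
  fractionsWithDenominator q = map (λ a → toℚ (suc a , suc q))
      (filter (λ a → coprime? (suc a) (suc q)) (upTo (suc q)))

  ∈withDenominator⁻ : ∀ {q r} → r ∈ fractionsWithDenominator q → ∃[ a ]
      (a ℕ.≤ q × Coprime (suc a) (suc q) × r ≡ toℚ (suc a , suc q))
  ∈withDenominator⁻ {q} r∈ =
    let a , a∈ , eq = ∈.∈-map⁻ (λ a → toℚ (suc a , suc q)) r∈
        a∈′ , cop = ∈.∈-filter⁻ (λ a → coprime? (suc a) (suc q)) {xs = upTo (suc q)} a∈
    in a , ℕ.≤-pred (∈.∈-upTo⁻ a∈′) , cop , eq

∈fareyFractions⁻ : ∀ {Q r} → r ∈ fareyFractions Q → ∃[ x ] (Farey Q x × r ≡ toℚ x)
∈fareyFractions⁻ {Q} r∈ =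
  let q , q∈ , r∈q = find (∈.∈-concatMap⁻ fractionsWithDenominator {xs = upTo Q} r∈)
      a , a≤q , cop , eq = ∈withDenominator⁻ r∈q
  in (suc a , suc q) , isFarey (s≤s z≤n) (s≤s a≤q) (∈.∈-upTo⁻ q∈) cop , eq

∈fareyFractions⁺ : ∀ {Q x} → Farey Q x → toℚ x ∈ fareyFractions Q
∈fareyFractions⁺ {Q} {suc a , suc q} (isFarey _ (s≤s a≤q) q<Q cop) =
  ∈.∈-concatMap⁺ fractionsWithDenominator {xs = upTo Q} (lose (∈.∈-upTo⁺ q<Q)
    (∈.∈-map⁺ _ (∈.∈-filter⁺ (λ a → coprime? (suc a) (suc q)) (∈.∈-upTo⁺ (s≤s a≤q)) cop)))

unique-fareyFractions : ∀ Q → Unique (fareyFractions Q)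
unique-fareyFractions Q = Unique.concat⁺
  (All.map⁺ (All.tabulate λ {q} _ → unique-row q))
  (AllPairs.map⁺ (AllPairs.map disjoint (Unique.upTo⁺ Q)))
  where
  disjoint : ∀ {p q} → p ≢ q → ∀ {r} → ¬ (r ∈ fractionsWithDenominator p × r ∈ fractionsWithDenominator q)
  disjoint p≢q (r∈p , r∈q) =
    let a , _ , cop , eq = ∈withDenominator⁻ r∈p
        b , _ , cop′ , eq′ = ∈withDenominator⁻ r∈q
    in p≢q (ℕ.suc-injective (cong proj₂ (toℚ-injective (s≤s z≤n) (s≤s z≤n) cop cop′ (trans (sym eq) eq′))))
  unique-map : ∀ {q xs} → All (λ a → Coprime (suc a) (suc q)) xs → Unique xs → Unique
      (map (λ a → toℚ (suc a , suc q)) xs)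
  unique-map [] [] = []
  unique-map {q} {x ∷ xs} (cop ∷ cops) (x# ∷ u) = All.map⁺ (All.tabulate λ {a} a∈ eq → All.lookup x# a∈
    (ℕ.suc-injective (cong proj₁ (toℚ-injective {suc x , suc q} {suc a , suc q} (s≤s z≤n) (s≤s z≤n) cop
        (All.lookup cops a∈) eq)))) ∷ unique-map cops u
  unique-row : ∀ q → Unique (fractionsWithDenominator q)
  unique-row q = unique-map (All.all-filter (λ a → coprime? (suc a) (suc q)) (upTo (suc q)))
      (Unique.filter⁺ (λ a → coprime? (suc a) (suc q)) (Unique.upTo⁺ (suc q)))

sort-unique : ∀ xs {ys} → Unique xs → AllPairs _<_ ys → (∀ {r} → r ∈ xs → r ∈ ys) → (∀ {r} → r ∈ ys → r ∈ xs) →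
              Sort.sort ℚ.≤-decTotalOrder xs ≡ ys
sort-unique xs unique increasing to from = Pointwise.Pointwise-≡⇒≡ (Sorted.↗↭↗⇒≋ totalOrder
    (Sort.sort-↗ ℚ.≤-decTotalOrder xs)
    (Sorted.AllPairs⇒Sorted totalOrder (AllPairs.map ℚ.<⇒≤ increasing))
    (↭.↭⇒↭ₛ (↭.trans (Sort.sort-↭ ℚ.≤-decTotalOrder xs)
      (∼bag⇒↭ (unique∧set⇒bag unique (AllPairs.map ℚ.<⇒≢ increasing) (mk⇔ to from))))))
  where totalOrder = DecTotalOrder.totalOrder ℚ.≤-decTotalOrder

𝓕≡farey : ∀ q → 𝓕 (suc q) ≡ map toℚ (farey (suc q))
𝓕≡farey q = sort-unique (fareyFractions (suc q)) (unique-fareyFractions (suc q)) (chain-sorted ch) to from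
  where
  ch : Chain (suc q) (0 , 1) (farey (suc q))
  ch = farey-chain q
  to : ∀ {r} → r ∈ fareyFractions (suc q) → r ∈ map toℚ (farey (suc q))
  to {r} r∈ = let x , fx , eq = ∈fareyFractions⁻ r∈ in
    subst (_∈ map toℚ (farey (suc q))) (sym eq)
      (∈.∈-map⁺ toℚ (Farey⇒chain ch fx (subst (0 ℕ.<_) (sym (ℕ.*-identityʳ (num x))) (Farey.num≥1 fx))))
  from : ∀ {r} → r ∈ map toℚ (farey (suc q)) → r ∈ fareyFractions (suc q)
  from {r} r∈ = let x , x∈ , eq = ∈.∈-map⁻ toℚ r∈ in
    subst (_∈ fareyFractions (suc q)) (sym eq) (∈fareyFractions⁺ (chain⇒Farey ch x∈))

-- The index of γᵢ

↧ₙ-+ℤ : ∀ p z → ↧ₙ (p + z / 1) ≡ ↧ₙ p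
↧ₙ-+ℤ p@(mkℚ n d c) z = cong ↧ₙ_ (ℚ.toℚᵘ-injective {p + z / 1} {mkℚ (n ℤ.+ z ℤ.* ℤ.+ suc d) d cop} (ℚᵘ.≃-trans
  (ℚ.toℚᵘ-homo-+ p (z / 1)) (ℚᵘ.≃-trans (ℚᵘ.+-cong {ℚ.toℚᵘ p} ℚᵘ.≃-refl (ℚ.toℚᵘ-fromℚᵘ (ℚᵘ.mkℚᵘ z 0)))
    (ℚᵘ.*≡* (cong₂ ℤ._*_ (cong (ℤ._+ z ℤ.* ℤ.+ suc d) (ℤ.*-identityʳ n))
        (cong ℤ.+_ (sym (ℕ.*-identityʳ (suc d)))))))))
  where
  cop : Coprime ℤ.∣ n ℤ.+ z ℤ.* ℤ.+ suc d ∣ (suc d)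
  cop {e} (e∣n+zd , e∣d) = Coprime.recompute c
      (ℤ∣.∣⇒∣ᵤ (ℤ∣.∣m+n∣n⇒∣m {ℤ.+ e} {n} {z ℤ.* ℤ.+ suc d} (ℤ∣.∣ᵤ⇒∣ e∣n+zd) (ℤ∣.∣n⇒∣m*n z (ℤ∣.∣ᵤ⇒∣ e∣d))) , e∣d)

ratio : ∀ x d .{{_ : ℕ.NonZero d}} k → x ≡ k ℕ.* d → ℤ.+ x / d ≡ ι k
ratio x (suc d) k refl = trans
  (ℚ.fromℚᵘ-cong {ℚᵘ.mkℚᵘ (ℤ.+ (k ℕ.* suc d)) d} {ℚᵘ.mkℚᵘ (ℤ.+ k) 0}
      (ℚᵘ.*≡* (trans (ℤ.*-identityʳ _) (ℤ.pos-* k (suc d)))))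
  (sym (ι≡fromℕ k))

↧ₙ-toℚ : ∀ {x} → 1 ℕ.≤ den x → Coprime (num x) (den x) → ↧ₙ (toℚ x) ≡ den x
↧ₙ-toℚ {a , suc q} _ cop = cong ↧ₙ_ (toℚ≡ cop)

module _ {Q : ℕ} where

  ↧ₙ-lookup : ∀ {x y ys} → Chain Q x (y ∷ ys) → ∀ (k : Fin (length (map toℚ (y ∷ ys)))) →
              ↧ₙ (List.lookup (map toℚ (y ∷ ys)) k) ≡ proj₂ (T^ Q (toℕ k) (den x , den y))
  ↧ₙ-lookup (link adj ch) Fin.zero = ↧ₙ-toℚ (Adjacent.y≥1 adj) (adjacent⇒coprime adj)
  ↧ₙ-lookup (link adj ch@(link adj′ _)) (Fin.suc k) = trans (↧ₙ-lookup ch k)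
    (cong (λ s → proj₂ (T^ Q (toℕ k) s)) (sym (T-adjacent adj adj′)))

  T^-period : ∀ n {s} → 1 ℕ.≤ n → T^ Q n s ≡ s → ∀ j → .{{_ : ℕ.NonZero n}} → T^ Q (j ℕ.% n) s ≡ T^ Q j s
  T^-period n {s} _ per j = sym (begin
    T^ Q j s                                    ≡⟨ cong (λ i → T^ Q i s)
        (trans (ℕ.m≡m%n+[m/n]*n j n) (ℕ.+-comm (j ℕ.% n) _)) ⟩
    T^ Q (j ℕ./ n ℕ.* n ℕ.+ j ℕ.% n) s          ≡⟨ T^-+ Q (j ℕ./ n ℕ.* n) (j ℕ.% n) s ⟩
    T^ Q (j ℕ.% n) (T^ Q (j ℕ./ n ℕ.* n) s)     ≡⟨ cong (T^ Q (j ℕ.% n)) (multiple (j ℕ./ n)) ⟩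
    T^ Q (j ℕ.% n) s                            ∎)
    where
    open ≡-Reasoning
    multiple : ∀ i → T^ Q (i ℕ.* n) s ≡ s
    multiple zero = refl
    multiple (suc i) = trans (T^-+ Q n (i ℕ.* n) s) (trans (cong (T^ Q (i ℕ.* n)) per) (multiple i))

opaque
  unfolding T

  proj₁-T : ∀ n s → proj₁ (T n s) ≡ proj₂ s
  proj₁-T n s = refl

-1%ℕ : ∀ n → suc (-[1+ 0 ] ℤ.%ℕ suc n) ≡ suc n
-1%ℕ zero = refl
-1%ℕ (suc n) = refl

module _ {Q : ℕ} {y ys} (ch : Chain Q (0 , 1) (y ∷ ys)) where

  private
    s₀ : Pair
    s₀ = 1 , den y

    n : ℕ
    n = length (map toℚ (y ∷ ys))

    n≡ : n ≡ suc (length ys)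
    n≡ = List.length-map toℚ (y ∷ ys)

    adj : Adjacent Q (0 , 1) y
    adj = case ch of λ { (link a _) → a }

    1≤Q : 1 ℕ.≤ Q
    1≤Q = ℕ.≤-trans (Adjacent.y≥1 adj) (Adjacent.y≤Q adj)

    period : T^ Q n s₀ ≡ s₀
    period = trans (cong (λ i → T^ Q i s₀) n≡)
        (trans (orbit-end 1≤Q ch) (cong (1 ,_) (sym (first-denominator adj))))

  s₀∈L : (1 , den y) ∈ L Q
  s₀∈L = ∈L⁺ (inL 1≤Q (Adjacent.y≤Q adj) (Adjacent.Q< adj))

  ↧ₙ-extend : ∀ j → ↧ₙ (extend (map toℚ (y ∷ ys)) (ℤ.+ suc j)) ≡ proj₂ (T^ Q j s₀)
  ↧ₙ-extend j = begin
    ↧ₙ (List.lookup (map toℚ (y ∷ ys)) k + (ℤ.+ (j ℕ./ n)) / 1)   ≡⟨ ↧ₙ-+ℤ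
        (List.lookup (map toℚ (y ∷ ys)) k) (ℤ.+ (j ℕ./ n)) ⟩
    ↧ₙ (List.lookup (map toℚ (y ∷ ys)) k)                         ≡⟨ ↧ₙ-lookup ch k ⟩
    proj₂ (T^ Q (toℕ k) s₀)                                       ≡⟨ cong (λ i → proj₂ (T^ Q i s₀))
        (Fin.toℕ-fromℕ< (ℤ.n%ℕd<d (ℤ.+ j) n)) ⟩
    proj₂ (T^ Q (j ℕ.% n) s₀)                                     ≡⟨ cong proj₂
        (T^-period n (s≤s z≤n) period j) ⟩
    proj₂ (T^ Q j s₀)                                             ∎
    where
    open ≡-Reasoning
    k : Fin n
    k = fromℕ< (ℤ.n%ℕd<d (ℤ.+ j) n)

  -- γ₀ = γ_N - 1 = 0. It is the only index with i - 1 negative that occurs, so the division of -1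
  -- by the length is computed by hand.
  ↧ₙ-extend-0 : ↧ₙ (extend (map toℚ (y ∷ ys)) (ℤ.+ 0)) ≡ 1
  ↧ₙ-extend-0 = begin
    ↧ₙ (List.lookup (map toℚ (y ∷ ys)) k + (-[1+ 0 ] ℤ./ℕ n) / 1)  ≡⟨ ↧ₙ-+ℤ
        (List.lookup (map toℚ (y ∷ ys)) k) (-[1+ 0 ] ℤ./ℕ n) ⟩
    ↧ₙ (List.lookup (map toℚ (y ∷ ys)) k)                          ≡⟨ ↧ₙ-lookup ch k ⟩
    proj₂ (T^ Q (toℕ k) s₀)                                        ≡⟨ proj₁-T Q (T^ Q (toℕ k) s₀) ⟨
    proj₁ (T Q (T^ Q (toℕ k) s₀))                                  ≡⟨ cong proj₁ (T^-suc Q (toℕ k) s₀) ⟨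
    proj₁ (T^ Q (suc (toℕ k)) s₀)                                  ≡⟨ cong (λ i → proj₁ (T^ Q i s₀))
        (trans (cong suc (Fin.toℕ-fromℕ< (ℤ.n%ℕd<d -[1+ 0 ] n))) (-1%ℕ (length (map toℚ ys)))) ⟩
    proj₁ (T^ Q n s₀)                                              ≡⟨ cong proj₁ period ⟩
    1                                                              ∎
    where
    open ≡-Reasoning
    k : Fin n
    k = fromℕ< (ℤ.n%ℕd<d -[1+ 0 ] n)

  ↧ₙ-orbit : ∀ j → ↧ₙ (extend (map toℚ (y ∷ ys)) (ℤ.+ j)) ≡ proj₁ (T^ Q j s₀)
  ↧ₙ-orbit zero = ↧ₙ-extend-0
  ↧ₙ-orbit (suc j) = trans (↧ₙ-extend j) (sym (trans (cong proj₁ (T^-suc Q j s₀)) (proj₁-T Q (T^ Q j s₀))))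

  module _ (𝓕≡ : 𝓕 Q ≡ map toℚ (y ∷ ys)) where

    private
      ↧ₙγ : ∀ j → ↧ₙ (γ Q (ℤ.+ j)) ≡ proj₁ (T^ Q j s₀)
      ↧ₙγ j = trans (cong (λ xs → ↧ₙ (extend xs (ℤ.+ j))) 𝓕≡) (↧ₙ-orbit j)

    -- The pair reached from the start after j steps consists of the denominators of γ_j and
    -- γ_{j+1}, so it carries the index of γ_{j+1}; hence the shift by one.
    ν≡κ : ∀ j → ν Q (ℤ.+ suc j) ≡ ι (κ Q (T^ Q j s₀))
    ν≡κ j = ratio (↧ₙ (γ Q (ℤ.+ j)) ℕ.+ ↧ₙ (γ Q (ℤ.+ suc j ℤ.+ ℤ.+ 1))) (↧ₙ (γ Q (ℤ.+ suc j))) (κ Q s) (begin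
      ↧ₙ (γ Q (ℤ.+ j)) ℕ.+ ↧ₙ (γ Q (ℤ.+ suc j ℤ.+ ℤ.+ 1))
        ≡⟨ cong₂ ℕ._+_ (↧ₙγ j) (trans (cong (λ i → ↧ₙ (γ Q (ℤ.+ i))) (ℕ.+-comm (suc j) 1))
            (↧ₙγ (suc (suc j)))) ⟩
      proj₁ s ℕ.+ proj₁ (T^ Q (suc (suc j)) s₀)
        ≡⟨ cong (λ u → proj₁ s ℕ.+ proj₁ u) (trans (T^-suc Q (suc j) s₀) (cong (T Q) (T^-suc Q j s₀))) ⟩
      proj₁ s ℕ.+ proj₁ (T Q (T Q s))
        ≡⟨ cong (λ u → proj₁ s ℕ.+ u) (trans (proj₁-T Q (T Q s))
            (cong proj₂ (T-unique (InL.1≤b i) (proj₂ nx)))) ⟩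
      proj₁ s ℕ.+ proj₁ nx
        ≡⟨ trans (ℕ.+-comm (proj₁ s) (proj₁ nx)) (Next.c+a≡kb (proj₂ nx)) ⟩
      κ Q s ℕ.* proj₂ s
        ≡⟨ cong (κ Q s ℕ.*_) (trans (↧ₙγ (suc j)) (trans (cong proj₁ (T^-suc Q j s₀)) (proj₁-T Q s))) ⟨
      κ Q s ℕ.* ↧ₙ (γ Q (ℤ.+ suc j)) ∎)
      where
      open ≡-Reasoning
      s : Pair
      s = T^ Q j s₀
      i : InL Q (proj₁ s) (proj₂ s)
      i = ∈L⁻ (T^-∈L j s₀∈L)
      nx : ∃[ c ] Next Q (proj₁ s) (proj₂ s) c (κ Q s)
      nx = κ-next i

    product≡ : ∀ {m} (h : Vec ℕ m) j →
               Vec.foldr (λ _ → ℚ) _*_ 1ℚ (Vec.map (λ hⱼ → ν Q (ℤ.+ (suc j ℕ.+ hⱼ))) h) ≡ ι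
                   (prodV (atPositions h Q (T^ Q j s₀)))
    product≡ [] j = sym ι-1
    product≡ (p ∷ h) j = trans
      (cong₂ _*_ (trans (ν≡κ (j ℕ.+ p)) (cong (λ s → ι (κ Q s)) (T^-+ Q j p s₀))) (product≡ h j))
      (sym (ι-* (κ Q (T^ Q p (T^ Q j s₀))) _))

    term : ∀ {m} → Vec ℕ m → ℕ → ℚ
    term h i = ν Q (ℤ.+ i) * Vec.foldr (λ _ → ℚ) _*_ 1ℚ (Vec.map (λ hⱼ → ν Q (ℤ.+ (i ℕ.+ hⱼ))) h)

    N≡ : N Q ≡ suc (length ys)
    N≡ = trans (cong length 𝓕≡) n≡

    S≡∑ : ∀ {m} (h : Vec ℕ m) → S h Q ≡ ∑ (denominators (0 , 1) (y ∷ ys)) (Φ (0 ∷ h) Q)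
    S≡∑ h = begin
      S h Q                                                        ≡⟨⟩
      ∑ [1⋯ N Q ] (term h)                                         ≡⟨ ∑-map suc (upTo (N Q)) (term h) ⟩
      ∑ (upTo (N Q)) (term h ∘ suc)                                ≡⟨ ∑-cong (upTo (N Q)) (λ {j} _ → term≡ j) ⟩
      ∑ (upTo (N Q)) (Φ (0 ∷ h) Q ∘ λ j → T^ Q j s₀)               ≡⟨ ∑-map (λ j → T^ Q j s₀)
          (upTo (N Q)) (Φ (0 ∷ h) Q) ⟨
      ∑ (map (λ j → T^ Q j s₀) (upTo (N Q))) (Φ (0 ∷ h) Q)         ≡⟨ cong (λ l → ∑ l (Φ (0 ∷ h) Q))
          (List.map-upTo (λ j → T^ Q j s₀) (N Q)) ⟩
      ∑ (List.applyUpTo (λ j → T^ Q j s₀) (N Q)) (Φ (0 ∷ h) Q)     ≡⟨ cong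
          (λ l → ∑ (List.applyUpTo (λ j → T^ Q j s₀) l) (Φ (0 ∷ h) Q)) N≡ ⟩
      ∑ (List.applyUpTo (λ j → T^ Q j s₀) (suc (length ys))) (Φ (0 ∷ h) Q)
                                                                   ≡⟨ cong (λ l → ∑ l (Φ (0 ∷ h) Q))
                                                                       (orbit ch) ⟨
      ∑ (denominators (0 , 1) (y ∷ ys)) (Φ (0 ∷ h) Q)              ∎
      where
      open ≡-Reasoning
      term≡ : ∀ j → term h (suc j) ≡ Φ (0 ∷ h) Q (T^ Q j s₀)
      term≡ j = trans (cong₂ _*_ (ν≡κ j) (product≡ h j)) (sym (ι-* (κ Q (T^ Q j s₀)) _))

length-denominators : ∀ x ys → length (denominators x ys) ≡ length ys
length-denominators x [] = refl
length-denominators x (y ∷ ys) = cong suc (length-denominators y ys)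

S-Farey : ∀ {m} (h : Vec ℕ m) q → S h (suc q) ≡ ∑ (L (suc q)) (λ s → 𝟙-coprime s * Φ (0 ∷ h) (suc q) s)
S-Farey h q = trans (helper (farey (suc q)) (farey-chain q) (𝓕≡farey q)) (∑-denominators q (Φ (0 ∷ h) (suc q)))
  where
  helper : ∀ ys → Chain (suc q) (0 , 1) ys → 𝓕 (suc q) ≡ map toℚ ys → S h (suc q) ≡ ∑
      (denominators (0 , 1) ys) (Φ (0 ∷ h) (suc q))
  helper (y ∷ ys) ch eq = S≡∑ ch eq h

N-Farey : ∀ q → fromℕ (N (suc q)) ≡ ∑ (L (suc q)) 𝟙-coprime
N-Farey q = begin
  fromℕ (N (suc q))                                     ≡⟨ ι≡fromℕ (N (suc q)) ⟨
  ι (N (suc q))                                         ≡⟨ cong ι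
      (trans (cong length (𝓕≡farey q)) (List.length-map toℚ (farey (suc q)))) ⟩
  ι (length (farey (suc q)))                            ≡⟨ cong ι
      (length-denominators (0 , 1) (farey (suc q))) ⟨
  ι (length (denominators (0 , 1) (farey (suc q))))     ≡⟨ ∑-length (denominators (0 , 1) (farey (suc q))) ⟨
  ∑ (denominators (0 , 1) (farey (suc q))) (λ _ → 1ℚ)   ≡⟨ ∑-denominators q (λ _ → 1ℚ) ⟩
  ∑ (L (suc q)) (λ s → 𝟙-coprime s * 1ℚ)                ≡⟨ ∑-cong (L (suc q))
      (λ {s} _ → ℚ.*-identityʳ (𝟙-coprime s)) ⟩
  ∑ (L (suc q)) 𝟙-coprime                               ∎
  where open ≡-Reasoning

-- Eventual properties of approximations

Ev : (ℕ → Set) → Set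
Ev P = ∃[ n₀ ] (∀ n → n₀ ℕ.≤ n → P n)

_∧ᴱ_ : ∀ {P Q} → Ev P → Ev Q → Ev (λ n → P n × Q n)
(a , p) ∧ᴱ (b , q) = a ℕ.⊔ b , λ n le →
  p n (ℕ.≤-trans (ℕ.m≤m⊔n a b) le) , q n (ℕ.≤-trans (ℕ.m≤n⊔m a b) le)

mapᴱ : ∀ {P Q : ℕ → Set} → (∀ n → P n → Q n) → Ev P → Ev Q
mapᴱ f (a , p) = a , λ n le → f n (p n le)

infixr 5 _∧ᴱ_

approx-· : ∀ k x m → approx (k ·ᴿ x) m ≡ ι k * approx x m
approx-· zero x m = sym (trans (cong (_* approx x m) ι-0) (ℚ.*-zeroˡ (approx x m)))
approx-· (suc k) x m = trans (cong (approx x m +_) (approx-· k x m))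
  (trans (solve 2 (λ a b → a :+ b :* a := ((con 1ℚ) :+ b) :* a) refl (approx x m) (ι k))
      (cong (_* approx x m) (sym (ι-suc k))))

≤ᴿ-intro : ∀ x y → Ev (λ m → approx x m ≤ approx y m) → x ≤ᴿ y
≤ᴿ-intro x y ev ε 0<ε = mapᴱ (λ m le → (lin≤ (le ⊕ (ℚ.<⇒≤ 0<ε))
                                         (solve 3 (λ a b c → a :+ (b :+ c)
                                             := b :+ c :+ (a :+ (con 0ℚ)))
                                           refl (approx x m) (approx y m) ε))) ev

-- Words of points of the real triangle

HasWord : ∀ {R} → Vec ℕ R → Plane → Set
HasWord [] p = ⊤
HasWord (k ∷ w) (x , y) = 𝒯[ k ] (x , y) × HasWord w (y , k ·ᴿ y -ᴿ x)

-- If l < k, then ky ≤ 1 + x < (l + 1) y ≤ ky. For approximations the strict inequality has a gap η,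
-- so the non-strict one is used with error η/2. The last step needs y ≥ 0, which comes from x ≤ 1
-- and x + y > 1 with the same ε.
𝒯-letter-≤ : ∀ {k l p} → 𝒯[ k ] p → 𝒯[ l ] p → k ℕ.≤ l
𝒯-letter-≤ {k} {l} {x , y} (((_ , x≤1) , _ , (ε , 0<ε , 1<x+y)) , ky≤ , _) (_ , _ , (η , 0<η , <ly)) =
  ℕ.≮⇒≥ λ l<k → contra l<k (x≤1 ε 0<ε ∧ᴱ 1<x+y ∧ᴱ ky≤ (½ * η) (0<* (pos ½) 0<η) ∧ᴱ <ly)
  where
  contra : l ℕ.< k → Ev (λ m → approx x m ≤ 1ℚ + ε × 1ℚ + ε ≤ approx x m + approx y m ×
             approx (k ·ᴿ y) m ≤ 1ℚ + approx x m + ½ * η × 1ℚ + approx x m + η ≤ approx (suc l ·ᴿ y) m) → ⊥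
  contra l<k (m , ev) = let le₁ , le₂ , le₃ , le₄ = ev m ℕ.≤-refl
                            0≤y = (lin≤ (le₁ ⊕ le₂)
                                    (solve 3 (λ a b c → (con 0ℚ) :+ ((con 1ℚ) :+ a :+ (b :+ c))
                                        := c :+ (b :+ ((con 1ℚ) :+ a)))
                                      refl ε (approx x m) (approx y m))) in absurd-ℚ
    (lin< (((fromℕ 2) ⊛ le₃) ⊕ ((fromℕ 2) ⊛ le₄) ⊕< 0<η <⊕
        ((fromℕ 2) ⊛ (ℚ.≤-reflexive (sym (approx-· k y m)))) <⊕
            ((fromℕ 2) ⊛ (ℚ.≤-reflexive (approx-· (suc l) y m))) <⊕
                ((fromℕ 2) ⊛ (*-mono-≤ (0≤ι k) 0≤y (ι-≤ l<k) (ℚ.≤-refl {approx y m}))))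
      (solve 7 (λ a b c d e f g → (con 0ℚ) :+
          ((con (fromℕ 2)) :* ((con 1ℚ) :+ a :+ (con ½) :* b) :+ (con (fromℕ 2)) :* c :+ b :+
              (con (fromℕ 2)) :* d :+ (con (fromℕ 2)) :* (e :* f) :+ (con (fromℕ 2)) :* (g :* f))
          := (con 0ℚ) :+ ((con (fromℕ 2)) :* d :+ (con (fromℕ 2)) :* ((con 1ℚ) :+ a :+ b) :+ (con 0ℚ) :+
              (con (fromℕ 2)) :* (g :* f) :+ (con (fromℕ 2)) :* c :+ (con (fromℕ 2)) :* (e :* f)))
        refl (approx x m) η (approx (suc l ·ᴿ y) m) (approx (k ·ᴿ y) m) (ι (suc l)) (approx y m) (ι k)))

𝒯-letter-unique : ∀ {k l p} → 𝒯[ k ] p → 𝒯[ l ] p → k ≡ l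
𝒯-letter-unique {p = p} k∈ l∈ = ℕ.≤-antisym (𝒯-letter-≤ {p = p} k∈ l∈) (𝒯-letter-≤ {p = p} l∈ k∈)

HasWord⇒T⁻ : ∀ {R} (w : Vec ℕ R) p → HasWord w p → ∀ t → t ℕ.< R → T⁻[ t ] 𝒯[ nth w t ] p
HasWord⇒T⁻ (k ∷ w) p (p∈ , _) zero _ = p∈
HasWord⇒T⁻ (k ∷ w) (x , y) (p∈ , hw) (suc t) (s≤s t<R) = k , p∈ , HasWord⇒T⁻ w (y , k ·ᴿ y -ᴿ x) hw t t<R

-- A preimage hides the letter of each step in an existential; by uniqueness it is the letter of the
-- word, so both follow the same orbit.
T⁻⇒letter : ∀ {R} (w : Vec ℕ R) p → HasWord w p → ∀ t → t ℕ.< R → ∀ {l} → T⁻[ t ] 𝒯[ l ] p → nth w t ≡ l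
T⁻⇒letter (k ∷ w) p (p∈ , _) zero _ p∈′ = 𝒯-letter-unique {p = p} p∈ p∈′
T⁻⇒letter (k ∷ w) (x , y) (p∈ , hw) (suc t) (s≤s t<R) {l} (k′ , p∈′ , q) = T⁻⇒letter w (y , k ·ᴿ y -ᴿ x)
    hw t t<R
  (subst image {k′} {k} (sym (𝒯-letter-unique {k} {k′} {x , y} p∈ p∈′)) q)
  where
  image : ℕ → Set
  image j = T⁻[ t ] 𝒯[ l ] (y , j ·ᴿ y -ᴿ x)

-- For a point with a known word, membership in a region becomes a decidable comparison of letters.
-- This and its converse connect regions with lattice points.
region⁺ : ∀ {m R} (h : Vec ℕ m) (w : Vec ℕ R) p {k l} → VecAll.All (ℕ._< R) (0 ∷ h) → HasWord w p →
          select (0 ∷ h) w ≡ k ∷ l → region h k l p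
region⁺ [] w p (0<R ∷ []) hw refl = HasWord⇒T⁻ w p hw 0 0<R
region⁺ (t ∷ h) w p (0<R ∷ t<R ∷ h<R) hw refl = HasWord⇒T⁻ w p hw t t<R , region⁺ h w p (0<R ∷ h<R) hw refl

region⁻ : ∀ {m R} (h : Vec ℕ m) (w : Vec ℕ R) p {k l} → VecAll.All (ℕ._< R) (0 ∷ h) → HasWord w p →
          region h k l p → select (0 ∷ h) w ≡ k ∷ l
region⁻ [] w p {l = []} (0<R ∷ []) hw p∈ = cong (_∷ []) (T⁻⇒letter w p hw 0 0<R p∈)
region⁻ (t ∷ h) w p {l = _ ∷ _} (0<R ∷ t<R ∷ h<R) hw (p∈t , p∈) =
  let eq = region⁻ h w p (0<R ∷ h<R) hw p∈ in
  cong₂ (λ k ls → k ∷ ls) (Vec.∷-injectiveˡ eq) (cong₂ _∷_ (T⁻⇒letter w p hw t t<R p∈t) (Vec.∷-injectiveʳ eq))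

-- Lattice points whose orbit keeps distance B from the sides of the triangle

Core : ℕ → ℕ → Pair → Set
Core n B (a , b) = a ℕ.+ B ℕ.≤ n × b ℕ.+ B ℕ.≤ n × n ℕ.+ B ℕ.< a ℕ.+ b

core? : ∀ n B s → Dec (Core n B s)
core? n B (a , b) = (a ℕ.+ B ℕ.≤? n) ×-dec ((b ℕ.+ B ℕ.≤? n) ×-dec (n ℕ.+ B ℕ.<? a ℕ.+ b))

Deep : ℕ → ℕ → ℕ → Pair → Set
Deep n B zero s    = Core n B s
Deep n B (suc R) s = Core n B s × Deep n B R (T n s)

deep? : ∀ n B R s → Dec (Deep n B R s)
deep? n B zero s    = core? n B s
deep? n B (suc R) s = core? n B s ×-dec deep? n B R (T n s)

Deep⇒Core : ∀ {n B} R {s} → Deep n B R s → Core n B s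
Deep⇒Core zero c = c
Deep⇒Core (suc R) (c , _) = c

Near : ℕ → ℕ → Plane → Pair → ℕ → Set
Near n E (x , y) (u , v) m = (ι u ≤ ι n * approx x m + ι E × ι n * approx x m ≤ ι u + ι E)
                           × (ι v ≤ ι n * approx y m + ι E × ι n * approx y m ≤ ι v + ι E)

-- If n (x , y) is within E of (u , v), its image is within (K + 1) E of the image of (u , v), as
-- the letter is at most K. After R steps the distance is still at most E (2 + K)^R ≤ B, less than
-- what separates the lattice orbit from the lines where the letter changes.
deep⇒HasWord : ∀ {n} R K B E {s} p → 1 ℕ.≤ n → s ∈ L n → Small K (letters n R s) → Deep n B R s →
               E ℕ.* (2 ℕ.+ K) ℕ.^ R ℕ.≤ B → Ev (Near n E p s) → HasWord (letters n R s) p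
deep⇒HasWord zero K B E _ _ _ _ _ _ _ = tt
deep⇒HasWord {n} (suc R) K B E {u , v} (x , y) 1≤n s∈ (k≤K ∷ small) (core , deep) E≤B near =
  (triangle , ky≤1+x , 1+x<[1+k]y) ,
  deep⇒HasWord R K B ((2 ℕ.+ K) ℕ.* E) (y , k ·ᴿ y -ᴿ x) 1≤n (T-∈L s∈) small deep
    (subst (ℕ._≤ B) (solveℕ 3 (λ a b c → a ⊠ (((conℕ 2) ⊞ b) ⊠ c)
                        ⊜ ((conℕ 2) ⊞ b) ⊠ a ⊠ c)
                      refl E K ((2 ℕ.+ K) ℕ.^ R)) E≤B)
    (subst (λ s → Ev (Near n ((2 ℕ.+ K) ℕ.* E) (y , k ·ᴿ y -ᴿ x) s)) (sym (T-unique (InL.1≤b i) nx))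
        (mapᴱ near′ near))
  where
  i = ∈L⁻ s∈
  k = κ n (u , v)
  c = proj₁ (κ-next i)
  nx : Next n u v c k
  nx = proj₂ (κ-next i)
  δ = inv n
  0<n : 0ℚ < ι n
  0<n = 0<ι 1≤n
  E₂≤B : (2 ℕ.+ K) ℕ.* E ℕ.≤ B
  E₂≤B = ℕ.≤-trans (subst₂ ℕ._≤_ (ℕ.*-identityʳ _) (solveℕ 3 (λ a b c → ((conℕ 2) ⊞ a) ⊠ b ⊠ c
        ⊜ b ⊠ (((conℕ 2) ⊞ a) ⊠ c))
      refl K E ((2 ℕ.+ K) ℕ.^ R))
    (ℕ.*-monoʳ-≤ ((2 ℕ.+ K) ℕ.* E) (ℕ.m^n>0 (2 ℕ.+ K) R))) E≤B
  KE≤B : fromℕ 2 * ι E + ι K * ι E ≤ ι B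
  KE≤B = lin≤ ((ι-≤ E₂≤B) ⊕ (ℚ.≤-reflexive (sym (ι-* (2 ℕ.+ K) E))) ⊕
      (ℚ.≤-reflexive (sym (trans (cong (_* ι E) (trans (ι-+ 2 K) (cong (_+ ι K) (ι≡fromℕ 2)))) refl))))
           (solve 5 (λ a b c d e → (con (fromℕ 2)) :* a :+ b :* a :+ (c :+ d :+ e :* a)
               := c :+ (d :+ e :* a :+ ((con (fromℕ 2)) :+ b) :* a))
             refl (ι E) (ι K) (ι B) (ι ((2 ℕ.+ K) ℕ.* E)) (ι (2 ℕ.+ K)))
  kE≤KE : ι k * ι E ≤ ι K * ι E
  kE≤KE = *-mono-≤ (0≤ι K) (0≤ι E) (ι-≤ k≤K) ℚ.≤-refl
  0≤KE : 0ℚ ≤ ι K * ι E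
  0≤KE = 0≤* (0≤ι K) (0≤ι E)
  u+B≤n : ι u + ι B ≤ ι n
  u+B≤n = subst (_≤ ι n) (ι-+ u B) (ι-≤ (proj₁ core))
  v+B≤n : ι v + ι B ≤ ι n
  v+B≤n = subst (_≤ ι n) (ι-+ v B) (ι-≤ (proj₁ (proj₂ core)))
  n+B<u+v : 1ℚ + (ι n + ι B) ≤ ι u + ι v
  n+B<u+v = subst₂ _≤_ (trans (ι-suc (n ℕ.+ B)) (cong (1ℚ +_) (ι-+ n B))) (ι-+ u v) (ι-≤ (proj₂ (proj₂ core)))
  -- 1 + x - ky corresponds to n - c, and (k + 1) y - 1 - x to v + c - n. Both are kept away from 0
  -- by the next point of the orbit, and so `Deep` involves R + 1 points.
  core′ : Core n B (v , c)
  core′ = subst (Core n B) (T-unique (InL.1≤b i) nx) (Deep⇒Core R deep)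
  c+B≤n : ι c + ι B ≤ ι n
  c+B≤n = subst (_≤ ι n) (ι-+ c B) (ι-≤ (proj₁ (proj₂ core′)))
  n+B<v+c : 1ℚ + (ι n + ι B) ≤ ι v + ι c
  n+B<v+c = subst₂ _≤_ (trans (ι-suc (n ℕ.+ B)) (cong (1ℚ +_) (ι-+ n B))) (ι-+ v c) (ι-≤ (proj₂ (proj₂ core′)))
  c≡ : ι c ≡ ι k * ι v - ι u
  c≡ = ι-next nx
  -- The gap 1 between integers becomes the gap 1/n that `<ᴿ` asks for.
  margin : ∀ {a b} → 1ℚ + ι n * a ≤ ι n * b → a + δ ≤ b
  margin {a} {b} le = *-cancelˡ-≤ (ι n) 0<n (lin≤ (le ⊕ (ℚ.≤-reflexive (inv-inverse 1≤n)))
      (solve 4 (λ a b c d → a :* (b :+ c) :+ (a :* d :+ (con 1ℚ))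
          := a :* d :+ ((con 1ℚ) :+ a :* b :+ a :* c))
        refl (ι n) a δ b))
  cancel : ∀ {a b} → ι n * a ≤ ι n * b → a ≤ b
  cancel = *-cancelˡ-≤ (ι n) 0<n
  0≤B = 0≤ι B
  0≤E = 0≤ι E
  module _ (m : ℕ) (nr : Near n E (x , y) (u , v) m) where
    X Y N′ : ℚ
    X = approx x m
    Y = approx y m
    N′ = ι n
    x≥ = proj₁ (proj₁ nr)
    x≤ = proj₂ (proj₁ nr)
    y≥ = proj₁ (proj₂ nr)
    y≤ = proj₂ (proj₂ nr)
    ky≥ = *-monoˡ-≤ (ι k) (0≤ι k) y≥
    ky≤ = *-monoˡ-≤ (ι k) (0≤ι k) y≤
    0≤X : 0ℚ ≤ X
    0≤X = cancel (lin≤ (x≥ ⊕ n+B<u+v ⊕ v+B≤n ⊕ ((fromℕ 2) ⊛ KE≤B) ⊕ ((fromℕ 2) ⊛ 0≤KE) ⊕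
        ((fromℕ 3) ⊛ 0≤E) ⊕ (nonneg 1ℚ))
                   (solve 7 (λ a b c d e f g → a :* (con 0ℚ) :+
                       (a :* b :+ c :+ (d :+ e) :+ a :+ (con (fromℕ 2)) :* f :+ (con (fromℕ 2)) :*
                           (g :* c) :+ (con (fromℕ 3)) :* c :+ (con 1ℚ))
                       := a :* b :+ (d :+ ((con 1ℚ) :+ (a :+ f)) :+ (e :+ f) :+ (con (fromℕ 2)) :*
                           ((con (fromℕ 2)) :* c :+ g :* c) :+ (con (fromℕ 2)) :* (con 0ℚ) :+
                               (con (fromℕ 3)) :* (con 0ℚ) :+ (con 0ℚ)))
                     refl N′ X (ι E) (ι u) (ι v) (ι B) (ι K)))
    X≤1 : X ≤ 1ℚ
    X≤1 = cancel (lin≤ (x≤ ⊕ u+B≤n ⊕ KE≤B ⊕ 0≤KE ⊕ 0≤E)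
                   (solve 6 (λ a b c d e f → a :* b :+ (c :+ d :+ a :+ e :+ f :* d :+ d)
                       := a :* (con 1ℚ) :+ (a :* b :+ (c :+ e) :+ ((con (fromℕ 2)) :* d :+ f :* d) :+
                           (con 0ℚ) :+ (con 0ℚ)))
                     refl N′ X (ι u) (ι E) (ι B) (ι K)))
    0≤Y : 0ℚ ≤ Y
    0≤Y = cancel (lin≤ (y≥ ⊕ n+B<u+v ⊕ u+B≤n ⊕ ((fromℕ 2) ⊛ KE≤B) ⊕ ((fromℕ 2) ⊛ 0≤KE) ⊕
        ((fromℕ 3) ⊛ 0≤E) ⊕ (nonneg 1ℚ))
                   (solve 7 (λ a b c d e f g → a :* (con 0ℚ) :+
                       (a :* b :+ c :+ (d :+ e) :+ a :+ (con (fromℕ 2)) :* f :+ (con (fromℕ 2)) :*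
                           (g :* c) :+ (con (fromℕ 3)) :* c :+ (con 1ℚ))
                       := a :* b :+ (e :+ ((con 1ℚ) :+ (a :+ f)) :+ (d :+ f) :+ (con (fromℕ 2)) :*
                           ((con (fromℕ 2)) :* c :+ g :* c) :+ (con (fromℕ 2)) :* (con 0ℚ) :+
                               (con (fromℕ 3)) :* (con 0ℚ) :+ (con 0ℚ)))
                     refl N′ Y (ι E) (ι u) (ι v) (ι B) (ι K)))
    Y≤1 : Y ≤ 1ℚ
    Y≤1 = cancel (lin≤ (y≤ ⊕ v+B≤n ⊕ KE≤B ⊕ 0≤KE ⊕ 0≤E)
                   (solve 6 (λ a b c d e f → a :* b :+ (c :+ d :+ a :+ e :+ f :* d :+ d)
                       := a :* (con 1ℚ) :+ (a :* b :+ (c :+ e) :+ ((con (fromℕ 2)) :* d :+ f :* d) :+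
                           (con 0ℚ) :+ (con 0ℚ)))
                     refl N′ Y (ι v) (ι E) (ι B) (ι K)))
    1<X+Y : 1ℚ + δ ≤ X + Y
    1<X+Y = margin (lin≤ (x≥ ⊕ y≥ ⊕ n+B<u+v ⊕ KE≤B ⊕ 0≤KE)
                     (solve 8 (λ a b c d e f g h → (con 1ℚ) :+ a :* (con 1ℚ) :+
                         (a :* b :+ c :+ (a :* d :+ c) :+ (e :+ f) :+ g :+ h :* c)
                         := a :* (b :+ d) :+ (e :+ f :+ ((con 1ℚ) :+ (a :+ g)) :+
                             ((con (fromℕ 2)) :* c :+ h :* c) :+ (con 0ℚ)))
                       refl N′ X (ι E) Y (ι u) (ι v) (ι B) (ι K)))
    kY≤ : ι k * Y ≤ 1ℚ + X
    kY≤ = cancel (lin≤ (ky≤ ⊕ x≥ ⊕ (ℚ.≤-reflexive (sym c≡)) ⊕ c+B≤n ⊕ kE≤KE ⊕ KE≤B ⊕ 0≤E)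
                   (solve 10 (λ a b c d e f g h i j → a :* (b :* c) :+
                       (b :* (d :+ e) :+ (a :* f :+ e) :+ g :+ a :+ h :* e :+ i :+ e)
                       := a :* ((con 1ℚ) :+ f) :+ (b :* (a :* c) :+ j :+ (b :* d :- j) :+ (g :+ i) :+ b
                           :* e :+ ((con (fromℕ 2)) :* e :+ h :* e) :+ (con 0ℚ)))
                     refl N′ (ι k) Y (ι v) (ι E) X (ι c) (ι K) (ι B) (ι u)))
    <kY : 1ℚ + X + δ ≤ ι (suc k) * Y
    <kY = margin (subst (λ t → 1ℚ + ι n * (1ℚ + X) ≤ ι n * (t * Y)) (sym (ι-suc k))
      (lin≤ (ky≥ ⊕ y≥ ⊕ x≤ ⊕ (ℚ.≤-reflexive c≡) ⊕ n+B<v+c ⊕ kE≤KE ⊕ KE≤B)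
        (solve 10 (λ a b c d e f g h i j → (con 1ℚ) :+ a :* ((con 1ℚ) :+ b) :+
            (c :* (a :* d :+ e) :+ (a :* d :+ e) :+ (f :+ e) :+ (c :* g :- f) :+ (g :+ h) :+ i :* e :+ j)
            := a :* (((con 1ℚ) :+ c) :* d) :+
                (c :* g :+ g :+ a :* b :+ h :+ ((con 1ℚ) :+ (a :+ j)) :+ c :* e :+
                    ((con (fromℕ 2)) :* e :+ i :* e)))
          refl N′ X (ι k) Y (ι E) (ι u) (ι v) (ι c) (ι K) (ι B))))
    near′ : Near n ((2 ℕ.+ K) ℕ.* E) (y , k ·ᴿ y -ᴿ x) (v , c) m
    near′ =
      ( (lin≤ (y≥ ⊕ (ℚ.≤-reflexive (sym F≡)) ⊕ 0≤KE ⊕ 0≤E)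
          (solve 6 (λ a b c d e f → a :+ (b :* c :+ d :+ e :+ f :* d :+ d)
              := b :* c :+ e :+ (a :+ ((con (fromℕ 2)) :* d :+ f :* d) :+ (con 0ℚ) :+ (con 0ℚ)))
            refl (ι v) N′ Y (ι E) F (ι K)))
      , (lin≤ (y≤ ⊕ (ℚ.≤-reflexive (sym F≡)) ⊕ 0≤KE ⊕ 0≤E)
          (solve 6 (λ a b c d e f → a :* b :+ (c :+ d :+ e :+ f :* d :+ d)
              := c :+ e :+ (a :* b :+ ((con (fromℕ 2)) :* d :+ f :* d) :+ (con 0ℚ) :+ (con 0ℚ)))
            refl N′ Y (ι v) (ι E) F (ι K))) ) ,
      ( (lin≤ ((ℚ.≤-reflexive (sym F≡)) ⊕ (ℚ.≤-reflexive (sym (cong (ι n *_) (approx-· k y m)))) ⊕ ky≥ ⊕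
          x≤ ⊕ (ℚ.≤-reflexive c≡) ⊕ kE≤KE ⊕ 0≤E)
          (solve 11 (λ a b c d e f g h i j k → a :+
              (b :+ c :* d :+ e :* (c :* f :+ g) :+ (h :+ g) :+ (e :* i :- h) :+ j :* g :+ g)
              := c :* (d :- k) :+ b :+ ((con (fromℕ 2)) :* g :+ j :* g :+ c :* (e :* f) :+ e :* i :+ c
                  :* k :+ a :+ e :* g :+ (con 0ℚ)))
            refl (ι c) F N′ (approx (k ·ᴿ y) m) (ι k) Y (ι E) (ι u) (ι v) (ι K) X))
      , (lin≤ ((ℚ.≤-reflexive (sym F≡)) ⊕ (ℚ.≤-reflexive (cong (ι n *_) (approx-· k y m))) ⊕ ky≤ ⊕ x≥ ⊕
          (ℚ.≤-reflexive (sym c≡)) ⊕ kE≤KE ⊕ 0≤E)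
          (solve 11 (λ a b c d e f g h i j k → a :* (b :- c) :+
              (d :+ a :* (e :* f) :+ e :* (g :+ h) :+ (a :* c :+ h) :+ i :+ j :* h :+ h)
              := i :+ d :+ ((con (fromℕ 2)) :* h :+ j :* h :+ a :* b :+ e :* (a :* f) :+ k :+
                  (e :* g :- k) :+ e :* h :+ (con 0ℚ)))
            refl N′ (approx (k ·ᴿ y) m) X F (ι k) Y (ι v) (ι E) (ι c) (ι K) (ι u))) )
      where
      F : ℚ
      F = ι ((2 ℕ.+ K) ℕ.* E)
      F≡ : F ≡ fromℕ 2 * ι E + ι K * ι E
      F≡ = trans (ι-* (2 ℕ.+ K) E) (trans (cong (_* ι E) (trans (ι-+ 2 K) (cong (_+ ι K) (ι≡fromℕ 2))))
          (ℚ.*-distribʳ-+ (ι E) (fromℕ 2) (ι K)))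
  triangle : 𝒯 (x , y)
  triangle = ( ≤ᴿ-intro (fromℚ 0ℚ) x (mapᴱ 0≤X near) , ≤ᴿ-intro x (fromℚ 1ℚ) (mapᴱ X≤1 near))
           , ( ≤ᴿ-intro (fromℚ 0ℚ) y (mapᴱ 0≤Y near) , ≤ᴿ-intro y (fromℚ 1ℚ) (mapᴱ Y≤1 near))
           , (δ , inv-positive 1≤n , mapᴱ 1<X+Y near)
  ky≤1+x : k ·ᴿ y ≤ᴿ fromℚ 1ℚ +ᴿ x
  ky≤1+x = ≤ᴿ-intro (k ·ᴿ y) (fromℚ 1ℚ +ᴿ x)
      (mapᴱ (λ m nr → subst (_≤ 1ℚ + approx x m) (sym (approx-· k y m)) (kY≤ m nr)) near)
  1+x<[1+k]y : fromℚ 1ℚ +ᴿ x <ᴿ suc k ·ᴿ y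
  1+x<[1+k]y = δ , inv-positive 1≤n , mapᴱ
      (λ m nr → subst (1ℚ + approx x m + δ ≤_) (sym (approx-· (suc k) y m)) (<kY m nr)) near

∑-𝟙-≤1 : ∀ {xs : List ℕ} x → Unique xs → ∑ xs (λ y → 𝟙 (x ℕ.≟ y)) ≤ 1ℚ
∑-𝟙-≤1 {[]} x _ = nonneg 1ℚ
∑-𝟙-≤1 {y ∷ ys} x (y# ∷ u) with x ℕ.≟ y
... | no _ = subst (_≤ 1ℚ) (sym (ℚ.+-identityˡ (∑ ys (λ y → 𝟙 (x ℕ.≟ y))))) (∑-𝟙-≤1 x u)
... | yes refl = ℚ.≤-reflexive (trans
    (cong (1ℚ +_) (∑-zero ys (λ {z} z∈ → 𝟙-no (x ℕ.≟ z) (All.lookup y# z∈)))) (ℚ.+-identityʳ 1ℚ))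

∑-L-≤ : ∀ n {F : Pair → ℚ} → (∀ s → 0ℚ ≤ F s) → ∑ (L n) F ≤ ∑ [1⋯ n ] (λ a → ∑ [1⋯ n ] (λ b → F (a , b)))
∑-L-≤ n {F} 0≤F = subst (_≤ ∑ [1⋯ n ] (λ a → ∑ [1⋯ n ] (λ b → F (a , b)))) (sym (∑-L n F))
  (∑-mono [1⋯ n ] λ {a} _ → ∑-mono [1⋯ n ] λ {b} _ → subst (𝟙 (n ℕ.<? a ℕ.+ b) * F (a , b) ≤_)
      (ℚ.*-identityˡ (F (a , b)))
    (*-mono-≤ (nonneg 1ℚ) (0≤F (a , b)) (𝟙≤1 (n ℕ.<? a ℕ.+ b)) ℚ.≤-refl))

∑-[1⋯]-const : ∀ n c → ∑ [1⋯ n ] (λ _ → c) ≡ c * ι n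
∑-[1⋯]-const n c = trans (∑-const [1⋯ n ] c) (cong (λ m → c * ι m) (length-[1⋯] n))

∑-𝟙-above-≤ : ∀ n B → ∑ [1⋯ n ] (λ a → 𝟙 (n ℕ.<? a ℕ.+ B)) ≤ ι B
∑-𝟙-above-≤ n B with ℕ.≤-total B n
... | inj₁ B≤n = ℚ.≤-reflexive (∑-𝟙-above n B B≤n)
... | inj₂ n≤B = ℚ.≤-trans (∑-mono [1⋯ n ] (λ {a} _ → 𝟙≤1 (n ℕ.<? a ℕ.+ B)))
  (subst (_≤ ι B) (sym (trans (∑-[1⋯]-const n 1ℚ) (ℚ.*-identityˡ (ι n)))) (ι-≤ n≤B))

∑-𝟙-antidiagonal-≤1 : ∀ n a c → ∑ [1⋯ n ] (λ b → 𝟙 (c ℕ.≟ a ℕ.+ b)) ≤ 1ℚ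
∑-𝟙-antidiagonal-≤1 n a c = ℚ.≤-trans
  (∑-mono [1⋯ n ] λ {b} _ → 𝟙-mono (c ℕ.≟ a ℕ.+ b) (c ℕ.∸ a ℕ.≟ b)
      (λ eq → trans (cong (ℕ._∸ a) eq) (ℕ.m+n∸m≡n a b)))
  (∑-𝟙-≤1 (c ℕ.∸ a) (unique-[1⋯] n))

-- The excluded points lie in three strips along the sides, each with at most B n points. The strip
-- along the hypotenuse is a union of B antidiagonals, each having at most one point for every a.
nonCore-bound : ∀ n B → ∑ (L n) (λ s → 𝟙 (¬? (core? n B s))) ≤ fromℕ 3 * ι B * ι n
nonCore-bound n B = begin
  ∑ (L n) (λ s → 𝟙 (¬? (core? n B s)))
    ≤⟨ ∑-mono (L n) (λ s∈ → pointwise (∈L⁻ s∈)) ⟩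
  ∑ (L n) (λ s → f₁ s + f₂ s + f₃ s)
    ≡⟨ trans (∑-+ (L n) _ f₃) (cong (_+ ∑ (L n) f₃) (∑-+ (L n) f₁ f₂)) ⟩
  ∑ (L n) f₁ + ∑ (L n) f₂ + ∑ (L n) f₃
    ≤⟨ ℚ.+-mono-≤ (ℚ.+-mono-≤ bound₁ (subst (_≤ ι B * ι n) (sym (∑-swap-L n f₁)) bound₁)) bound₃ ⟩
  ι B * ι n + ι B * ι n + ι B * ι n
    ≡⟨ (solve 2 (λ a b → a :* b :+ a :* b :+ a :* b := (con (fromℕ 3)) :* a :* b) refl (ι B) (ι n)) ⟩
  fromℕ 3 * ι B * ι n ∎
  where
  open ℚ.≤-Reasoning
  f₁ f₂ f₃ : Pair → ℚ
  f₁ (a , b) = 𝟙 (n ℕ.<? a ℕ.+ B)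
  f₂ (a , b) = 𝟙 (n ℕ.<? b ℕ.+ B)
  f₃ (a , b) = ∑ [1⋯ B ] (λ j → 𝟙 (n ℕ.+ j ℕ.≟ a ℕ.+ b))
  0≤f₃ : ∀ s → 0ℚ ≤ f₃ s
  0≤f₃ (a , b) = 0≤∑ [1⋯ B ] (λ {j} _ → 0≤𝟙 (n ℕ.+ j ℕ.≟ a ℕ.+ b))
  pointwise : ∀ {a b} → InL n a b → 𝟙 (¬? (core? n B (a , b))) ≤ f₁ (a , b) + f₂ (a , b) + f₃ (a , b)
  pointwise {a} {b} i = cases (a ℕ.+ B ℕ.≤? n) (b ℕ.+ B ℕ.≤? n) (n ℕ.+ B ℕ.<? a ℕ.+ b)
    where
    0≤₁ = 0≤𝟙 (n ℕ.<? a ℕ.+ B)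
    0≤₂ = 0≤𝟙 (n ℕ.<? b ℕ.+ B)
    0≤₃ = 0≤f₃ (a , b)
    ≤1 = 𝟙≤1 (¬? (core? n B (a , b)))
    cases : Dec (a ℕ.+ B ℕ.≤ n) → Dec (b ℕ.+ B ℕ.≤ n) → Dec (n ℕ.+ B ℕ.< a ℕ.+ b) →
            𝟙 (¬? (core? n B (a , b))) ≤ f₁ (a , b) + f₂ (a , b) + f₃ (a , b)
    cases (no ≰) _ _ = lin≤ (≤1 ⊕ (ℚ.≤-reflexive (sym (𝟙-yes (n ℕ.<? a ℕ.+ B) (ℕ.≰⇒> ≰)))) ⊕ 0≤₂ ⊕ 0≤₃)
                         (solve 4 (λ a b c d → a :+ ((con 1ℚ) :+ b :+ c :+ d)
                             := b :+ c :+ d :+ (a :+ (con 1ℚ) :+ (con 0ℚ) :+ (con 0ℚ)))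
                           refl (𝟙 (¬? (core? n B (a , b)))) (f₁ (a , b)) (f₂ (a , b)) (f₃ (a , b)))
    cases (yes _) (no ≰) _ = lin≤ (≤1 ⊕ (ℚ.≤-reflexive (sym (𝟙-yes (n ℕ.<? b ℕ.+ B) (ℕ.≰⇒> ≰)))) ⊕ 0≤₁ ⊕ 0≤₃)
                               (solve 4 (λ a b c d → a :+ ((con 1ℚ) :+ b :+ c :+ d)
                                   := c :+ b :+ d :+ (a :+ (con 1ℚ) :+ (con 0ℚ) :+ (con 0ℚ)))
                                 refl (𝟙 (¬? (core? n B (a , b)))) (f₂ (a , b)) (f₁ (a , b)) (f₃ (a , b)))
    cases (yes p) (yes q) (yes r) = lin≤
        ((ℚ.≤-reflexive (𝟙-no (¬? (core? n B (a , b))) (λ ¬core → ¬core (p , q , r)))) ⊕ 0≤₁ ⊕ 0≤₂ ⊕ 0≤₃)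
                                      (solve 4 (λ a b c d → a :+ ((con 0ℚ) :+ b :+ c :+ d)
                                          := b :+ c :+ d :+ (a :+ (con 0ℚ) :+ (con 0ℚ) :+ (con 0ℚ)))
                                        refl (𝟙 (¬? (core? n B (a , b)))) (f₁ (a , b)) (f₂ (a , b))
                                            (f₃ (a , b)))
    cases (yes _) (yes _) (no ≮) = lin≤ (≤1 ⊕ (ℚ.≤-reflexive (sym one)) ⊕ 0≤₁ ⊕ 0≤₂)
                                     (solve 4 (λ a b c d → a :+ ((con 1ℚ) :+ b :+ c :+ d)
                                         := c :+ d :+ b :+ (a :+ (con 1ℚ) :+ (con 0ℚ) :+ (con 0ℚ)))
                                       refl (𝟙 (¬? (core? n B (a , b)))) (f₃ (a , b)) (f₁ (a , b)) (f₂ (a , b)))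
      where
      j = a ℕ.+ b ℕ.∸ n
      j+n : n ℕ.+ j ≡ a ℕ.+ b
      j+n = ℕ.m+[n∸m]≡n (ℕ.<⇒≤ (InL.n<a+b i))
      one : f₃ (a , b) ≡ 1ℚ
      one = trans (∑-cong [1⋯ B ] (λ {j′} _ → trans
          (𝟙-⇔ (n ℕ.+ j′ ℕ.≟ a ℕ.+ b) (j ℕ.≟ j′)
            (λ eq → ℕ.+-cancelˡ-≡ n j j′ (trans j+n (sym eq))) (λ { refl → j+n }))
          (sym (ℚ.*-identityʳ (𝟙 (j ℕ.≟ j′))))))
        (∑-δ ℕ._≟_ j (λ _ → 1ℚ) (unique-[1⋯] B) (∈[1⋯]⁺ (ℕ.m<n⇒0<n∸m (InL.n<a+b i))
          (ℕ.+-cancelˡ-≤ n j B (subst (ℕ._≤ n ℕ.+ B) (sym j+n) (ℕ.≮⇒≥ ≮)))))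
  bound₁ : ∑ (L n) f₁ ≤ ι B * ι n
  bound₁ = ℚ.≤-trans (∑-L-≤ n (λ s → 0≤𝟙 (n ℕ.<? proj₁ s ℕ.+ B)))
    (subst (_≤ ι B * ι n) (sym (trans (∑-cong [1⋯ n ] (λ {a} _ → ∑-[1⋯]-const n (𝟙 (n ℕ.<? a ℕ.+ B))))
        (∑-*ʳ [1⋯ n ] (ι n) (λ a → 𝟙 (n ℕ.<? a ℕ.+ B)))))
      (*-mono-≤ (0≤ι B) (0≤ι n) (∑-𝟙-above-≤ n B) ℚ.≤-refl))
  bound₃ : ∑ (L n) f₃ ≤ ι B * ι n
  bound₃ = begin
    ∑ (L n) f₃                                          ≤⟨ ∑-L-≤ n 0≤f₃ ⟩
    ∑ [1⋯ n ] (λ a → ∑ [1⋯ n ] (λ b → f₃ (a , b)))      ≡⟨ ∑-cong [1⋯ n ]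
        (λ {a} _ → ∑-swap [1⋯ n ] [1⋯ B ] (λ b j → 𝟙 (n ℕ.+ j ℕ.≟ a ℕ.+ b))) ⟩
    ∑ [1⋯ n ] (λ a → ∑ [1⋯ B ] (λ j → ∑ [1⋯ n ] (λ b → 𝟙 (n ℕ.+ j ℕ.≟ a ℕ.+ b))))
      ≤⟨ ∑-mono [1⋯ n ] (λ {a} _ → ∑-mono [1⋯ B ] (λ {j} _ → ∑-𝟙-antidiagonal-≤1 n a (n ℕ.+ j))) ⟩
    ∑ [1⋯ n ] (λ a → ∑ [1⋯ B ] (λ j → 1ℚ))              ≡⟨ trans
        (∑-cong [1⋯ n ] (λ _ → trans (∑-[1⋯]-const B 1ℚ) (ℚ.*-identityˡ (ι B)))) (∑-[1⋯]-const n (ι B)) ⟩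
    ι B * ι n                                           ∎

nonDeep-bound : ∀ n B R → ∑ (L n) (λ s → 𝟙 (¬? (deep? n B R s))) ≤ ι (suc R) * (fromℕ 3 * ι B) * ι n
nonDeep-bound n B zero = ℚ.≤-trans (nonCore-bound n B)
  (ℚ.≤-reflexive (trans (solve 2 (λ a b → a :* b := (con 1ℚ) :* a :* b) refl (fromℕ 3 * ι B) (ι n))
      (cong (λ x → x * (fromℕ 3 * ι B) * ι n) (sym ι-1))))
nonDeep-bound n B (suc R) = begin
  ∑ (L n) (λ s → 𝟙 (¬? (deep? n B (suc R) s)))
    ≤⟨ ∑-mono (L n) (λ {s} _ → pointwise s) ⟩
  ∑ (L n) (λ s → 𝟙 (¬? (core? n B s)) + 𝟙 (¬? (deep? n B R (T n s))))
    ≡⟨ trans (∑-+ (L n) _ _) (cong (∑ (L n) (λ s → 𝟙 (¬? (core? n B s))) +_)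
        (∑-T n (λ s → 𝟙 (¬? (deep? n B R s))))) ⟩
  ∑ (L n) (λ s → 𝟙 (¬? (core? n B s))) + ∑ (L n) (λ s → 𝟙 (¬? (deep? n B R s)))
    ≤⟨ ℚ.+-mono-≤ (nonCore-bound n B) (nonDeep-bound n B R) ⟩
  fromℕ 3 * ι B * ι n + ι (suc R) * (fromℕ 3 * ι B) * ι n
    ≡⟨ (solve 3 (λ a b c → a :* b :+ c :* a :* b
           := ((con 1ℚ) :+ c) :* a :* b)
         refl (fromℕ 3 * ι B) (ι n) (ι (suc R))) ⟩
  (1ℚ + ι (suc R)) * (fromℕ 3 * ι B) * ι n
    ≡⟨ cong (λ x → x * (fromℕ 3 * ι B) * ι n) (ι-suc (suc R)) ⟨
  ι (suc (suc R)) * (fromℕ 3 * ι B) * ι n ∎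
  where
  open ℚ.≤-Reasoning
  pointwise : ∀ s → 𝟙 (¬? (deep? n B (suc R) s)) ≤ 𝟙 (¬? (core? n B s)) + 𝟙 (¬? (deep? n B R (T n s)))
  pointwise s with core? n B s | deep? n B R (T n s)
  ... | yes _ | yes _ = nonneg 0ℚ
  ... | yes _ | no _  = ℚ.≤-refl
  ... | no _  | yes _ = ℚ.≤-refl
  ... | no _  | no _  = lin≤ (nonneg 1ℚ)
                          (solve 0 ((con 1ℚ) :+ (con 1ℚ) := (con 1ℚ) :+ (con 1ℚ) :+ (con 0ℚ)) refl )

-- The box of (a , b) is [(a - 1)/n , a/n] × [(b - 1)/n , b/n], enlarged by e on every side.

module Grid (n : ℕ) (1≤n : 1 ℕ.≤ n) where

  δ : ℚ
  δ = inv n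

  nδ≡1 : ι n * δ ≡ 1ℚ
  nδ≡1 = inv-inverse 1≤n

  0<δ : 0ℚ < δ
  0<δ = inv-positive 1≤n

  δ≤1 : δ ≤ 1ℚ
  δ≤1 = subst₂ _≤_ (trans (cong (_* δ) ι-1) (ℚ.*-identityˡ δ)) nδ≡1
      (*-mono-≤ (0≤ι n) (ℚ.<⇒≤ 0<δ) (ι-≤ 1≤n) ℚ.≤-refl)

  module _ (e : ℚ) (0≤e : 0ℚ ≤ e) where

    lo hi : ℕ → ℚ
    lo a = ι a * δ - δ - e
    hi a = ι a * δ + e

    lo≤hi : ∀ a → lo a ≤ hi a
    lo≤hi a = lin≤ (((fromℕ 2) ⊛ 0≤e) ⊕ (ℚ.<⇒≤ 0<δ))
                (solve 3 (λ a b c → a :- b :- c :+ ((con (fromℕ 2)) :* c :+ b)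
                    := a :+ c :+ ((con (fromℕ 2)) :* (con 0ℚ) :+ (con 0ℚ)))
                  refl (ι a * δ) δ e)

    box : Pair → Box
    box (a , b) = record { left = lo a ; right = hi a ; bottom = lo b ; top = hi b ; left≤right = lo≤hi
        a ; bottom≤top = lo≤hi b }

    width : ℚ
    width = δ + fromℕ 2 * e

    totalArea-boxes : ∀ xs → totalArea (map box xs) ≡ ∑ xs (λ _ → 1ℚ) * (width * width)
    totalArea-boxes xs = trans (∑-map box xs _)
        (trans (∑-cong xs (λ {s} _ → area s)) (∑-*ʳ xs (width * width) (λ _ → 1ℚ)))
      where
      area : ∀ s → (hi (proj₁ s) - lo (proj₁ s)) * (hi (proj₂ s) - lo (proj₂ s)) ≡ 1ℚ * (width * width)
      area (a , b) = solve 4 (λ a b c d → (a :+ b :- (a :- c :- b)) :* (d :+ b :- (d :- c :- b))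
                         := (con 1ℚ) :* ((c :+ (con (fromℕ 2)) :* b) :* (c :+ (con (fromℕ 2)) :* b)))
                       refl (ι a * δ) e δ (ι b * δ)

    -- The distance 3 consists of 1 for the cell, 1 for the enlargement n e ≤ 1, and 1 for reading
    -- the approximations to precision δ = 1/n.
    near-box : e ≤ δ → ∀ s p → ⟦ box s ⟧ p → Ev (Near n 3 p s)
    near-box e≤δ (a , b) (x , y) ((lx , ux) , (ly , uy)) =
      mapᴱ (λ m (p , q , r , s) → near m x a p q , near m y b r s)
          (lx δ 0<δ ∧ᴱ ux δ 0<δ ∧ᴱ ly δ 0<δ ∧ᴱ uy δ 0<δ)
      where
      near : ∀ m z c → lo c ≤ approx z m + δ → approx z m ≤ hi c + δ →
             ι c ≤ ι n * approx z m + ι 3 × ι n * approx z m ≤ ι c + ι 3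
      near m z c le ge =
        (lin≤ ((*-monoˡ-≤ (ι n) (0≤ι n) le) ⊕ (*-monoˡ-≤ (ι n) (0≤ι n) e≤δ) ⊕
            ((fromℕ 3) ⊛ (ℚ.≤-reflexive nδ≡1)) ⊕ (ℚ.≤-reflexive (sym (cong (ι c *_) nδ≡1))) ⊕
                (ℚ.≤-reflexive (sym (ι≡fromℕ 3))))
          (solve 6 (λ a b c d e f → a :+ (b :* (c :+ d) :+ b :* d :+ (con (fromℕ 3)) :* (con 1ℚ) :+ a :*
              (b :* d) :+ e)
              := b :* c :+ e :+ (b :* (a :* d :- d :- f) :+ b :* f :+ (con (fromℕ 3)) :* (b :* d) :+ a
                  :* (con 1ℚ) :+ (con (fromℕ 3))))
            refl (ι c) (ι n) (approx z m) δ (ι 3) e)) ,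
        (lin≤ ((*-monoˡ-≤ (ι n) (0≤ι n) ge) ⊕ (*-monoˡ-≤ (ι n) (0≤ι n) e≤δ) ⊕
            ((fromℕ 2) ⊛ (ℚ.≤-reflexive nδ≡1)) ⊕ (ℚ.≤-reflexive (cong (ι c *_) nδ≡1)) ⊕
                (ℚ.≤-reflexive (sym (ι≡fromℕ 3))) ⊕ (nonneg 1ℚ))
          (solve 6 (λ a b c d e f → a :* b :+
              (a :* (c :* d :+ e :+ d) :+ a :* d :+ (con (fromℕ 2)) :* (con 1ℚ) :+ c :* (con 1ℚ) :+ f :+
                  (con 1ℚ))
              := c :+ f :+ (a :* b :+ a :* e :+ (con (fromℕ 2)) :* (a :* d) :+ c :* (a :* d) :+
                  (con (fromℕ 3)) :+ (con 0ℚ)))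
            refl (ι n) (approx z m) (ι c) δ e (ι 3)))

    -- Descending from n, the first a whose left neighbour no longer contains q below its right end
    -- is taken. This is a search with decisions, hence for rational q only.
    locate : ∀ q → - e ≤ q → q ≤ 1ℚ + e → ∃[ a ] (a ∈ [1⋯ n ] × lo a ≤ q × q ≤ hi a)
    locate q -e≤q q≤1+e = search (ℕ.pred n) (ℕ.≤-reflexive suc-pred)
        (subst (λ m → q ≤ hi m) (sym suc-pred) (subst (λ x → q ≤ x + e) (sym nδ≡1) q≤1+e))
      where
      suc-pred : suc (ℕ.pred n) ≡ n
      suc-pred = ℕ.suc-pred n {{ℕ.>-nonZero 1≤n}}
      search : ∀ m → suc m ℕ.≤ n → q ≤ hi (suc m) → ∃[ a ] (a ∈ [1⋯ n ] × lo a ≤ q × q ≤ hi a)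
      search zero m≤n q≤ = 1 , ∈[1⋯]⁺ ℕ.≤-refl m≤n , (lin≤ (-e≤q ⊕ (ℚ.≤-reflexive (cong (_* δ) ι-1)))
          (solve 4 (λ a b c d → a :* b :- b :- c :+ (d :+ (con 1ℚ) :* b)
              := d :+ ((:- c) :+ a :* b))
            refl (ι 1) δ e q)) , q≤
      search (suc m) m≤n q≤ with q ℚ.≤? hi (suc m)
      ... | yes q≤′ = search m (ℕ.<⇒≤ m≤n) q≤′
      ... | no q≰ = suc (suc m) , ∈[1⋯]⁺ (s≤s z≤n) m≤n ,
        (lin≤ ((ℚ.<⇒≤ (ℚ.≰⇒> q≰)) ⊕ (ℚ.≤-reflexive (cong (_* δ) (ι-suc (suc m)))) ⊕ ((fromℕ 2) ⊛ 0≤e))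
          (solve 5 (λ a b c d e → a :* b :- b :- c :+ (d :+ ((con 1ℚ) :+ e) :* b :+ (con (fromℕ 2)) :* c)
              := d :+ (e :* b :+ c :+ a :* b :+ (con (fromℕ 2)) :* (con 0ℚ)))
            refl (ι (suc (suc m))) δ e q (ι (suc m)))) , q≤

  separated : ∀ {a a′} → a ℕ.< a′ → hi 0ℚ ℚ.≤-refl a ≤ lo 0ℚ ℚ.≤-refl a′
  separated {a} {a′} lt = lin≤ ((*-mono-≤ (0≤ι a′) (ℚ.<⇒≤ 0<δ) (ι-≤ lt) ℚ.≤-refl) ⊕
      (ℚ.≤-reflexive (sym (cong (_* δ) (ι-suc a)))))
                            (solve 4 (λ a b c d → a :* b :+ (con 0ℚ) :+ (c :* b :+ d :* b)
                                := c :* b :- b :- (con 0ℚ) :+ (d :* b :+ ((con 1ℚ) :+ a) :* b))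
                              refl (ι a) δ (ι a′) (ι (suc a)))

  nonOverlapping : ∀ {s s′} → s ≢ s′ → NonOverlapping (box 0ℚ ℚ.≤-refl s) (box 0ℚ ℚ.≤-refl s′)
  nonOverlapping {a , b} {a′ , b′} s≢s′ with ℕ.<-cmp a a′ | ℕ.<-cmp b b′
  ... | Tri.tri< lt _ _ | _ = inj₁ (inj₁ (separated lt))
  ... | Tri.tri> _ _ gt | _ = inj₁ (inj₂ (separated gt))
  ... | Tri.tri≈ _ _ _  | Tri.tri< lt _ _ = inj₂ (inj₁ (separated lt))
  ... | Tri.tri≈ _ _ _  | Tri.tri> _ _ gt = inj₂ (inj₂ (separated gt))
  ... | Tri.tri≈ _ refl _ | Tri.tri≈ _ refl _ = ⊥-elim (s≢s′ refl)

  divide-≤ : ∀ a c d → a * (ι n * ι n) ≤ c + d * ι n → a ≤ c * (δ * δ) + d * δ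
  divide-≤ a c d le = subst₂ _≤_ eq₁ eq₂ (*-monoˡ-≤ (δ * δ) (0≤* (ℚ.<⇒≤ 0<δ) (ℚ.<⇒≤ 0<δ)) le)
    where
    eq₁ : δ * δ * (a * (ι n * ι n)) ≡ a
    eq₁ = trans (solve 3 (λ a b c → a :* a :* (b :* (c :* c))
                    := b :* (c :* a :* (c :* a)))
                  refl δ a (ι n))
      (trans (cong (λ t → a * (t * t)) nδ≡1) (solve 1 (λ a → a :* ((con 1ℚ) :* (con 1ℚ))
            := a)
          refl a))
    eq₂ : δ * δ * (c + d * ι n) ≡ c * (δ * δ) + d * δ
    eq₂ = trans (solve 4 (λ a b c d → a :* a :* (b :+ c :* d)
                    := b :* (a :* a) :+ c :* a :* (d :* a))
                  refl δ c d (ι n))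
      (trans (cong (λ t → c * (δ * δ) + d * δ * t) nδ≡1) (solve 3 (λ a b c → a :* (b :* b) :+ c :* b :* (con 1ℚ)
            := a :* (b :* b) :+ c :* b)
          refl c δ d))

-- Areas as limits of densities of lattice points

open Quad

region⇒𝒯 : ∀ {m} (h : Vec ℕ m) k l p → region h k l p → 𝒯 p
region⇒𝒯 [] k [] p p∈ = proj₁ p∈
region⇒𝒯 (_ ∷ h) k (_ ∷ l) p p∈ = region⇒𝒯 h k l p (proj₂ p∈)

≤ᴿ-const : ∀ q x → Ev (λ m → q ≤ approx x m) → fromℚ q ≤ᴿ x
≤ᴿ-const q x = ≤ᴿ-intro (fromℚ q) x

const-≤ᴿ : ∀ x q → Ev (λ m → approx x m ≤ q) → x ≤ᴿ fromℚ q
const-≤ᴿ x q = ≤ᴿ-intro x (fromℚ q)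

half-positive : ∀ {ε} → 0ℚ < ε → 0ℚ < ½ * ε
half-positive = 0<* (pos ½)

inv-small : ∀ c ε → 0ℚ < ε → ∃[ K ] (∀ K′ → K ℕ.≤ K′ → c * inv (suc K′) < ε)
inv-small c ε 0<ε with recip ε 0<ε
... | v , 0<v , εv≡1 with archimedean (c * v)
...   | K , cv≤K = K , λ K′ K≤K′ → *-cancelˡ-< (ι (suc K′)) (0<ι {suc K′} (s≤s z≤n))
  (lin< ((ℚ.≤-reflexive (cong (c *_) (inv-inverse {suc K′} (s≤s z≤n)))) ⊕
      (ℚ.≤-reflexive (sym (cong (c *_) εv≡1))) ⊕ (*-monoˡ-≤ ε (ℚ.<⇒≤ 0<ε) cv≤K) ⊕<
          (*-monoˡ-< ε 0<ε (ι-< {K} {suc K′} (s≤s K≤K′))))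
    (solve 6 (λ a b c d e f → a :* (b :* c) :+ (b :* (con 1ℚ) :+ b :* (d :* e) :+ d :* f :+ d :* a)
        := a :* d :+ (b :* (a :* c) :+ b :* (con 1ℚ) :+ d :* (b :* e) :+ d :* f))
      refl (ι (suc K′)) c (inv (suc K′)) ε v (ι K)))

module Areas {m : ℕ} (h : Vec ℕ m) (unique : VecUnique.Unique (0 ∷ h)) (H : ℕ) (ps≤H : VecAll.All (ℕ._≤ H) (0 ∷ h)) where

  open Correlation (0 ∷ h) unique H ps≤H hiding (c; e)

  ps<R : VecAll.All (ℕ._< R) (0 ∷ h)
  ps<R = VecAll.map s≤s ps≤H

  tailBound : ℕ → ℚ
  tailBound K = tailConstant * fromℕ 4 * inv (suc K)

  count-tailBound : ∀ K n → ∑ (L n) (notSmall K n) ≤ tailBound K * (ι n * ι n)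
  count-tailBound K n = subst₂ _≤_
    (trans (solve 3 (λ a b c → a :* (b :* c)
               := b :* a :* c)
             refl (inv (suc K)) (ι (suc K)) (∑ (L n) (notSmall K n)))
      (trans (cong (_* ∑ (L n) (notSmall K n)) (inv-inverse {suc K} (s≤s z≤n)))
          (ℚ.*-identityˡ (∑ (L n) (notSmall K n)))))
    (solve 3 (λ a b c → a :* (b :* c)
        := b :* a :* c)
      refl (inv (suc K)) (tailConstant * fromℕ 4) (ι n * ι n))
    (*-monoˡ-≤ (inv (suc K)) (ℚ.<⇒≤ (inv-positive {suc K} (s≤s z≤n))) (count-tail K n))

  Φ-tailBound : ∀ K n → K₀ ℕ.≤ K → ∑ (L n) (λ s → notSmall K n s * Φ (0 ∷ h) n s) ≤ tailBound K * (ι n * ι n)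
  Φ-tailBound K n K₀≤K = subst₂ _≤_
    (trans (solve 3 (λ a b c → a :* (b :* c) := b :* a :* c) refl (inv (suc K)) (ι (suc K)) X)
      (trans (cong (_* X) (inv-inverse {suc K} (s≤s z≤n))) (ℚ.*-identityˡ X)))
    (solve 3 (λ a b c → a :* (b :* c)
        := b :* a :* c)
      refl (inv (suc K)) (tailConstant * fromℕ 4) (ι n * ι n))
    (*-monoˡ-≤ (inv (suc K)) (ℚ.<⇒≤ (inv-positive {suc K} (s≤s z≤n))) (Φ-tail K n K₀≤K))
    where
    X : ℚ
    X = ∑ (L n) (λ s → notSmall K n s * Φ (0 ∷ h) n s)

  tailBound-small : ∀ ε → 0ℚ < ε → ∃[ K ] (∀ K′ → K ℕ.≤ K′ → tailBound K′ < ε)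
  tailBound-small = inv-small (tailConstant * fromℕ 4)

  module _ (v : Vec ℕ (suc m)) where

    selected : Vec ℕ R → ℚ
    selected w = 𝟙 (select (0 ∷ h) w ≟ⱽ v)

    Quad-selected : ∀ K → Quad (smallSum selected K)
    Quad-selected = Quad-smallSum⁺ selected (λ w → 0≤𝟙 (select (0 ∷ h) w ≟ⱽ v))

    -- Scaled by 1/n, the lattice has n² points per unit of area; so this is the area of the part of
    -- the region on which the first R letters are at most K.
    α : ℕ → ℚ
    α K = coef (Quad-selected K)

    α-mono : ∀ {K K′} → K ℕ.≤ K′ → α K ≤ α K′
    α-mono {K} {K′} K≤K′ = coef-mono (Quad-selected K) (Quad-selected K′) λ n → ∑-mono (L n) λ {s} _ →
      *-mono-≤ (0≤𝟙 (small? K′ (letters n R s))) (0≤𝟙 (select (0 ∷ h) (letters n R s) ≟ⱽ v))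
        (𝟙-mono (small? K (letters n R s)) (small? K′ (letters n R s))
            (VecAll.map (λ le → ℕ.≤-trans le K≤K′))) ℚ.≤-refl

    -- Raising the bound on the letters adds only points with a letter above K, whose density is at
    -- most `tailBound K`.
    α-tail : ∀ K K′ → α K′ ≤ α K + tailBound K
    α-tail K K′ = coef-≤ (Quad-selected K′) (Quad-selected K) (tailBound K) 0ℚ λ n _ →
      (lin≤ ((ℚ.≤-trans (∑-mono (L n) (λ {s} _ → pointwise n s)) (ℚ.≤-reflexive (∑-+ (L n) _ _))) ⊕
          (count-tailBound K n))
        (solve 6 (λ a b c d e f → a :+ (b :+ c :+ d :* e)
            := b :+ d :* e :+ (con 0ℚ) :* f :+ (a :+ c))
          refl (smallSum selected K′ n) (smallSum selected K n) (∑ (L n) (notSmall K n)) (tailBound K)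
              (ι n * ι n) (ι n)))
      where
      pointwise : ∀ n s → 𝟙 (small? K′ (letters n R s)) * selected (letters n R s) ≤
                  𝟙 (small? K (letters n R s)) * selected (letters n R s) + notSmall K n s
      pointwise n s with small? K (letters n R s)
      ... | yes _ = lin≤ (*-mono-≤ (nonneg 1ℚ) 0≤b (𝟙≤1 (small? K′ (letters n R s))) ℚ.≤-refl)
                      (solve 2 (λ a b → a :* b :+ (con 1ℚ) :* b
                          := (con 1ℚ) :* b :+ (con 0ℚ) :+ a :* b)
                        refl (𝟙 (small? K′ (letters n R s))) (selected (letters n R s)))
        where 0≤b = 0≤𝟙 (select (0 ∷ h) (letters n R s) ≟ⱽ v)
      ... | no _ = lin≤ (*-mono-≤ (nonneg 1ℚ) 0≤b (𝟙≤1 (small? K′ (letters n R s)))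
          (𝟙≤1 (select (0 ∷ h) (letters n R s) ≟ⱽ v)))
                     (solve 2 (λ a b → a :* b :+ (con 1ℚ) :* (con 1ℚ)
                         := (con 0ℚ) :* b :+ (con 1ℚ) :+ a :* b)
                       refl (𝟙 (small? K′ (letters n R s))) (selected (letters n R s)))
        where 0≤b = 0≤𝟙 (select (0 ∷ h) (letters n R s) ≟ⱽ v)

    α-cauchy : ∀ ε → 0ℚ < ε → ∃[ K ] (∀ i j → K ℕ.≤ i → K ℕ.≤ j → ∣ α i - α j ∣ < ε)
    α-cauchy ε 0<ε = K , λ i j K≤i K≤j → ℚ.≤-<-trans
      (∣∣≤ (lin≤ ((α-tail K i) ⊕ (α-mono K≤j))
             (solve 4 (λ a b c d → a :- b :+ (c :+ d :+ b)
                 := d :+ (a :+ c))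
               refl (α i) (α j) (α K) (tailBound K)))
           (lin≤ ((α-tail K j) ⊕ (α-mono K≤i))
             (solve 4 (λ a b c d → (:- (a :- b)) :+ (c :+ d :+ a)
                 := d :+ (b :+ c))
               refl (α i) (α j) (α K) (tailBound K))))
      (proj₂ (tailBound-small ε 0<ε) K ℕ.≤-refl)
      where
      K : ℕ
      K = proj₁ (tailBound-small ε 0<ε)

    -- A limit over the bound K, since the letters at positions that are not selected are unbounded.
    area : ℝ
    area = mkℝ α α-cauchy

  -- For fixed K and n, the lattice points with letters ≤ K whose orbit stays away from the sides of
  -- the triangle represent boxes on which the first R letters are constant.
  module Approximation (k : ℕ) (l : Vec ℕ m) (K n : ℕ) (1≤n : 1 ℕ.≤ n) where

    open Grid n 1≤n

    B : ℕ
    -- The factor 3 is the distance of `near-box`, the power its growth over R steps.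
    B = 3 ℕ.* (2 ℕ.+ K) ℕ.^ R

    D : ℚ
    D = ι (suc R) * (fromℕ 3 * ι B)

    small?ₙ : ∀ s → Dec (Small K (letters n R s))
    small?ₙ s = small? K (letters n R s)

    deep?ₙ : ∀ s → Dec (Deep n B R s)
    deep?ₙ = deep? n B R

    selected?ₙ : ∀ s → Dec (select (0 ∷ h) (letters n R s) ≡ k ∷ l)
    selected?ₙ s = select (0 ∷ h) (letters n R s) ≟ⱽ (k ∷ l)

    good? : ∀ s → Dec (Small K (letters n R s) × Deep n B R s × select (0 ∷ h) (letters n R s) ≡ k ∷ l)
    good? s = small?ₙ s ×-dec (deep?ₙ s ×-dec selected?ₙ s)

    bad? : ∀ s → Dec (Small K (letters n R s) × Deep n B R s × select (0 ∷ h) (letters n R s) ≢ k ∷ l)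
    bad? s = small?ₙ s ×-dec (deep?ₙ s ×-dec ¬? (selected?ₙ s))

    boxWord : ∀ {e} 0≤e → e ≤ δ → ∀ s p → s ∈ L n → Small K (letters n R s) → Deep n B R s → ⟦ box e 0≤e
        s ⟧ p → HasWord (letters n R s) p
    boxWord {e} 0≤e e≤δ s p s∈ small deep p∈ = deep⇒HasWord R K B 3 p 1≤n s∈ small deep ℕ.≤-refl
        (near-box e 0≤e e≤δ s p p∈)

    nonDeep : ∑ (L n) (λ s → 𝟙 (¬? (deep?ₙ s))) ≤ D * ι n
    nonDeep = nonDeep-bound n B R

    inner : List Box
    inner = map (box 0ℚ ℚ.≤-refl) (filter good? (L n))

    inner-nonOverlapping : AllPairs NonOverlapping inner
    inner-nonOverlapping = AllPairs.map⁺ (AllPairs.map nonOverlapping (Unique.filter⁺ good? (unique-L n)))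

    inner⊆region : All (λ b → ∀ {p} → ⟦ b ⟧ p → region h k l p) inner
    inner⊆region = All.map⁺ (All.tabulate λ {s} s∈ {p} p∈ →
      let s∈L , small , deep , sel = ∈.∈-filter⁻ good? {xs = L n} s∈ in
      region⁺ h (letters n R s) p ps<R (boxWord ℚ.≤-refl (ℚ.<⇒≤ 0<δ) s p s∈L small deep p∈) sel)

    inner-area : α (k ∷ l) K ≤ totalArea inner + (D + err (Quad-selected (k ∷ l) K)) * δ
    inner-area = subst (λ x → α (k ∷ l) K ≤ x + (D + err (Quad-selected (k ∷ l) K)) * δ) (sym total)
      (divide-≤ (α (k ∷ l) K) c (D + err (Quad-selected (k ∷ l) K))
        (lin≤ ((lower (Quad-selected (k ∷ l) K) n 1≤n) ⊕ count ⊕ nonDeep)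
          (solve 8 (λ a b c d e f g h → a :* b :+ (c :+ d :* e :+ (f :+ g) :+ h :* e)
              := f :+ (h :+ d) :* e :+ (a :* b :+ c :+ g))
            refl (α (k ∷ l) K) (ι n * ι n) (smallSum (selected (k ∷ l)) K n)
                (err (Quad-selected (k ∷ l) K)) (ι n) c (∑ (L n) (λ s → 𝟙 (¬? (deep?ₙ s)))) D)))
      where
      c : ℚ
      c = ∑ (L n) (λ s → 𝟙 (good? s))
      total : totalArea inner ≡ c * (δ * δ)
      total = trans (totalArea-boxes 0ℚ ℚ.≤-refl (filter good? (L n)))
        (cong₂ _*_ (trans (∑-filter good? (L n) (λ _ → 1ℚ))
            (∑-cong (L n) (λ {s} _ → ℚ.*-identityʳ (𝟙 (good? s)))))
          (solve 1 (λ a → (a :+ (con (fromℕ 2)) :* (con 0ℚ)) :* (a :+ (con (fromℕ 2)) :* (con 0ℚ))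
              := a :* a)
            refl δ))
      count : smallSum (selected (k ∷ l)) K n ≤ c + ∑ (L n) (λ s → 𝟙 (¬? (deep?ₙ s)))
      count = ℚ.≤-trans (∑-mono (L n) (λ {s} _ → pointwise s)) (ℚ.≤-reflexive (∑-+ (L n) _ _))
        where
        pointwise : ∀ s → 𝟙 (small?ₙ s) * 𝟙 (selected?ₙ s) ≤ 𝟙 (good? s) + 𝟙 (¬? (deep?ₙ s))
        pointwise s with small?ₙ s | deep?ₙ s | selected?ₙ s
        ... | yes _ | yes _ | yes _ = lin≤ (ℚ.≤-refl {0ℚ})
                                        (solve 0 ((con 1ℚ) :* (con 1ℚ) :+ (con 0ℚ)
                                            := (con 1ℚ) :+ (con 0ℚ) :+ (con 0ℚ))
                                          refl )
        ... | yes _ | yes _ | no _  = lin≤ (ℚ.≤-refl {0ℚ})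
                                        (solve 0 ((con 1ℚ) :* (con 0ℚ) :+ (con 0ℚ)
                                            := (con 0ℚ) :+ (con 0ℚ) :+ (con 0ℚ))
                                          refl )
        ... | yes _ | no _  | yes _ = lin≤ (ℚ.≤-refl {0ℚ})
                                        (solve 0 ((con 1ℚ) :* (con 1ℚ) :+ (con 0ℚ)
                                            := (con 0ℚ) :+ (con 1ℚ) :+ (con 0ℚ))
                                          refl )
        ... | yes _ | no _  | no _  = lin≤ (nonneg 1ℚ)
                                        (solve 0 ((con 1ℚ) :* (con 0ℚ) :+ (con 1ℚ)
                                            := (con 0ℚ) :+ (con 1ℚ) :+ (con 0ℚ))
                                          refl )
        ... | no _  | yes _ | yes _ = lin≤ (ℚ.≤-refl {0ℚ})
                                        (solve 0 ((con 0ℚ) :* (con 1ℚ) :+ (con 0ℚ)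
                                            := (con 0ℚ) :+ (con 0ℚ) :+ (con 0ℚ))
                                          refl )
        ... | no _  | yes _ | no _  = lin≤ (ℚ.≤-refl {0ℚ})
                                        (solve 0 ((con 0ℚ) :* (con 0ℚ) :+ (con 0ℚ)
                                            := (con 0ℚ) :+ (con 0ℚ) :+ (con 0ℚ))
                                          refl )
        ... | no _  | no _  | yes _ = lin≤ (nonneg 1ℚ)
                                        (solve 0 ((con 0ℚ) :* (con 1ℚ) :+ (con 1ℚ)
                                            := (con 0ℚ) :+ (con 1ℚ) :+ (con 0ℚ))
                                          refl )
        ... | no _  | no _  | no _  = lin≤ (nonneg 1ℚ)
                                        (solve 0 ((con 0ℚ) :* (con 0ℚ) :+ (con 1ℚ)
                                            := (con 0ℚ) :+ (con 1ℚ) :+ (con 0ℚ))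
                                          refl )

    -- The cell of a real point cannot be decided, so a rational approximation is located instead
    -- and the boxes of the cover are enlarged by e. Being of order δ², the enlargement changes the
    -- total area of at most n² boxes only by O(δ).
    e : ℚ
    e = δ * δ

    0<e : 0ℚ < e
    0<e = 0<* 0<δ 0<δ

    0≤e : 0ℚ ≤ e
    0≤e = ℚ.<⇒≤ 0<e

    e≤δ : e ≤ δ
    e≤δ = subst (e ≤_) (ℚ.*-identityʳ δ) (*-monoˡ-≤ δ (ℚ.<⇒≤ 0<δ) δ≤1)

    candidate? : ∀ s → Dec (n ℕ.< 2 ℕ.+ (proj₁ s ℕ.+ proj₂ s))
    candidate? s = n ℕ.<? 2 ℕ.+ (proj₁ s ℕ.+ proj₂ s)

    candidates : List Pair
    candidates = filter candidate? (cartesianProduct [1⋯ n ] [1⋯ n ])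

    -- A box is dropped only if its word is certain and selects other letters than k ∷ l. The excess
    -- consists of points with a large letter, points that are not deep and the two extra
    -- antidiagonals.
    outer : List Box
    outer = map (box e 0≤e) (filter (¬? ∘ bad?) candidates)

    cover : ∀ {p} → region h k l p → Any (λ b → ⟦ b ⟧ p) outer
    cover {p@(x , y)} p∈ = go (region⇒𝒯 h k l p p∈) (cauchy x (½ * e) 0<e₂) (cauchy y (½ * e) 0<e₂)
      where
      0<e₂ : 0ℚ < ½ * e
      0<e₂ = half-positive 0<e
      go : 𝒯 (x , y) →
           ∃[ n₀ ] (∀ i j → n₀ ℕ.≤ i → n₀ ℕ.≤ j → ∣ approx x i - approx x j ∣ < ½ * e) →
           ∃[ n₀ ] (∀ i j → n₀ ℕ.≤ i → n₀ ℕ.≤ j → ∣ approx y i - approx y j ∣ < ½ * e) →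
           Any (λ b → ⟦ b ⟧ p) outer
      go ((0≤x , x≤1) , (0≤y , y≤1) , (η , 0<η , 1<x+y)) (nˣ , cauchyˣ) (nʸ , cauchyʸ) =
        found (0≤x (½ * e) 0<e₂ ∧ᴱ x≤1 (½ * e) 0<e₂ ∧ᴱ 0≤y (½ * e) 0<e₂ ∧ᴱ y≤1 (½ * e) 0<e₂ ∧ᴱ 1<x+y ∧ᴱ
               (nˣ , λ i nˣ≤i j nˣ≤j → cauchyˣ i j nˣ≤i nˣ≤j) ∧ᴱ (nʸ , λ i nʸ≤i j nʸ≤j → cauchyʸ i j nʸ≤i nʸ≤j))
        where
        inBox : ∀ z q n₀ → (∀ j → n₀ ℕ.≤ j → ∣ q - approx z j ∣ < ½ * e) → ∀ a → lo (½ * e) (ℚ.<⇒≤ 0<e₂)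
            a ≤ q → q ≤ hi (½ * e) (ℚ.<⇒≤ 0<e₂) a →
                fromℚ (lo e 0≤e a) ≤ᴿ z × z ≤ᴿ fromℚ (hi e 0≤e a)
        inBox z q n₀ close a lo≤q q≤hi =
          ≤ᴿ-const (lo e 0≤e a) z (n₀ , λ j le → (lin≤ (lo≤q ⊕ (x≤∣x∣ (q - approx z j)) ⊕ (ℚ.<⇒≤ (close j le)))
              (solve 6 (λ a b c d e f → a :- b :- c :+ (d :+ e :+ (con ½) :* c)
                  := f :+ (a :- b :- (con ½) :* c :+ (d :- f) :+ e))
                refl (ι a * δ) δ e q (∣ q - approx z j ∣) (approx z j)))) ,
          const-≤ᴿ z (hi e 0≤e a) (n₀ , λ j le → (lin≤ (q≤hi ⊕ (-x≤∣x∣ (q - approx z j)) ⊕ (ℚ.<⇒≤ (close j le)))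
              (solve 5 (λ a b c d e → a :+ (b :+ (con ½) :* c :+ d :+ (con ½) :* c)
                  := b :+ c :+ (e :+ (:- (e :- a)) :+ d))
                refl (approx z j) (ι a * δ) e (∣ q - approx z j ∣) q)))
        found : Ev (λ i → 0ℚ ≤ approx x i + ½ * e × approx x i ≤ 1ℚ + ½ * e × 0ℚ ≤ approx y i + ½ * e ×
            approx y i ≤ 1ℚ + ½ * e ×
                  1ℚ + η ≤ approx x i + approx y i ×
                  (∀ j → nˣ ℕ.≤ j → ∣ approx x i - approx x j ∣ < ½ * e) ×
                      (∀ j → nʸ ℕ.≤ j → ∣ approx y i - approx y j ∣ < ½ * e)) →
                Any (λ b → ⟦ b ⟧ p) outer
        found (i , ev) = lose (∈.∈-map⁺ (box e 0≤e) (∈.∈-filter⁺ (¬? ∘ bad?) s∈candidates not-bad)) p∈box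
          where
          X Y : ℚ
          X = approx x i
          Y = approx y i
          facts = ev i ℕ.≤-refl
          0≤X = proj₁ facts
          X≤1 = proj₁ (proj₂ facts)
          0≤Y = proj₁ (proj₂ (proj₂ facts))
          Y≤1 = proj₁ (proj₂ (proj₂ (proj₂ facts)))
          1<X+Y = proj₁ (proj₂ (proj₂ (proj₂ (proj₂ facts))))
          closeˣ = proj₁ (proj₂ (proj₂ (proj₂ (proj₂ (proj₂ facts)))))
          closeʸ = proj₂ (proj₂ (proj₂ (proj₂ (proj₂ (proj₂ facts)))))
          -- The approximation at i is located with enlargement e/2. All later ones are within e/2
          -- of it, so the real number itself lies in the box enlarged by e.
          fa = locate (½ * e) (ℚ.<⇒≤ 0<e₂) X (lin≤ 0≤X
              (solve 2 (λ a b → (:- ((con ½) :* a)) :+ (b :+ (con ½) :* a) := b :+ (con 0ℚ)) refl e X)) X≤1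
          fb = locate (½ * e) (ℚ.<⇒≤ 0<e₂) Y (lin≤ 0≤Y
              (solve 2 (λ a b → (:- ((con ½) :* a)) :+ (b :+ (con ½) :* a) := b :+ (con 0ℚ)) refl e Y)) Y≤1
          a b : ℕ
          a = proj₁ fa
          b = proj₁ fb
          a∈ = proj₁ (proj₂ fa)
          b∈ = proj₁ (proj₂ fb)
          X≤hi = proj₂ (proj₂ (proj₂ fa))
          Y≤hi = proj₂ (proj₂ (proj₂ fb))
          p∈box : ⟦ box e 0≤e (a , b) ⟧ p
          p∈box = inBox x X nˣ closeˣ a (proj₁ (proj₂ (proj₂ fa))) X≤hi , inBox y Y nʸ closeʸ b
              (proj₁ (proj₂ (proj₂ fb))) Y≤hi
          n<2+a+b : n ℕ.< 2 ℕ.+ (a ℕ.+ b)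
          n<2+a+b = ι-cancel-< (subst (ι n <_) (sym (trans (ι-+ 2 (a ℕ.+ b)) (cong₂ _+_ (ι≡fromℕ 2) (ι-+ a b))))
            (lin< ((*-monoˡ-≤ (ι n) (0≤ι n) X≤hi) ⊕ (*-monoˡ-≤ (ι n) (0≤ι n) Y≤hi) ⊕
                (ℚ.≤-reflexive (cong (ι a *_) nδ≡1)) ⊕ (ℚ.≤-reflexive (cong (ι b *_) nδ≡1)) ⊕
                    (ℚ.≤-reflexive (cong (_* δ) nδ≡1)) ⊕ δ≤1 ⊕ (*-monoˡ-≤ (ι n) (0≤ι n) 1<X+Y) ⊕
                        (0≤* (0≤ι n) (ℚ.<⇒≤ 0<η)) ⊕< (pos 1ℚ))
              (solve 7 (λ a b c d e f g → a :+
                  (a :* (b :* c :+ (con ½) :* (c :* c)) :+ a :* (d :* c :+ (con ½) :* (c :* c)) :+ b :*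
                      (con 1ℚ) :+ d :* (con 1ℚ) :+ (con 1ℚ) :* c :+ (con 1ℚ) :+ a :* (e :+ f) :+ a :* g
                          :+ (con 1ℚ))
                  := (con (fromℕ 2)) :+ (b :+ d) :+
                      (a :* e :+ a :* f :+ b :* (a :* c) :+ d :* (a :* c) :+ a :* c :* c :+ c :+ a :*
                          ((con 1ℚ) :+ g) :+ (con 0ℚ) :+ (con 0ℚ)))
                refl (ι n) (ι a) δ (ι b) X Y η)))
          s∈candidates : (a , b) ∈ candidates
          s∈candidates = ∈.∈-filter⁺ candidate? (∈.∈-cartesianProduct⁺ a∈ b∈) n<2+a+b
          not-bad : ¬ (Small K (letters n R (a , b)) × Deep n B R (a , b) × select (0 ∷ h)
              (letters n R (a , b)) ≢ k ∷ l)
          not-bad (small , deep , unselected) = unselected (region⁻ h (letters n R (a , b)) p ps<R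
            (boxWord 0≤e e≤δ (a , b) p (∈L⁺ (inL (proj₂ (∈[1⋯]⁻ a∈)) (proj₂ (∈[1⋯]⁻ b∈))
              (ℕ.≤-<-trans (ℕ.m≤m+n n B) (proj₂ (proj₂ (Deep⇒Core R deep)))))) small deep p∈box) p∈)

    -- Of the constant 10, the two extra antidiagonals account for 2. The enlargement accounts for
    -- 8: it multiplies the unenlarged area, which is at most 1, by 1 + 4δ + 4δ², and δ ≤ 1.
    outer-area : totalArea outer ≤ α (k ∷ l) K + tailBound K +
        (err (Quad-selected (k ∷ l) K) + D + fromℕ 10) * δ
    outer-area = subst (_≤ α (k ∷ l) K + tailBound K + (E + D + fromℕ 10) * δ) (sym total)
      (lin≤ (q≤ ⊕ (*-mono-≤ (nonneg 1ℚ) 0≤x q≤1 ℚ.≤-refl) ⊕ ((fromℕ 4) ⊛ e≤δ))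
        (solve 6 (λ a b c d e f → a :* ((con 1ℚ) :+ (con (fromℕ 4)) :* b :+ (con (fromℕ 4)) :* (b :* b))
            :+ (c :+ d :+ (e :+ f :+ (con (fromℕ 2))) :* b :+ (con 1ℚ) :*
                ((con (fromℕ 4)) :* b :+ (con (fromℕ 4)) :* (b :* b)) :+ (con (fromℕ 4)) :* b)
            := c :+ d :+ (e :+ f :+ (con (fromℕ 10))) :* b :+
                (a :+ a :* ((con (fromℕ 4)) :* b :+ (con (fromℕ 4)) :* (b :* b)) :+ (con (fromℕ 4)) :*
                    (b :* b)))
          refl q δ (α (k ∷ l) K) (tailBound K) E D))
      where
      E c q : ℚ
      E = err (Quad-selected (k ∷ l) K)
      c = ∑ [1⋯ n ] (λ a → ∑ [1⋯ n ] (λ b → 𝟙 (candidate? (a , b)) * 𝟙 (¬? (bad? (a , b)))))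
      q = c * (δ * δ)
      0≤x : 0ℚ ≤ fromℕ 4 * δ + fromℕ 4 * (δ * δ)
      0≤x = lin≤ (((fromℕ 4) ⊛ (ℚ.<⇒≤ 0<δ)) ⊕ ((fromℕ 4) ⊛ 0≤e))
              (solve 1 (λ a → (con 0ℚ) :+ ((con (fromℕ 4)) :* a :+ (con (fromℕ 4)) :* (a :* a))
                  := (con (fromℕ 4)) :* a :+ (con (fromℕ 4)) :* (a :* a) :+
                      ((con (fromℕ 4)) :* (con 0ℚ) :+ (con (fromℕ 4)) :* (con 0ℚ)))
                refl δ)
      total : totalArea outer ≡ q * (1ℚ + fromℕ 4 * δ + fromℕ 4 * (δ * δ))
      total = trans (totalArea-boxes e 0≤e (filter (¬? ∘ bad?) candidates)) (trans
        (cong (_* (width e 0≤e * width e 0≤e)) (trans (∑-filter (¬? ∘ bad?) candidates (λ _ → 1ℚ)) (trans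
          (∑-filter candidate? (cartesianProduct [1⋯ n ] [1⋯ n ]) _)
              (trans (∑-productWith _,_ [1⋯ n ] [1⋯ n ] _)
          (∑-cong [1⋯ n ] (λ {a} _ → ∑-cong [1⋯ n ]
              (λ {b} _ → cong (𝟙 (candidate? (a , b)) *_) (ℚ.*-identityʳ (𝟙 (¬? (bad? (a , b))))))))))))
        (solve 2 (λ a b → a :* ((b :+ (con (fromℕ 2)) :* (b :* b)) :* (b :+ (con (fromℕ 2)) :* (b :* b)))
            := a :* (b :* b) :* ((con 1ℚ) :+ (con (fromℕ 4)) :* b :+ (con (fromℕ 4)) :* (b :* b)))
          refl c δ))
      c≤n² : c ≤ ι n * ι n
      c≤n² = subst (c ≤_) (trans (∑-cong [1⋯ n ]
          (λ _ → trans (∑-[1⋯]-const n 1ℚ) (ℚ.*-identityˡ (ι n)))) (∑-[1⋯]-const n (ι n)))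
        (∑-mono [1⋯ n ] λ {a} _ → ∑-mono [1⋯ n ] λ {b} _ →
          subst (𝟙 (candidate? (a , b)) * 𝟙 (¬? (bad? (a , b))) ≤_) (ℚ.*-identityˡ 1ℚ)
            (*-mono-≤ (nonneg 1ℚ) (0≤𝟙 (¬? (bad? (a , b)))) (𝟙≤1 (candidate? (a , b)))
                (𝟙≤1 (¬? (bad? (a , b))))))
      scaleδ : ∀ a d → δ * δ * (a * (ι n * ι n) + d * ι n) ≡ a + d * δ
      scaleδ a d = trans (solve 4 (λ a b c d → a :* a :* (b :* (c :* c) :+ d :* c)
                             := b :* (c :* a :* (c :* a)) :+ d :* a :* (c :* a))
                           refl δ a (ι n) d)
        (trans (cong (λ t → a * (t * t) + d * δ * t) nδ≡1)
            (solve 3 (λ a b c → a :* ((con 1ℚ) :* (con 1ℚ)) :+ b :* c :* (con 1ℚ)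
              := a :+ b :* c)
            refl a d δ))
      q≤1 : q ≤ 1ℚ
      q≤1 = subst₂ _≤_ (ℚ.*-comm (δ * δ) c) (trans (scaleδ 1ℚ 0ℚ) (solve 1 (λ a → (con 1ℚ) :+ (con 0ℚ) :* a
            := con 1ℚ)
          refl δ))
        (*-monoˡ-≤ (δ * δ) 0≤e (lin≤ c≤n²
                                 (solve 2 (λ a b → a :+ b :* b
                                     := (con 1ℚ) :* (b :* b) :+ (con 0ℚ) :* b :+ a)
                                   refl c (ι n))))
      strip : ∀ a b → 𝟙 (candidate? (a , b)) * 𝟙 (¬? (bad? (a , b))) ≤
              𝟙 (n ℕ.<? a ℕ.+ b) * 𝟙 (¬? (bad? (a , b))) + 𝟙 (n ℕ.≟ a ℕ.+ b) + 𝟙 (n ℕ.≟ suc a ℕ.+ b)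
      strip a b = cases (n ℕ.<? a ℕ.+ b) (candidate? (a , b))
        where
        x y z : ℚ
        x = 𝟙 (¬? (bad? (a , b)))
        y = 𝟙 (n ℕ.≟ a ℕ.+ b)
        z = 𝟙 (n ℕ.≟ suc a ℕ.+ b)
        0≤x′ = 0≤𝟙 (¬? (bad? (a , b)))
        x≤1 = 𝟙≤1 (¬? (bad? (a , b)))
        0≤y = 0≤𝟙 (n ℕ.≟ a ℕ.+ b)
        0≤z = 0≤𝟙 (n ℕ.≟ suc a ℕ.+ b)
        cases : (d : Dec (n ℕ.< a ℕ.+ b)) (d′ : Dec (n ℕ.< 2 ℕ.+ (a ℕ.+ b))) → 𝟙 d′ * x ≤ 𝟙 d * x + y + z
        cases (yes _) d′ = lin≤ ((*-mono-≤ (nonneg 1ℚ) 0≤x′ (𝟙≤1 d′) ℚ.≤-refl) ⊕ 0≤y ⊕ 0≤z)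
                             (solve 4 (λ a b c d → a :* b :+ ((con 1ℚ) :* b :+ c :+ d)
                                 := (con 1ℚ) :* b :+ c :+ d :+ (a :* b :+ (con 0ℚ) :+ (con 0ℚ)))
                               refl (𝟙 d′) x y z)
        cases (no _) (no _) = lin≤ (0≤y ⊕ 0≤z)
                                (solve 3 (λ a b c → (con 0ℚ) :* a :+ (b :+ c)
                                    := (con 0ℚ) :* a :+ b :+ c :+ ((con 0ℚ) :+ (con 0ℚ)))
                                  refl x y z)
        cases (no ≮) (yes (s≤s n≤)) with ℕ.m≤n⇒m<n∨m≡n n≤
        ... | inj₂ eq = lin≤ (x≤1 ⊕ (ℚ.≤-reflexive (sym (𝟙-yes (n ℕ.≟ suc a ℕ.+ b) eq))) ⊕ 0≤y)
                          (solve 3 (λ a b c → (con 1ℚ) :* a :+ ((con 1ℚ) :+ b :+ c)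
                              := (con 0ℚ) :* a :+ c :+ b :+ (a :+ (con 1ℚ) :+ (con 0ℚ)))
                            refl x z y)
        ... | inj₁ (s≤s n≤′) = lin≤ (x≤1 ⊕
            (ℚ.≤-reflexive (sym (𝟙-yes (n ℕ.≟ a ℕ.+ b) (ℕ.≤-antisym n≤′ (ℕ.≮⇒≥ ≮))))) ⊕ 0≤z)
                                 (solve 3 (λ a b c → (con 1ℚ) :* a :+ ((con 1ℚ) :+ b :+ c)
                                     := (con 0ℚ) :* a :+ b :+ c :+ (a :+ (con 1ℚ) :+ (con 0ℚ)))
                                   refl x y z)
      c≤ : c ≤ ∑ (L n) (λ s → 𝟙 (¬? (bad? s))) + ι n + ι n
      c≤ = begin
        c
          ≤⟨ ∑-mono [1⋯ n ] (λ {a} _ → ∑-mono [1⋯ n ] (λ {b} _ → strip a b)) ⟩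
        ∑ [1⋯ n ] (λ a → ∑ [1⋯ n ] (λ b → X a b + Y a b + Z a b))
          ≡⟨ trans (∑-cong [1⋯ n ] (λ {a} _ → trans (∑-+ [1⋯ n ] _ (Z a))
              (cong (_+ ∑ [1⋯ n ] (Z a)) (∑-+ [1⋯ n ] (X a) (Y a)))))
               (trans (∑-+ [1⋯ n ] _ _) (cong (_+ ∑ [1⋯ n ] (λ a → ∑ [1⋯ n ] (Z a))) (∑-+ [1⋯ n ] _ _))) ⟩
        ∑ [1⋯ n ] (λ a → ∑ [1⋯ n ] (X a)) + ∑ [1⋯ n ] (λ a → ∑ [1⋯ n ] (Y a)) + ∑ [1⋯ n ]
            (λ a → ∑ [1⋯ n ] (Z a))
          ≤⟨ ℚ.+-mono-≤ (ℚ.+-mono-≤ (ℚ.≤-reflexive (sym (∑-L n _)))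
              (ones (λ a → ∑-𝟙-antidiagonal-≤1 n a n))) (ones (λ a → ∑-𝟙-antidiagonal-≤1 n (suc a) n)) ⟩
        ∑ (L n) (λ s → 𝟙 (¬? (bad? s))) + ι n + ι n ∎
        where
        open ℚ.≤-Reasoning
        X Y Z : ℕ → ℕ → ℚ
        X a b = 𝟙 (n ℕ.<? a ℕ.+ b) * 𝟙 (¬? (bad? (a , b)))
        Y a b = 𝟙 (n ℕ.≟ a ℕ.+ b)
        Z a b = 𝟙 (n ℕ.≟ suc a ℕ.+ b)
        ones : ∀ {f : ℕ → ℚ} → (∀ a → f a ≤ 1ℚ) → ∑ [1⋯ n ] f ≤ ι n
        ones {f} le = subst (∑ [1⋯ n ] f ≤_) (trans (∑-[1⋯]-const n 1ℚ) (ℚ.*-identityˡ (ι n)))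
            (∑-mono [1⋯ n ] (λ {a} _ → le a))
      classify : ∀ s → 𝟙 (¬? (bad? s)) ≤ 𝟙 (small?ₙ s) * 𝟙 (selected?ₙ s) + notSmall K n s + 𝟙 (¬? (deep?ₙ s))
      classify s with small?ₙ s | deep?ₙ s | selected?ₙ s
      ... | yes _ | yes _ | yes _ = lin≤ (ℚ.≤-refl {0ℚ})
                                      (solve 0 ((con 1ℚ) :+ (con 0ℚ)
                                          := (con 1ℚ) :* (con 1ℚ) :+ (con 0ℚ) :+ (con 0ℚ) :+ (con 0ℚ))
                                        refl )
      ... | yes _ | yes _ | no _  = lin≤ (ℚ.≤-refl {0ℚ})
                                      (solve 0 ((con 0ℚ) :+ (con 0ℚ)
                                          := (con 1ℚ) :* (con 0ℚ) :+ (con 0ℚ) :+ (con 0ℚ) :+ (con 0ℚ))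
                                        refl )
      ... | yes _ | no _  | yes _ = lin≤ (nonneg 1ℚ)
                                      (solve 0 ((con 1ℚ) :+ (con 1ℚ)
                                          := (con 1ℚ) :* (con 1ℚ) :+ (con 0ℚ) :+ (con 1ℚ) :+ (con 0ℚ))
                                        refl )
      ... | yes _ | no _  | no _  = lin≤ (ℚ.≤-refl {0ℚ})
                                      (solve 0 ((con 1ℚ) :+ (con 0ℚ)
                                          := (con 1ℚ) :* (con 0ℚ) :+ (con 0ℚ) :+ (con 1ℚ) :+ (con 0ℚ))
                                        refl )
      ... | no _  | yes _ | yes _ = lin≤ (ℚ.≤-refl {0ℚ})
                                      (solve 0 ((con 1ℚ) :+ (con 0ℚ)
                                          := (con 0ℚ) :* (con 1ℚ) :+ (con 1ℚ) :+ (con 0ℚ) :+ (con 0ℚ))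
                                        refl )
      ... | no _  | yes _ | no _  = lin≤ (ℚ.≤-refl {0ℚ})
                                      (solve 0 ((con 1ℚ) :+ (con 0ℚ)
                                          := (con 0ℚ) :* (con 0ℚ) :+ (con 1ℚ) :+ (con 0ℚ) :+ (con 0ℚ))
                                        refl )
      ... | no _  | no _  | yes _ = lin≤ (nonneg 1ℚ)
                                      (solve 0 ((con 1ℚ) :+ (con 1ℚ)
                                          := (con 0ℚ) :* (con 1ℚ) :+ (con 1ℚ) :+ (con 1ℚ) :+ (con 0ℚ))
                                        refl )
      ... | no _  | no _  | no _  = lin≤ (nonneg 1ℚ)
                                      (solve 0 ((con 1ℚ) :+ (con 1ℚ)
                                          := (con 0ℚ) :* (con 0ℚ) :+ (con 1ℚ) :+ (con 1ℚ) :+ (con 0ℚ))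
                                        refl )
      count : ∑ (L n) (λ s → 𝟙 (¬? (bad? s))) ≤ smallSum (selected (k ∷ l)) K n + ∑ (L n) (notSmall K n)
          + ∑ (L n) (λ s → 𝟙 (¬? (deep?ₙ s)))
      count = ℚ.≤-trans (∑-mono (L n) (λ {s} _ → classify s))
        (ℚ.≤-reflexive (trans (∑-+ (L n) _ _) (cong (_+ ∑ (L n) (λ s → 𝟙 (¬? (deep?ₙ s)))) (∑-+ (L n) _ _))))
      q≤ : q ≤ α (k ∷ l) K + tailBound K + (E + D + fromℕ 2) * δ
      q≤ = subst₂ _≤_ (ℚ.*-comm (δ * δ) c) (scaleδ (α (k ∷ l) K + tailBound K) (E + D + fromℕ 2))
        (*-monoˡ-≤ (δ * δ) 0≤e
          (lin≤ (c≤ ⊕ count ⊕ (upper (Quad-selected (k ∷ l) K) n 1≤n) ⊕ (count-tailBound K n) ⊕ nonDeep)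
            (solve 11 (λ a b c d e f g h i j k → a :+
                (b :+ c :+ c :+ (d :+ e :+ f) :+ (g :* h :+ i :* c) :+ j :* h :+ k :* c)
                := (g :+ j) :* h :+ (i :+ k :+ (con (fromℕ 2))) :* c :+ (a :+ b :+ d :+ e :+ f))
              refl c (∑ (L n) (λ s → 𝟙 (¬? (bad? s)))) (ι n) (smallSum (selected (k ∷ l)) K n)
                  (∑ (L n) (notSmall K n)) (∑ (L n) (λ s → 𝟙 (¬? (deep?ₙ s)))) (α (k ∷ l) K) (ι n * ι n)
                      E (tailBound K) D)))

  -- K is fixed first, making the large letters negligible; n is chosen afterwards, because the
  -- constants of the boundary error depend on K.
  hasArea : ∀ k l → HasArea (region h k l) (area (k ∷ l))
  hasArea k l ε 0<ε =
    let K , tail<½ε = tailBound-small (½ * ε) (half-positive 0<ε)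
        n , error<½ε = inv-small (err (Quad-selected (k ∷ l) K) + ι (suc R) *
            (fromℕ 3 * ι (3 ℕ.* (2 ℕ.+ K) ℕ.^ R)) + fromℕ 10) (½ * ε) (half-positive 0<ε)
    in approximate K (tail<½ε K ℕ.≤-refl) n (error<½ε n ℕ.≤-refl)
    where
    approximate : ∀ K → tailBound K < ½ * ε → ∀ n′ →
                  (err (Quad-selected (k ∷ l) K) + ι (suc R) * (fromℕ 3 * ι (3 ℕ.* (2 ℕ.+ K) ℕ.^ R)) +
                      fromℕ 10) * inv (suc n′) < ½ * ε →
                  (∃[ bs ] (AllPairs NonOverlapping bs × All (λ b → ∀ {p} → ⟦ b ⟧ p → region h k l p) bs
                            × area (k ∷ l) ≤ᴿ fromℚ (totalArea bs + ε)))
                × (∃[ bs ] ((∀ {p} → region h k l p → Any (λ b → ⟦ b ⟧ p) bs)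
                            × fromℚ (totalArea bs - ε) ≤ᴿ area (k ∷ l)))
    approximate K tail<½ε n′ error<½ε =
      (inner , inner-nonOverlapping , inner⊆region , const-≤ᴿ (area (k ∷ l)) (totalArea inner + ε)
          (0 , λ i _ → area≤inner i)) ,
      (outer , cover , ≤ᴿ-const (totalArea outer - ε) (area (k ∷ l)) (K , outer≤area))
      where
      open Approximation k l K (suc n′) (s≤s z≤n)
      open Grid (suc n′) (s≤s z≤n) using (δ; 0<δ)
      E : ℚ
      E = err (Quad-selected (k ∷ l) K)
      area≤inner : ∀ i → α (k ∷ l) i ≤ totalArea inner + ε
      area≤inner i =
        lin≤ ((α-tail (k ∷ l) K i) ⊕ (ℚ.<⇒≤ tail<½ε) ⊕ inner-area ⊕ (ℚ.<⇒≤ error<½ε) ⊕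
            ((fromℕ 10) ⊛ (ℚ.<⇒≤ 0<δ)))
          (solve 8 (λ a b c d e f g h → a :+
              (b :+ c :+ (con ½) :* d :+ (e :+ (f :+ g) :* h) :+ (con ½) :* d :+ (con (fromℕ 10)) :* h)
              := e :+ d :+ (a :+ c :+ b :+ (g :+ f :+ (con (fromℕ 10))) :* h :+ (con (fromℕ 10)) :* (con 0ℚ)))
            refl (α (k ∷ l) i) (α (k ∷ l) K) (tailBound K) ε (totalArea inner) D E δ)
      outer≤area : ∀ i → K ℕ.≤ i → totalArea outer - ε ≤ α (k ∷ l) i
      outer≤area i K≤i =
        lin≤ ((α-mono (k ∷ l) K≤i) ⊕ (ℚ.<⇒≤ tail<½ε) ⊕ outer-area ⊕ (ℚ.<⇒≤ error<½ε))
          (solve 8 (λ a b c d e f g h → a :- b :+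
              (c :+ (con ½) :* b :+ (d :+ e :+ (f :+ g :+ (con (fromℕ 10))) :* h) :+ (con ½) :* b)
              := c :+ (d :+ e :+ a :+ (f :+ g :+ (con (fromℕ 10))) :* h))
            refl (totalArea outer) ε (α (k ∷ l) i) (α (k ∷ l) K) (tailBound K) E D δ)

-- The series of areas has the sum A

small-nth : ∀ {R M} {w : Vec ℕ R} → Small M w → ∀ p → nth w p ℕ.≤ M
small-nth [] p = z≤n
small-nth (x≤M ∷ w≤M) zero = x≤M
small-nth (x≤M ∷ w≤M) (suc p) = small-nth w≤M p

small-select : ∀ {R M d} {w : Vec ℕ R} (ps : Vec ℕ d) → Small M w → Small M (select ps w)
small-select [] small = []
small-select (p ∷ ps) small = small-nth small p ∷ small-select ps small

approx-∑ : {A : Set} (f : A → ℝ) (xs : List A) → ∀ i →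
           approx (foldr _+ᴿ_ (fromℚ 0ℚ) (map f xs)) i ≡ ∑ xs (λ x → approx (f x) i)
approx-∑ f [] i = refl
approx-∑ f (x ∷ xs) i = cong (approx (f x) i +_) (approx-∑ f xs i)

module Series {m : ℕ} (h : Vec ℕ m) (unique : VecUnique.Unique (0 ∷ h)) (H : ℕ) (ps≤H : VecAll.All (ℕ._≤ H) (0 ∷ h)) where

  open Correlation (0 ∷ h) unique H ps≤H hiding (c; e)
  open Areas h unique H ps≤H

  weight : Vec ℕ (suc m) → ℕ
  weight v = 2 ℕ.* prodV v

  -- M truncates the series, i is the index at which the areas are approximated, and n is the size
  -- of the lattice. For finite n this is the sum of 2Φ over the points with bounded letters, which
  -- is directly comparable with the sum over all points.
  partialSum : ℕ → ℕ → ℕ → ℚ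
  partialSum M i n = ∑ (indices M (suc m)) (λ v → ι (weight v) * smallSum (selected v) i n)

  Quad-partialSum : ∀ M i → Quad (partialSum M i)
  Quad-partialSum M i = Quad-∑ (indices M (suc m))
      (λ v → Quad-*⁺ (ι (weight v)) (0≤ι (weight v)) (Quad-selected v i))

  coef-partialSum : ∀ M i → Quad.coef (Quad-partialSum M i) ≡ ∑ (indices M (suc m)) (λ v → ι (weight v) * α v i)
  coef-partialSum M i = coef-∑ (indices M (suc m))
      (λ v → Quad-*⁺ (ι (weight v)) (0≤ι (weight v)) (Quad-selected v i))

  restricted : ℕ → ℕ → ℕ → Pair → ℚ
  restricted M i n s = 𝟙 (small? i (letters n R s)) *
      (𝟙 (small? M (select (0 ∷ h) (letters n R s))) * (fromℕ 2 * Φ (0 ∷ h) n s))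

  partialSum≡ : ∀ M i n → partialSum M i n ≡ ∑ (L n) (restricted M i n)
  partialSum≡ M i n = begin
    ∑ I (λ v → ι (weight v) * ∑ (L n) (λ s → σ s * 𝟙 (select (0 ∷ h) (letters n R s) ≟ⱽ v)))
      ≡⟨ ∑-cong I (λ {v} _ → sym (∑-*ˡ (L n) (ι (weight v)) _)) ⟩
    ∑ I (λ v → ∑ (L n) (λ s → ι (weight v) * (σ s * 𝟙 (select (0 ∷ h) (letters n R s) ≟ⱽ v))))
      ≡⟨ ∑-swap I (L n) _ ⟩
    ∑ (L n) (λ s → ∑ I (λ v → ι (weight v) * (σ s * 𝟙 (select (0 ∷ h) (letters n R s) ≟ⱽ v))))
      ≡⟨ ∑-cong (L n) (λ {s} s∈ → row s s∈) ⟩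
    ∑ (L n) (restricted M i n) ∎
    where
    open ≡-Reasoning
    I : List (Vec ℕ (suc m))
    I = indices M (suc m)
    σ : Pair → ℚ
    σ s = 𝟙 (small? i (letters n R s))
    row : ∀ s → s ∈ L n → ∑ I (λ v → ι (weight v) * (σ s * 𝟙 (select (0 ∷ h) (letters n R s) ≟ⱽ v))) ≡
        restricted M i n s
    row s s∈ = begin
      ∑ I (λ v → ι (weight v) * (σ s * 𝟙 (sel ≟ⱽ v)))
        ≡⟨ ∑-cong I (λ {v} _ → (solve 3 (λ a b c → a :* (b :* c)
                                   := b :* (c :* a))
                                 refl (ι (weight v)) (σ s) (𝟙 (sel ≟ⱽ v)))) ⟩
      ∑ I (λ v → σ s * (𝟙 (sel ≟ⱽ v) * ι (weight v)))
        ≡⟨ ∑-*ˡ I (σ s) _ ⟩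
      σ s * ∑ I (λ v → 𝟙 (sel ≟ⱽ v) * ι (weight v))
        ≡⟨ cong (σ s *_) (∑-indices-δ M sel sel≥1 (ι ∘ weight)) ⟩
      σ s * (𝟙 (small? M sel) * ι (weight sel))
        ≡⟨ cong (λ x → σ s * (𝟙 (small? M sel) * x))
            (trans (ι-* 2 (prodV sel)) (cong₂ _*_ (ι≡fromℕ 2) (cong (ι ∘ prodV) sel≡))) ⟩
      restricted M i n s ∎
      where
      sel : Vec ℕ (suc m)
      sel = select (0 ∷ h) (letters n R s)
      sel≡ : sel ≡ atPositions (0 ∷ h) n s
      sel≡ = select-letters n R s ps<R
      sel≥1 : VecAll.All (1 ℕ.≤_) sel
      sel≥1 = subst (VecAll.All (1 ℕ.≤_)) (sym sel≡) (atPositions≥1 (0 ∷ h) s∈)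

  Quad-2Φ : Quad (λ n → fromℕ 2 * Φ-sum n)
  Quad-2Φ = Quad-*⁺ (fromℕ 2) (nonneg (fromℕ 2)) Quad-Φ

  0≤2Φ : ∀ n s → 0ℚ ≤ fromℕ 2 * Φ (0 ∷ h) n s
  0≤2Φ n s = 0≤* (nonneg (fromℕ 2)) (0≤Φ (0 ∷ h))

  coef≤A : ∀ M i → Quad.coef (Quad-partialSum M i) ≤ A
  coef≤A M i = coef-mono (Quad-partialSum M i) Quad-2Φ λ n → subst₂ _≤_ (sym (partialSum≡ M i n))
      (∑-*ˡ (L n) (fromℕ 2) (Φ (0 ∷ h) n))
    (∑-mono (L n) λ {s} _ → pointwise n s)
    where
    pointwise : ∀ n s → restricted M i n s ≤ fromℕ 2 * Φ (0 ∷ h) n s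
    pointwise n s with small? i (letters n R s) | small? M (select (0 ∷ h) (letters n R s))
    ... | yes _ | yes _ = lin≤ (ℚ.≤-refl {0ℚ})
                            (solve 1 (λ a → (con 1ℚ) :* ((con 1ℚ) :* a) :+ (con 0ℚ)
                                := a :+ (con 0ℚ))
                              refl (fromℕ 2 * Φ (0 ∷ h) n s))
    ... | yes _ | no _  = lin≤ (0≤2Φ n s)
                            (solve 1 (λ a → (con 1ℚ) :* ((con 0ℚ) :* a) :+ a
                                := a :+ (con 0ℚ))
                              refl (fromℕ 2 * Φ (0 ∷ h) n s))
    ... | no _  | d = lin≤ (0≤2Φ n s)
                        (solve 2 (λ a b → (con 0ℚ) :* (a :* b) :+ b
                            := b :+ (con 0ℚ))
                          refl (𝟙 d) (fromℕ 2 * Φ (0 ∷ h) n s))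

  -- Points whose R letters are all at most M are counted in full: as M ≤ i, neither truncation
  -- removes them. The others contribute the tail of Φ, which is controlled from M = K₀ on.
  A≤coef : ∀ M i → K₀ ℕ.≤ M → M ℕ.≤ i → A ≤ Quad.coef (Quad-partialSum M i) + fromℕ 2 * tailBound M
  A≤coef M i K₀≤M M≤i = coef-≤ Quad-2Φ (Quad-partialSum M i) (fromℕ 2 * tailBound M) 0ℚ λ n _ →
    (lin≤ ((split n) ⊕ (ℚ.≤-reflexive (sym (partialSum≡ M i n))) ⊕ ((fromℕ 2) ⊛ (Φ-tailBound M n K₀≤M)))
      (solve 7 (λ a b c d e f g → a :+ (b :+ (con (fromℕ 2)) :* c :+ d :+ (con (fromℕ 2)) :* (e :* f))
          := d :+ (con (fromℕ 2)) :* e :* f :+ (con 0ℚ) :* g :+ (a :+ b :+ (con (fromℕ 2)) :* c))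
        refl (fromℕ 2 * Φ-sum n) (∑ (L n) (restricted M i n))
            (∑ (L n) (λ s → notSmall M n s * Φ (0 ∷ h) n s)) (partialSum M i n) (tailBound M)
                (ι n * ι n) (ι n)))
    where
    pointwise : ∀ n s → fromℕ 2 * Φ (0 ∷ h) n s ≤ restricted M i n s + fromℕ 2 *
        (notSmall M n s * Φ (0 ∷ h) n s)
    pointwise n s = cases (small? M w) (small? i w) (small? M (select (0 ∷ h) w))
      where
      w : Vec ℕ R
      w = letters n R s
      φ : ℚ
      φ = Φ (0 ∷ h) n s
      cases : (d : Dec (Small M w)) (d′ : Dec (Small i w)) (d″ : Dec (Small M (select (0 ∷ h) w))) →
              fromℕ 2 * φ ≤ 𝟙 d′ * (𝟙 d″ * (fromℕ 2 * φ)) + fromℕ 2 * (𝟙 (¬? d) * φ)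
      cases (no _) d′ d″ = lin≤ (0≤* (0≤𝟙 d′) (0≤* (0≤𝟙 d″) (0≤2Φ n s)))
                             (solve 3 (λ a b c → (con (fromℕ 2)) :* a :+ b :* (c :* ((con (fromℕ 2)) :* a))
                                 := b :* (c :* ((con (fromℕ 2)) :* a)) :+ (con (fromℕ 2)) :*
                                     ((con 1ℚ) :* a) :+ (con 0ℚ))
                               refl φ (𝟙 d′) (𝟙 d″))
      cases (yes _) (yes _) (yes _) = lin≤ (ℚ.≤-refl {0ℚ})
                                        (solve 1 (λ a → (con (fromℕ 2)) :* a :+ (con 0ℚ)
                                            := (con 1ℚ) :* ((con 1ℚ) :* ((con (fromℕ 2)) :* a)) :+
                                                (con (fromℕ 2)) :* ((con 0ℚ) :* a) :+ (con 0ℚ))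
                                          refl φ)
      cases (yes small) (no ¬small) _ = ⊥-elim (¬small (VecAll.map (λ le → ℕ.≤-trans le M≤i) small))
      cases (yes small) (yes _) (no ¬small) = ⊥-elim (¬small (small-select (0 ∷ h) small))
    split : ∀ n → fromℕ 2 * Φ-sum n ≤ ∑ (L n) (restricted M i n) + fromℕ 2 * ∑ (L n)
        (λ s → notSmall M n s * Φ (0 ∷ h) n s)
    split n = subst₂ _≤_ (∑-*ˡ (L n) (fromℕ 2) (Φ (0 ∷ h) n))
      (trans (∑-+ (L n) _ _) (cong (∑ (L n) (restricted M i n) +_) (∑-*ˡ (L n) (fromℕ 2) _)))
      (∑-mono (L n) λ {s} _ → pointwise n s)

  -- `f` is kept abstract because the terms of the series are local to `IsCorrelationConstant`. The
  -- approximation of a partial sum at i is a leading coefficient, bounded above by A for every i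
  -- and below by A - ε from i = M on.
  sumsTo : (f : Vec ℕ (suc m) → ℝ) → (∀ k l → f (k ∷ l) ≡ weight (k ∷ l) ·ᴿ area (k ∷ l)) → SumsTo f A
  sumsTo f f≡ ε 0<ε = K₀ ℕ.⊔ proj₁ K , λ M le →
      ≤ᴿ-const (A - ε) (s M) (M , λ i M≤i →
        (lin≤ ((A≤coef M i (ℕ.≤-trans (ℕ.m≤m⊔n K₀ (proj₁ K)) le) M≤i) ⊕ (ℚ.≤-reflexive (sym (sum≡ M i)))
            ⊕ ((fromℕ 2) ⊛ (ℚ.<⇒≤ (proj₂ K M (ℕ.≤-trans (ℕ.m≤n⊔m K₀ (proj₁ K)) le)))))
          (solve 5 (λ a b c d e → a :- b :+
              (c :+ (con (fromℕ 2)) :* d :+ e :+ (con (fromℕ 2)) :* ((con ½) :* b))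
              := e :+ (a :+ c :+ (con (fromℕ 2)) :* d))
            refl A ε (Quad.coef (Quad-partialSum M i)) (tailBound M) (approx (s M) i)))) ,
      const-≤ᴿ (s M) (A + ε) (0 , λ i _ →
        (lin≤ ((coef≤A M i) ⊕ (ℚ.≤-reflexive (sum≡ M i)) ⊕ (ℚ.<⇒≤ 0<ε))
          (solve 4 (λ a b c d → a :+ (b :+ c :+ d)
              := b :+ d :+ (c :+ a :+ (con 0ℚ)))
            refl (approx (s M) i) A (Quad.coef (Quad-partialSum M i)) ε)))
    where
    K : ∃[ K ] (∀ K′ → K ℕ.≤ K′ → tailBound K′ < ½ * ε)
    K = tailBound-small (½ * ε) (half-positive 0<ε)
    s : ℕ → ℝ
    s M = foldr _+ᴿ_ (fromℚ 0ℚ) (map f (indices M (suc m)))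
    term≡ : ∀ i v → approx (f v) i ≡ ι (weight v) * α v i
    term≡ i (k ∷ l) = trans (cong (λ x → approx x i) (f≡ k l)) (approx-· (weight (k ∷ l)) (area (k ∷ l)) i)
    sum≡ : ∀ M i → approx (s M) i ≡ Quad.coef (Quad-partialSum M i)
    sum≡ M i = trans (approx-∑ f (indices M (suc m)) i)
      (trans (∑-cong (indices M (suc m)) (λ {v} _ → term≡ i v)) (sym (coef-partialSum M i)))

  -- The error term

  -- Subtracting A at every point, rather than A N(Q) at the end, cancels the terms in n² before
  -- Möbius inversion.
  deviation : ℕ → Pair → ℚ
  deviation n s = Φ (0 ∷ h) n s - A

  deviation-scale : ∀ {Q z s} → 1 ℕ.≤ z → s ∈ L (Q ÷ z) → deviation Q (scale z s) ≡ deviation (Q ÷ z) s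
  deviation-scale {Q} {z} {s} 1≤z s∈ = cong (λ w → ι (prodV w) - A) (go (0 ∷ h))
    where
    go : ∀ {d} (ps : Vec ℕ d) → atPositions ps Q (scale z s) ≡ atPositions ps (Q ÷ z) s
    go [] = refl
    go (p ∷ ps) = cong₂ _∷_ (κ-T^-scale p 1≤z s∈) (go ps)

  -- A times the cardinality is coef n (n + 1); its linear term is the reason for the second
  -- summand.
  errorConstant : ℚ
  errorConstant = Quad.err Quad-Φ + Quad.coef Quad-Φ

  0<coef : 0ℚ < Quad.coef Quad-Φ
  0<coef = lin< (½ ⊛< 0<A)
             (solve 1 (λ a → (con 0ℚ) :+ (con ½) :* ((con (fromℕ 2)) :* a)
                 := a :+ (con ½) :* (con 0ℚ))
               refl (Quad.coef Quad-Φ))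

  0≤errorConstant : 0ℚ ≤ errorConstant
  0≤errorConstant = lin≤ ((ℚ.<⇒≤ 0<coef) ⊕ (½ ⊛ (Quad.upper Quad-Φ 1 (s≤s z≤n))) ⊕
      (½ ⊛ (Quad.lower Quad-Φ 1 (s≤s z≤n))) ⊕ (ℚ.≤-reflexive (cong (e *_) ι-1)))
                      (solve 4 (λ a b c d → (con 0ℚ) :+
                          (a :+ (con ½) :* (a :* (b :* b) :+ c :* b) :+ (con ½) :* (d :+ c :* b) :+ c :*
                              (con 1ℚ))
                          := c :+ a :+ ((con 0ℚ) :+ (con ½) :* d :+ (con ½) :* (a :* (b :* b)) :+ c :* b))
                        refl (Quad.coef Quad-Φ) (ι 1) e (Φ-sum 1))
    where
    e : ℚ
    e = Quad.err Quad-Φ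

  deviation-bound : ∀ n → ∣ ∑ (L n) (deviation n) ∣ ≤ errorConstant * ι n
  deviation-bound zero = ℚ.≤-reflexive
      (trans (cong ∣_∣ (L0 (deviation 0)))
          (sym (trans (cong (errorConstant *_) ι-0) (ℚ.*-zeroʳ errorConstant))))
  deviation-bound n@(suc _) = ∣∣≤
    (lin≤ ((ℚ.≤-reflexive sum≡) ⊕ (ℚ.≤-reflexive (sym a*card)) ⊕ (Quad.upper Quad-Φ n (s≤s z≤n)) ⊕
        ((fromℕ 2) ⊛ (0≤* (ℚ.<⇒≤ 0<coef) (0≤ι n))))
      (solve 6 (λ a b c d e f → a :+ (b :- (con (fromℕ 2)) :* c :* d :+ c :* ((con (fromℕ 2)) :* d) :+
          (c :* (e :* e) :+ f :* e) :+ (con (fromℕ 2)) :* (c :* e))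
          := (f :+ c) :* e :+ (a :+ c :* (e :* (e :+ (con 1ℚ))) :+ b :+ (con (fromℕ 2)) :* (con 0ℚ)))
        refl (∑ (L n) (deviation n)) (Φ-sum n) (Quad.coef Quad-Φ) (card n) (ι n) (Quad.err Quad-Φ)))
    (lin≤ ((ℚ.≤-reflexive (sym sum≡)) ⊕ (ℚ.≤-reflexive a*card) ⊕ (Quad.lower Quad-Φ n (s≤s z≤n)))
      (solve 6 (λ a b c d e f → (:- a) :+ (a :+ b :* (c :* (c :+ (con 1ℚ))) :+ (d :+ e :* c))
          := (e :+ b) :* c :+ (d :- (con (fromℕ 2)) :* b :* f :+ b :* ((con (fromℕ 2)) :* f) :+ b :* (c :* c)))
        refl (∑ (L n) (deviation n)) (Quad.coef Quad-Φ) (ι n) (Φ-sum n) (Quad.err Quad-Φ) (card n)))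
    where
    sum≡ : ∑ (L n) (deviation n) ≡ Φ-sum n - A * card n
    sum≡ = trans (∑-- (L n) (Φ (0 ∷ h) n) (λ _ → A)) (cong (λ x → Φ-sum n - x)
      (trans (∑-cong (L n) (λ _ → sym (ℚ.*-identityʳ A))) (∑-*ˡ (L n) A (λ _ → 1ℚ))))
    a*card : Quad.coef Quad-Φ * (fromℕ 2 * card n) ≡ Quad.coef Quad-Φ * (ι n * (ι n + 1ℚ))
    a*card = cong (Quad.coef Quad-Φ *_) (twice-card n)

  error≡ : ∀ q → S h (suc q) - A * fromℕ (N (suc q)) ≡ coprimeSum deviation deviation-scale (suc q)
  error≡ q = begin
    S h Q - A * fromℕ (N Q)
      ≡⟨ cong₂ (λ x y → x - A * y) (S-Farey h q) (N-Farey q) ⟩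
    ∑ (L Q) (λ s → 𝟙-coprime s * Φ (0 ∷ h) Q s) - A * ∑ (L Q) 𝟙-coprime
      ≡⟨ cong (λ x → ∑ (L Q) (λ s → 𝟙-coprime s * Φ (0 ∷ h) Q s) - x) (∑-*ˡ (L Q) A 𝟙-coprime) ⟨
    ∑ (L Q) (λ s → 𝟙-coprime s * Φ (0 ∷ h) Q s) - ∑ (L Q) (λ s → A * 𝟙-coprime s)
      ≡⟨ ∑-- (L Q) _ _ ⟨
    ∑ (L Q) (λ s → 𝟙-coprime s * Φ (0 ∷ h) Q s - A * 𝟙-coprime s)
      ≡⟨ ∑-cong (L Q) (λ {s} _ → (solve 3 (λ a b c → a :* b :- c :* a
                                     := a :* (b :- c))
                                   refl (𝟙-coprime s) (Φ (0 ∷ h) Q s) A)) ⟩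
    coprimeSum deviation deviation-scale Q ∎
    where
    open ≡-Reasoning
    Q : ℕ
    Q = suc q

  -- Möbius inversion leaves a multiple of Q (1 + ℓ) with ℓ = ⌊log₂ Q⌋. From Q = 2 on ℓ ≥ 1, hence 1
  -- + ℓ ≤ 2ℓ², which gives the factor 2.
  error-bound : (λ Q → S h Q - A * fromℕ (N Q)) =O[ Qlog²Q ]
  error-bound = fromℕ 2 * errorConstant , 2 , bound
    where
    bound : ∀ Q → 2 ℕ.≤ Q → ∣ S h Q - A * fromℕ (N Q) ∣ ≤ fromℕ 2 * errorConstant * ∣ Qlog²Q Q ∣
    bound Q@(suc q) 2≤Q = begin
      ∣ S h Q - A * fromℕ (N Q) ∣                           ≡⟨ cong ∣_∣ (error≡ q) ⟩
      ∣ coprimeSum deviation deviation-scale Q ∣            ≤⟨ coprimeSum-bound deviation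
          deviation-scale errorConstant deviation-bound 0≤errorConstant Q ⟩
      errorConstant * ι (Q ℕ.* suc ℓ)                       ≤⟨ *-monoˡ-≤ errorConstant 0≤errorConstant
          (ι-≤ Q[1+ℓ]≤2Qℓ²) ⟩
      errorConstant * ι (2 ℕ.* (Q ℕ.* ℓ ℕ.^ 2))             ≡⟨ cong (errorConstant *_)
          (trans (ι-* 2 (Q ℕ.* ℓ ℕ.^ 2)) (cong₂ _*_ (ι≡fromℕ 2) (ι≡fromℕ (Q ℕ.* ℓ ℕ.^ 2)))) ⟩
      errorConstant * (fromℕ 2 * Qlog²Q Q)                  ≡⟨ (solve 2 (λ a b → a :* ((con (fromℕ 2)) :* b)
            := (con (fromℕ 2)) :* a :* b)
          refl errorConstant (Qlog²Q Q)) ⟩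
      fromℕ 2 * errorConstant * Qlog²Q Q                    ≤⟨ *-monoˡ-≤ (fromℕ 2 * errorConstant)
          (0≤* (nonneg (fromℕ 2)) 0≤errorConstant) (x≤∣x∣ (Qlog²Q Q)) ⟩
      fromℕ 2 * errorConstant * ∣ Qlog²Q Q ∣                ∎
      where
      open ℚ.≤-Reasoning
      ℓ : ℕ
      ℓ = ⌊log₂ Q ⌋
      1≤ℓ : 1 ℕ.≤ ℓ
      1≤ℓ = log≥1 2≤Q
      Q[1+ℓ]≤2Qℓ² : Q ℕ.* suc ℓ ℕ.≤ 2 ℕ.* (Q ℕ.* ℓ ℕ.^ 2)
      Q[1+ℓ]≤2Qℓ² = subst (Q ℕ.* suc ℓ ℕ.≤_) (solveℕ 2 (λ a b → a ⊠ ((conℕ 2) ⊠ (b ⊠ (b ⊠ (conℕ 1))))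
            ⊜ (conℕ 2) ⊠ (a ⊠ (b ⊠ (b ⊠ (conℕ 1)))))
          refl Q ℓ)
        (ℕ.*-monoʳ-≤ Q (linℕ ((ℕ.*-mono-≤ 1≤ℓ 1≤ℓ) ⊕ℕ (ℕ.*-monoˡ-≤ ℓ 1≤ℓ))
                         (solveℕ 1 (λ a → (conℕ 1) ⊞ a ⊞ (a ⊠ a ⊞ a ⊠ a)
                             ⊜ (conℕ 2) ⊠ (a ⊠ (a ⊠ (conℕ 1))) ⊞ ((conℕ 1) ⊠ (conℕ 1) ⊞ (conℕ 1) ⊠ a))
                           refl ℓ)))

maximum : ∀ {d} → Vec ℕ d → ℕ
maximum = Vec.foldr _ ℕ._⊔_ 0

≤maximum : ∀ {d} (v : Vec ℕ d) → VecAll.All (ℕ._≤ maximum v) v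
≤maximum [] = []
≤maximum (x ∷ v) = ℕ.m≤m⊔n x (maximum v) ∷ VecAll.map (λ le → ℕ.≤-trans le (ℕ.m≤n⊔m x (maximum v))) (≤maximum v)

theorem1p7 : (m : ℕ) → 1 ℕ.≤ m → (h : Vec ℕ m) → VecAll.All (1 ℕ.≤_) h → VecUnique.Unique h →
    ∃[ A ] (0ℚ < A × IsCorrelationConstant h A ×
    (λ Q → S h Q - A * fromℕ (N Q)) =O[ Qlog²Q ])
theorem1p7 m _ h h≥1 unique = A , 0<A , (area′ , hasArea , sumsTo _ (λ k l → refl)) , error-bound
  where
  -- Position 0 stands for the factor ν(γᵢ) itself; it differs from all shifts because these are
  -- positive.
  unique₀ : VecUnique.Unique (0 ∷ h)
  unique₀ = VecAll.map ℕ.<⇒≢ h≥1 ∷ unique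
  open Correlation (0 ∷ h) unique₀ (maximum h) (z≤n ∷ ≤maximum h) using (A; 0<A)
  open Areas h unique₀ (maximum h) (z≤n ∷ ≤maximum h) using (area; hasArea)
  open Series h unique₀ (maximum h) (z≤n ∷ ≤maximum h) using (sumsTo; error-bound)
  area′ : ℕ → Vec ℕ m → ℝ
  area′ k l = area (k ∷ l)
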